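{- Let $\sigma$ be a connected skew Young diagram whose topmost row is row $1$. Then $$RG_\sigma(\mathbf{x};\mathbf{w}) \;=\; \sum_{(\mu,\mathbf{e})} (-1)^{|B(\mu/\sigma)|}\, a_{\sigma,\mu,\mathbf{e}}\, s_\mu(\mathbf{x})\,\mathbf{w}^{\mathbf{e}},$$ where the sum is over all skew shapes $\mu\supseteq\sigma$ (containment convention below) and all eventually-zero nonnegative integer sequences $\mathbf{e}=(e_1,e_2,\ldots)$, and $a_{\sigma,\mu,\mathbf{e}}$ is the (nonnegative) number of pairs $(T',T'')$ such that $T'$ is a row-weakly-bounded semistandard tableau on $A(\mu/\sigma)$, $T''$ is a reverse row-strict, row-bounded tableau on $B(\mu/\sigma)$, and $c(T')+c(T'')=\mathbf{e}$.
   Context: Boxes are pairs $(i,j)$ of positive integers, $i$ the row index (increasing downward), $j$ the column index (increasing to the right); $(i,j)\preceq(i',j')$ iff $i\le i'$, $j\le j'$. A skew Young diagram (skew shape) is a finite set of boxes closed under intervals ($a,c\in\sigma$, $a\preceq b\preceq c$ implies $b\in\sigma$); connected means its Hasse diagram under $\preceq$ is connected. Rows are numbered so that the top row of $\sigma$ is row 1. Containment convention: $\mu\supseteq\sigma$ means every box of $\sigma$ is in $\mu$ and every box of $\mu$ is in the same column as some box of $\sigma$. Then $\mu\setminus\sigma$ splits into $A(\mu/\sigma)$ (boxes above boxes of $\sigma$ in their column) and $B(\mu/\sigma)$ (boxes below). A tableau assigns a positive integer to each box; semistandard: rows weakly increasing left to right, columns strictly increasing top to bottom; reverse row-strict: rows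 strictly decreasing left to right, columns weakly decreasing top to bottom; row-bounded: $T(i,j)<i$ for each box $(i,j)$; row-weakly-bounded: $T(i,j)\le i$. Content $c(T)=(c_1,c_2,\dots)$ with $c_i$ the number of occurrences of label $i$; $\mathbf{x}^c=\prod x_i^{c_i}$, $\mathbf{w}^{\mathbf{e}}=\prod w_i^{e_i}$. A set-valued tableau assigns a nonempty finite set of positive integers to each box; with $S\le T$ meaning $\max S\le \min T$ and $S<T$ meaning $\max S<\min T$, it is semistandard if rows weakly increase and columns strictly increase. $\mathrm{SS}(\sigma)$ is the set of semistandard set-valued tableaux of shape $\sigma$. The excess $e(T)=(e_1,e_2,\dots)$ has $e_i$ = (number of labels in row $i$) minus (number of boxes in row $i$); $|e(T)|=\sum e_i$. $s_\mu(\mathbf{x})=\sum_T\mathbf{x}^{c(T)}$ over semistandard tableaux of shape $\mu$. The row-refined skew stable Grothendieck polynomial is $RG_\sigma(\mathbf{x};\mathbf{w})=\sum_{T\in\mathrm{SS}(\sigma)}(-1)^{|e(T)|}\mathbf{x}^{c(T)}\mathbf{w}^{e(T)}$. -}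

module Defs where

-- Row-refined skew stable Grothendieck polynomials: everything is stated
-- coefficientwise, with finite objects (shapes, tableaux) represented as lists
-- and counted by explicit enumeration.

open import Data.Nat using (ℕ; zero; suc; _+_; _∸_; _⊔_; _≤_; _≡ᵇ_; _≤ᵇ_; _<ᵇ_)
open import Data.Bool using (Bool; true; false; _∧_; _∨_; not; if_then_else_; T)
open import Data.List using (List; []; _∷_; map; concatMap; length; upTo; cartesianProduct; foldr)
open import Data.Bool.ListAction using (all; any)
open import Data.Nat.ListAction using (sum)
open import Data.List.Membership.Propositional using (_∈_)
open import Data.Product using (_×_; _,_; proj₁; proj₂; ∃-syntax)
open import Data.Empty using (⊥)
open import Data.Integer using (ℤ; +_; -_; _*_)
  renaming (_+_ to _+ℤ_)
open import Relation.Binary.PropositionalEquality using (_≡_; _≢_)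

filterᵇ : {A : Set} → (A → Bool) → List A → List A
filterᵇ p []       = []
filterᵇ p (x ∷ xs) = if p x then x ∷ filterᵇ p xs else filterᵇ p xs

countᵇ : {A : Set} → (A → Bool) → List A → ℕ
countᵇ p xs = length (filterᵇ p xs)

_⇒ᵇ_ : Bool → Bool → Bool
a ⇒ᵇ b = not a ∨ b

-- [a .. b] (empty if b < a)
range : ℕ → ℕ → List ℕ
range a b = map (λ k → a + k) (upTo (suc b ∸ a))

subsets : {A : Set} → List A → List (List A)
subsets []       = [] ∷ []
subsets (x ∷ xs) = let r = subsets xs in r Data.List.++ map (x ∷_) r

nonemptySubsets : {A : Set} → List A → List (List A)
nonemptySubsets []       = []
nonemptySubsets (x ∷ xs) = map (x ∷_) (subsets xs) Data.List.++ nonemptySubsets xs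

-- 1-indexed entry of an eventually-zero sequence given by a finite list
-- (entries beyond the list are 0; entry 0 is unused and set to 0)
at : List ℕ → ℕ → ℕ
at []       _             = 0
at (x ∷ xs) zero          = 0
at (x ∷ xs) (suc zero)    = x
at (x ∷ xs) (suc (suc k)) = at xs (suc k)

negOnePow : ℕ → ℤ
negOnePow zero    = + 1
negOnePow (suc k) = - negOnePow k

sumℤ : List ℤ → ℤ
sumℤ = foldr _+ℤ_ (+ 0)

-- a box (i , j): i = row index (increasing downward), j = column index
Box : Set
Box = ℕ × ℕ

row : Box → ℕ
row = proj₁

column : Box → ℕ
column = proj₂

_==ᴮ_ : Box → Box → Bool
(i , j) ==ᴮ (i' , j') = (i ≡ᵇ i') ∧ (j ≡ᵇ j')

memᵇ : Box → List Box → Bool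
memᵇ b σ = any (b ==ᴮ_) σ

boxesBetween : Box → Box → List Box
boxesBetween (i , j) (i' , j') = concatMap (λ r → map (r ,_) (range j j')) (range i i')

noDupᵇ : List Box → Bool
noDupᵇ []       = true
noDupᵇ (b ∷ bs) = not (memᵇ b bs) ∧ noDupᵇ bs

positiveᵇ : Box → Bool
positiveᵇ (i , j) = (1 ≤ᵇ i) ∧ (1 ≤ᵇ j)

intervalClosedᵇ : List Box → Bool
intervalClosedᵇ σ = all (λ a → all (λ c → all (λ b → memᵇ b σ) (boxesBetween a c)) σ) σ

-- A finite set of boxes is represented by a duplicate-free list.
-- It is a skew shape iff its boxes have positive coordinates and it is
-- closed under intervals.
isSkewShape : List Box → Bool
isSkewShape σ = noDupᵇ σ ∧ all positiveᵇ σ ∧ intervalClosedᵇ σ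

_⪯_ : Box → Box → Set
(i , j) ⪯ (i' , j') = (i ≤ i') × (j ≤ j')

_≺_ : Box → Box → Set
a ≺ c = (a ⪯ c) × (a ≢ c)

Covers : List Box → Box → Box → Set
Covers σ a c = (a ∈ σ) × (c ∈ σ) × (a ≺ c) × (∀ b → b ∈ σ → a ≺ b → b ≺ c → ⊥)

data Linked (σ : List Box) : Box → Box → Set where
  here : ∀ {a} → Linked σ a a
  up   : ∀ {a b c} → Covers σ a b → Linked σ b c → Linked σ a c
  down : ∀ {a b c} → Covers σ b a → Linked σ b c → Linked σ a c

Connected : List Box → Set
Connected σ = ∀ a b → a ∈ σ → b ∈ σ → Linked σ a b

-- the topmost row of σ is row 1 (σ has positive coordinates, and some box lies in row 1)
TopRowIsOne : List Box → Set
TopRowIsOne σ = ∃[ b ] ((b ∈ σ) × (row b ≡ 1))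

maxRow : List Box → ℕ
maxRow σ = foldr (λ b m → row b ⊔ m) 0 σ

maxCol : List Box → ℕ
maxCol σ = foldr (λ b m → column b ⊔ m) 0 σ

sameColumnᵇ : Box → Box → Bool
sameColumnᵇ a b = column a ≡ᵇ column b

containsᵇ : List Box → List Box → Bool
containsᵇ μ σ = all (λ b → memᵇ b μ) σ ∧ all (λ b → any (sameColumnᵇ b) σ) μ

Aboxes : List Box → List Box → List Box
Aboxes σ μ = filterᵇ (λ b → not (memᵇ b σ) ∧ any (λ s → sameColumnᵇ b s ∧ (row b <ᵇ row s)) σ) μ

Bboxes : List Box → List Box → List Box
Bboxes σ μ = filterᵇ (λ b → not (memᵇ b σ) ∧ any (λ s → sameColumnᵇ b s ∧ (row s <ᵇ row b)) σ) μ

columnsOf : List Box → List ℕ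
columnsOf σ = filterᵇ (λ j → any (λ b → column b ≡ᵇ j) σ) (range 1 (maxCol σ))

candidateBoxes : List Box → ℕ → List Box
candidateBoxes σ N = concatMap (λ i → map (i ,_) (columnsOf σ)) (range 1 N)

shapesAbove : List Box → ℕ → List (List Box)
shapesAbove σ N = filterᵇ (λ μ → isSkewShape μ ∧ containsᵇ μ σ) (subsets (candidateBoxes σ N))

Filling : Set → Set
Filling L = List (Box × L)

fillings : {L : Set} → List Box → (Box → List L) → List (Filling L)
fillings []       opts = [] ∷ []
fillings (b ∷ bs) opts = concatMap (λ x → map ((b , x) ∷_) (fillings bs opts)) (opts b)

pairwiseᵇ : {L : Set} → (Box × L → Box × L → Bool) → Filling L → Bool
pairwiseᵇ R t = all (λ p → all (λ q → R p q) t) t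

sameRowLeftOf : Box → Box → Bool
sameRowLeftOf (i , j) (i' , j') = (i ≡ᵇ i') ∧ (j <ᵇ j')

sameColAbove : Box → Box → Bool
sameColAbove (i , j) (i' , j') = (j ≡ᵇ j') ∧ (i <ᵇ i')

semistandardᵇ : Filling ℕ → Bool
semistandardᵇ = pairwiseᵇ (λ { (a , x) (b , y) →
  (sameRowLeftOf a b ⇒ᵇ (x ≤ᵇ y)) ∧ (sameColAbove a b ⇒ᵇ (x <ᵇ y)) })

reverseRowStrictᵇ : Filling ℕ → Bool
reverseRowStrictᵇ = pairwiseᵇ (λ { (a , x) (b , y) →
  (sameRowLeftOf a b ⇒ᵇ (y <ᵇ x)) ∧ (sameColAbove a b ⇒ᵇ (y ≤ᵇ x)) })

rowBoundedᵇ : Filling ℕ → Bool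
rowBoundedᵇ = all (λ { ((i , j) , x) → x <ᵇ i })

rowWeaklyBoundedᵇ : Filling ℕ → Bool
rowWeaklyBoundedᵇ = all (λ { ((i , j) , x) → x ≤ᵇ i })

allLabelsPositiveᵇ : Filling ℕ → Bool
allLabelsPositiveᵇ = all (λ p → 1 ≤ᵇ proj₂ p)

cnt : ℕ → Filling ℕ → ℕ
cnt k t = countᵇ (λ p → proj₂ p ≡ᵇ k) t

-- c(t) agrees with the sequence α on labels 1..B
-- (used with B ≥ every label and B ≥ length α, so this says c(t) = α)
contentIsᵇ : ℕ → Filling ℕ → List ℕ → Bool
contentIsᵇ B t α = all (λ k → cnt k t ≡ᵇ at α k) (range 1 B)

-- Kostka number: number of semistandard tableaux of shape μ with content α.
-- Labels of such a tableau lie in 1..length α, so candidates use those labels.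
kostka : List Box → List ℕ → ℕ
kostka μ α = countᵇ (λ t → semistandardᵇ t ∧ contentIsᵇ (length α) t α)
                    (fillings μ (λ _ → range 1 (length α)))

-- a_{σ,μ,e}: pairs (T', T'') with T' a row-weakly-bounded semistandard tableau
-- on A(μ/σ), T'' a reverse row-strict row-bounded tableau on B(μ/σ), and
-- c(T') + c(T'') = e.  (Labels are positive and bounded by the row index.)
aCoeff : List Box → List Box → List ℕ → ℕ
aCoeff σ μ e =
  countᵇ (λ { (t' , t'') → all (λ k → (cnt k t' + cnt k t'') ≡ᵇ at e k)
                                 (range 1 (maxRow μ ⊔ length e)) })
         (cartesianProduct
           (filterᵇ (λ t → allLabelsPositiveᵇ t ∧ semistandardᵇ t ∧ rowWeaklyBoundedᵇ t)
                    (fillings (Aboxes σ μ) (λ b → range 1 (row b))))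
           (filterᵇ (λ t → allLabelsPositiveᵇ t ∧ reverseRowStrictᵇ t ∧ rowBoundedᵇ t)
                    (fillings (Bboxes σ μ) (λ b → range 1 (row b)))))

-- Set-valued tableaux (each box gets a nonempty finite set of positive
-- integers, represented as a strictly increasing nonempty list)

semistandardSVᵇ : Filling (List ℕ) → Bool
semistandardSVᵇ = pairwiseᵇ (λ { (a , S) (b , S') →
  (sameRowLeftOf a b ⇒ᵇ all (λ x → all (λ y → x ≤ᵇ y) S') S) ∧
  (sameColAbove a b ⇒ᵇ all (λ x → all (λ y → x <ᵇ y) S') S) })

cntSV : ℕ → Filling (List ℕ) → ℕ
cntSV k t = sum (map (λ p → countᵇ (_≡ᵇ k) (proj₂ p)) t)

excessRow : ℕ → Filling (List ℕ) → ℕ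
excessRow i t = sum (map (λ p → if row (proj₁ p) ≡ᵇ i then length (proj₂ p) else 0) t)
                ∸ countᵇ (λ p → row (proj₁ p) ≡ᵇ i) t

-- number of T ∈ SS(σ) with c(T) = α and e(T) = e.
-- Labels of such T lie in 1..length α; rows of σ lie in 1..maxRow σ.
svCount : List Box → List ℕ → List ℕ → ℕ
svCount σ α e =
  countᵇ (λ t → semistandardSVᵇ t
               ∧ all (λ k → cntSV k t ≡ᵇ at α k) (range 1 (length α))
               ∧ all (λ i → excessRow i t ≡ᵇ at e i) (range 1 (maxRow σ ⊔ length e)))
         (fillings σ (λ _ → nonemptySubsets (range 1 (length α))))

coeffRG : List Box → List ℕ → List ℕ → ℤ
coeffRG σ α e = negOnePow (sum e) * (+ (svCount σ α e))

-- coefficient of x^α w^e in the right-hand side, summed only over the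
-- skew shapes μ ⊇ σ lying in rows ≤ N (a partial sum of the sum over all μ)
coeffRHSupTo : List Box → List ℕ → List ℕ → ℕ → ℤ
coeffRHSupTo σ α e N =
  sumℤ (map (λ μ → negOnePow (length (Bboxes σ μ)) * ((+ (aCoeff σ μ e)) * (+ (kostka μ α))))
            (shapesAbove σ N))

{-# OPTIONS --safe #-}
-- A shape of N rows is a pair of vectors of row lengths, and adding one label to a tableau multiplies
-- by a matrix indexed by such vectors. Put v_i = - w_i, let U_k(x) be the matrix of horizontal strips
-- weighted by x^(size), with an extra factor 1 + v_i x for each row i ≤ k whose last old box is a corner,
-- let M_k be the matrix of vertical strips in the rows > k weighted by v_k^(size), H_k that of horizontal
-- strips in the rows ≥ k weighted by (- v_k)^(size), and D_k the matrix of arbitrary extensions of the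
-- rows ≤ k weighted by the (- v_i). Then
--     U_k(x) M_k = M_k U_(k-1)(x)   and   M_k D_(k-1) H_k = D_k,
-- both by telescoping from row to row, whence
--     U_N(x_n) … U_N(x_1) D_N = M_N … M_1 U_0(x_n) … U_0(x_1) H_1 … H_N.
-- The left side generates the set-valued tableaux (D_N corrects for the inner corners, which are no boxes
-- of σ); on the right M_N … M_1 generates T'', the U_0's the Schur function, and H_1 … H_N generates T'.
module Submission where

open import Defs
open import Algebra.Bundles using (CommutativeRing)
open import Data.Bool using (Bool; true; false; _∧_; not; if_then_else_; T; T?)
open import Data.Bool.ListAction using (all; any)
open import Data.Bool.Properties using (T-∧)
open import Data.Empty using (⊥; ⊥-elim)
open import Data.Integer as ℤ using (ℤ)
import Data.Integer.Properties as ℤₚ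
import Data.Integer.Solver as ℤSolver
open import Data.List using (List; []; _∷_; _++_; map; concatMap; length; upTo; cartesianProduct)
open import Data.List.Membership.Propositional using (_∈_; _∉_)
open import Data.List.Membership.Propositional.Properties using (∈-map⁺; ∈-map⁻; ∈-++⁺ˡ; ∈-++⁺ʳ; ∈-++⁻; ∈-upTo⁺; ∈-upTo⁻)
open import Data.List.Membership.Propositional.Properties.WithK using (unique∧set⇒bag)
open import Data.List.Relation.Binary.BagAndSetEquality using (∼bag⇒↭)
open import Data.List.Relation.Binary.Permutation.Propositional as Perm using (_↭_)
open import Data.List.Relation.Unary.All as All using (All; []; _∷_)
open import Data.List.Relation.Unary.AllPairs using (AllPairs; []; _∷_)
open import Data.List.Relation.Unary.Any using (here; there)
open import Data.List.Relation.Unary.Unique.Propositional using (Unique)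
import Data.List.Relation.Unary.Unique.Propositional.Properties as Uniq
open import Data.Nat as ℕ using (ℕ; zero; suc; _∸_; _⊔_; _≤_; _<_; z≤n; s≤s; _≡ᵇ_; _≤ᵇ_; _<ᵇ_)
open import Data.Nat.ListAction using (sum)
open import Data.Nat.Properties as ℕₚ using (≤-trans; ≤-refl; ≤ᵇ⇒≤; ≤⇒≤ᵇ; <ᵇ⇒<; <⇒<ᵇ; ≡ᵇ⇒≡; ≡⇒≡ᵇ; <⇒≱; ≤⇒≯)
open import Data.Product using (_×_; _,_; proj₁; proj₂; ∃-syntax; Σ-syntax)
open import Data.Product.Properties using (≡-dec)
open import Data.Sum using (_⊎_; inj₁; inj₂)
open import Data.Unit using (⊤)
open import Data.Vec using (Vec; []; _∷_)
open import Function using (_∘_; const; id; mk⇔)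
open import Function.Bundles using (Equivalence)
open import Level using (0ℓ)
open import Relation.Binary.Definitions using (tri<; tri≈; tri>)
open import Relation.Binary.PropositionalEquality using (_≡_; _≢_; refl; sym; trans; cong; cong₂; subst; subst₂)
open import Relation.Nullary using (¬_; Dec; yes; no)

-- The factor `1 + v_i x` is attached to the last old box of a row whether or not that box belongs
-- to `σ`: only then does it depend on two neighbouring row lengths alone, as the row-by-row
-- exchange with `M_k` requires. The price is that chains of shapes may shrink below the inner
-- border of `σ`, where there is no tableau left to describe. The signed weights of `D_N` make these
-- chains cancel (`RowCollapse`), and it is `D_N` again that releases the matrices `H_k`, hence
-- `T'`. The exchange leaves one factor over, the corner factor of the last row, which is 1 only
-- when that row is empty. Since a horizontal strip adds at most one row, `n` strips over a shape
-- with `R` rows call for `N > n + R`; this is the origin of the bound on `N`. Connectedness enters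
-- only through the shapes: consecutive rows of `σ` share a column, so `σ` and every shape above it
-- are differences of two partitions within one and the same interval of columns.

-- Booleans, duplicate-free lists and intervals of integers.

T⇒true : ∀ {b} → T b → b ≡ true
T⇒true {true} _ = refl

¬T⇒false : ∀ {b} → ¬ T b → b ≡ false
¬T⇒false {false} _ = refl
¬T⇒false {true}  h = ⊥-elim (h _)

T-ext : ∀ {a b} → (T a → T b) → (T b → T a) → a ≡ b
T-ext {true}  {true}  _ _ = refl
T-ext {true}  {false} f _ = ⊥-elim (f _)
T-ext {false} {true}  _ g = ⊥-elim (g _)
T-ext {false} {false} _ _ = refl

T-∧⁺ : ∀ {a b} → T a → T b → T (a ∧ b)
T-∧⁺ p q = Equivalence.from T-∧ (p , q)

T-∧⁻ : ∀ {a b} → T (a ∧ b) → T a × T b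
T-∧⁻ = Equivalence.to T-∧

T-all⁺ : {A : Set} (p : A → Bool) (xs : List A) → (∀ x → x ∈ xs → T (p x)) → T (all p xs)
T-all⁺ p []       _ = _
T-all⁺ p (x ∷ xs) h = T-∧⁺ (h x (here refl)) (T-all⁺ p xs (λ y y∈ → h y (there y∈)))

T-all⁻ : {A : Set} (p : A → Bool) (xs : List A) → T (all p xs) → ∀ x → x ∈ xs → T (p x)
T-all⁻ p (x ∷ xs) h _ (here refl) = proj₁ (T-∧⁻ h)
T-all⁻ p (x ∷ xs) h y (there y∈)  = T-all⁻ p xs (proj₂ (T-∧⁻ {p x} h)) y y∈

T-any⁺ : {A : Set} (p : A → Bool) (xs : List A) → ∀ x → x ∈ xs → T (p x) → T (any p xs)
T-any⁺ p (x ∷ xs) _ (here refl) h rewrite T⇒true h = _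
T-any⁺ p (x ∷ xs) y (there y∈)  h with p x
... | true  = _
... | false = T-any⁺ p xs y y∈ h

T-any⁻ : {A : Set} (p : A → Bool) (xs : List A) → T (any p xs) → ∃[ x ] x ∈ xs × T (p x)
T-any⁻ p (x ∷ xs) h with p x in eq
... | true  = x , here refl , subst T (sym eq) _
... | false with y , y∈ , hy ← T-any⁻ p xs h = y , there y∈ , hy

all-cong : {A : Set} {p q : A → Bool} (xs : List A) → (∀ x → x ∈ xs → p x ≡ q x) → all p xs ≡ all q xs
all-cong []       _ = refl
all-cong (x ∷ xs) h = cong₂ _∧_ (h x (here refl)) (all-cong xs (λ y y∈ → h y (there y∈)))

∈-filterᵇ⁺ : {A : Set} (p : A → Bool) {x : A} (xs : List A) → x ∈ xs → T (p x) → x ∈ filterᵇ p xs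
∈-filterᵇ⁺ p (x ∷ xs) (here refl) h rewrite T⇒true h = here refl
∈-filterᵇ⁺ p (x ∷ xs) (there x∈)  h with p x
... | true  = there (∈-filterᵇ⁺ p xs x∈ h)
... | false = ∈-filterᵇ⁺ p xs x∈ h

∈-filterᵇ⁻ : {A : Set} (p : A → Bool) {x : A} (xs : List A) → x ∈ filterᵇ p xs → x ∈ xs × T (p x)
∈-filterᵇ⁻ p (y ∷ xs) x∈ with p y in eq
∈-filterᵇ⁻ p (y ∷ xs) (here refl) | true = here refl , subst T (sym eq) _
∈-filterᵇ⁻ p (y ∷ xs) (there x∈)  | true with a , b ← ∈-filterᵇ⁻ p xs x∈ = there a , b
∈-filterᵇ⁻ p (y ∷ xs) x∈ | false with a , b ← ∈-filterᵇ⁻ p xs x∈ = there a , b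

∉⇒All≢ : {A : Set} {x : A} (xs : List A) → x ∉ xs → All (x ≢_) xs
∉⇒All≢ []       _ = []
∉⇒All≢ (y ∷ xs) h = (λ e → h (here e)) ∷ ∉⇒All≢ xs (h ∘ there)

All≢⇒∉ : {A : Set} {x : A} (xs : List A) → All (x ≢_) xs → x ∉ xs
All≢⇒∉ (y ∷ xs) (p ∷ _)  (here e)   = p e
All≢⇒∉ (y ∷ xs) (_ ∷ ps) (there x∈) = All≢⇒∉ xs ps x∈

filterᵇ-unique : {A : Set} (p : A → Bool) (xs : List A) → Unique xs → Unique (filterᵇ p xs)
filterᵇ-unique p []       _        = []
filterᵇ-unique p (x ∷ xs) (a ∷ us) with p x
... | true  = ∉⇒All≢ _ (λ x∈ → All≢⇒∉ xs a (proj₁ (∈-filterᵇ⁻ p xs x∈))) ∷ filterᵇ-unique p xs us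
... | false = filterᵇ-unique p xs us

filterᵇ-cong : {A : Set} {p q : A → Bool} (xs : List A) → (∀ x → x ∈ xs → p x ≡ q x) → filterᵇ p xs ≡ filterᵇ q xs
filterᵇ-cong []       _ = refl
filterᵇ-cong {q = q} (x ∷ xs) h rewrite h x (here refl) with q x
... | true  = cong (x ∷_) (filterᵇ-cong xs (λ y y∈ → h y (there y∈)))
... | false = filterᵇ-cong xs (λ y y∈ → h y (there y∈))

map-unique : {A B : Set} (φ : B → A) (ys : List B) →
  (∀ y y' → y ∈ ys → y' ∈ ys → φ y ≡ φ y' → y ≡ y') → Unique ys → Unique (map φ ys)
map-unique φ []       _   _        = []
map-unique φ (y ∷ ys) inj (a ∷ us) =
  ∉⇒All≢ _ (λ φy∈ → let (y' , y'∈ , e) = ∈-map⁻ φ φy∈ in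
    All≢⇒∉ ys a (subst (_∈ ys) (sym (inj y y' (here refl) (there y'∈) e)) y'∈))
  ∷ map-unique φ ys (λ u v u∈ v∈ → inj u v (there u∈) (there v∈)) us

∈-concatMap : {A B : Set} (f : A → List B) (xs : List A) {x : A} {b : B} → x ∈ xs → b ∈ f x → b ∈ concatMap f xs
∈-concatMap f (x ∷ xs) (here refl) b∈ = ∈-++⁺ˡ b∈
∈-concatMap f (x ∷ xs) (there x∈)  b∈ = ∈-++⁺ʳ (f x) (∈-concatMap f xs x∈ b∈)

concatMap-∈ : {A B : Set} (f : A → List B) (xs : List A) {b : B} → b ∈ concatMap f xs → ∃[ x ] x ∈ xs × b ∈ f x
concatMap-∈ f (z ∷ zs) b∈ with ∈-++⁻ (f z) b∈
... | inj₁ p = z , here refl , p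
... | inj₂ p with y , y∈ , q ← concatMap-∈ f zs p = y , there y∈ , q

concatMap-unique : {A B : Set} (f : A → List B) (xs : List A) → Unique xs →
  (∀ x → Unique (f x)) → (∀ x y b → b ∈ f x → b ∈ f y → x ≡ y) → Unique (concatMap f xs)
concatMap-unique f []       _        _  _   = []
concatMap-unique f (x ∷ xs) (a ∷ us) uf dis =
  Uniq.++⁺ (uf x) (concatMap-unique f xs us uf dis)
    (λ { {b} (b∈₁ , b∈₂) → let (y , y∈ , b∈y) = concatMap-∈ f xs b∈₂ in
      All≢⇒∉ xs a (subst (_∈ xs) (sym (dis x y b b∈₁ b∈y)) y∈) })

unique-↭ : {A : Set} {xs ys : List A} → Unique xs → Unique ys →
  (∀ x → x ∈ xs → x ∈ ys) → (∀ x → x ∈ ys → x ∈ xs) → xs ↭ ys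
unique-↭ u v f g = ∼bag⇒↭ (unique∧set⇒bag u v (λ {x} → mk⇔ (f x) (g x)))

∈-range⁺ : ∀ {a b k} → a ≤ k → k ≤ b → k ∈ range a b
∈-range⁺ {a} {b} {k} a≤k k≤b = subst (_∈ range a b) (ℕₚ.m+[n∸m]≡n a≤k)
  (∈-map⁺ (a ℕ.+_) (∈-upTo⁺ (ℕₚ.∸-monoˡ-< (s≤s k≤b) a≤k)))

∈-range⁻ : ∀ a b {k} → k ∈ range a b → a ≤ k × k ≤ b
∈-range⁻ a b k∈ with i , i∈ , refl ← ∈-map⁻ (a ℕ.+_) k∈ = ℕₚ.m≤m+n a i , ℕₚ.≤-pred (lem (∈-upTo⁻ i∈))
  where
  lem : i < suc b ∸ a → a ℕ.+ i < suc b
  -- As `upTo (suc b ∸ a)` has the member `i`, the difference is not truncated to 0, so `a ≤ suc b`.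
  lem p = subst (_≤ suc b) (ℕₚ.+-suc a i)
    (≤-trans (ℕₚ.+-monoʳ-≤ a p) (ℕₚ.≤-reflexive (ℕₚ.m+[n∸m]≡n {a} {suc b} (ℕₚ.<⇒≤ (ℕₚ.m∸n≢0⇒n<m {suc b} {a} (λ e → ℕₚ.n≮0 (subst (i <_) e p)))))))

range-unique : ∀ a b → Unique (range a b)
range-unique a b = Uniq.map⁺ (ℕₚ.+-cancelˡ-≡ a _ _) (Uniq.upTo⁺ _)

range-suc : ∀ n → range 1 (suc n) ≡ range 1 n ++ (suc n ∷ [])
range-suc n = trans (cong (map suc) (sym (upTo-∷ʳ n))) (map-++ suc (upTo n) (n ∷ []))
  where open import Data.List.Properties using (upTo-∷ʳ; map-++)

range-split : ∀ {a n b} → a ≤ suc n → n ≤ b → range a b ↭ range a n ++ range (suc n) b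
range-split {a} {n} {b} a≤sn n≤b = unique-↭ (range-unique a b)
  (Uniq.++⁺ (range-unique a n) (range-unique (suc n) b) (λ (p , q) → <⇒≱ (proj₁ (∈-range⁻ (suc n) b q)) (proj₂ (∈-range⁻ a n p))))
  to from
  where
  to : ∀ y → y ∈ range a b → y ∈ range a n ++ range (suc n) b
  to y y∈ with y ℕₚ.≤? n
  ... | yes p = ∈-++⁺ˡ (∈-range⁺ (proj₁ (∈-range⁻ a b y∈)) p)
  ... | no np = ∈-++⁺ʳ (range a n) (∈-range⁺ (ℕₚ.≰⇒> np) (proj₂ (∈-range⁻ a b y∈)))
  from : ∀ y → y ∈ range a n ++ range (suc n) b → y ∈ range a b
  from y y∈ with ∈-++⁻ (range a n) y∈
  ... | inj₁ p = ∈-range⁺ (proj₁ (∈-range⁻ a n p)) (≤-trans (proj₂ (∈-range⁻ a n p)) n≤b)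
  ... | inj₂ p = ∈-range⁺ (≤-trans a≤sn (proj₁ (∈-range⁻ (suc n) b p))) (proj₂ (∈-range⁻ (suc n) b p))

≤ᵇ-yes : ∀ {m n} → m ≤ n → (m ≤ᵇ n) ≡ true
≤ᵇ-yes p = T⇒true (≤⇒≤ᵇ p)

≤ᵇ-no : ∀ {m n} → n < m → (m ≤ᵇ n) ≡ false
≤ᵇ-no {m} {n} p = ¬T⇒false (λ t → <⇒≱ p (≤ᵇ⇒≤ m n t))

<ᵇ-yes : ∀ {m n} → m < n → (m <ᵇ n) ≡ true
<ᵇ-yes p = T⇒true (<⇒<ᵇ p)

<ᵇ-no : ∀ {m n} → n ≤ m → (m <ᵇ n) ≡ false
<ᵇ-no {m} {n} p = ¬T⇒false (λ t → ≤⇒≯ p (<ᵇ⇒< m n t))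

≡ᵇ-refl : ∀ n → (n ≡ᵇ n) ≡ true
≡ᵇ-refl n = T⇒true (≡⇒≡ᵇ n n refl)

≡ᵇ-no : ∀ {m n} → m ≢ n → (m ≡ᵇ n) ≡ false
≡ᵇ-no {m} {n} p = ¬T⇒false (λ t → p (≡ᵇ⇒≡ m n t))

-- Finite sums and products in a commutative ring.

module Sums {c ℓ} (R : CommutativeRing c ℓ) where
  open CommutativeRing R
    hiding (zero)
    renaming (refl to ≈-refl; sym to ≈-sym; trans to ≈-trans; reflexive to ≈-reflexive)
  open import Algebra.Properties.Semiring.Exp semiring public using (_^_; ^-congˡ)
  open import Algebra.Solver.Ring.NaturalCoefficients.Default commutativeSemiring public
    using (solve; _:+_; _:*_; con; _:=_)
  open import Relation.Binary.Reasoning.Setoid setoid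

  ⟦_⟧ : Bool → Carrier
  ⟦ true ⟧  = 1#
  ⟦ false ⟧ = 0#

  ⟦∧⟧ : ∀ a b → ⟦ a ∧ b ⟧ ≈ ⟦ a ⟧ * ⟦ b ⟧
  ⟦∧⟧ true  b = ≈-sym (*-identityˡ _)
  ⟦∧⟧ false b = ≈-sym (zeroˡ _)

  ∑ ∏ : {A : Set} → List A → (A → Carrier) → Carrier
  ∑ []       f = 0#
  ∑ (x ∷ xs) f = f x + ∑ xs f
  ∏ []       f = 1#
  ∏ (x ∷ xs) f = f x * ∏ xs f

  ∑-cong∈ : {A : Set} (xs : List A) {f g : A → Carrier} → (∀ x → x ∈ xs → f x ≈ g x) → ∑ xs f ≈ ∑ xs g
  ∑-cong∈ []       h = ≈-refl
  ∑-cong∈ (x ∷ xs) h = +-cong (h x (here refl)) (∑-cong∈ xs (λ y y∈ → h y (there y∈)))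

  ∑-cong : {A : Set} (xs : List A) {f g : A → Carrier} → (∀ x → f x ≈ g x) → ∑ xs f ≈ ∑ xs g
  ∑-cong xs h = ∑-cong∈ xs (λ x _ → h x)

  ∑-zero : {A : Set} (xs : List A) {f : A → Carrier} → (∀ x → x ∈ xs → f x ≈ 0#) → ∑ xs f ≈ 0#
  ∑-zero []       h = ≈-refl
  ∑-zero (x ∷ xs) h = ≈-trans (+-cong (h x (here refl)) (∑-zero xs (λ y y∈ → h y (there y∈)))) (+-identityˡ 0#)

  ∑-+ : {A : Set} (xs : List A) (f g : A → Carrier) → ∑ xs (λ x → f x + g x) ≈ ∑ xs f + ∑ xs g
  ∑-+ []       f g = ≈-sym (+-identityˡ 0#)
  ∑-+ (x ∷ xs) f g = ≈-trans (+-congˡ (∑-+ xs f g))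
    (solve 4 (λ a b c d → (a :+ b) :+ (c :+ d) := (a :+ c) :+ (b :+ d)) ≈-refl (f x) (g x) (∑ xs f) (∑ xs g))

  ∑-*ˡ : {A : Set} (xs : List A) (a : Carrier) (f : A → Carrier) → ∑ xs (λ x → a * f x) ≈ a * ∑ xs f
  ∑-*ˡ []       a f = ≈-sym (zeroʳ a)
  ∑-*ˡ (x ∷ xs) a f = ≈-trans (+-congˡ (∑-*ˡ xs a f)) (≈-sym (distribˡ a (f x) (∑ xs f)))

  ∑-*ʳ : {A : Set} (xs : List A) (a : Carrier) (f : A → Carrier) → ∑ xs (λ x → f x * a) ≈ ∑ xs f * a
  ∑-*ʳ xs a f = ≈-trans (∑-cong xs (λ x → *-comm (f x) a)) (≈-trans (∑-*ˡ xs a f) (*-comm a _))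

  ∑-++ : {A : Set} (xs ys : List A) (f : A → Carrier) → ∑ (xs ++ ys) f ≈ ∑ xs f + ∑ ys f
  ∑-++ []       ys f = ≈-sym (+-identityˡ _)
  ∑-++ (x ∷ xs) ys f = ≈-trans (+-congˡ (∑-++ xs ys f)) (≈-sym (+-assoc (f x) _ _))

  ∑-map : {A B : Set} (φ : B → A) (ys : List B) (f : A → Carrier) → ∑ (map φ ys) f ≡ ∑ ys (f ∘ φ)
  ∑-map φ []       f = refl
  ∑-map φ (y ∷ ys) f = cong (f (φ y) +_) (∑-map φ ys f)

  ∑-concatMap : {A B : Set} (φ : B → List A) (ys : List B) (f : A → Carrier) →
    ∑ (concatMap φ ys) f ≈ ∑ ys (λ y → ∑ (φ y) f)
  ∑-concatMap φ []       f = ≈-refl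
  ∑-concatMap φ (y ∷ ys) f = ≈-trans (∑-++ (φ y) _ f) (+-congˡ (∑-concatMap φ ys f))

  ∑-swap : {A B : Set} (xs : List A) (ys : List B) (f : A → B → Carrier) →
    ∑ xs (λ x → ∑ ys (f x)) ≈ ∑ ys (λ y → ∑ xs (λ x → f x y))
  ∑-swap []       ys f = ≈-sym (∑-zero ys (λ _ _ → ≈-refl))
  ∑-swap (x ∷ xs) ys f = ≈-trans (+-congˡ (∑-swap xs ys f)) (≈-sym (∑-+ ys (f x) _))

  ∑-↭ : {A : Set} {xs ys : List A} (f : A → Carrier) → xs ↭ ys → ∑ xs f ≈ ∑ ys f
  ∑-↭ f Perm.refl          = ≈-refl
  ∑-↭ f (Perm.prep x p)    = +-congˡ (∑-↭ f p)
  ∑-↭ f (Perm.swap {xs} {ys} x y p) = ≈-trans (+-congˡ (+-congˡ (∑-↭ f p)))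
    (solve 3 (λ a b c → a :+ (b :+ c) := b :+ (a :+ c)) ≈-refl (f x) (f y) (∑ ys f))
  ∑-↭ f (Perm.trans p q)   = ≈-trans (∑-↭ f p) (∑-↭ f q)

  ∑-filterᵇ : {A : Set} (p : A → Bool) (xs : List A) (f : A → Carrier) →
    ∑ (filterᵇ p xs) f ≈ ∑ xs (λ x → ⟦ p x ⟧ * f x)
  ∑-filterᵇ p []       f = ≈-refl
  ∑-filterᵇ p (x ∷ xs) f with p x
  ... | true  = +-cong (≈-sym (*-identityˡ _)) (∑-filterᵇ p xs f)
  ... | false = ≈-trans (∑-filterᵇ p xs f) (≈-trans (≈-sym (+-identityˡ _)) (+-congʳ (≈-sym (zeroˡ _))))

  ∑-reindex : {A B : Set} (xs : List A) (ys : List B) (φ : B → A) (f : A → Carrier) →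
    Unique xs → Unique ys → (∀ y y' → y ∈ ys → y' ∈ ys → φ y ≡ φ y' → y ≡ y') →
    (∀ y → y ∈ ys → φ y ∈ xs) → (∀ x → x ∈ xs → ∃[ y ] y ∈ ys × x ≡ φ y) →
    ∑ xs f ≈ ∑ ys (f ∘ φ)
  ∑-reindex xs ys φ f ux uy inj to from = ≈-trans
    (∑-↭ f (unique-↭ ux (map-unique φ ys inj uy)
      (λ x x∈ → let (y , y∈ , e) = from x x∈ in subst (_∈ map φ ys) (sym e) (∈-map⁺ φ y∈))
      (λ x x∈ → let (y , y∈ , e) = ∈-map⁻ φ x∈ in subst (_∈ xs) (sym e) (to y y∈))))
    (≈-reflexive (∑-map φ ys f))

  ∑-delta : (xs : List ℕ) (a : ℕ) (f : ℕ → Carrier) → Unique xs → a ∈ xs →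
    ∑ xs (λ x → ⟦ a ≡ᵇ x ⟧ * f x) ≈ f a
  ∑-delta (x ∷ xs) a f (n ∷ us) (here refl) rewrite ≡ᵇ-refl a = begin
    1# * f a + ∑ xs (λ y → ⟦ a ≡ᵇ y ⟧ * f y)
      ≈⟨ +-cong (*-identityˡ _) (∑-zero xs (λ y y∈ → ≈-trans (*-congʳ (≈-reflexive (cong ⟦_⟧ (≡ᵇ-no (λ e → All≢⇒∉ xs n (subst (_∈ xs) (sym e) y∈)))))) (zeroˡ _))) ⟩
    f a + 0# ≈⟨ +-identityʳ _ ⟩
    f a ∎
  ∑-delta (x ∷ xs) a f (n ∷ us) (there a∈) = begin
    ⟦ a ≡ᵇ x ⟧ * f x + ∑ xs (λ y → ⟦ a ≡ᵇ y ⟧ * f y)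
      ≈⟨ +-cong (≈-trans (*-congʳ (≈-reflexive (cong ⟦_⟧ (≡ᵇ-no (λ e → All≢⇒∉ xs n (subst (_∈ xs) e a∈)))))) (zeroˡ _)) (∑-delta xs a f us a∈) ⟩
    0# + f a ≈⟨ +-identityˡ _ ⟩
    f a ∎

  ∏-cong∈ : {A : Set} (xs : List A) {f g : A → Carrier} → (∀ x → x ∈ xs → f x ≈ g x) → ∏ xs f ≈ ∏ xs g
  ∏-cong∈ []       h = ≈-refl
  ∏-cong∈ (x ∷ xs) h = *-cong (h x (here refl)) (∏-cong∈ xs (λ y y∈ → h y (there y∈)))

  ∏-one : {A : Set} (xs : List A) {f : A → Carrier} → (∀ x → x ∈ xs → f x ≈ 1#) → ∏ xs f ≈ 1#
  ∏-one []       h = ≈-refl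
  ∏-one (x ∷ xs) h = ≈-trans (*-cong (h x (here refl)) (∏-one xs (λ y y∈ → h y (there y∈)))) (*-identityˡ 1#)

  ∏-* : {A : Set} (xs : List A) (f g : A → Carrier) → ∏ xs (λ x → f x * g x) ≈ ∏ xs f * ∏ xs g
  ∏-* []       f g = ≈-sym (*-identityˡ 1#)
  ∏-* (x ∷ xs) f g = ≈-trans (*-congˡ (∏-* xs f g))
    (solve 4 (λ a b c d → (a :* b) :* (c :* d) := (a :* c) :* (b :* d)) ≈-refl (f x) (g x) (∏ xs f) (∏ xs g))

  ∏-++ : {A : Set} (xs ys : List A) (f : A → Carrier) → ∏ (xs ++ ys) f ≈ ∏ xs f * ∏ ys f
  ∏-++ []       ys f = ≈-sym (*-identityˡ _)
  ∏-++ (x ∷ xs) ys f = ≈-trans (*-congˡ (∏-++ xs ys f)) (≈-sym (*-assoc (f x) _ _))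

  ∏-map : {A B : Set} (φ : B → A) (ys : List B) (f : A → Carrier) → ∏ (map φ ys) f ≡ ∏ ys (f ∘ φ)
  ∏-map φ []       f = refl
  ∏-map φ (y ∷ ys) f = cong (f (φ y) *_) (∏-map φ ys f)

  ∏-↭ : {A : Set} {xs ys : List A} (f : A → Carrier) → xs ↭ ys → ∏ xs f ≈ ∏ ys f
  ∏-↭ f Perm.refl          = ≈-refl
  ∏-↭ f (Perm.prep x p)    = *-congˡ (∏-↭ f p)
  ∏-↭ f (Perm.swap {xs} {ys} x y p) = ≈-trans (*-congˡ (*-congˡ (∏-↭ f p)))
    (solve 3 (λ a b c → a :* (b :* c) := b :* (a :* c)) ≈-refl (f x) (f y) (∏ ys f))
  ∏-↭ f (Perm.trans p q)   = ≈-trans (∏-↭ f p) (∏-↭ f q)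

  ⟦all⟧ : {A : Set} (p : A → Bool) (xs : List A) → ⟦ all p xs ⟧ ≈ ∏ xs (λ x → ⟦ p x ⟧)
  ⟦all⟧ p []       = ≈-refl
  ⟦all⟧ p (x ∷ xs) = ≈-trans (⟦∧⟧ (p x) _) (*-congˡ (⟦all⟧ p xs))

-- Strips as matrices indexed by row lengths

module Matrices {c ℓ} (R : CommutativeRing c ℓ) (c₀ C : ℕ) where
  open CommutativeRing R
    hiding (zero)
    renaming (refl to ≈-refl; sym to ≈-sym; trans to ≈-trans; reflexive to ≈-reflexive)
  open Sums R
  open import Relation.Binary.Reasoning.Setoid setoid

  cs : List ℕ
  cs = range c₀ C

  vecs : ∀ N → List (Vec ℕ N)
  vecs zero    = [] ∷ []
  vecs (suc N) = concatMap (λ c → map (c ∷_) (vecs N)) cs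

  hd : ∀ {N} → Vec ℕ N → ℕ
  hd []       = c₀
  hd (l ∷ ls) = l

  -- Partitions with `c₀` in the role of 0: the condition in the empty case is handed upwards and
  -- forces every row to end at `c₀` or beyond.
  data Par : ∀ {N} → ℕ → Vec ℕ N → Set where
    []  : ∀ {a} → c₀ ≤ a → Par a []
    _∷_ : ∀ {N a l} {ls : Vec ℕ N} → l ≤ a → Par l ls → Par a (l ∷ ls)

  Par-hd : ∀ {N a} {ls : Vec ℕ N} → Par a ls → hd ls ≤ a
  Par-hd ([] h)  = h
  Par-hd (h ∷ _) = h

  Par-c₀≤hd : ∀ {N a} {ls : Vec ℕ N} → Par a ls → c₀ ≤ hd ls
  Par-c₀≤hd ([] _)   = ≤-refl
  Par-c₀≤hd (_ ∷ ps) = ≤-trans (Par-c₀≤hd ps) (Par-hd ps)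

  hfac : Carrier → ℕ → ℕ → Carrier
  hfac x l n = ⟦ n ≤ᵇ l ⟧ * x ^ (l ∸ n)

  vfac : Carrier → ℕ → ℕ → Carrier
  vfac y l l' = ⟦ l ≡ᵇ l' ⟧ + ⟦ suc l ≡ᵇ l' ⟧ * y

  -- In a horizontal strip ls/ns the next row of ls has length l ≤ a, where a is the
  -- length of the current row of ns; the last box of that row is a corner when l < a.
  cap : Carrier → Carrier → ℕ → ℕ → Carrier
  cap x v l a = ⟦ l ≤ᵇ a ⟧ * (1# + ⟦ l <ᵇ a ⟧ * (v * x))

  Hrows : ∀ {N} → (x v : ℕ → Carrier) → Vec ℕ N → Vec ℕ N → Carrier
  Hrows x v []       []       = 1#
  Hrows x v (l ∷ ls) (n ∷ ns) = hfac (x 0) l n * (cap (x 0) (v 0) (hd ls) n * Hrows (x ∘ suc) (v ∘ suc) ls ns)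

  -- Entry 0 of x and v belongs to the row above the vectors, whose length in the smaller shape is a.
  Hor : ∀ {N} → (x v : ℕ → Carrier) → ℕ → Vec ℕ N → Vec ℕ N → Carrier
  Hor x v a ls ns = cap (x 0) (v 0) (hd ls) a * Hrows (x ∘ suc) (v ∘ suc) ls ns

  -- Here and in `Dif` the second vector is the larger shape, in `Hor` it is the first. So shapes
  -- grow along a factor `Ver` or `Dif` and shrink along a factor `Hor`.
  Ver : ∀ {N} → (y : ℕ → Carrier) → Vec ℕ N → Vec ℕ N → Carrier
  Ver y []       []       = 1#
  Ver y (l ∷ ls) (n ∷ ns) = vfac (y 0) l n * Ver (y ∘ suc) ls ns

  Dif : ∀ {N} → (d : ℕ → Carrier) → Vec ℕ N → Vec ℕ N → Carrier
  Dif d []       []       = 1#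
  Dif d (l ∷ ls) (n ∷ ns) = hfac (d 0) n l * Dif (d ∘ suc) ls ns

  zeros : ℕ → Carrier
  zeros _ = 0#

  -- Entry `i` of a weight sequence belongs to row `i` in `Hor`, but to row `i + 1` in `Ver` and
  -- `Dif`, which have no row above. So `U_k` has the weights `before (suc k) u`, while the single
  -- cut `after k` gives the rows `≥ k` in `H_k` and the rows `> k` in `M_k`. This is the difference
  -- between the weak bound on `T'` and the strict bound on `T''`.
  before : ℕ → (ℕ → Carrier) → ℕ → Carrier
  before zero    u i       = 0#
  before (suc k) u zero    = u 0
  before (suc k) u (suc i) = before k (u ∘ suc) i

  after : ℕ → Carrier → ℕ → Carrier
  after zero    y i       = y
  after (suc k) y zero    = 0#
  after (suc k) y (suc i) = after k y i

  ∑-vecs : ∀ N (f : Vec ℕ (suc N) → Carrier) →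
    ∑ (vecs (suc N)) f ≈ ∑ cs (λ c → ∑ (vecs N) (λ v → f (c ∷ v)))
  ∑-vecs N f = ≈-trans (∑-concatMap (λ c → map (c ∷_) (vecs N)) cs f)
    (∑-cong cs (λ c → ≈-reflexive (∑-map (c ∷_) (vecs N) f)))

  ∑-vecs-* : ∀ N {F : Vec ℕ (suc N) → Carrier} {f : ℕ → Carrier} {g : Vec ℕ N → Carrier} →
    (∀ c v → F (c ∷ v) ≈ f c * g v) → ∑ (vecs (suc N)) F ≈ ∑ cs f * ∑ (vecs N) g
  ∑-vecs-* N {F} {f} {g} h = begin
    ∑ (vecs (suc N)) F                             ≈⟨ ∑-vecs N F ⟩
    ∑ cs (λ c → ∑ (vecs N) (λ v → F (c ∷ v)))      ≈⟨ ∑-cong cs (λ c → ≈-trans (∑-cong (vecs N) (h c)) (∑-*ˡ (vecs N) (f c) g)) ⟩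
    ∑ cs (λ c → f c * ∑ (vecs N) g)                ≈⟨ ∑-*ʳ cs _ f ⟩
    ∑ cs f * ∑ (vecs N) g                          ∎

  ∈-cs : ∀ {a} → c₀ ≤ a → a ≤ C → a ∈ cs
  ∈-cs = ∈-range⁺

  ∑-vecs-δ : ∀ N {F : Vec ℕ (suc N) → Carrier} {G : ℕ → Vec ℕ N → Carrier} a → c₀ ≤ a → a ≤ C →
    (∀ c v → F (c ∷ v) ≈ ⟦ a ≡ᵇ c ⟧ * G c v) → ∑ (vecs (suc N)) F ≈ ∑ (vecs N) (G a)
  ∑-vecs-δ N {F} {G} a p q h = begin
    ∑ (vecs (suc N)) F                             ≈⟨ ∑-vecs N F ⟩
    ∑ cs (λ c → ∑ (vecs N) (λ v → F (c ∷ v)))      ≈⟨ ∑-cong cs (λ c → ≈-trans (∑-cong (vecs N) (h c)) (∑-*ˡ (vecs N) _ (G c))) ⟩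
    ∑ cs (λ c → ⟦ a ≡ᵇ c ⟧ * ∑ (vecs N) (G c))     ≈⟨ ∑-delta cs a _ (range-unique c₀ C) (∈-cs p q) ⟩
    ∑ (vecs N) (G a)                               ∎

  δ-no : ∀ m n {f} → m ≢ n → ⟦ m ≡ᵇ n ⟧ * f ≈ 0#
  δ-no m n p rewrite ≡ᵇ-no p = zeroˡ _

  hfac-yes : ∀ x {l n} → n ≤ l → hfac x l n ≈ x ^ (l ∸ n)
  hfac-yes x p rewrite ≤ᵇ-yes p = *-identityˡ _

  hfac-no : ∀ x {l n} → l < n → hfac x l n ≈ 0#
  hfac-no x p rewrite ≤ᵇ-no p = zeroˡ _

  cap-0 : ∀ x l a → cap x 0# l a ≈ ⟦ l ≤ᵇ a ⟧
  cap-0 x l a = ≈-trans (*-congˡ (≈-trans (+-congˡ (≈-trans (*-congˡ (zeroˡ x)) (zeroʳ _))) (+-identityʳ 1#))) (*-identityʳ _)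

  vfac-0 : ∀ l n → vfac 0# l n ≈ ⟦ l ≡ᵇ n ⟧
  vfac-0 l n = ≈-trans (+-congˡ (zeroʳ _)) (+-identityʳ _)

  -- The column `suc l` may lie outside the range of summation; the last hypothesis says that
  -- nothing is lost then.
  ∑-vfacˡ : ∀ y l (g : ℕ → Carrier) → c₀ ≤ l → l ≤ C → (C < suc l → g (suc l) ≈ 0#) →
    ∑ cs (λ l' → vfac y l l' * g l') ≈ g l + y * g (suc l)
  ∑-vfacˡ y l g p q h = begin
    ∑ cs (λ l' → vfac y l l' * g l')
      ≈⟨ ∑-cong cs (λ l' → solve 4 (λ a b y g → (a :+ b :* y) :* g := a :* g :+ y :* (b :* g)) ≈-refl ⟦ l ≡ᵇ l' ⟧ ⟦ suc l ≡ᵇ l' ⟧ y (g l')) ⟩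
    ∑ cs (λ l' → ⟦ l ≡ᵇ l' ⟧ * g l' + y * (⟦ suc l ≡ᵇ l' ⟧ * g l'))
      ≈⟨ ∑-+ cs _ _ ⟩
    ∑ cs (λ l' → ⟦ l ≡ᵇ l' ⟧ * g l') + ∑ cs (λ l' → y * (⟦ suc l ≡ᵇ l' ⟧ * g l'))
      ≈⟨ +-cong (∑-delta cs l g (range-unique c₀ C) (∈-cs p q)) (≈-trans (∑-*ˡ cs y _) (*-congˡ rest)) ⟩
    g l + y * g (suc l) ∎
    where
    rest : ∑ cs (λ l' → ⟦ suc l ≡ᵇ l' ⟧ * g l') ≈ g (suc l)
    rest with suc l ℕₚ.≤? C
    ... | yes s = ∑-delta cs (suc l) g (range-unique c₀ C) (∈-cs (ℕₚ.m≤n⇒m≤1+n p) s)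
    ... | no ns = ≈-trans (∑-zero cs (λ x x∈ → δ-no (suc l) x (λ { refl → ns (proj₂ (∈-range⁻ c₀ C x∈)) }))) (≈-sym (h (ℕₚ.≰⇒> ns)))

  ∑-vfacʳ : ∀ y n (h : ℕ → Carrier) → c₀ ≤ suc n → suc n ≤ C → (n < c₀ → h n ≈ 0#) →
    ∑ cs (λ k → h k * vfac y k (suc n)) ≈ h (suc n) + y * h n
  ∑-vfacʳ y n h p q z = begin
    ∑ cs (λ k → h k * vfac y k (suc n))
      ≈⟨ ∑-cong cs (λ k → ≈-trans (*-congˡ (+-cong (≈-reflexive (cong ⟦_⟧ (≡ᵇ-sym k (suc n)))) (*-congʳ (≈-reflexive (cong ⟦_⟧ (≡ᵇ-sym k n))))))
           (solve 4 (λ a b y g → g :* (a :+ b :* y) := a :* g :+ y :* (b :* g)) ≈-refl ⟦ suc n ≡ᵇ k ⟧ ⟦ n ≡ᵇ k ⟧ y (h k))) ⟩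
    ∑ cs (λ k → ⟦ suc n ≡ᵇ k ⟧ * h k + y * (⟦ n ≡ᵇ k ⟧ * h k))
      ≈⟨ ∑-+ cs _ _ ⟩
    ∑ cs (λ k → ⟦ suc n ≡ᵇ k ⟧ * h k) + ∑ cs (λ k → y * (⟦ n ≡ᵇ k ⟧ * h k))
      ≈⟨ +-cong (∑-delta cs (suc n) h (range-unique c₀ C) (∈-cs p q)) (≈-trans (∑-*ˡ cs y _) (*-congˡ rest)) ⟩
    h (suc n) + y * h n ∎
    where
    ≡ᵇ-sym : ∀ a b → (a ≡ᵇ b) ≡ (b ≡ᵇ a)
    ≡ᵇ-sym a b = T-ext (λ t → ≡⇒≡ᵇ b a (sym (≡ᵇ⇒≡ a b t))) (λ t → ≡⇒≡ᵇ a b (sym (≡ᵇ⇒≡ b a t)))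
    rest : ∑ cs (λ k → ⟦ n ≡ᵇ k ⟧ * h k) ≈ h n
    rest with c₀ ℕₚ.≤? n
    ... | yes s = ∑-delta cs n h (range-unique c₀ C) (∈-cs s (ℕₚ.<⇒≤ q))
    ... | no ns = ≈-trans (∑-zero cs (λ x x∈ → δ-no n x (λ { refl → ns (proj₁ (∈-range⁻ c₀ C x∈)) }))) (≈-sym (z (ℕₚ.≰⇒> ns)))

  ∑-vfacʳ-0 : ∀ y (h : ℕ → Carrier) → c₀ ≤ 0 → ∑ cs (λ k → h k * vfac y k 0) ≈ h 0
  ∑-vfacʳ-0 y h p = begin
    ∑ cs (λ k → h k * vfac y k 0)  ≈⟨ ∑-cong cs lem ⟩
    ∑ cs (λ k → ⟦ 0 ≡ᵇ k ⟧ * h k)  ≈⟨ ∑-delta cs 0 h (range-unique c₀ C) (∈-cs p z≤n) ⟩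
    h 0 ∎
    where
    lem : ∀ k → h k * vfac y k 0 ≈ ⟦ 0 ≡ᵇ k ⟧ * h k
    lem zero    = solve 2 (λ h y → h :* (con 1 :+ con 0 :* y) := con 1 :* h) ≈-refl (h 0) y
    lem (suc k) = solve 2 (λ h y → h :* (con 0 :+ con 0 :* y) := con 0 :* h) ≈-refl (h (suc k)) y

  -- One row of the exchange of `Hor` and `Ver` between fixed outer vectors `ls` and `ns`: their
  -- current rows are `l` and `n`, the next row of `ls` is `m`, the previous row of `ns` is `a`.
  -- With `Ver` first, the strip condition compares the middle row with `a`; with `Hor` first, it
  -- compares `m` with the middle row. In both orders only fixed neighbours occur, so the sum over
  -- the middle vectors factors into row sums, `S₁` and `S₂` respectively.
  module Row (x y : Carrier) (m l n a : ℕ) (m≤l : m ≤ l) (n≤a : n ≤ a) (l≤C : l ≤ C) (a≤C : a ≤ C)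
             (c₀≤m : c₀ ≤ m) (c₀≤n : c₀ ≤ n) where
    g h : ℕ → Carrier
    g l' = ⟦ l' ≤ᵇ a ⟧ * hfac x l' n
    h k  = hfac x l k * ⟦ m ≤ᵇ k ⟧

    S₁ S₂ : Carrier
    S₁ = ∑ cs (λ l' → vfac y l l' * g l')
    S₂ = ∑ cs (λ k → h k * vfac y k n)

    S₁≈ : S₁ ≈ g l + y * g (suc l)
    S₁≈ = ∑-vfacˡ y l g (≤-trans c₀≤m m≤l) l≤C
      (λ q → ≈-trans (*-congʳ (≈-reflexive (cong ⟦_⟧ (≤ᵇ-no (ℕₚ.≤-<-trans a≤C q))))) (zeroˡ _))

    g-yes : ∀ {l'} → l' ≤ a → n ≤ l' → g l' ≈ x ^ (l' ∸ n)
    g-yes p q rewrite ≤ᵇ-yes p = ≈-trans (*-identityˡ _) (hfac-yes x q)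

    g-hi : ∀ {l'} → a < l' → g l' ≈ 0#
    g-hi p rewrite ≤ᵇ-no p = zeroˡ _

    g-lo : ∀ {l'} → l' < n → g l' ≈ 0#
    g-lo p = ≈-trans (*-congˡ (hfac-no x p)) (zeroʳ _)

    d p q : Carrier
    d = x ^ (l ∸ n)
    p = ⟦ m ≤ᵇ n ⟧
    q = ⟦ m <ᵇ n ⟧

    pq : p * q ≈ q
    pq with m ℕₚ.≤? n
    ... | yes r rewrite ≤ᵇ-yes r = *-identityˡ _
    ... | no nr rewrite ≤ᵇ-no (ℕₚ.≰⇒> nr) | <ᵇ-no (ℕₚ.<⇒≤ (ℕₚ.≰⇒> nr)) = zeroˡ _

    S₂-ge : n ≤ l → S₂ ≈ d * p + y * ((x * d) * q)
    S₂-ge = go n c₀≤n (≤-trans n≤a a≤C)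
      where
      go : ∀ n → c₀ ≤ n → n ≤ C → n ≤ l →
        ∑ cs (λ k → h k * vfac y k n) ≈ x ^ (l ∸ n) * ⟦ m ≤ᵇ n ⟧ + y * ((x * x ^ (l ∸ n)) * ⟦ m <ᵇ n ⟧)
      -- Column 0 has no predecessor from which a vertical step could come; the formula agrees since
      -- `m <ᵇ 0` is false.
      go zero z _ _ = ≈-trans (∑-vfacʳ-0 y h z)
        (≈-trans (*-congʳ (hfac-yes x {l} {0} z≤n)) (solve 3 (λ e y z → e := e :+ y :* (z :* con 0)) ≈-refl _ y _))
      go (suc n') z w r = ≈-trans (∑-vfacʳ y n' h z w (λ s → ≈-trans (*-congˡ (≈-reflexive (cong ⟦_⟧ (≤ᵇ-no (ℕₚ.<-≤-trans s c₀≤m))))) (zeroʳ _)))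
        (+-cong (*-congʳ (hfac-yes x r)) (*-congˡ (*-cong (≈-trans (hfac-yes x {l} {n'} (ℕₚ.<⇒≤ r))
          (≈-reflexive (cong (x ^_) (ℕₚ.+-∸-assoc 1 r)))) (≈-reflexive (cong ⟦_⟧ eq)))))
        where
        eq : (m ≤ᵇ n') ≡ (m <ᵇ suc n')
        eq = T-ext (λ t → <⇒<ᵇ (s≤s (≤ᵇ⇒≤ m n' t))) (λ t → ≤⇒≤ᵇ (ℕₚ.≤-pred (<ᵇ⇒< m (suc n') t)))

    -- Only `k = l` survives: the horizontal strip wants `k ≤ l`, the vertical one `n ≤ suc k`.
    S₂-lt : l < n → S₂ ≈ ⟦ suc l ≡ᵇ n ⟧ * y
    S₂-lt = go n c₀≤n (≤-trans n≤a a≤C)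
      where
      go : ∀ n → c₀ ≤ n → n ≤ C → l < n → ∑ cs (λ k → h k * vfac y k n) ≈ ⟦ suc l ≡ᵇ n ⟧ * y
      go (suc n') z w r = ≈-trans (∑-vfacʳ y n' h z w (λ s → ≈-trans (*-congˡ (≈-reflexive (cong ⟦_⟧ (≤ᵇ-no (ℕₚ.<-≤-trans s c₀≤m))))) (zeroʳ _)))
        (≈-trans (+-congʳ (≈-trans (*-congʳ (hfac-no x r)) (zeroˡ _))) (≈-trans (+-identityˡ _) (≈-trans (*-comm _ _) (*-congʳ eq))))
        where
        eq : h n' ≈ ⟦ l ≡ᵇ n' ⟧
        eq with l ℕₚ.≟ n'
        ... | yes refl rewrite ≤ᵇ-yes m≤l | ≡ᵇ-refl l | ≤ᵇ-yes (≤-refl {l}) | ℕₚ.n∸n≡0 l = ≈-trans (*-identityʳ _) (*-identityˡ _)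
        ... | no l≢n' rewrite ≡ᵇ-no l≢n' = ≈-trans (*-congʳ (hfac-no x (ℕₚ.≤∧≢⇒< (ℕₚ.≤-pred r) l≢n'))) (zeroˡ _)

    cap-yes : ∀ {l a} → l < a → cap x y l a ≈ 1# + y * x
    cap-yes r rewrite ≤ᵇ-yes (ℕₚ.<⇒≤ r) | <ᵇ-yes r = ≈-trans (*-identityˡ _) (+-congˡ (*-identityˡ _))

    cap-eq : ∀ {l} → cap x y l l ≈ 1#
    cap-eq {l} rewrite ≤ᵇ-yes (≤-refl {l}) | <ᵇ-no (≤-refl {l}) = ≈-trans (*-identityˡ _) (≈-trans (+-congˡ (zeroˡ _)) (+-identityʳ _))

    cap-no : ∀ {l a} → a < l → cap x y l a ≈ 0#
    cap-no r rewrite ≤ᵇ-no r = zeroˡ _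

    -- For `n ≤ l` one has `S₁ = x^(l - n) cap x y l a` and `S₂ = x^(l - n) cap x y m n`: the
    -- vertical step, possible exactly when there is room for it, contributes the corner term of the
    -- cap. For `suc l = n` both sums are `y` and both caps are `1 + y x`. For smaller `l` both sums
    -- vanish.
    identity : S₁ * cap x y m n ≈ cap x y l a * S₂
    identity with n ℕₚ.≤? l
    identity | yes n≤l with ℕₚ.<-cmp l a
    ... | tri< l<a _ _ = begin
      S₁ * cap x y m n
        ≈⟨ *-congʳ (≈-trans S₁≈ (+-cong (g-yes (ℕₚ.<⇒≤ l<a) n≤l) (*-congˡ (≈-trans (g-yes l<a (ℕₚ.m≤n⇒m≤1+n n≤l)) (≈-reflexive (cong (x ^_) (ℕₚ.+-∸-assoc 1 n≤l))))))) ⟩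
      (d + y * (x * d)) * (p * (1# + q * (y * x)))
        ≈⟨ solve 5 (λ d y x p q → (d :+ y :* (x :* d)) :* (p :* (con 1 :+ q :* (y :* x))) := (con 1 :+ y :* x) :* (d :* p :+ y :* ((x :* d) :* (p :* q)))) ≈-refl d y x p q ⟩
      (1# + y * x) * (d * p + y * ((x * d) * (p * q)))
        ≈⟨ *-cong (≈-sym (cap-yes l<a)) (≈-trans (+-congˡ (*-congˡ (*-congˡ pq))) (≈-sym (S₂-ge n≤l))) ⟩
      cap x y l a * S₂ ∎
    ... | tri≈ _ refl _ = begin
      S₁ * cap x y m n
        ≈⟨ *-congʳ (≈-trans S₁≈ (+-cong (g-yes ≤-refl n≤l) (*-congˡ (g-hi (ℕₚ.n<1+n l))))) ⟩
      (d + y * 0#) * (p * (1# + q * (y * x)))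
        ≈⟨ solve 5 (λ d y x p q → (d :+ y :* con 0) :* (p :* (con 1 :+ q :* (y :* x))) := con 1 :* (d :* p :+ y :* ((x :* d) :* (p :* q)))) ≈-refl d y x p q ⟩
      1# * (d * p + y * ((x * d) * (p * q)))
        ≈⟨ *-cong (≈-sym (cap-eq {l})) (≈-trans (+-congˡ (*-congˡ (*-congˡ pq))) (≈-sym (S₂-ge n≤l))) ⟩
      cap x y l a * S₂ ∎
    ... | tri> _ _ a<l = begin
      S₁ * cap x y m n
        ≈⟨ *-congʳ (≈-trans S₁≈ (+-cong (g-hi a<l) (*-congˡ (g-hi (ℕₚ.m<n⇒m<1+n a<l))))) ⟩
      (0# + y * 0#) * cap x y m n
        ≈⟨ solve 3 (λ y c s → (con 0 :+ y :* con 0) :* c := con 0 :* s) ≈-refl y _ S₂ ⟩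
      0# * S₂
        ≈⟨ *-congʳ (≈-sym (cap-no a<l)) ⟩
      cap x y l a * S₂ ∎
    identity | no ¬n≤l with ℕₚ.≰⇒> ¬n≤l
    ... | l<n with suc l ℕₚ.≟ n
    ...   | yes refl = begin
      S₁ * cap x y m n
        ≈⟨ *-cong (≈-trans S₁≈ (+-cong (g-lo l<n) (*-congˡ (≈-trans (g-yes n≤a ≤-refl) (≈-reflexive (cong (x ^_) (ℕₚ.n∸n≡0 n))))))) (cap-yes (s≤s m≤l)) ⟩
      (0# + y * 1#) * (1# + y * x)
        ≈⟨ solve 2 (λ y x → (con 0 :+ y :* con 1) :* (con 1 :+ y :* x) := (con 1 :+ y :* x) :* (con 1 :* y)) ≈-refl y x ⟩
      (1# + y * x) * (1# * y)
        ≈⟨ *-cong (≈-sym (cap-yes n≤a)) (≈-trans (*-congʳ (≈-reflexive (sym (cong ⟦_⟧ (≡ᵇ-refl n))))) (≈-sym (S₂-lt l<n))) ⟩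
      cap x y l a * S₂ ∎
    ...   | no sl≢n = begin
      S₁ * cap x y m n
        ≈⟨ *-congʳ (≈-trans S₁≈ (+-cong (g-lo l<n) (*-congˡ (g-lo (ℕₚ.≤∧≢⇒< l<n sl≢n))))) ⟩
      (0# + y * 0#) * cap x y m n
        ≈⟨ solve 3 (λ y c s → (con 0 :+ y :* con 0) :* c := s :* (con 0 :* y)) ≈-refl y _ _ ⟩
      cap x y l a * (0# * y)
        ≈⟨ *-congˡ (≈-trans (*-congʳ (≈-reflexive (sym (cong ⟦_⟧ (≡ᵇ-no sl≢n))))) (≈-sym (S₂-lt l<n))) ⟩
      cap x y l a * S₂ ∎

-- The relations between the strip matrices.

module Commutation {c ℓ} (R : CommutativeRing c ℓ) (c₀ C : ℕ) where
  open CommutativeRing R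
    hiding (zero)
    renaming (refl to ≈-refl; sym to ≈-sym; trans to ≈-trans; reflexive to ≈-reflexive)
  open Sums R
  open Matrices R c₀ C
  open import Relation.Binary.Reasoning.Setoid setoid

  -- The last row is empty, where `a` counts as a row above the vector. At this row the cap that is
  -- left over from the telescoping equals 1.
  Last : ∀ {N} → ℕ → Vec ℕ N → Set
  Last a []       = a ≡ c₀
  Last a (n ∷ ns) = Last n ns

  -- By `Row.identity` the factor `cap x y` of the row above moves down one row at each step of `go`
  -- while `S₁` turns into `S₂`, until it disappears in the empty last row.
  Hor-Ver₀ : ∀ {N} x y a b (ls ns : Vec ℕ N) → Par b ls → b ≤ C → Par a ns → a ≤ C → Last a ns →
    ∑ (vecs N) (λ v → Ver (const y) ls v * Hor (const x) zeros a v ns)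
    ≈ ∑ (vecs N) (λ v → (cap x y (hd ls) a * Hrows (const x) zeros ls v) * Ver (const y) v ns)
  Hor-Ver₀ {N} x y a b ls ns pl b≤C pn a≤C la = ≈-trans (go a b ls ns pl b≤C pn a≤C la)
    (≈-trans (≈-sym (∑-*ˡ (vecs N) _ _)) (∑-cong (vecs N) (λ v → ≈-sym (*-assoc _ _ _))))
    where
    Q : ∀ {N} (ls ns : Vec ℕ N) → Carrier
    Q {N} ls ns = ∑ (vecs N) (λ v → Hrows (const x) zeros ls v * Ver (const y) v ns)

    go : ∀ {N} a b (ls ns : Vec ℕ N) → Par b ls → b ≤ C → Par a ns → a ≤ C → Last a ns →
      ∑ (vecs N) (λ v → Ver (const y) ls v * Hor (const x) zeros a v ns) ≈ cap x y (hd ls) a * Q ls ns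
    go a b [] [] _ _ _ _ refl rewrite ≤ᵇ-yes (≤-refl {c₀}) | <ᵇ-no (≤-refl {c₀}) =
      solve 2 (λ x y → con 1 :* ((con 1 :* (con 1 :+ con 0 :* (con 0 :* x))) :* con 1) :+ con 0
                     := (con 1 :* (con 1 :+ con 0 :* (y :* x))) :* (con 1 :* con 1 :+ con 0)) ≈-refl x y
    go {suc N} a b (l ∷ ls) (n ∷ ns) (l≤b ∷ pl) b≤C (n≤a ∷ pn) a≤C la = begin
      ∑ (vecs (suc N)) (λ v → Ver (const y) (l ∷ ls) v * Hor (const x) zeros a v (n ∷ ns))
        ≈⟨ ∑-vecs-* N (λ c v → ≈-trans (*-congˡ (*-congʳ (cap-0 x c a)))
             (solve 5 (λ p q r s t → (p :* q) :* (r :* (s :* t)) := (p :* (r :* s)) :* (q :* t)) ≈-refl _ _ _ _ _)) ⟩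
      S₁ * ∑ (vecs N) (λ v → Ver (const y) ls v * Hor (const x) zeros n v ns)
        ≈⟨ *-congˡ (go n l ls ns pl (≤-trans l≤b b≤C) pn (≤-trans n≤a a≤C) la) ⟩
      S₁ * (cap x y (hd ls) n * Q ls ns)
        ≈⟨ ≈-sym (*-assoc _ _ _) ⟩
      (S₁ * cap x y (hd ls) n) * Q ls ns
        ≈⟨ *-congʳ identity ⟩
      (cap x y l a * S₂) * Q ls ns
        ≈⟨ *-assoc _ _ _ ⟩
      cap x y l a * (S₂ * Q ls ns)
        ≈⟨ *-congˡ (≈-sym (∑-vecs-* N (λ c v → ≈-trans (*-congʳ (*-congˡ (*-congʳ (cap-0 x (hd ls) c))))
             (solve 5 (λ p q r s t → (p :* (q :* r)) :* (s :* t) := ((p :* q) :* s) :* (r :* t)) ≈-refl _ _ _ _ _)))) ⟩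
      cap x y l a * Q (l ∷ ls) (n ∷ ns) ∎
      where open Row x y (hd ls) l n a (Par-hd pl) n≤a (≤-trans l≤b b≤C) a≤C (Par-c₀≤hd pl)
                     (≤-trans (Par-c₀≤hd pn) (Par-hd pn))

  ⟦≡ᵇ⟧-sym : ∀ a b → ⟦ a ≡ᵇ b ⟧ ≈ ⟦ b ≡ᵇ a ⟧
  ⟦≡ᵇ⟧-sym a b = ≈-reflexive (cong ⟦_⟧ (T-ext (λ t → ≡⇒≡ᵇ b a (sym (≡ᵇ⇒≡ a b t))) (λ t → ≡⇒≡ᵇ a b (sym (≡ᵇ⇒≡ b a t)))))

  -- This is `M_k U_(k-1) = U_k M_k`. In the rows up to `k` the matrix `Ver` is the identity, so the
  -- middle vector is forced there and both sides have equal factors. The rows below are the case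
  -- `k = 0`, with row `k` as the row above; its corner factor is what `U_k` has in excess of
  -- `U_(k-1)`.
  Hor-Ver : ∀ {N} x k (u : ℕ → Carrier) a b (ls ns : Vec ℕ N) → Par b ls → b ≤ C → Par a ns → a ≤ C → Last a ns →
    ∑ (vecs N) (λ v → Ver (after k (u k)) ls v * Hor (const x) (before k u) a v ns)
    ≈ ∑ (vecs N) (λ v → Hor (const x) (before (suc k) u) a ls v * Ver (after k (u k)) v ns)
  Hor-Ver x zero u a b ls ns pl b≤C pn a≤C la = Hor-Ver₀ x (u 0) a b ls ns pl b≤C pn a≤C la
  Hor-Ver x (suc k) u a b [] [] pl b≤C pn a≤C la = +-congʳ (*-comm _ _)
  Hor-Ver {suc N} x (suc k) u a b (l ∷ ls) (n ∷ ns) (l≤b ∷ pl) b≤C (n≤a ∷ pn) a≤C la = begin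
    ∑ (vecs (suc N)) (λ v → Ver (after (suc k) (u (suc k))) (l ∷ ls) v * Hor (const x) (before (suc k) u) a v (n ∷ ns))
      ≈⟨ ∑-vecs-δ N l (≤-trans (Par-c₀≤hd pl) (Par-hd pl)) (≤-trans l≤b b≤C)
           (λ c v → ≈-trans (*-congʳ (*-congʳ (vfac-0 l c)))
             (solve 5 (λ p q r s t → (p :* q) :* (r :* (s :* t)) := p :* ((r :* s) :* (q :* t))) ≈-refl _ _ _ _ _)) ⟩
    ∑ (vecs N) (λ v → (cap x (u 0) l a * hfac x l n) * (Ver (after k (u (suc k))) ls v * Hor (const x) (before k (u ∘ suc)) n v ns))
      ≈⟨ ∑-*ˡ (vecs N) _ _ ⟩
    (cap x (u 0) l a * hfac x l n) * ∑ (vecs N) (λ v → Ver (after k (u (suc k))) ls v * Hor (const x) (before k (u ∘ suc)) n v ns)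
      ≈⟨ *-congˡ (Hor-Ver x k (u ∘ suc) n l ls ns pl (≤-trans l≤b b≤C) pn (≤-trans n≤a a≤C) la) ⟩
    (cap x (u 0) l a * hfac x l n) * ∑ (vecs N) (λ v → Hor (const x) (before (suc k) (u ∘ suc)) n ls v * Ver (after k (u (suc k))) v ns)
      ≈⟨ ≈-sym (∑-*ˡ (vecs N) _ _) ⟩
    ∑ (vecs N) (λ v → (cap x (u 0) l a * hfac x l n) * (Hor (const x) (before (suc k) (u ∘ suc)) n ls v * Ver (after k (u (suc k))) v ns))
      ≈⟨ ≈-sym (∑-vecs-δ N n (≤-trans (Par-c₀≤hd pn) (Par-hd pn)) (≤-trans n≤a a≤C)
           (λ c v → ≈-trans (*-congˡ (*-congʳ (≈-trans (vfac-0 c n) (⟦≡ᵇ⟧-sym c n))))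
             (solve 5 (λ p q r s t → (p :* (q :* r)) :* (s :* t) := s :* ((p :* q) :* (r :* t))) ≈-refl _ _ _ _ _))) ⟩
    ∑ (vecs (suc N)) (λ v → Hor (const x) (before (suc (suc k)) u) a (l ∷ ls) v * Ver (after (suc k) (u (suc k))) v (n ∷ ns)) ∎

  -- As `x ^ 0` is 1, a row of weight 0 just keeps its length. The weight is given up to `≈` because
  -- `Dif` meets it in the form `- 0#`.
  hfac-δ : ∀ {x} → x ≈ 0# → ∀ l n → hfac x l n ≈ ⟦ n ≡ᵇ l ⟧
  hfac-δ {x} x≈0 l n with ℕₚ.<-cmp n l
  ... | tri< n<l n≢l _ rewrite ≡ᵇ-no n≢l = ≈-trans (hfac-yes x (ℕₚ.<⇒≤ n<l)) (lem (ℕₚ.m<n⇒0<n∸m n<l))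
    where
    lem : ∀ {k} → 0 < k → x ^ k ≈ 0#
    lem {suc k} _ = ≈-trans (*-congʳ x≈0) (zeroˡ _)
  ... | tri≈ _ refl _ rewrite ≡ᵇ-refl n | ≤ᵇ-yes (≤-refl {n}) | ℕₚ.n∸n≡0 n = *-identityʳ _
  ... | tri> _ n≢l l<n rewrite ≡ᵇ-no n≢l = hfac-no x l<n

  -0≈0 : - 0# ≈ 0#
  -0≈0 = ≈-trans (≈-sym (+-identityʳ _)) (-‿inverseˡ 0#)

  neg : (ℕ → Carrier) → ℕ → Carrier
  neg u i = - u i

  ∈-vecs⁻ : ∀ {N c} {v : Vec ℕ N} → (c ∷ v) ∈ vecs (suc N) → c ∈ cs × v ∈ vecs N
  ∈-vecs⁻ {N} m with c' , c'∈ , m' ← concatMap-∈ (λ c → map (c ∷_) (vecs N)) cs m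
    with v' , v'∈ , refl ← ∈-map⁻ (c' ∷_) m' = c'∈ , v'∈

  ∑-Dif-δ : ∀ {N} (v : Vec ℕ N) → v ∈ vecs N → (F : Vec ℕ N → Carrier) →
    ∑ (vecs N) (λ v' → Dif (neg zeros) v v' * F v') ≈ F v
  ∑-Dif-δ [] _ F = ≈-trans (+-identityʳ _) (*-identityˡ _)
  ∑-Dif-δ {suc N} (c ∷ v) m F with c∈ , v∈ ← ∈-vecs⁻ m with p , q ← ∈-range⁻ c₀ C c∈ = ≈-trans
    (∑-vecs-δ N c p q (λ c' v' → ≈-trans (*-congʳ (*-congʳ (hfac-δ -0≈0 c' c))) (*-assoc _ _ _)))
    (∑-Dif-δ v v∈ (λ v' → F (c ∷ v')))

  -- The relation `E(y) H(-y) = 1` between elementary and complete symmetric functions, acting by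
  -- strips. In a row with `l < n` the two possible middle lengths `l` and `suc l` contribute
  -- `(- y)^(n - l)` and `y (- y)^(n - l - 1)`, which cancel.
  Ver-Hor-inverse : ∀ {N} y a b (ls ns : Vec ℕ N) → Par b ls → b ≤ C → hd ls ≤ a → a ≤ C →
    ∑ (vecs N) (λ v → Ver (const y) ls v * Hor (const (- y)) zeros a ns v) ≈ Dif (neg zeros) ls ns
  Ver-Hor-inverse y a b [] [] _ _ p _ = ≈-trans (+-identityʳ _) (≈-trans (*-identityˡ _) (≈-trans (*-identityʳ _)
    (≈-trans (cap-0 (- y) c₀ a) (≈-reflexive (cong ⟦_⟧ (≤ᵇ-yes p))))))
  Ver-Hor-inverse {suc N} y a b (l ∷ ls) (n ∷ ns) (l≤b ∷ pl) b≤C l≤a a≤C = begin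
    ∑ (vecs (suc N)) (λ v → Ver (const y) (l ∷ ls) v * Hor (const (- y)) zeros a (n ∷ ns) v)
      ≈⟨ ∑-vecs N _ ⟩
    ∑ cs (λ c → ∑ (vecs N) (λ v → (vfac y l c * Ver (const y) ls v) * (cap (- y) 0# n a * (hfac (- y) n c * Hor (const (- y)) zeros c ns v))))
      ≈⟨ ∑-cong∈ cs step ⟩
    ∑ cs (λ c → (vfac y l c * g c) * Dif (neg zeros) ls ns)
      ≈⟨ ∑-*ʳ cs _ _ ⟩
    ∑ cs (λ c → vfac y l c * g c) * Dif (neg zeros) ls ns
      ≈⟨ *-congʳ (≈-trans (∑-vfacˡ y l g (≤-trans (Par-c₀≤hd pl) (Par-hd pl)) (≤-trans l≤b b≤C) g-hi) (≈-trans g-row (≈-sym (hfac-δ -0≈0 n l)))) ⟩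
    hfac (- 0#) n l * Dif (neg zeros) ls ns ∎
    where
    g : ℕ → Carrier
    g c = ⟦ n ≤ᵇ a ⟧ * hfac (- y) n c

    g-hi : C < suc l → g (suc l) ≈ 0#
    g-hi p with n ℕₚ.≤? a
    ... | yes q = ≈-trans (*-congˡ (hfac-no (- y) (ℕₚ.≤-<-trans (≤-trans q a≤C) p))) (zeroʳ _)
    ... | no nq rewrite ≤ᵇ-no (ℕₚ.≰⇒> nq) = zeroˡ _

    step : ∀ c → c ∈ cs →
      ∑ (vecs N) (λ v → (vfac y l c * Ver (const y) ls v) * (cap (- y) 0# n a * (hfac (- y) n c * Hor (const (- y)) zeros c ns v)))
      ≈ (vfac y l c * g c) * Dif (neg zeros) ls ns
    step c c∈ with l ℕₚ.≤? c
    -- The next row of `ls` is at most `l ≤ c`, so the inductive hypothesis applies and the sum over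
    -- the lower rows does not depend on `c`.
    ... | yes l≤c = ≈-trans (∑-cong (vecs N) (λ v → ≈-trans (*-congˡ (*-congʳ (cap-0 (- y) n a)))
            (solve 5 (λ p q r s t → (p :* q) :* (r :* (s :* t)) := (p :* (r :* s)) :* (q :* t)) ≈-refl _ _ _ _ _)))
          (≈-trans (∑-*ˡ (vecs N) _ _)
            (*-congˡ (Ver-Hor-inverse y c l ls ns pl (≤-trans l≤b b≤C) (≤-trans (Par-hd pl) l≤c) (proj₂ (∈-range⁻ c₀ C c∈)))))
    ... | no l≰c = ≈-trans (∑-zero (vecs N) (λ v _ → ≈-trans (*-congʳ (≈-trans (*-congʳ vz) (zeroˡ _))) (zeroˡ _)))
          (≈-sym (≈-trans (*-congʳ (≈-trans (*-congʳ vz) (zeroˡ _))) (zeroˡ _)))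
      where
      vz : vfac y l c ≈ 0#
      vz rewrite ≡ᵇ-no {l} {c} (λ { refl → l≰c ≤-refl }) | ≡ᵇ-no {suc l} {c} (λ { refl → l≰c (ℕₚ.n≤1+n l) })
        = ≈-trans (+-identityˡ _) (zeroˡ _)

    g-row : g l + y * g (suc l) ≈ ⟦ l ≡ᵇ n ⟧
    g-row with ℕₚ.<-cmp l n
    ... | tri> _ l≢n n<l rewrite ≡ᵇ-no l≢n = ≈-trans
        (+-cong (≈-trans (*-congˡ (hfac-no (- y) n<l)) (zeroʳ _))
                (≈-trans (*-congˡ (≈-trans (*-congˡ (hfac-no (- y) (ℕₚ.m<n⇒m<1+n n<l))) (zeroʳ _))) (zeroʳ _)))
        (+-identityˡ _)
    ... | tri≈ _ refl _ rewrite ≡ᵇ-refl l = ≈-trans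
        (+-cong (≈-trans (*-cong (≈-reflexive (cong ⟦_⟧ (≤ᵇ-yes l≤a))) (≈-trans (hfac-yes (- y) {l} {l} ≤-refl) (≈-reflexive (cong ((- y) ^_) (ℕₚ.n∸n≡0 l))))) (*-identityˡ _))
                (≈-trans (*-congˡ (≈-trans (*-congˡ (hfac-no (- y) (ℕₚ.n<1+n l))) (zeroʳ _))) (zeroʳ _)))
        (+-identityʳ _)
    ... | tri< l<n l≢n _ rewrite ≡ᵇ-no l≢n = begin
      ⟦ n ≤ᵇ a ⟧ * hfac (- y) n l + y * (⟦ n ≤ᵇ a ⟧ * hfac (- y) n (suc l))
        ≈⟨ +-cong (*-congˡ (≈-trans (hfac-yes (- y) (ℕₚ.<⇒≤ l<n)) (≈-reflexive (cong ((- y) ^_) (ℕₚ.+-∸-assoc 1 l<n)))))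
                  (*-congˡ (*-congˡ (hfac-yes (- y) l<n))) ⟩
      ⟦ n ≤ᵇ a ⟧ * ((- y) * e) + y * (⟦ n ≤ᵇ a ⟧ * e)
        ≈⟨ solve 4 (λ i m y e → i :* (m :* e) :+ y :* (i :* e) := (m :+ y) :* (i :* e)) ≈-refl _ (- y) y e ⟩
      (- y + y) * (⟦ n ≤ᵇ a ⟧ * e)
        ≈⟨ ≈-trans (*-congʳ (-‿inverseˡ y)) (zeroˡ _) ⟩
      0# ∎
      where e = (- y) ^ (n ∸ suc l)

  -- This is `M_k D_(k-1) H_k = D_k`, with the sequence `u` shifted so that its entry 0 belongs to
  -- the first row. The rows above the one of index `k` meet only `Dif`; the row of index `k` meets
  -- only the horizontal strip, which supplies the factor that `D_(k-1)` lacks; in the rows below,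
  -- vertical and horizontal strips cancel by `Ver-Hor-inverse`.
  Ver-Dif-Hor : ∀ {N} k (u : ℕ → Carrier) a b (ls ns : Vec ℕ N) → Par b ls → b ≤ C → Par a ns → a ≤ C →
    ∑ (vecs N) (λ v → Ver (after (suc k) (u k)) ls v *
      ∑ (vecs N) (λ v' → Dif (neg (before k u)) v v' * Hrows (after k (- u k)) zeros ns v'))
    ≈ Dif (neg (before (suc k) u)) ls ns
  Ver-Dif-Hor k u a b [] [] _ _ _ _ =
    solve 0 (con 1 :* (con 1 :* con 1 :+ con 0) :+ con 0 := con 1) ≈-refl
  Ver-Dif-Hor {suc N} zero u a b (l ∷ ls) (n ∷ ns) (l≤b ∷ pl) b≤C (n≤a ∷ pn) a≤C = begin
    ∑ (vecs (suc N)) (λ v → Ver (after 1 (u 0)) (l ∷ ls) v *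
      ∑ (vecs (suc N)) (λ v' → Dif (neg zeros) v v' * Hrows (const (- u 0)) zeros (n ∷ ns) v'))
      ≈⟨ ∑-cong∈ (vecs (suc N)) (λ v v∈ → *-congˡ (∑-Dif-δ v v∈ (Hrows (const (- u 0)) zeros (n ∷ ns)))) ⟩
    ∑ (vecs (suc N)) (λ v → Ver (after 1 (u 0)) (l ∷ ls) v * Hrows (const (- u 0)) zeros (n ∷ ns) v)
      ≈⟨ ∑-vecs-δ N l (≤-trans (Par-c₀≤hd pl) (Par-hd pl)) (≤-trans l≤b b≤C)
           (λ c v → ≈-trans (*-congʳ (*-congʳ (vfac-0 l c)))
             (solve 4 (λ p q r s → (p :* q) :* (r :* s) := p :* (r :* (q :* s))) ≈-refl _ _ _ _)) ⟩
    ∑ (vecs N) (λ v → hfac (- u 0) n l * (Ver (const (u 0)) ls v * Hor (const (- u 0)) zeros l ns v))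
      ≈⟨ ∑-*ˡ (vecs N) _ _ ⟩
    hfac (- u 0) n l * ∑ (vecs N) (λ v → Ver (const (u 0)) ls v * Hor (const (- u 0)) zeros l ns v)
      ≈⟨ *-congˡ (Ver-Hor-inverse (u 0) l l ls ns pl (≤-trans l≤b b≤C) (Par-hd pl) (≤-trans l≤b b≤C)) ⟩
    hfac (- u 0) n l * Dif (neg zeros) ls ns ∎
  Ver-Dif-Hor {suc N} (suc k) u a b (l ∷ ls) (n ∷ ns) (l≤b ∷ pl) b≤C (n≤a ∷ pn) a≤C = begin
    ∑ (vecs (suc N)) (λ v → Ver (after (suc (suc k)) (u (suc k))) (l ∷ ls) v *
      ∑ (vecs (suc N)) (λ v' → Dif (neg (before (suc k) u)) v v' * Hrows (after (suc k) (- u (suc k))) zeros (n ∷ ns) v'))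
      ≈⟨ ∑-vecs-δ N l (≤-trans (Par-c₀≤hd pl) (Par-hd pl)) (≤-trans l≤b b≤C)
           (λ c v → ≈-trans (*-congʳ (*-congʳ (vfac-0 l c))) (*-assoc _ _ _)) ⟩
    ∑ (vecs N) (λ v → V v *
      ∑ (vecs (suc N)) (λ v' → Dif (neg (before (suc k) u)) (l ∷ v) v' * Hrows (after (suc k) (- u (suc k))) zeros (n ∷ ns) v'))
      ≈⟨ ∑-cong (vecs N) (λ v → *-congˡ (≈-trans (∑-vecs-δ N n (≤-trans (Par-c₀≤hd pn) (Par-hd pn)) (≤-trans n≤a a≤C)
           (λ c v' → ≈-trans (*-congˡ (*-cong (≈-trans (hfac-δ ≈-refl n c) (⟦≡ᵇ⟧-sym c n)) (*-congʳ (cap-0 0# (hd ns) c))))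
             (solve 5 (λ p q r s t → (p :* q) :* (r :* (s :* t)) := r :* ((p :* s) :* (q :* t))) ≈-refl _ _ _ _ _)))
           (∑-*ˡ (vecs N) _ _))) ⟩
    ∑ (vecs N) (λ v → V v * ((hfac (- u 0) n l * ⟦ hd ns ≤ᵇ n ⟧) * W v))
      ≈⟨ ∑-cong (vecs N) (λ v → solve 3 (λ p q r → p :* (q :* r) := q :* (p :* r)) ≈-refl _ _ _) ⟩
    ∑ (vecs N) (λ v → (hfac (- u 0) n l * ⟦ hd ns ≤ᵇ n ⟧) * (V v * W v))
      ≈⟨ ∑-*ˡ (vecs N) _ _ ⟩
    (hfac (- u 0) n l * ⟦ hd ns ≤ᵇ n ⟧) * ∑ (vecs N) (λ v → V v * W v)
      ≈⟨ *-cong (≈-trans (*-congˡ (≈-reflexive (cong ⟦_⟧ (≤ᵇ-yes (Par-hd pn))))) (*-identityʳ _))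
                (Ver-Dif-Hor k (u ∘ suc) n l ls ns pl (≤-trans l≤b b≤C) pn (≤-trans n≤a a≤C)) ⟩
    hfac (- u 0) n l * Dif (neg (before (suc k) (u ∘ suc))) ls ns ∎
    where
    V W : Vec ℕ N → Carrier
    V v = Ver (after (suc k) (u (suc k))) ls v
    W v = ∑ (vecs N) (λ v' → Dif (neg (before k (u ∘ suc))) v v' * Hrows (after k (- u (suc k))) zeros ns v')

-- Products of strip matrices and their factorisation.

module Expansion {c ℓ} (R : CommutativeRing c ℓ) (c₀ C : ℕ) where
  open CommutativeRing R
    hiding (zero)
    renaming (refl to ≈-refl; sym to ≈-sym; trans to ≈-trans; reflexive to ≈-reflexive)
  open Sums R
  open Matrices R c₀ C
  open Commutation R c₀ C
  open import Relation.Binary.Reasoning.Setoid setoid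

  -- Counted from 0: ent ls i is the last column of row suc i. All columns are > c₀, so c₀ stands for an empty row.
  ent : ∀ {N} → Vec ℕ N → ℕ → ℕ
  ent []       i       = c₀
  ent (l ∷ ls) zero    = l
  ent (l ∷ ls) (suc i) = ent ls i

  parᵇ : ∀ {N} → ℕ → Vec ℕ N → Bool
  parᵇ a []       = c₀ ≤ᵇ a
  parᵇ a (l ∷ ls) = (l ≤ᵇ a) ∧ parᵇ l ls

  parᵇ⇒Par : ∀ {N} a (ls : Vec ℕ N) → T (parᵇ a ls) → Par a ls
  parᵇ⇒Par a []       t = [] (≤ᵇ⇒≤ c₀ a t)
  parᵇ⇒Par a (l ∷ ls) t with p , q ← T-∧⁻ {l ≤ᵇ a} t = ≤ᵇ⇒≤ l a p ∷ parᵇ⇒Par l ls q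

  Par⇒parᵇ : ∀ {N a} {ls : Vec ℕ N} → Par a ls → T (parᵇ a ls)
  Par⇒parᵇ ([] p)   = ≤⇒≤ᵇ p
  Par⇒parᵇ (p ∷ ps) = T-∧⁺ (≤⇒≤ᵇ p) (Par⇒parᵇ ps)

  pars : ∀ N → List (Vec ℕ N)
  pars N = filterᵇ (parᵇ C) (vecs N)

  ∈-pars⁻ : ∀ {N} {v : Vec ℕ N} → v ∈ pars N → v ∈ vecs N × Par C v
  ∈-pars⁻ {N} {v} m with p , q ← ∈-filterᵇ⁻ (parᵇ C) (vecs N) m = p , parᵇ⇒Par C v q

  Par-Par : ∀ {N a b} {ls : Vec ℕ N} → Par a ls → a ≤ b → Par b ls
  Par-Par ([] p)   q = [] (≤-trans p q)
  Par-Par (p ∷ ps) q = ≤-trans p q ∷ ps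

  ∈-vecs⁺ : ∀ {N a} {v : Vec ℕ N} → Par a v → a ≤ C → v ∈ vecs N
  ∈-vecs⁺ ([] _) _ = here refl
  ∈-vecs⁺ (_∷_ {N} {l = l} p ps) q = ∈-concatMap (λ c → map (c ∷_) (vecs N)) cs
    (∈-cs (≤-trans (Par-c₀≤hd ps) (Par-hd ps)) (≤-trans p q)) (∈-map⁺ (l ∷_) (∈-vecs⁺ ps (≤-trans p q)))

  ∈-pars⁺ : ∀ {N} {v : Vec ℕ N} → Par C v → v ∈ pars N
  ∈-pars⁺ {N} p = ∈-filterᵇ⁺ (parᵇ C) (vecs N) (∈-vecs⁺ p ≤-refl) (Par⇒parᵇ p)

  -- Matrix products run over partitions, whereas the relations above are proved row by row and so
  -- need sums over all vectors. The support of the summand reconciles the two.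
  ∑-pars : ∀ N {f : Vec ℕ N → Carrier} → (∀ v → Par C v ⊎ f v ≈ 0#) → ∑ (pars N) f ≈ ∑ (vecs N) f
  ∑-pars N {f} h = ≈-trans (∑-filterᵇ (parᵇ C) (vecs N) f) (∑-cong (vecs N) lem)
    where
    lem : ∀ v → ⟦ parᵇ C v ⟧ * f v ≈ f v
    lem v with h v
    ... | inj₁ p rewrite T⇒true (Par⇒parᵇ p) = *-identityˡ _
    ... | inj₂ z = ≈-trans (*-congˡ z) (≈-trans (zeroʳ _) (≈-sym z))

  ent≥c₀ : ∀ {N a} {ls : Vec ℕ N} → Par a ls → ∀ i → c₀ ≤ ent ls i
  ent≥c₀ ([] _)   i       = ≤-refl
  ent≥c₀ (_ ∷ ps) zero    = ≤-trans (Par-c₀≤hd ps) (Par-hd ps)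
  ent≥c₀ (_ ∷ ps) (suc i) = ent≥c₀ ps i

  ent≤ : ∀ {N a} {ls : Vec ℕ N} → Par a ls → ∀ i → ent ls i ≤ a
  ent≤ ([] p)   i       = p
  ent≤ (p ∷ ps) zero    = p
  ent≤ (p ∷ ps) (suc i) = ≤-trans (ent≤ ps i) p

  ent-anti : ∀ {N a} {ls : Vec ℕ N} → Par a ls → ∀ {i j} → i ≤ j → ent ls j ≤ ent ls i
  ent-anti ([] p)   _                       = ≤-refl
  ent-anti (p ∷ ps) {j = zero}  z≤n         = ≤-refl
  ent-anti (p ∷ ps) {j = suc j} z≤n         = ent≤ ps j
  ent-anti (p ∷ ps) (s≤s q)                 = ent-anti ps q

  ent-beyond : ∀ {N} (ls : Vec ℕ N) i → N ≤ i → ent ls i ≡ c₀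
  ent-beyond []       i       _       = refl
  ent-beyond (l ∷ ls) (suc i) (s≤s p) = ent-beyond ls i p

  Last-ent : ∀ {N a} {ls : Vec ℕ N} → Par a ls → ∀ i → i < N → ent ls i ≤ c₀ → Last a ls
  Last-ent {suc zero}    (_ ∷ ([] p))  zero    _       q = ℕₚ.≤-antisym q p
  Last-ent {suc (suc N)} (_ ∷ (p ∷ ps)) zero   _       q = Last-ent (p ∷ ps) 0 (s≤s z≤n) (≤-trans p q)
  Last-ent               (_ ∷ ps)      (suc i) (s≤s r) q = Last-ent ps i r q

  data HStrip : ∀ {N} → ℕ → Vec ℕ N → Vec ℕ N → Set where
    []  : ∀ {a} → c₀ ≤ a → HStrip a [] []
    _∷_ : ∀ {N a l n} {ls ns : Vec ℕ N} → n ≤ l × l ≤ a → HStrip n ls ns → HStrip a (l ∷ ls) (n ∷ ns)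

  cap-supp : ∀ x v l a → l ≤ a ⊎ cap x v l a ≈ 0#
  cap-supp x v l a with l ℕₚ.≤? a
  ... | yes p = inj₁ p
  ... | no np rewrite ≤ᵇ-no (ℕₚ.≰⇒> np) = inj₂ (zeroˡ _)

  hfac-supp : ∀ x l n → n ≤ l ⊎ hfac x l n ≈ 0#
  hfac-supp x l n with n ℕₚ.≤? l
  ... | yes p = inj₁ p
  ... | no np = inj₂ (hfac-no x (ℕₚ.≰⇒> np))

  0*≈ : ∀ {a b} → a ≈ 0# → a * b ≈ 0#
  0*≈ z = ≈-trans (*-congʳ z) (zeroˡ _)

  *0≈ : ∀ {a b} → b ≈ 0# → a * b ≈ 0#
  *0≈ z = ≈-trans (*-congˡ z) (zeroʳ _)

  Hor-supp : ∀ {N} x v a (ls ns : Vec ℕ N) → HStrip a ls ns ⊎ Hor x v a ls ns ≈ 0#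
  Hor-supp x v a [] [] with cap-supp (x 0) (v 0) c₀ a
  ... | inj₁ p = inj₁ ([] p)
  ... | inj₂ z = inj₂ (0*≈ z)
  Hor-supp x v a (l ∷ ls) (n ∷ ns) with cap-supp (x 0) (v 0) l a | hfac-supp (x 1) l n | Hor-supp (x ∘ suc) (v ∘ suc) n ls ns
  ... | inj₂ z | _      | _      = inj₂ (0*≈ z)
  ... | inj₁ _ | inj₂ z | _      = inj₂ (*0≈ (0*≈ z))
  ... | inj₁ _ | inj₁ _ | inj₂ z = inj₂ (*0≈ (*0≈ z))
  ... | inj₁ p | inj₁ q | inj₁ r = inj₁ ((q , p) ∷ r)

  HStrip⇒Parˡ : ∀ {N a} {ls ns : Vec ℕ N} → HStrip a ls ns → Par a ls
  HStrip⇒Parˡ ([] p)         = [] p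
  HStrip⇒Parˡ ((q , p) ∷ hs) = p ∷ Par-Par (HStrip⇒Parˡ hs) q

  HStrip⇒Parʳ : ∀ {N a} {ls ns : Vec ℕ N} → HStrip a ls ns → Par a ns
  HStrip⇒Parʳ ([] p)         = [] p
  HStrip⇒Parʳ ((q , p) ∷ hs) = ≤-trans q p ∷ HStrip⇒Parʳ hs

  HStrip-ent≤ : ∀ {N a} {ls ns : Vec ℕ N} → HStrip a ls ns → ∀ i → ent ns i ≤ ent ls i
  HStrip-ent≤ ([] p)         i       = ≤-refl
  HStrip-ent≤ ((q , _) ∷ hs) zero    = q
  HStrip-ent≤ ((_ , _) ∷ hs) (suc i) = HStrip-ent≤ hs i

  HStrip-hd : ∀ {N a} {ls ns : Vec ℕ N} → HStrip a ls ns → ent ls 0 ≤ a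
  HStrip-hd ([] p)        = p
  HStrip-hd ((_ , p) ∷ _) = p

  HStrip-ent-suc : ∀ {N a} {ls ns : Vec ℕ N} → HStrip a ls ns → ∀ i → ent ls (suc i) ≤ ent ns i
  HStrip-ent-suc ([] p)   i       = ≤-refl
  HStrip-ent-suc (_ ∷ hs) zero    = HStrip-hd hs
  HStrip-ent-suc (_ ∷ hs) (suc i) = HStrip-ent-suc hs i

  Dif-supp : ∀ {N} d (ls ns : Vec ℕ N) → (∀ i → ent ls i ≤ ent ns i) ⊎ Dif d ls ns ≈ 0#
  Dif-supp d [] [] = inj₁ (λ _ → ≤-refl)
  Dif-supp d (l ∷ ls) (n ∷ ns) with hfac-supp (d 0) n l | Dif-supp (d ∘ suc) ls ns
  ... | inj₂ z | _      = inj₂ (0*≈ z)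
  ... | inj₁ _ | inj₂ z = inj₂ (*0≈ z)
  ... | inj₁ p | inj₁ q = inj₁ (λ { zero → p ; (suc i) → q i })

  Dif-δ-supp : ∀ {N} (ls ns : Vec ℕ N) → ls ≡ ns ⊎ Dif (neg zeros) ls ns ≈ 0#
  Dif-δ-supp [] [] = inj₁ refl
  Dif-δ-supp (l ∷ ls) (n ∷ ns) with l ℕₚ.≟ n | Dif-δ-supp ls ns
  ... | no ne    | _      = inj₂ (0*≈ (≈-trans (hfac-δ -0≈0 n l) (≈-reflexive (cong ⟦_⟧ (≡ᵇ-no ne)))))
  ... | yes _    | inj₂ z = inj₂ (*0≈ z)
  ... | yes refl | inj₁ e = inj₁ (cong (l ∷_) e)

  -- Adding a vertical strip may destroy the partition property. Here, however, `p` agrees with `ls`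
  -- in the rows of index up to `k` and with `q` in those from `k` on; two partitions glued along a
  -- common row form a partition.
  Ver-Dif-supp : ∀ {N} k y (u : ℕ → Carrier) {a b} (ls p q : Vec ℕ N) → Par b ls → Par a q →
    Par b p ⊎ Ver (after (suc k) y) ls p * Dif (neg (before k u)) p q ≈ 0#
  Ver-Dif-supp k y u [] [] [] pl _ = inj₁ pl
  Ver-Dif-supp k y u (l ∷ ls) (p ∷ ps) (q ∷ qs) (l≤b ∷ pl) (q≤a ∷ pq) with l ℕₚ.≟ p
  ... | no ne = inj₂ (0*≈ (0*≈ (≈-trans (vfac-0 l p) (≈-reflexive (cong ⟦_⟧ (≡ᵇ-no ne))))))
  Ver-Dif-supp zero y u (l ∷ ls) (p ∷ ps) (q ∷ qs) (l≤b ∷ pl) (q≤a ∷ pq) | yes refl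
    with Dif-δ-supp (l ∷ ps) (q ∷ qs)
  ... | inj₁ refl = inj₁ (l≤b ∷ pq)
  ... | inj₂ z    = inj₂ (*0≈ z)
  Ver-Dif-supp (suc k) y u (l ∷ ls) (p ∷ ps) (q ∷ qs) (l≤b ∷ pl) (q≤a ∷ pq) | yes refl
    with Ver-Dif-supp k y (u ∘ suc) ls ps qs pl pq
  ... | inj₁ r = inj₁ (l≤b ∷ r)
  ... | inj₂ z = inj₂ (≈-trans (solve 4 (λ a b c d → (a :* b) :* (c :* d) := (a :* c) :* (b :* d)) ≈-refl _ _ _ _) (*0≈ z))

  -- The matrix product `U(x_1) ... U(x_n) D`, with `D` weighted by `v` without its entry for the
  -- row above. The shapes shrink along the factors `Hor` and the last of them grows to `ns`, so
  -- rows shorter than those of `ns` do occur on the way.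
  Pow : ∀ {N} → (ℕ → Carrier) → List (ℕ → Carrier) → Vec ℕ N → Vec ℕ N → Carrier
  Pow     v []       ls ns = Dif (neg (v ∘ suc)) ls ns
  Pow {N} v (x ∷ xs) ls ns = ∑ (pars N) (λ ks → Hor x v C ls ks * Pow v xs ks ns)

  -- In a horizontal strip row `j + 1` of the larger shape is contained in row `j` of the smaller
  -- one. After `length xs` strips row `i` is therefore still nonempty, and `Dif` can only lengthen
  -- it.
  Pow-vanish : ∀ {N} v xs (p q : Vec ℕ N) i → c₀ < ent p (length xs ℕ.+ i) → ent q i ≤ c₀ → Pow v xs p q ≈ 0#
  Pow-vanish v [] p q i h₁ h₂ with Dif-supp (neg (v ∘ suc)) p q
  ... | inj₁ le = ⊥-elim (<⇒≱ h₁ (≤-trans (le i) h₂))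
  ... | inj₂ z  = z
  Pow-vanish {N} v (x ∷ xs) p q i h₁ h₂ = ∑-zero (pars N) (λ ks _ → term ks)
    where
    term : ∀ ks → Hor x v C p ks * Pow v xs ks q ≈ 0#
    term ks with Hor-supp x v C p ks
    ... | inj₂ z = 0*≈ z
    ... | inj₁ hs = *0≈ (Pow-vanish v xs ks q i (ℕₚ.<-≤-trans h₁ (HStrip-ent-suc hs _)) h₂)

  ∑-assoc : ∀ {A B : Set} (xs : List A) (ys : List B) (f : A → Carrier) (g : A → B → Carrier) (h : B → Carrier) →
    ∑ xs (λ x → f x * ∑ ys (λ y → g x y * h y)) ≈ ∑ ys (λ y → ∑ xs (λ x → f x * g x y) * h y)
  ∑-assoc xs ys f g h = begin
    ∑ xs (λ x → f x * ∑ ys (λ y → g x y * h y))    ≈⟨ ∑-cong xs (λ x → ≈-sym (∑-*ˡ ys _ _)) ⟩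
    ∑ xs (λ x → ∑ ys (λ y → f x * (g x y * h y)))  ≈⟨ ∑-swap xs ys _ ⟩
    ∑ ys (λ y → ∑ xs (λ x → f x * (g x y * h y)))  ≈⟨ ∑-cong ys (λ y → ≈-trans (∑-cong xs (λ x → ≈-sym (*-assoc _ _ _))) (∑-*ʳ xs _ _)) ⟩
    ∑ ys (λ y → ∑ xs (λ x → f x * g x y) * h y)    ∎

  consts : List Carrier → List (ℕ → Carrier)
  consts = map const

  -- With `K = suc k`: the factor `D_K` is rewritten as `M_K D_(K-1) H_K`, and `M_K` then passes the
  -- factors `U_K` one after the other, turning each into `U_(K-1)`. The hypotheses on row `i` of
  -- `ns` and on `N` provide the empty row for `Hor-Ver`.
  Pow-step : ∀ {N} k (u : ℕ → Carrier) xs (ls ns : Vec ℕ N) i → Par C ls → Par C ns →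
    ent ns i ≤ c₀ → length (consts xs) ℕ.+ i < N →
    Pow (before (suc (suc k)) u) (consts xs) ls ns
    ≈ ∑ (pars N) (λ p → Ver (after (suc k) (u (suc k))) ls p *
        ∑ (pars N) (λ q → Pow (before (suc k) u) (consts xs) p q * Hor (after (suc k) (- u (suc k))) zeros C ns q))
  Pow-step {N} k u [] ls ns i pl pn _ _ = ≈-sym (begin
    ∑ (pars N) (λ p → V p * ∑ (pars N) (λ q → Dif d p q * H q))
      ≈⟨ ∑-cong (pars N) (λ p → *-congˡ (≈-trans (∑-pars N (λ q → inner p q)) (∑-cong (vecs N) (λ q → *-congˡ H≈)))) ⟩
    ∑ (pars N) (λ p → V p * ∑ (vecs N) (λ q → Dif d p q * Hrows (after k (- u (suc k))) zeros ns q))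
      ≈⟨ ∑-pars N outer ⟩
    ∑ (vecs N) (λ p → V p * ∑ (vecs N) (λ q → Dif d p q * Hrows (after k (- u (suc k))) zeros ns q))
      ≈⟨ Ver-Dif-Hor k (u ∘ suc) C C ls ns pl ≤-refl pn ≤-refl ⟩
    Dif (neg (before (suc k) (u ∘ suc))) ls ns ∎)
    where
    V H : Vec ℕ N → Carrier
    V p = Ver (after (suc k) (u (suc k))) ls p
    H q = Hor (after (suc k) (- u (suc k))) zeros C ns q
    d : ℕ → Carrier
    d = neg (before k (u ∘ suc))
    H≈ : ∀ {q} → H q ≈ Hrows (after k (- u (suc k))) zeros ns q
    H≈ = ≈-trans (*-congʳ (≈-trans (cap-0 0# (hd ns) C) (≈-reflexive (cong ⟦_⟧ (≤ᵇ-yes (Par-hd pn)))))) (*-identityˡ _)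
    inner : ∀ p q → Par C q ⊎ Dif d p q * H q ≈ 0#
    inner p q with Hor-supp (after (suc k) (- u (suc k))) zeros C ns q
    ... | inj₁ hs = inj₁ (HStrip⇒Parʳ hs)
    ... | inj₂ z  = inj₂ (*0≈ z)
    outer : ∀ p → Par C p ⊎ V p * ∑ (vecs N) (λ q → Dif d p q * Hrows (after k (- u (suc k))) zeros ns q) ≈ 0#
    outer p with T? (parᵇ C p)
      where open import Data.Bool using (T?)
    ... | yes t = inj₁ (parᵇ⇒Par C p t)
    ... | no nt = inj₂ (≈-trans (≈-sym (∑-*ˡ (vecs N) _ _)) (∑-zero (vecs N) (λ q _ → term q)))
      where
      term : ∀ q → V p * (Dif d p q * Hrows (after k (- u (suc k))) zeros ns q) ≈ 0#
      term q with Hor-supp (after (suc k) (- u (suc k))) zeros C ns q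
      ... | inj₂ z  = *0≈ (*0≈ (≈-trans (≈-sym H≈) z))
      ... | inj₁ hs with Ver-Dif-supp k (u (suc k)) (u ∘ suc) ls p q pl (HStrip⇒Parʳ hs)
      ...   | inj₁ pp = ⊥-elim (nt (Par⇒parᵇ pp))
      ...   | inj₂ z  = ≈-trans (≈-sym (*-assoc _ _ _)) (0*≈ z)
  Pow-step {N} k u (x ∷ xs) ls ns i pl pn ns≤ len = begin
    ∑ (pars N) (λ ks → U ls ks * Pow (before (suc (suc k)) u) (consts xs) ks ns)
      ≈⟨ ∑-cong∈ (pars N) (λ ks ks∈ → *-congˡ (Pow-step k u xs ks ns i (proj₂ (∈-pars⁻ ks∈)) pn ns≤ (ℕₚ.<⇒≤ len))) ⟩
    ∑ (pars N) (λ ks → U ls ks * ∑ (pars N) (λ p → V ks p * W p))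
      ≈⟨ ∑-assoc (pars N) (pars N) (U ls) V W ⟩
    ∑ (pars N) (λ p → ∑ (pars N) (λ ks → U ls ks * V ks p) * W p)
      ≈⟨ ∑-cong∈ (pars N) exchange ⟩
    ∑ (pars N) (λ p → ∑ (pars N) (λ ks → V ls ks * U' ks p) * W p)
      ≈⟨ ≈-sym (∑-assoc (pars N) (pars N) (V ls) U' W) ⟩
    ∑ (pars N) (λ ks → V ls ks * ∑ (pars N) (λ p → U' ks p * W p))
      ≈⟨ ∑-cong (pars N) (λ ks → *-congˡ (∑-assoc (pars N) (pars N) (U' ks) (Pow (before (suc k) u) (consts xs)) H)) ⟩
    ∑ (pars N) (λ p → V ls p * ∑ (pars N) (λ q → Pow (before (suc k) u) (consts (x ∷ xs)) p q * H q)) ∎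
    where
    U U' V : Vec ℕ N → Vec ℕ N → Carrier
    U  = Hor (const x) (before (suc (suc k)) u) C
    U' = Hor (const x) (before (suc k) u) C
    V  = Ver (after (suc k) (u (suc k)))
    H W : Vec ℕ N → Carrier
    H q = Hor (after (suc k) (- u (suc k))) zeros C ns q
    W p = ∑ (pars N) (λ q → Pow (before (suc k) u) (consts xs) p q * H q)
    j : ℕ
    j = length (consts xs) ℕ.+ i
    W-vanish : ∀ p → c₀ < ent p j → W p ≈ 0#
    W-vanish p h = ∑-zero (pars N) (λ q _ → term q)
      where
      term : ∀ q → Pow (before (suc k) u) (consts xs) p q * H q ≈ 0#
      term q with Hor-supp (after (suc k) (- u (suc k))) zeros C ns q
      ... | inj₂ z  = *0≈ z
      ... | inj₁ hs = 0*≈ (Pow-vanish (before (suc k) u) (consts xs) p q i h (≤-trans (HStrip-ent≤ hs i) ns≤))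
    -- `Hor-Ver` asks for an empty row in `p`. If row `j` of `p` is not empty, then `W p` vanishes;
    -- hence the exchange holds only after multiplication by `W p`.
    exchange : ∀ p → p ∈ pars N →
      ∑ (pars N) (λ ks → U ls ks * V ks p) * W p ≈ ∑ (pars N) (λ ks → V ls ks * U' ks p) * W p
    exchange p p∈ with ent p j ℕₚ.≤? c₀
    ... | no np = ≈-trans (*0≈ (W-vanish p (ℕₚ.≰⇒> np))) (≈-sym (*0≈ (W-vanish p (ℕₚ.≰⇒> np))))
    ... | yes le = *-congʳ (begin
      ∑ (pars N) (λ ks → U ls ks * V ks p)   ≈⟨ ∑-pars N left ⟩
      ∑ (vecs N) (λ ks → U ls ks * V ks p)
        ≈⟨ ≈-sym (Hor-Ver x (suc k) u C C ls p pl ≤-refl pp ≤-refl (Last-ent pp j (ℕₚ.<⇒≤ len) le)) ⟩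
      ∑ (vecs N) (λ ks → V ls ks * U' ks p)  ≈⟨ ≈-sym (∑-pars N right) ⟩
      ∑ (pars N) (λ ks → V ls ks * U' ks p)  ∎)
      where
      pp : Par C p
      pp = proj₂ (∈-pars⁻ p∈)
      left : ∀ ks → Par C ks ⊎ U ls ks * V ks p ≈ 0#
      left ks with Hor-supp (const x) (before (suc (suc k)) u) C ls ks
      ... | inj₁ hs = inj₁ (HStrip⇒Parʳ hs)
      ... | inj₂ z  = inj₂ (0*≈ z)
      right : ∀ ks → Par C ks ⊎ V ls ks * U' ks p ≈ 0#
      right ks with Hor-supp (const x) (before (suc k) u) C ks p
      ... | inj₁ hs = inj₁ (HStrip⇒Parˡ hs)
      ... | inj₂ z  = inj₂ (*0≈ z)

  -- `Dif (neg zeros)` serves as the identity matrix. The first entry of the list belongs to the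
  -- outermost strip of `p`.
  Vpow : ∀ {N} → List (ℕ → Carrier) → Vec ℕ N → Vec ℕ N → Carrier
  Vpow     []       p ls = Dif (neg zeros) p ls
  Vpow {N} (y ∷ ys) p ls = ∑ (pars N) (λ ks → Ver y ks p * Vpow ys ks ls)

  Dif-δ-sym : ∀ {N} (p q : Vec ℕ N) → Dif (neg zeros) p q ≈ Dif (neg zeros) q p
  Dif-δ-sym [] [] = ≈-refl
  Dif-δ-sym (l ∷ p) (n ∷ q) = *-cong (≈-trans (hfac-δ -0≈0 n l) (≈-trans (⟦≡ᵇ⟧-sym l n) (≈-sym (hfac-δ -0≈0 l n)))) (Dif-δ-sym p q)

  ∑-pars-δ : ∀ {N} (p : Vec ℕ N) → Par C p → (F : Vec ℕ N → Carrier) →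
    ∑ (pars N) (λ q → Dif (neg zeros) p q * F q) ≈ F p
  ∑-pars-δ {N} p pp F = ≈-trans (∑-pars N lem) (∑-Dif-δ p (∈-vecs⁺ pp ≤-refl) F)
    where
    lem : ∀ q → Par C q ⊎ Dif (neg zeros) p q * F q ≈ 0#
    lem q with Dif-δ-supp p q
    ... | inj₁ refl = inj₁ pp
    ... | inj₂ z    = inj₂ (0*≈ z)

  Vpow-∷ʳ : ∀ {N} ys y (p ls : Vec ℕ N) → Par C p → Par C ls →
    Vpow (ys ++ (y ∷ [])) p ls ≈ ∑ (pars N) (λ ks → Ver y ls ks * Vpow ys p ks)
  Vpow-∷ʳ {N} [] y p ls pp pl = begin
    ∑ (pars N) (λ ks → Ver y ks p * Dif (neg zeros) ks ls)
      ≈⟨ ∑-cong (pars N) (λ ks → ≈-trans (*-comm _ _) (*-congʳ (Dif-δ-sym ks ls))) ⟩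
    ∑ (pars N) (λ ks → Dif (neg zeros) ls ks * Ver y ks p)
      ≈⟨ ∑-pars-δ ls pl _ ⟩
    Ver y ls p
      ≈⟨ ≈-sym (∑-pars-δ p pp _) ⟩
    ∑ (pars N) (λ ks → Dif (neg zeros) p ks * Ver y ls ks)
      ≈⟨ ∑-cong (pars N) (λ ks → *-comm _ _) ⟩
    ∑ (pars N) (λ ks → Ver y ls ks * Dif (neg zeros) p ks) ∎
  Vpow-∷ʳ {N} (z ∷ ys) y p ls pp pl = begin
    ∑ (pars N) (λ ks → Ver z ks p * Vpow (ys ++ (y ∷ [])) ks ls)
      ≈⟨ ∑-cong∈ (pars N) (λ ks ks∈ → *-congˡ (≈-trans (Vpow-∷ʳ ys y ks ls (proj₂ (∈-pars⁻ ks∈)) pl) (∑-cong (pars N) (λ _ → *-comm _ _)))) ⟩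
    ∑ (pars N) (λ ks → Ver z ks p * ∑ (pars N) (λ r → Vpow ys ks r * Ver y ls r))
      ≈⟨ ∑-assoc (pars N) (pars N) _ _ _ ⟩
    ∑ (pars N) (λ r → Vpow (z ∷ ys) p r * Ver y ls r)
      ≈⟨ ∑-cong (pars N) (λ _ → *-comm _ _) ⟩
    ∑ (pars N) (λ r → Ver y ls r * Vpow (z ∷ ys) p r) ∎

  -- Both lists are ordered as labels are peeled off the lower right border: there `T''` has its
  -- smallest labels and `T'` its largest.
  vlabels hlabels : (ℕ → Carrier) → ℕ → List (ℕ → Carrier)
  vlabels u zero    = []
  vlabels u (suc k) = vlabels u k ++ (after (suc k) (u (suc k)) ∷ [])
  hlabels u zero    = []
  hlabels u (suc k) = after (suc k) (- u (suc k)) ∷ hlabels u k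

  -- In `before 1 u` only the row above has a weight, so `Pow (before 1 u)` is the product of the
  -- factors `U_0` with the identity `D_0`.
  Pow-expand : ∀ {N} k (u : ℕ → Carrier) xs (ls ns : Vec ℕ N) i → Par C ls → Par C ns →
    ent ns i ≤ c₀ → length (consts xs) ℕ.+ i < N →
    Pow (before (suc k) u) (consts xs) ls ns
    ≈ ∑ (pars N) (λ p → Vpow (vlabels u k) p ls *
        ∑ (pars N) (λ q → Pow (before 1 u) (consts xs) p q * Pow zeros (hlabels u k) ns q))
  Pow-expand {N} zero u xs ls ns i pl pn _ _ = ≈-sym (begin
    ∑ (pars N) (λ p → Dif (neg zeros) p ls * ∑ (pars N) (λ q → S p q * Dif (neg zeros) ns q))
      ≈⟨ ∑-cong (pars N) (λ p → *-cong (Dif-δ-sym p ls) (≈-trans (∑-cong (pars N) (λ q → *-comm _ _)) (∑-pars-δ ns pn (S p)))) ⟩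
    ∑ (pars N) (λ p → Dif (neg zeros) ls p * S p ns)
      ≈⟨ ∑-pars-δ ls pl _ ⟩
    S ls ns ∎)
    where
    S : Vec ℕ N → Vec ℕ N → Carrier
    S = Pow (before 1 u) (consts xs)
  Pow-expand {N} (suc k) u xs ls ns i pl pn ns≤ len = begin
    Pow (before (suc (suc k)) u) (consts xs) ls ns
      ≈⟨ Pow-step k u xs ls ns i pl pn ns≤ len ⟩
    ∑ (pars N) (λ r → V ls r * ∑ (pars N) (λ s → Pow (before (suc k) u) (consts xs) r s * H s))
      ≈⟨ ∑-cong∈ (pars N) (λ r r∈ → *-congˡ (≈-trans (∑-cong∈ (pars N) (λ s s∈ → IH r r∈ s s∈)) (regroup r))) ⟩
    ∑ (pars N) (λ r → V ls r * ∑ (pars N) (λ p → Vpow (vlabels u k) p r * ∑ (pars N) (λ q → S p q * A q)))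
      ≈⟨ ∑-assoc (pars N) (pars N) _ _ _ ⟩
    ∑ (pars N) (λ p → ∑ (pars N) (λ r → V ls r * Vpow (vlabels u k) p r) * ∑ (pars N) (λ q → S p q * A q))
      ≈⟨ ∑-cong∈ (pars N) (λ p p∈ → *-congʳ (≈-sym (Vpow-∷ʳ (vlabels u k) _ p ls (proj₂ (∈-pars⁻ p∈)) pl))) ⟩
    ∑ (pars N) (λ p → Vpow (vlabels u (suc k)) p ls * ∑ (pars N) (λ q → S p q * A q)) ∎
    where
    V S : Vec ℕ N → Vec ℕ N → Carrier
    V = Ver (after (suc k) (u (suc k)))
    S = Pow (before 1 u) (consts xs)
    H A : Vec ℕ N → Carrier
    H s = Hor (after (suc k) (- u (suc k))) zeros C ns s
    A = Pow zeros (hlabels u (suc k)) ns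
    E : Vec ℕ N → Vec ℕ N → Carrier
    E r s = ∑ (pars N) (λ p → Vpow (vlabels u k) p r * ∑ (pars N) (λ q → S p q * Pow zeros (hlabels u k) s q))
    IH : ∀ r → r ∈ pars N → ∀ s → s ∈ pars N → Pow (before (suc k) u) (consts xs) r s * H s ≈ E r s * H s
    IH r r∈ s s∈ with Hor-supp (after (suc k) (- u (suc k))) zeros C ns s
    ... | inj₂ z  = ≈-trans (*0≈ z) (≈-sym (*0≈ z))
    -- Removing a strip from `ns` leaves its empty row `i` empty, so the hypotheses pass to `s`.
    ... | inj₁ hs = *-congʳ (Pow-expand k u xs r s i (proj₂ (∈-pars⁻ r∈)) (proj₂ (∈-pars⁻ s∈))
                      (≤-trans (HStrip-ent≤ hs i) ns≤) len)
    regroup : ∀ r → ∑ (pars N) (λ s → E r s * H s) ≈ ∑ (pars N) (λ p → Vpow (vlabels u k) p r * ∑ (pars N) (λ q → S p q * A q))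
    regroup r = begin
      ∑ (pars N) (λ s → E r s * H s)
        ≈⟨ ≈-sym (∑-assoc (pars N) (pars N) _ _ _) ⟩
      ∑ (pars N) (λ p → Vpow (vlabels u k) p r * ∑ (pars N) (λ s → ∑ (pars N) (λ q → S p q * Pow zeros (hlabels u k) s q) * H s))
        ≈⟨ ∑-cong (pars N) (λ p → *-congˡ (≈-trans (≈-sym (∑-assoc (pars N) (pars N) _ _ _))
             (∑-cong (pars N) (λ q → *-congˡ (∑-cong (pars N) (λ s → *-comm _ _)))))) ⟩
      ∑ (pars N) (λ p → Vpow (vlabels u k) p r * ∑ (pars N) (λ q → S p q * A q)) ∎

-- Peeling one label off a tableau

-- What a box holds with respect to the label being peeled: nothing but that label, or a remaining
-- nonempty set `S`, with a mark that is true when the label was there too.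
data Cell : Set where
  new  : Cell
  keep : List ℕ → Bool → Cell

kept : Filling Cell → Filling (List ℕ)
kept []                   = []
kept ((b , new) ∷ s)      = kept s
kept ((b , keep S β) ∷ s) = (b , S) ∷ kept s

marks : Filling Cell → Filling Bool
marks []                   = []
marks ((b , new) ∷ s)      = marks s
marks ((b , keep S β) ∷ s) = (b , β) ∷ marks s

isOld : Cell → Bool
isOld new        = false
isOld (keep _ _) = true

oldness : Filling Cell → Filling Bool
oldness = map (λ p → proj₁ p , isOld (proj₂ p))

oldBoxes : Filling Bool → List Box
oldBoxes []                = []
oldBoxes ((b , true) ∷ χ)  = b ∷ oldBoxes χ
oldBoxes ((b , false) ∷ χ) = oldBoxes χ

bools : List Bool
bools = true ∷ false ∷ []

compat : {L : Set} → (L → L → Bool) → (L → L → Bool) → Box × L → Box × L → Bool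
compat ρ κ (a , x) (b , y) = (sameRowLeftOf a b ⇒ᵇ ρ x y) ∧ (sameColAbove a b ⇒ᵇ κ x y)

allPairs : (ℕ → ℕ → Bool) → List ℕ → List ℕ → Bool
allPairs ρ S S' = all (λ x → all (λ y → ρ x y) S') S

-- May a box with flag x precede one with flag y, the flags marking the boxes without the peeled
-- label and q telling whether that label may be repeated?
may : Bool → Bool → Bool → Bool
may q true  _     = true
may q false true  = false
may q false false = q

∈-fillings : {L : Set} (bs : List Box) (opts : Box → List L) (t : Filling L) → t ∈ fillings bs opts →
  ∀ b x → (b , x) ∈ t → b ∈ bs × x ∈ opts b
∈-fillings []       opts .[] (here refl) b x ()
∈-fillings (b ∷ bs) opts t t∈ b' x' m
  with x , x∈ , t∈' ← concatMap-∈ (λ x → map ((b , x) ∷_) (fillings bs opts)) (opts b) t∈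
  with t' , t'∈ , refl ← ∈-map⁻ ((b , x) ∷_) t∈'
  with m
... | here refl = here refl , x∈
... | there m'  with p , q ← ∈-fillings bs opts t' t'∈ b' x' m' = there p , q

∈-subsets : {A : Set} (xs S : List A) → S ∈ subsets xs → ∀ x → x ∈ S → x ∈ xs
∈-subsets []       .[] (here refl) x ()
∈-subsets (y ∷ xs) S S∈ x x∈ with ∈-++⁻ (subsets xs) S∈
... | inj₁ m = there (∈-subsets xs S m x x∈)
... | inj₂ m with S' , S'∈ , refl ← ∈-map⁻ (y ∷_) m with x∈
...   | here refl = here refl
...   | there x∈' = there (∈-subsets xs S' S'∈ x x∈')

∈-nonemptySubsets : {A : Set} (xs S : List A) → S ∈ nonemptySubsets xs → ∃[ y ] ∃[ ys ] S ≡ y ∷ ys × (∀ x → x ∈ S → x ∈ xs)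
∈-nonemptySubsets (y ∷ xs) S S∈ with ∈-++⁻ (map (y ∷_) (subsets xs)) S∈
... | inj₁ m with S' , S'∈ , refl ← ∈-map⁻ (y ∷_) m =
  y , S' , refl , λ { x (here refl) → here refl ; x (there x∈) → there (∈-subsets xs S' S'∈ x x∈) }
... | inj₂ m with z , zs , e , h ← ∈-nonemptySubsets xs S m = z , zs , e , λ x x∈ → there (h x x∈)

-- The label `l` comes last in the order meant by `ρ`: it is the largest for semistandard tableaux,
-- the smallest for reverse row-strict ones. The flag `q` separates weak from strict relations.
record Peelable (ρ : ℕ → ℕ → Bool) (l : ℕ) (ls : List ℕ) (q : Bool) : Set where
  field
    below : ∀ x → x ∈ ls → ρ x l ≡ true
    above : ∀ x → x ∈ ls → ρ l x ≡ false
    self  : ρ l l ≡ q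

module Peel {c ℓ} (R : CommutativeRing c ℓ) where
  open CommutativeRing R
    hiding (zero)
    renaming (refl to ≈-refl; sym to ≈-sym; trans to ≈-trans; reflexive to ≈-reflexive)
  open Sums R
  open import Relation.Binary.Reasoning.Setoid setoid

  ∑-fillings : {L : Set} (b : Box) (bs : List Box) (opts : Box → List L) (f : Filling L → Carrier) →
    ∑ (fillings (b ∷ bs) opts) f ≈ ∑ (opts b) (λ x → ∑ (fillings bs opts) (λ t → f ((b , x) ∷ t)))
  ∑-fillings b bs opts f = ≈-trans (∑-concatMap (λ x → map ((b , x) ∷_) (fillings bs opts)) (opts b) f)
    (∑-cong (opts b) (λ x → ≈-reflexive (∑-map ((b , x) ∷_) (fillings bs opts) f)))

  ∑-fillings-∏ : {L : Set} (bs : List Box) (opts : Box → List L) (h : Box × L → Carrier) →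
    ∑ (fillings bs opts) (λ t → ∏ t h) ≈ ∏ bs (λ b → ∑ (opts b) (λ x → h (b , x)))
  ∑-fillings-∏ []       opts h = +-identityʳ 1#
  ∑-fillings-∏ (b ∷ bs) opts h = ≈-trans (∑-fillings b bs opts _)
    (≈-trans (∑-cong (opts b) (λ x → ≈-trans (∑-*ˡ (fillings bs opts) _ _) (*-congˡ (∑-fillings-∏ bs opts h))))
      (∑-*ʳ (opts b) _ _))

  ∑-subsets : {A : Set} (xs : List A) (f : List A → Carrier) → ∑ (subsets xs) f ≈ f [] + ∑ (nonemptySubsets xs) f
  ∑-subsets []       f = ≈-refl
  ∑-subsets (x ∷ xs) f = begin
    ∑ (subsets xs ++ map (x ∷_) (subsets xs)) f
      ≈⟨ ≈-trans (∑-++ (subsets xs) _ f) (+-congʳ (∑-subsets xs f)) ⟩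
    (f [] + ∑ (nonemptySubsets xs) f) + ∑ (map (x ∷_) (subsets xs)) f
      ≈⟨ solve 3 (λ a b c → (a :+ b) :+ c := a :+ (c :+ b)) ≈-refl _ _ _ ⟩
    f [] + (∑ (map (x ∷_) (subsets xs)) f + ∑ (nonemptySubsets xs) f)
      ≈⟨ +-congˡ (≈-sym (∑-++ (map (x ∷_) (subsets xs)) _ f)) ⟩
    f [] + ∑ (nonemptySubsets (x ∷ xs)) f ∎

  ∑-nonemptySubsets : {A : Set} (x : A) (xs : List A) (f : List A → Carrier) →
    ∑ (nonemptySubsets (x ∷ xs)) f ≈ f (x ∷ []) + ∑ (nonemptySubsets xs) (λ S → f (x ∷ S) + f S)
  ∑-nonemptySubsets x xs f = begin
    ∑ (map (x ∷_) (subsets xs) ++ nonemptySubsets xs) f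
      ≈⟨ ≈-trans (∑-++ (map (x ∷_) (subsets xs)) _ f) (+-congʳ (≈-trans (≈-reflexive (∑-map (x ∷_) (subsets xs) f)) (∑-subsets xs _))) ⟩
    (f (x ∷ []) + ∑ (nonemptySubsets xs) (λ S → f (x ∷ S))) + ∑ (nonemptySubsets xs) f
      ≈⟨ ≈-trans (+-assoc _ _ _) (+-congˡ (≈-sym (∑-+ (nonemptySubsets xs) _ _))) ⟩
    f (x ∷ []) + ∑ (nonemptySubsets xs) (λ S → f (x ∷ S) + f S) ∎

  ⟦pairwise⟧ : {L : Set} (r : Box × L → Box × L → Bool) (t : Filling L) →
    ⟦ pairwiseᵇ r t ⟧ ≈ ∏ t (λ p → ∏ t (λ q → ⟦ r p q ⟧))
  ⟦pairwise⟧ r t = ≈-trans (⟦all⟧ _ t) (∏-cong∈ t (λ p _ → ⟦all⟧ _ t))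

  ∏-kept : (s : Filling Cell) (f : Box × Cell → Carrier) (g : Box × List ℕ → Carrier) →
    (∀ b → f (b , new) ≈ 1#) → (∀ b S β → f (b , keep S β) ≈ g (b , S)) → ∏ s f ≈ ∏ (kept s) g
  ∏-kept []                   f g h₁ h₂ = ≈-refl
  ∏-kept ((b , new) ∷ s)      f g h₁ h₂ = ≈-trans (*-cong (h₁ b) (∏-kept s f g h₁ h₂)) (*-identityˡ _)
  ∏-kept ((b , keep S β) ∷ s) f g h₁ h₂ = *-cong (h₂ b S β) (∏-kept s f g h₁ h₂)

  ∏-marks : (s : Filling Cell) (f : Box × Cell → Carrier) (g : Box × Bool → Carrier) →
    (∀ b → f (b , new) ≈ 1#) → (∀ b S β → f (b , keep S β) ≈ g (b , β)) → ∏ s f ≈ ∏ (marks s) g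
  ∏-marks []                   f g h₁ h₂ = ≈-refl
  ∏-marks ((b , new) ∷ s)      f g h₁ h₂ = ≈-trans (*-cong (h₁ b) (∏-marks s f g h₁ h₂)) (*-identityˡ _)
  ∏-marks ((b , keep S β) ∷ s) f g h₁ h₂ = *-cong (h₂ b S β) (∏-marks s f g h₁ h₂)

  -- The exponent of `v` is the share of the box in the excess of its row. The weight `g` of a label
  -- may depend on the row, which later encodes the row bounds on `T'` and `T''`.
  weight : (ℕ → Carrier) → (ℕ → ℕ → Carrier) → Box × List ℕ → Carrier
  weight v g (b , S) = v (row b) ^ (length S ∸ 1) * ∏ S (λ l → g l (row b))

  tableaux : (ρ κ : ℕ → ℕ → Bool) → (ℕ → Carrier) → (ℕ → ℕ → Carrier) → List Box → List ℕ → Carrier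
  tableaux ρ κ v g bs ls = ∑ (fillings bs (λ _ → nonemptySubsets ls))
    (λ t → ⟦ pairwiseᵇ (compat (allPairs ρ) (allPairs κ)) t ⟧ * ∏ t (weight v g))

  cells : List ℕ → List Cell
  cells ls = new ∷ concatMap (λ S → keep S true ∷ keep S false ∷ []) (nonemptySubsets ls)

  ∑-cells : ∀ ls (f : Cell → Carrier) →
    ∑ (cells ls) f ≈ f new + ∑ (nonemptySubsets ls) (λ S → f (keep S true) + f (keep S false))
  ∑-cells ls f = +-congˡ (≈-trans (∑-concatMap _ (nonemptySubsets ls) f)
    (∑-cong (nonemptySubsets ls) (λ S → +-congˡ (+-identityʳ _))))

  ∑-bools : (f : Bool → Carrier) → ∑ bools f ≈ f true + f false
  ∑-bools f = +-congˡ (+-identityʳ _)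

  ∑-fillings-bools : ∀ b (bs : List Box) (f : Filling Bool → Carrier) →
    ∑ (fillings (b ∷ bs) (λ _ → bools)) f
    ≈ ∑ (fillings bs (λ _ → bools)) (λ t → f ((b , true) ∷ t)) + ∑ (fillings bs (λ _ → bools)) (λ t → f ((b , false) ∷ t))
  ∑-fillings-bools b bs f = ≈-trans (∑-fillings b bs (λ _ → bools) f)
    (∑-bools (λ x → ∑ (fillings bs (λ _ → bools)) (λ t → f ((b , x) ∷ t))))

  -- Once the old boxes are fixed, their remaining sets and their marks are chosen independently.
  ∑-cells-split : ∀ (bs : List Box) ls (Ψ : Filling Bool → Filling (List ℕ) → Filling Bool → Carrier) →
    ∑ (fillings bs (λ _ → cells ls)) (λ s → Ψ (oldness s) (kept s) (marks s))
    ≈ ∑ (fillings bs (λ _ → bools)) (λ χ → ∑ (fillings (oldBoxes χ) (λ _ → nonemptySubsets ls))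
        (λ t → ∑ (fillings (oldBoxes χ) (λ _ → bools)) (λ β → Ψ χ t β)))
  ∑-cells-split []       ls Ψ = ≈-sym (+-congʳ (≈-trans (+-identityʳ _) (+-identityʳ _)))
  ∑-cells-split (b ∷ bs) ls Ψ = begin
    ∑ (fillings (b ∷ bs) (λ _ → cells ls)) (λ s → Ψ (oldness s) (kept s) (marks s))
      ≈⟨ ≈-trans (∑-fillings b bs (λ _ → cells ls) (λ s → Ψ (oldness s) (kept s) (marks s)))
           (∑-cells ls (λ x → ∑ F₀ (λ s → Ψ (oldness ((b , x) ∷ s)) (kept ((b , x) ∷ s)) (marks ((b , x) ∷ s))))) ⟩
    ∑ F₀ (λ s → Ψ ((b , false) ∷ oldness s) (kept s) (marks s)) +
    ∑ ne (λ S → ∑ F₀ (λ s → Ψ ((b , true) ∷ oldness s) ((b , S) ∷ kept s) ((b , true) ∷ marks s))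
              + ∑ F₀ (λ s → Ψ ((b , true) ∷ oldness s) ((b , S) ∷ kept s) ((b , false) ∷ marks s)))
      ≈⟨ +-cong (∑-cells-split bs ls (λ χ t β → Ψ ((b , false) ∷ χ) t β))
           (∑-cong ne (λ S → +-cong (∑-cells-split bs ls (λ χ t β → Ψ ((b , true) ∷ χ) ((b , S) ∷ t) ((b , true) ∷ β)))
                                    (∑-cells-split bs ls (λ χ t β → Ψ ((b , true) ∷ χ) ((b , S) ∷ t) ((b , false) ∷ β))))) ⟩
    N + ∑ ne (λ S → ∑ F₁ (λ χ → O χ S true) + ∑ F₁ (λ χ → O χ S false))
      ≈⟨ +-congˡ (∑-cong ne (λ S → ≈-sym (∑-+ F₁ _ _))) ⟩
    N + ∑ ne (λ S → ∑ F₁ (λ χ → O χ S true + O χ S false))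
      ≈⟨ +-congˡ (∑-swap ne F₁ _) ⟩
    N + ∑ F₁ (λ χ → ∑ ne (λ S → O χ S true + O χ S false))
      ≈⟨ +-congˡ (∑-cong F₁ (λ χ → ≈-sym (≈-trans (∑-fillings b (oldBoxes χ) (λ _ → ne) _)
           (∑-cong ne (λ S → ≈-trans (∑-cong (fillings (oldBoxes χ) (λ _ → ne)) (λ t → ∑-fillings-bools b (oldBoxes χ) _))
             (∑-+ (fillings (oldBoxes χ) (λ _ → ne)) _ _)))))) ⟩
    N + ∑ F₁ (λ χ → G ((b , true) ∷ χ))
      ≈⟨ +-comm _ _ ⟩
    ∑ F₁ (λ χ → G ((b , true) ∷ χ)) + N
      ≈⟨ ≈-sym (∑-fillings-bools b bs G) ⟩
    ∑ (fillings (b ∷ bs) (λ _ → bools)) G ∎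
    where
    F₀ = fillings bs (λ _ → cells ls)
    F₁ = fillings bs (λ _ → bools)
    ne = nonemptySubsets ls
    G : Filling Bool → Carrier
    G χ = ∑ (fillings (oldBoxes χ) (λ _ → ne)) (λ t → ∑ (fillings (oldBoxes χ) (λ _ → bools)) (λ β → Ψ χ t β))
    N : Carrier
    N = ∑ F₁ (λ χ → G ((b , false) ∷ χ))
    O : Filling Bool → List ℕ → Bool → Carrier
    O χ S β₀ = ∑ (fillings (oldBoxes χ) (λ _ → ne)) (λ t → ∑ (fillings (oldBoxes χ) (λ _ → bools))
      (λ β → Ψ ((b , true) ∷ χ) ((b , S) ∷ t) ((b , β₀) ∷ β)))

  encode : ℕ → Cell → List ℕ
  encode l new            = l ∷ []
  encode l (keep S true)  = l ∷ S
  encode l (keep S false) = S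

  ∑-encode : ∀ (bs : List Box) l ls (f : Filling (List ℕ) → Carrier) →
    ∑ (fillings bs (λ _ → nonemptySubsets (l ∷ ls))) f
    ≈ ∑ (fillings bs (λ _ → cells ls)) (λ s → f (map (λ p → proj₁ p , encode l (proj₂ p)) s))
  ∑-encode []       l ls f = ≈-refl
  ∑-encode (b ∷ bs) l ls f = begin
    ∑ (fillings (b ∷ bs) (λ _ → nonemptySubsets (l ∷ ls))) f
      ≈⟨ ≈-trans (∑-fillings b bs (λ _ → nonemptySubsets (l ∷ ls)) f) (∑-nonemptySubsets l ls H) ⟩
    H (l ∷ []) + ∑ (nonemptySubsets ls) (λ S → H (l ∷ S) + H S)
      ≈⟨ ≈-sym (∑-cells ls (λ x → H (encode l x))) ⟩
    ∑ (cells ls) (λ x → H (encode l x))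
      ≈⟨ ∑-cong (cells ls) (λ x → ∑-encode bs l ls (λ t → f ((b , encode l x) ∷ t))) ⟩
    ∑ (cells ls) (λ x → ∑ (fillings bs (λ _ → cells ls)) (λ s → f ((b , encode l x) ∷ map (λ p → proj₁ p , encode l (proj₂ p)) s)))
      ≈⟨ ≈-sym (∑-fillings b bs (λ _ → cells ls) (λ s → f (map (λ p → proj₁ p , encode l (proj₂ p)) s))) ⟩
    ∑ (fillings (b ∷ bs) (λ _ → cells ls)) (λ s → f (map (λ p → proj₁ p , encode l (proj₂ p)) s)) ∎
    where
    H : List ℕ → Carrier
    H x = ∑ (fillings bs (λ _ → nonemptySubsets (l ∷ ls))) (λ t → f ((b , x) ∷ t))

  markᵇ : Cell → Bool
  markᵇ (keep _ β) = β
  markᵇ new        = false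

  GoodCell : List ℕ → Cell → Set
  GoodCell ls new        = ⊤
  GoodCell ls (keep S _) = ∃[ y ] ∃[ ys ] S ≡ y ∷ ys × (∀ x → x ∈ S → x ∈ ls)

  goodCell : ∀ ls x → x ∈ cells ls → GoodCell ls x
  goodCell ls new        _ = _
  goodCell ls (keep S β) (there m)
    with S' , S'∈ , m' ← concatMap-∈ (λ S → keep S true ∷ keep S false ∷ []) (nonemptySubsets ls) m with m'
  ... | here refl         = ∈-nonemptySubsets ls S' S'∈
  ... | there (here refl) = ∈-nonemptySubsets ls S' S'∈

  keptᵇ : ∀ {a} {A : Set a} → (List ℕ → List ℕ → A) → A → Cell → Cell → A
  keptᵇ f d (keep S _) (keep S' _) = f S S'
  keptᵇ f d _          _           = d

  -- A box holding `l` can precede only a box holding `l` alone, while an `l` in the second box is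
  -- never an obstacle to older labels in the first. So the mark of `y` does not matter, and the
  -- condition splits into one on which boxes are old, one on the mark of `x`, and one on the
  -- remaining sets.
  allPairs-encode : ∀ {ρ l ls q} → Peelable ρ l ls q → ∀ x y → GoodCell ls x → GoodCell ls y →
    allPairs ρ (encode l x) (encode l y)
    ≡ (may q (isOld x) (isOld y) ∧ may q (not (markᵇ x)) (isOld y)) ∧ keptᵇ (allPairs ρ) true x y
  allPairs-encode {ρ} {l} {ls} {q} pe = go
    where
    open Peelable pe
    open import Data.Bool.Properties using (∧-identityʳ; ∧-zeroʳ)
    all-below : ∀ S → (∀ x → x ∈ S → x ∈ ls) → allPairs ρ S (l ∷ []) ≡ true
    all-below S h = T⇒true (T-all⁺ _ S (λ x x∈ → subst T (sym (trans (∧-identityʳ _) (below x (h x x∈)))) _))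
    l-above : ∀ S → (∃[ y ] ∃[ ys ] S ≡ y ∷ ys × (∀ x → x ∈ S → x ∈ ls)) → all (ρ l) S ≡ false
    l-above _ (y , ys , refl , h) rewrite above y (h y (here refl)) = refl
    snoc : ∀ S S' → (∀ x → x ∈ S → x ∈ ls) → allPairs ρ S (l ∷ S') ≡ allPairs ρ S S'
    snoc S S' h = all-cong S (λ x x∈ → cong (_∧ all (ρ x) S') (below x (h x x∈)))
    go : ∀ x y → GoodCell ls x → GoodCell ls y →
      allPairs ρ (encode l x) (encode l y)
      ≡ (may q (isOld x) (isOld y) ∧ may q (not (markᵇ x)) (isOld y)) ∧ keptᵇ (allPairs ρ) true x y
    go new new _ _ rewrite self = refl
    go new (keep S true)  _ gy rewrite self | l-above S gy | ∧-zeroʳ q = refl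
    go new (keep S false) _ gy rewrite l-above S gy = refl
    go (keep S true) new (_ , _ , _ , h) _ rewrite self | all-below S h = ∧-identityʳ (q ∧ true)
    go (keep S false) new (_ , _ , _ , h) _ = all-below S h
    go (keep S true) (keep S' true) _ gy rewrite l-above S' gy | ∧-zeroʳ (ρ l l) = refl
    go (keep S true) (keep S' false) _ gy rewrite l-above S' gy = refl
    go (keep S false) (keep S' true) (_ , _ , _ , h) _ = snoc S S' h
    go (keep S false) (keep S' false) _ _ = refl

  -- Whether an old box may be marked depends on which boxes are old and not on the other marks.
  -- Summing over the marks therefore gives a product, with a factor `1 + v g` for each old box that
  -- can take the label and 1 for the others.
  tableaux-peel : ∀ {ρ κ l ls r c} v g (bs : List Box) → Peelable ρ l ls r → Peelable κ l ls c →
    tableaux ρ κ v g bs (l ∷ ls)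
    ≈ ∑ (fillings bs (λ _ → bools)) (λ χ → ⟦ pairwiseᵇ (compat (may r) (may c)) χ ⟧ *
        ((∏ χ (λ p → if proj₂ p then 1# else g l (row (proj₁ p))) *
          ∏ (oldBoxes χ) (λ b → ⟦ all (compat (may r) (may c) (b , false)) χ ⟧ * (v (row b) * g l (row b)) + 1#)) *
         tableaux ρ κ v g (oldBoxes χ) ls))
  tableaux-peel {ρ} {κ} {l} {ls} {r} {c} v g bs pρ pκ = begin
    tableaux ρ κ v g bs (l ∷ ls)
      ≈⟨ ∑-encode bs l ls _ ⟩
    ∑ (fillings bs (λ _ → cells ls)) (λ s → ⟦ pairwiseᵇ rel (map enc s) ⟧ * ∏ (map enc s) (weight v g))
      ≈⟨ ∑-cong∈ (fillings bs (λ _ → cells ls)) pointwise ⟩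
    ∑ (fillings bs (λ _ → cells ls)) (λ s → Ψ (oldness s) (kept s) (marks s))
      ≈⟨ ∑-cells-split bs ls Ψ ⟩
    ∑ (fillings bs (λ _ → bools)) (λ χ → ∑ (fillings (oldBoxes χ) (λ _ → nonemptySubsets ls))
        (λ t → ∑ (fillings (oldBoxes χ) (λ _ → bools)) (λ β → Ψ χ t β)))
      ≈⟨ ∑-cong (fillings bs (λ _ → bools)) collect ⟩
    _ ∎
    where
    rel = compat (allPairs ρ) (allPairs κ)
    flag = compat (may r) (may c)
    enc : Box × Cell → Box × List ℕ
    enc p = proj₁ p , encode l (proj₂ p)
    ω : Box × Bool → Carrier
    ω p = if proj₂ p then 1# else g l (row (proj₁ p))
    μ : Filling Bool → Box × Bool → Carrier
    μ χ (b , β) = if β then ⟦ all (flag (b , false)) χ ⟧ * (v (row b) * g l (row b)) else 1#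
    Ψ : Filling Bool → Filling (List ℕ) → Filling Bool → Carrier
    Ψ χ t β = (⟦ pairwiseᵇ flag χ ⟧ * ∏ χ ω) * (∏ β (μ χ) * (⟦ pairwiseᵇ rel t ⟧ * ∏ t (weight v g)))

    collect : ∀ χ → ∑ (fillings (oldBoxes χ) (λ _ → nonemptySubsets ls))
        (λ t → ∑ (fillings (oldBoxes χ) (λ _ → bools)) (λ β → Ψ χ t β)) ≈ _
    collect χ = begin
      ∑ Ft (λ t → ∑ Fβ (λ β → (P * Q) * (∏ β (μ χ) * X t)))
        ≈⟨ ∑-cong Ft (λ t → ≈-trans (∑-*ˡ Fβ _ _) (*-congˡ (≈-trans (∑-*ʳ Fβ _ _) (*-congʳ M≈)))) ⟩
      ∑ Ft (λ t → (P * Q) * (M * X t))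
        ≈⟨ ≈-trans (∑-*ˡ Ft _ _) (*-congˡ (∑-*ˡ Ft _ _)) ⟩
      (P * Q) * (M * tableaux ρ κ v g (oldBoxes χ) ls)
        ≈⟨ solve 4 (λ p q m t → (p :* q) :* (m :* t) := p :* ((q :* m) :* t)) ≈-refl P Q M _ ⟩
      P * ((Q * M) * tableaux ρ κ v g (oldBoxes χ) ls) ∎
      where
      Ft = fillings (oldBoxes χ) (λ _ → nonemptySubsets ls)
      Fβ = fillings (oldBoxes χ) (λ _ → bools)
      P Q M : Carrier
      P = ⟦ pairwiseᵇ flag χ ⟧
      Q = ∏ χ ω
      M = ∏ (oldBoxes χ) (λ b → ⟦ all (flag (b , false)) χ ⟧ * (v (row b) * g l (row b)) + 1#)
      X : Filling (List ℕ) → Carrier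
      X t = ⟦ pairwiseᵇ rel t ⟧ * ∏ t (weight v g)
      M≈ : ∑ Fβ (λ β → ∏ β (μ χ)) ≈ M
      M≈ = ≈-trans (∑-fillings-∏ (oldBoxes χ) _ (μ χ)) (∏-cong∈ (oldBoxes χ) (λ b _ → ∑-bools (λ x → μ χ (b , x))))

    pointwise : ∀ s → s ∈ fillings bs (λ _ → cells ls) →
      ⟦ pairwiseᵇ rel (map enc s) ⟧ * ∏ (map enc s) (weight v g) ≈ Ψ (oldness s) (kept s) (marks s)
    pointwise s s∈ = begin
      ⟦ pairwiseᵇ rel (map enc s) ⟧ * ∏ (map enc s) (weight v g)
        ≈⟨ *-cong relations weights ⟩
      ((⟦ pairwiseᵇ flag (oldness s) ⟧ * E₁) * ⟦ pairwiseᵇ rel (kept s) ⟧) * ((∏ (oldness s) ω * E₂) * ∏ (kept s) (weight v g))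
        ≈⟨ solve 6 (λ p e₁ q o e₂ w → ((p :* e₁) :* q) :* ((o :* e₂) :* w) := (p :* o) :* ((e₁ :* e₂) :* (q :* w))) ≈-refl _ _ _ _ _ _ ⟩
      (⟦ pairwiseᵇ flag (oldness s) ⟧ * ∏ (oldness s) ω) * ((E₁ * E₂) * (⟦ pairwiseᵇ rel (kept s) ⟧ * ∏ (kept s) (weight v g)))
        ≈⟨ *-congˡ (*-congʳ (≈-trans (≈-sym (∏-* (marks s) e₁ e₂)) (∏-cong∈ (marks s) (λ p _ → e₁e₂ p)))) ⟩
      Ψ (oldness s) (kept s) (marks s) ∎
      where
      e₁ e₂ : Box × Bool → Carrier
      e₁ (b , β) = if β then ⟦ all (flag (b , false)) (oldness s) ⟧ else 1#
      e₂ (b , β) = if β then v (row b) * g l (row b) else 1#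
      e₁e₂ : ∀ p → e₁ p * e₂ p ≈ μ (oldness s) p
      e₁e₂ (b , true)  = ≈-refl
      e₁e₂ (b , false) = *-identityˡ 1#
      E₁ E₂ : Carrier
      E₁ = ∏ (marks s) e₁
      E₂ = ∏ (marks s) e₂

      old : Box × Cell → Box × Bool
      old p = proj₁ p , isOld (proj₂ p)
      A B K : Box × Cell → Box × Cell → Carrier
      A p q = ⟦ flag (old p) (old q) ⟧
      B p q = ⟦ flag (proj₁ p , not (markᵇ (proj₂ p))) (old q) ⟧
      K p q = keptᵇ (λ S S' → ⟦ rel (proj₁ p , S) (proj₁ q , S') ⟧) 1# (proj₂ p) (proj₂ q)

      good : ∀ p → p ∈ s → GoodCell ls (proj₂ p)
      good (b , x) p∈ = goodCell ls x (proj₂ (∈-fillings bs _ s s∈ b x p∈))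

      pair : ∀ p q → p ∈ s → q ∈ s → ⟦ rel (enc p) (enc q) ⟧ ≈ (A p q * B p q) * K p q
      pair (a , x) (b , y) p∈ q∈
        rewrite allPairs-encode pρ x y (good (a , x) p∈) (good (b , y) q∈)
              | allPairs-encode pκ x y (good (a , x) p∈) (good (b , y) q∈)
        = split (sameRowLeftOf a b) (sameColAbove a b) x y
        where
        arrow : ∀ t a b k → ⟦ t ⇒ᵇ ((a ∧ b) ∧ k) ⟧ ≈ (⟦ t ⇒ᵇ a ⟧ * ⟦ t ⇒ᵇ b ⟧) * ⟦ t ⇒ᵇ k ⟧
        arrow true  a b k = ≈-trans (⟦∧⟧ (a ∧ b) k) (*-congʳ (⟦∧⟧ a b))
        arrow false a b k = solve 0 (con 1 := (con 1 :* con 1) :* con 1) ≈-refl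
        both : ∀ t u a b k a' b' k' →
          ⟦ (t ⇒ᵇ ((a ∧ b) ∧ k)) ∧ (u ⇒ᵇ ((a' ∧ b') ∧ k')) ⟧
          ≈ (⟦ (t ⇒ᵇ a) ∧ (u ⇒ᵇ a') ⟧ * ⟦ (t ⇒ᵇ b) ∧ (u ⇒ᵇ b') ⟧) * ⟦ (t ⇒ᵇ k) ∧ (u ⇒ᵇ k') ⟧
        both t u a b k a' b' k' = begin
          ⟦ (t ⇒ᵇ ((a ∧ b) ∧ k)) ∧ (u ⇒ᵇ ((a' ∧ b') ∧ k')) ⟧
            ≈⟨ ≈-trans (⟦∧⟧ (t ⇒ᵇ ((a ∧ b) ∧ k)) _) (*-cong (arrow t a b k) (arrow u a' b' k')) ⟩
          ((⟦ t ⇒ᵇ a ⟧ * ⟦ t ⇒ᵇ b ⟧) * ⟦ t ⇒ᵇ k ⟧) * ((⟦ u ⇒ᵇ a' ⟧ * ⟦ u ⇒ᵇ b' ⟧) * ⟦ u ⇒ᵇ k' ⟧)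
            ≈⟨ solve 6 (λ a b k a' b' k' → ((a :* b) :* k) :* ((a' :* b') :* k') := ((a :* a') :* (b :* b')) :* (k :* k')) ≈-refl _ _ _ _ _ _ ⟩
          ((⟦ t ⇒ᵇ a ⟧ * ⟦ u ⇒ᵇ a' ⟧) * (⟦ t ⇒ᵇ b ⟧ * ⟦ u ⇒ᵇ b' ⟧)) * (⟦ t ⇒ᵇ k ⟧ * ⟦ u ⇒ᵇ k' ⟧)
            ≈⟨ ≈-sym (*-cong (*-cong (⟦∧⟧ (t ⇒ᵇ a) _) (⟦∧⟧ (t ⇒ᵇ b) _)) (⟦∧⟧ (t ⇒ᵇ k) _)) ⟩
          _ ∎
        trivial : ∀ t u → ⟦ (t ⇒ᵇ true) ∧ (u ⇒ᵇ true) ⟧ ≈ 1#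
        trivial true  true  = ≈-refl
        trivial true  false = ≈-refl
        trivial false true  = ≈-refl
        trivial false false = ≈-refl
        split : ∀ t u x y →
          ⟦ (t ⇒ᵇ ((may r (isOld x) (isOld y) ∧ may r (not (markᵇ x)) (isOld y)) ∧ keptᵇ (allPairs ρ) true x y))
          ∧ (u ⇒ᵇ ((may c (isOld x) (isOld y) ∧ may c (not (markᵇ x)) (isOld y)) ∧ keptᵇ (allPairs κ) true x y)) ⟧
          ≈ (⟦ (t ⇒ᵇ may r (isOld x) (isOld y)) ∧ (u ⇒ᵇ may c (isOld x) (isOld y)) ⟧
             * ⟦ (t ⇒ᵇ may r (not (markᵇ x)) (isOld y)) ∧ (u ⇒ᵇ may c (not (markᵇ x)) (isOld y)) ⟧)
            * keptᵇ (λ S S' → ⟦ (t ⇒ᵇ allPairs ρ S S') ∧ (u ⇒ᵇ allPairs κ S S') ⟧) 1# x y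
        split t u x y = ≈-trans (both t u (may r (isOld x) (isOld y)) (may r (not (markᵇ x)) (isOld y)) _
          (may c (isOld x) (isOld y)) (may c (not (markᵇ x)) (isOld y)) _) (*-congˡ (last x y))
          where
          last : ∀ x y → ⟦ (t ⇒ᵇ keptᵇ (allPairs ρ) true x y) ∧ (u ⇒ᵇ keptᵇ (allPairs κ) true x y) ⟧
            ≈ keptᵇ (λ S S' → ⟦ (t ⇒ᵇ allPairs ρ S S') ∧ (u ⇒ᵇ allPairs κ S S') ⟧) 1# x y
          last new        new        = trivial t u
          last new        (keep _ _) = trivial t u
          last (keep _ _) new        = trivial t u
          last (keep _ _) (keep _ _) = ≈-refl

      relations : ⟦ pairwiseᵇ rel (map enc s) ⟧ ≈ (⟦ pairwiseᵇ flag (oldness s) ⟧ * E₁) * ⟦ pairwiseᵇ rel (kept s) ⟧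
      relations = begin
        ⟦ pairwiseᵇ rel (map enc s) ⟧
          ≈⟨ ≈-trans (⟦pairwise⟧ rel (map enc s)) (≈-trans (≈-reflexive (∏-map enc s _))
               (∏-cong∈ s (λ p _ → ≈-reflexive (∏-map enc s _)))) ⟩
        ∏ s (λ p → ∏ s (λ q → ⟦ rel (enc p) (enc q) ⟧))
          ≈⟨ ∏-cong∈ s (λ p p∈ → ≈-trans (∏-cong∈ s (λ q q∈ → pair p q p∈ q∈))
               (≈-trans (∏-* s _ _) (*-congʳ (∏-* s _ _)))) ⟩
        ∏ s (λ p → (∏ s (A p) * ∏ s (B p)) * ∏ s (K p))
          ≈⟨ ≈-trans (∏-* s _ _) (*-congʳ (∏-* s _ _)) ⟩
        (∏ s (λ p → ∏ s (A p)) * ∏ s (λ p → ∏ s (B p))) * ∏ s (λ p → ∏ s (K p))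
          ≈⟨ *-cong (*-cong A≈ B≈) K≈ ⟩
        (⟦ pairwiseᵇ flag (oldness s) ⟧ * E₁) * ⟦ pairwiseᵇ rel (kept s) ⟧ ∎
        where
        A≈ : ∏ s (λ p → ∏ s (A p)) ≈ ⟦ pairwiseᵇ flag (oldness s) ⟧
        A≈ = ≈-sym (≈-trans (⟦pairwise⟧ flag (oldness s)) (≈-trans (≈-reflexive (∏-map old s _))
               (∏-cong∈ s (λ p _ → ≈-reflexive (∏-map old s _)))))
        free : ∀ b q → ⟦ flag (b , true) q ⟧ ≈ 1#
        free b q with sameRowLeftOf b (proj₁ q) | sameColAbove b (proj₁ q)
        ... | true  | true  = ≈-refl
        ... | true  | false = ≈-refl
        ... | false | true  = ≈-refl
        ... | false | false = ≈-refl
        B≈ : ∏ s (λ p → ∏ s (B p)) ≈ E₁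
        B≈ = ∏-marks s _ e₁ (λ b → ∏-one s (λ q _ → free b (old q))) lem
          where
          lem : ∀ b S β → ∏ s (B (b , keep S β)) ≈ e₁ (b , β)
          lem b S true  = ≈-trans (≈-reflexive (sym (∏-map old s _))) (≈-sym (⟦all⟧ (flag (b , false)) (oldness s)))
          lem b S false = ∏-one s (λ q _ → free b (old q))
        K≈ : ∏ s (λ p → ∏ s (K p)) ≈ ⟦ pairwiseᵇ rel (kept s) ⟧
        K≈ = ≈-trans (∏-kept s _ (λ p → ∏ (kept s) (λ q → ⟦ rel p q ⟧)) (λ b → ∏-one s (λ q _ → ≈-refl))
               (λ b S β → ∏-kept s _ _ (λ _ → ≈-refl) (λ _ _ _ → ≈-refl)))
             (≈-sym (⟦pairwise⟧ rel (kept s)))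

      weights : ∏ (map enc s) (weight v g) ≈ (∏ (oldness s) ω * E₂) * ∏ (kept s) (weight v g)
      weights = begin
        ∏ (map enc s) (weight v g)
          ≈⟨ ≈-reflexive (∏-map enc s _) ⟩
        ∏ s (λ p → weight v g (enc p))
          ≈⟨ ∏-cong∈ s (λ p p∈ → factor (proj₁ p) (proj₂ p) (good p p∈)) ⟩
        ∏ s (λ p → (ω (old p) * f₂ p) * f₃ p)
          ≈⟨ ≈-trans (∏-* s _ _) (*-congʳ (∏-* s _ _)) ⟩
        (∏ s (λ p → ω (old p)) * ∏ s f₂) * ∏ s f₃
          ≈⟨ *-cong (*-cong (≈-reflexive (sym (∏-map old s _))) (∏-marks s f₂ e₂ (λ _ → ≈-refl) (λ _ _ _ → ≈-refl)))
                    (∏-kept s f₃ (weight v g) (λ _ → ≈-refl) (λ _ _ _ → ≈-refl)) ⟩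
        (∏ (oldness s) ω * E₂) * ∏ (kept s) (weight v g) ∎
        where
        f₂ f₃ : Box × Cell → Carrier
        f₂ (b , x) = e₂ (b , markᵇ x)
        f₃ (b , new)      = 1#
        f₃ (b , keep S _) = weight v g (b , S)
        factor : ∀ b x → GoodCell ls x → weight v g (b , encode l x) ≈ (ω (b , isOld x) * f₂ (b , x)) * f₃ (b , x)
        factor b new _ = solve 1 (λ a → con 1 :* (a :* con 1) := (a :* con 1) :* con 1) ≈-refl _
        factor b (keep S false) _ = solve 1 (λ a → a := (con 1 :* con 1) :* a) ≈-refl _
        -- As the remaining set is nonempty, the additional label raises the truncated
        -- `length S ∸ 1` by one; hence the factor `v`.
        factor b (keep _ true) (y , ys , refl , _) =
          solve 4 (λ w e g q → (w :* e) :* (g :* q) := (con 1 :* (w :* g)) :* (e :* q)) ≈-refl (v (row b)) (v (row b) ^ length ys) (g l (row b)) _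

-- Sets of old boxes as vectors of row lengths.

T-⇒⁺ : ∀ a {b} → (T a → T b) → T (a ⇒ᵇ b)
T-⇒⁺ true  h = h _
T-⇒⁺ false h = _

T-⇒⁻ : ∀ {a b} → T (a ⇒ᵇ b) → T a → T b
T-⇒⁻ {true} h _ = h

range-empty : ∀ {a b} → b < a → range a b ≡ []
range-empty {a} {b} p rewrite ℕₚ.m≤n⇒m∸n≡0 {suc b} {a} p = refl

range-∷ʳ : ∀ {a b} → a ≤ suc b → range a (suc b) ≡ range a b ++ (suc b ∷ [])
range-∷ʳ {a} {b} p rewrite ℕₚ.+-∸-assoc 1 p =
  trans (cong (map (a ℕ.+_)) (sym (upTo-∷ʳ (suc b ∸ a))))
    (trans (map-++ (a ℕ.+_) (upTo (suc b ∸ a)) _) (cong (λ z → range a b ++ (z ∷ [])) (ℕₚ.m+[n∸m]≡n p)))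
  where open import Data.List.Properties using (upTo-∷ʳ; map-++)

withFlags : (Box → Bool) → List Box → Filling Bool
withFlags f = map (λ b → b , f b)

fillings-withFlags⁺ : (f : Box → Bool) (bs : List Box) → withFlags f bs ∈ fillings bs (λ _ → bools)
fillings-withFlags⁺ f []       = here refl
fillings-withFlags⁺ f (b ∷ bs) = ∈-concatMap (λ x → map ((b , x) ∷_) (fillings bs (λ _ → bools))) bools (lem (f b))
  (∈-map⁺ ((b , f b) ∷_) (fillings-withFlags⁺ f bs))
  where
  lem : ∀ x → x ∈ bools
  lem true  = here refl
  lem false = there (here refl)

_≟ᴮ_ : (a b : Box) → Dec (a ≡ b)
_≟ᴮ_ = ≡-dec ℕ._≟_ ℕ._≟_

-- Without duplicate boxes a filling is the graph of a function; `f'` overrides the function found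
-- for the tail at the first box.
fillings-withFlags⁻ : (bs : List Box) → Unique bs → (χ : Filling Bool) → χ ∈ fillings bs (λ _ → bools) →
  ∃[ f ] χ ≡ withFlags f bs
fillings-withFlags⁻ []       _        χ (here refl) = (λ _ → true) , refl
fillings-withFlags⁻ (b ∷ bs) (n ∷ us) χ χ∈
  with x , _ , m ← concatMap-∈ (λ x → map ((b , x) ∷_) (fillings bs (λ _ → bools))) bools χ∈
  with χ' , χ'∈ , refl ← ∈-map⁻ ((b , x) ∷_) m
  with f , refl ← fillings-withFlags⁻ bs us χ' χ'∈
  = f' , cong₂ _∷_ (cong (b ,_) (sym f'-b)) (map-cong-∈ bs (λ c c∈ → cong (c ,_) (sym (f'-c c c∈))))
  where
  f' : Box → Bool
  f' c with c ≟ᴮ b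
  ... | yes _ = x
  ... | no _  = f c
  f'-b : f' b ≡ x
  f'-b with b ≟ᴮ b
  ... | yes _ = refl
  ... | no ne = ⊥-elim (ne refl)
  f'-c : ∀ c → c ∈ bs → f' c ≡ f c
  f'-c c c∈ with c ≟ᴮ b
  ... | yes refl = ⊥-elim (All≢⇒∉ bs n c∈)
  ... | no _ = refl
  map-cong-∈ : {A B : Set} {g h : A → B} (xs : List A) → (∀ x → x ∈ xs → g x ≡ h x) → map g xs ≡ map h xs
  map-cong-∈ []       _ = refl
  map-cong-∈ (x ∷ xs) e = cong₂ _∷_ (e x (here refl)) (map-cong-∈ xs (λ y y∈ → e y (there y∈)))

withFlags-cong : {f g : Box → Bool} (bs : List Box) → (∀ b → b ∈ bs → f b ≡ g b) → withFlags f bs ≡ withFlags g bs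
withFlags-cong []       _ = refl
withFlags-cong (b ∷ bs) e = cong₂ _∷_ (cong (b ,_) (e b (here refl))) (withFlags-cong bs (λ y y∈ → e y (there y∈)))

withFlags-injective : (f g : Box → Bool) (bs : List Box) → withFlags f bs ≡ withFlags g bs → ∀ b → b ∈ bs → f b ≡ g b
withFlags-injective f g (b ∷ bs) e .b (here refl) = cong proj₂ (proj₁ (∷-injective e))
  where open import Data.List.Properties using (∷-injective)
withFlags-injective f g (b ∷ bs) e c (there c∈) = withFlags-injective f g bs (proj₂ (∷-injective e)) c c∈
  where open import Data.List.Properties using (∷-injective)

oldBoxes-withFlags : (f : Box → Bool) (bs : List Box) → oldBoxes (withFlags f bs) ≡ filterᵇ f bs
oldBoxes-withFlags f []       = refl
oldBoxes-withFlags f (b ∷ bs) with f b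
... | true  = cong (b ∷_) (oldBoxes-withFlags f bs)
... | false = oldBoxes-withFlags f bs

bool-fillings-unique : (bs : List Box) → Unique (fillings bs (λ _ → bools))
bool-fillings-unique []       = [] ∷ []
bool-fillings-unique (b ∷ bs) = concatMap-unique (λ x → map ((b , x) ∷_) (fillings bs (λ _ → bools))) bools
  (((λ ()) ∷ []) ∷ ([] ∷ []))
  (λ x → Uniq.map⁺ (λ { refl → refl }) (bool-fillings-unique bs))
  (λ x y t t∈ t∈' → lem t x y (∈-map⁻ _ t∈) (∈-map⁻ _ t∈'))
  where
  lem : ∀ t x y → ∃[ s ] s ∈ fillings bs (λ _ → bools) × t ≡ (b , x) ∷ s →
    ∃[ s ] s ∈ fillings bs (λ _ → bools) × t ≡ (b , y) ∷ s → x ≡ y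
  lem t x y (_ , _ , refl) (_ , _ , refl) = refl

T-pairwise-withFlags⁺ : ∀ {ρ κ : Bool → Bool → Bool} (f : Box → Bool) (bs : List Box) →
  (∀ a b → a ∈ bs → b ∈ bs → (T (sameRowLeftOf a b) → T (ρ (f a) (f b))) × (T (sameColAbove a b) → T (κ (f a) (f b)))) →
  T (pairwiseᵇ (compat ρ κ) (withFlags f bs))
T-pairwise-withFlags⁺ f bs h = T-all⁺ _ (withFlags f bs) (λ p p∈ → T-all⁺ _ (withFlags f bs) (λ q q∈ → lem p q (∈-map⁻ _ p∈) (∈-map⁻ _ q∈)))
  where
  lem : ∀ p q → _ → _ → _
  lem _ _ (a , a∈ , refl) (b , b∈ , refl) with x , y ← h a b a∈ b∈ =
    T-∧⁺ (T-⇒⁺ (sameRowLeftOf a b) x) (T-⇒⁺ (sameColAbove a b) y)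

T-pairwise-withFlags⁻ : ∀ {ρ κ : Bool → Bool → Bool} (f : Box → Bool) (bs : List Box) →
  T (pairwiseᵇ (compat ρ κ) (withFlags f bs)) → ∀ a b → a ∈ bs → b ∈ bs →
  (T (sameRowLeftOf a b) → T (ρ (f a) (f b))) × (T (sameColAbove a b) → T (κ (f a) (f b)))
T-pairwise-withFlags⁻ {ρ} {κ} f bs h a b a∈ b∈
  with x , y ← T-∧⁻ {sameRowLeftOf a b ⇒ᵇ ρ (f a) (f b)} (T-all⁻ _ (withFlags f bs) (T-all⁻ _ (withFlags f bs) h (a , f a) (∈-map⁺ _ a∈)) (b , f b) (∈-map⁺ _ b∈))
  = T-⇒⁻ x , T-⇒⁻ y

sameRow⁺ : ∀ {i j j'} → j < j' → T (sameRowLeftOf (i , j) (i , j'))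
sameRow⁺ {i} p = T-∧⁺ (≡⇒≡ᵇ i i refl) (<⇒<ᵇ p)

sameRow⁻ : ∀ {i j i' j'} → T (sameRowLeftOf (i , j) (i' , j')) → i ≡ i' × j < j'
sameRow⁻ {i} {j} {i'} {j'} t with p , q ← T-∧⁻ {i ≡ᵇ i'} t = ≡ᵇ⇒≡ i i' p , <ᵇ⇒< j j' q

sameCol⁺ : ∀ {i i' j} → i < i' → T (sameColAbove (i , j) (i' , j))
sameCol⁺ {j = j} p = T-∧⁺ (≡⇒≡ᵇ j j refl) (<⇒<ᵇ p)

sameCol⁻ : ∀ {i j i' j'} → T (sameColAbove (i , j) (i' , j')) → j ≡ j' × i < i'
sameCol⁻ {i} {j} {i'} {j'} t with p , q ← T-∧⁻ {j ≡ᵇ j'} t = ≡ᵇ⇒≡ j j' p , <ᵇ⇒< i i' q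

threshold : (f : ℕ → Bool) (n d : ℕ) →
  (∀ j j' → n < j → j < j' → j' ≤ n ℕ.+ d → T (f j') → T (f j)) →
  ∃[ k ] n ≤ k × k ≤ n ℕ.+ d × (∀ j → n < j → j ≤ n ℕ.+ d → f j ≡ (j ≤ᵇ k))
threshold f n zero h = n , ≤-refl , ℕₚ.m≤m+n n 0 , λ j p q → ⊥-elim (<⇒≱ p (subst (j ≤_) (ℕₚ.+-identityʳ n) q))
threshold f n (suc d) h with f (n ℕ.+ suc d) in eq
... | true = n ℕ.+ suc d , ℕₚ.m≤m+n n _ , ≤-refl , λ j p q → trans (T⇒true (holds j p q)) (sym (≤ᵇ-yes q))
  where
  holds : ∀ j → n < j → j ≤ n ℕ.+ suc d → T (f j)
  holds j p q with ℕₚ.m≤n⇒m<n∨m≡n q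
  ... | inj₁ r    = h j (n ℕ.+ suc d) p r ≤-refl (subst T (sym eq) _)
  ... | inj₂ refl = subst T (sym eq) _
... | false with k , a , b , e ← threshold f n d (λ j j' p q r → h j j' p q (≤-trans r (ℕₚ.+-monoʳ-≤ n (ℕₚ.n≤1+n d))))
  = k , a , ≤-trans b (ℕₚ.+-monoʳ-≤ n (ℕₚ.n≤1+n d)) , λ j p q → lem j p q
  where
  lem : ∀ j → n < j → j ≤ n ℕ.+ suc d → f j ≡ (j ≤ᵇ k)
  lem j p q with ℕₚ.m≤n⇒m<n∨m≡n q
  ... | inj₁ r = e j p (ℕₚ.≤-pred (subst (j <_) (ℕₚ.+-suc n d) r))
  ... | inj₂ refl = trans eq (sym (≤ᵇ-no (subst (k <_) (sym (ℕₚ.+-suc n d)) (s≤s b))))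

module Reindex {c ℓ} (R : CommutativeRing c ℓ) (c₀ C : ℕ) where
  open CommutativeRing R
    hiding (zero)
    renaming (refl to ≈-refl; sym to ≈-sym; trans to ≈-trans; reflexive to ≈-reflexive)
  open Sums R
  open Matrices R c₀ C
  open Commutation R c₀ C
  open Expansion R c₀ C
  open Peel R
  open import Relation.Binary.Reasoning.Setoid setoid

  -- The vector `ls` need not dominate `ns`: a row that would end before it begins has no boxes.
  -- Vectors count rows from 0, boxes count them from 1.
  record Rep {N} (bs : List Box) (ls ns : Vec ℕ N) : Set where
    field
      unique : Unique bs
      row≢0  : ∀ {j} → (0 , j) ∉ bs
      inside : ∀ {i j} → (suc i , j) ∈ bs → ent ns i < j × j ≤ ent ls i
      member : ∀ {i j} → ent ns i < j → j ≤ ent ls i → (suc i , j) ∈ bs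

    row< : ∀ {i j} → (suc i , j) ∈ bs → i < N
    row< {i} m with i ℕₚ.<? N
    ... | yes p = p
    ... | no np with p , q ← inside m rewrite ent-beyond ls i (ℕₚ.≮⇒≥ np) | ent-beyond ns i (ℕₚ.≮⇒≥ np) = ⊥-elim (<⇒≱ p q)

  vec-choice : ∀ N (P : ℕ → ℕ → Set) → (∀ i → i < N → ∃[ k ] P i k) → Σ[ κ ∈ Vec ℕ N ] (∀ i → i < N → P i (ent κ i))
  vec-choice zero    P h = [] , λ i ()
  vec-choice (suc N) P h with k , p ← h 0 (s≤s z≤n) | κ , q ← vec-choice N (P ∘ suc) (λ i i<N → h (suc i) (s≤s i<N)) =
    k ∷ κ , λ { zero _ → p ; (suc i) (s≤s i<N) → q i i<N }

  ent-ext : ∀ {N} (κ κ' : Vec ℕ N) → (∀ i → i < N → ent κ i ≡ ent κ' i) → κ ≡ κ'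
  ent-ext []      []        h = refl
  ent-ext (k ∷ κ) (k' ∷ κ') h = cong₂ _∷_ (h 0 (s≤s z≤n)) (ent-ext κ κ' (λ i p → h (suc i) (s≤s p)))

  ∈-vecs : ∀ {N} (κ : Vec ℕ N) → (∀ i → i < N → c₀ ≤ ent κ i × ent κ i ≤ C) → κ ∈ vecs N
  ∈-vecs []      h = here refl
  ∈-vecs {suc N} (k ∷ κ) h with p , q ← h 0 (s≤s z≤n) =
    ∈-concatMap (λ c → map (c ∷_) (vecs N)) cs (∈-cs p q) (∈-map⁺ (k ∷_) (∈-vecs κ (λ i r → h (suc i) (s≤s r))))

  vecs-unique : ∀ N → Unique (vecs N)
  vecs-unique zero    = [] ∷ []
  vecs-unique (suc N) = concatMap-unique (λ c → map (c ∷_) (vecs N)) cs (range-unique c₀ C)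
    (λ x → Uniq.map⁺ (λ { refl → refl }) (vecs-unique N))
    (λ x y t t∈ t∈' → lem x y t (∈-map⁻ _ t∈) (∈-map⁻ _ t∈'))
    where
    lem : ∀ x y (t : Vec ℕ (suc N)) → ∃[ s ] s ∈ vecs N × t ≡ x ∷ s → ∃[ s ] s ∈ vecs N × t ≡ y ∷ s → x ≡ y
    lem x y t (_ , _ , refl) (_ , _ , refl) = refl

  allI : ℕ → (ℕ → Bool) → Bool
  allI N p = all p (upTo N)

  T-allI⁺ : ∀ N (p : ℕ → Bool) → (∀ i → i < N → T (p i)) → T (allI N p)
  T-allI⁺ N p h = T-all⁺ p (upTo N) (λ i i∈ → h i (∈-upTo⁻ i∈))

  T-allI⁻ : ∀ N (p : ℕ → Bool) → T (allI N p) → ∀ i → i < N → T (p i)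
  T-allI⁻ N p h i i<N = T-all⁻ p (upTo N) h i (∈-upTo⁺ i<N)

  below : ∀ {N} → Vec ℕ N → Box → Bool
  below κ (i , j) = j ≤ᵇ ent κ (ℕ.pred i)

  -- The bound `ent ns i ⊔ ent ls i` makes the vector unique: in a row without boxes it forces
  -- `ent κ i` to be `ent ns i`.
  betweenᵇ : ∀ {N} → Vec ℕ N → Vec ℕ N → Vec ℕ N → Bool
  betweenᵇ {N} ls ns κ = allI N (λ i → (ent ns i ≤ᵇ ent κ i) ∧ (ent κ i ≤ᵇ (ent ns i ⊔ ent ls i)))

  between⁻ : ∀ {N} (ls ns κ : Vec ℕ N) → T (betweenᵇ ls ns κ) → ∀ i → i < N → ent ns i ≤ ent κ i × ent κ i ≤ ent ns i ⊔ ent ls i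
  between⁻ {N} ls ns κ t i i<N with p , q ← T-∧⁻ {ent ns i ≤ᵇ ent κ i} (T-allI⁻ N _ t i i<N) = ≤ᵇ⇒≤ _ _ p , ≤ᵇ⇒≤ _ _ q

  between⁺ : ∀ {N} (ls ns κ : Vec ℕ N) → (∀ i → i < N → ent ns i ≤ ent κ i × ent κ i ≤ ent ns i ⊔ ent ls i) → T (betweenᵇ ls ns κ)
  between⁺ {N} ls ns κ h = T-allI⁺ N _ (λ i i<N → T-∧⁺ (≤⇒≤ᵇ (proj₁ (h i i<N))) (≤⇒≤ᵇ (proj₂ (h i i<N))))

  <⊔⇒≤ʳ : ∀ {n l j k} → n < j → j ≤ k → k ≤ n ⊔ l → j ≤ l
  <⊔⇒≤ʳ {n} {l} p q r with ℕₚ.⊔-sel n l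
  ... | inj₁ e rewrite e = ⊥-elim (<⇒≱ p (≤-trans q r))
  ... | inj₂ e rewrite e = ≤-trans q r

  -- Within a row an old box cannot follow a new one, since `may r false true` is false. So the old
  -- boxes of each row form an initial segment, which is recorded by its end.
  ∑-flags : ∀ {N} (bs : List Box) (ls ns : Vec ℕ N) r c (G : Filling Bool → Carrier) → Rep bs ls ns → Par C ls → Par C ns →
    ∑ (fillings bs (λ _ → bools)) (λ χ → ⟦ pairwiseᵇ (compat (may r) (may c)) χ ⟧ * G χ)
    ≈ ∑ (vecs N) (λ κ → ⟦ betweenᵇ ls ns κ ∧ pairwiseᵇ (compat (may r) (may c)) (withFlags (below κ) bs) ⟧ * G (withFlags (below κ) bs))
  ∑-flags {N} bs ls ns r c G rep pl pn = begin
    ∑ (fillings bs (λ _ → bools)) (λ χ → ⟦ pw χ ⟧ * G χ)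
      ≈⟨ ≈-sym (∑-filterᵇ pw (fillings bs (λ _ → bools)) G) ⟩
    ∑ (filterᵇ pw (fillings bs (λ _ → bools))) G
      ≈⟨ ∑-reindex _ _ φ G (filterᵇ-unique pw _ (bool-fillings-unique bs)) (filterᵇ-unique good _ (vecs-unique N)) inj to from ⟩
    ∑ (filterᵇ good (vecs N)) (G ∘ φ)
      ≈⟨ ∑-filterᵇ good (vecs N) (G ∘ φ) ⟩
    ∑ (vecs N) (λ κ → ⟦ good κ ⟧ * G (φ κ)) ∎
    where
    open Rep rep
    pw : Filling Bool → Bool
    pw = pairwiseᵇ (compat (may r) (may c))
    φ : Vec ℕ N → Filling Bool
    φ κ = withFlags (below κ) bs
    good : Vec ℕ N → Bool
    good κ = betweenᵇ ls ns κ ∧ pw (φ κ)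

    to : ∀ κ → κ ∈ filterᵇ good (vecs N) → φ κ ∈ filterᵇ pw (fillings bs (λ _ → bools))
    to κ m = ∈-filterᵇ⁺ pw _ (fillings-withFlags⁺ (below κ) bs) (proj₂ (T-∧⁻ {betweenᵇ ls ns κ} (proj₂ (∈-filterᵇ⁻ good (vecs N) m))))

    half : ∀ κ κ' → T (betweenᵇ ls ns κ) → T (betweenᵇ ls ns κ') → φ κ ≡ φ κ' → ∀ i → i < N → ent κ i ≤ ent κ' i
    half κ κ' b b' e i i<N with ent κ i ℕₚ.≤? ent κ' i
    ... | yes p = p
    -- Otherwise the box at the end `ent κ i` would be old for `κ` and new for `κ'`.
    ... | no np = ⊥-elim (subst T (trans (withFlags-injective (below κ) (below κ') bs e (suc i , ent κ i)
            (member (ℕₚ.≤-<-trans (proj₁ (between⁻ ls ns κ' b' i i<N)) (ℕₚ.≰⇒> np))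
              (<⊔⇒≤ʳ (ℕₚ.≤-<-trans (proj₁ (between⁻ ls ns κ' b' i i<N)) (ℕₚ.≰⇒> np)) ≤-refl (proj₂ (between⁻ ls ns κ b i i<N)))))
            (≤ᵇ-no (ℕₚ.≰⇒> np))) (≤⇒≤ᵇ (≤-refl {ent κ i})))

    inj : ∀ κ κ' → κ ∈ filterᵇ good (vecs N) → κ' ∈ filterᵇ good (vecs N) → φ κ ≡ φ κ' → κ ≡ κ'
    inj κ κ' m m' e = ent-ext κ κ' (λ i p → ℕₚ.≤-antisym (half κ κ' b b' e i p) (half κ' κ b' b (sym e) i p))
      where
      b  = proj₁ (T-∧⁻ {betweenᵇ ls ns κ} (proj₂ (∈-filterᵇ⁻ good (vecs N) m)))
      b' = proj₁ (T-∧⁻ {betweenᵇ ls ns κ'} (proj₂ (∈-filterᵇ⁻ good (vecs N) m')))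

    from : ∀ χ → χ ∈ filterᵇ pw (fillings bs (λ _ → bools)) → ∃[ κ ] κ ∈ filterᵇ good (vecs N) × χ ≡ φ κ
    from χ m with m₁ , t ← ∈-filterᵇ⁻ pw _ m with f , refl ← fillings-withFlags⁻ bs unique χ m₁ =
      κ , ∈-filterᵇ⁺ good (vecs N) (∈-vecs κ bounds) (T-∧⁺ (between⁺ ls ns κ bt) (subst (T ∘ pw) χ≡ t)) , χ≡
      where
      cut : ∀ n l → n ℕ.+ (l ∸ n) ≡ n ⊔ l
      cut n l with ℕₚ.≤-total n l
      ... | inj₁ p = trans (ℕₚ.m+[n∸m]≡n p) (sym (ℕₚ.m≤n⇒m⊔n≡n p))
      ... | inj₂ p = trans (cong (n ℕ.+_) (ℕₚ.m≤n⇒m∸n≡0 p)) (trans (ℕₚ.+-identityʳ n) (sym (ℕₚ.m≥n⇒m⊔n≡m p)))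
      P : ℕ → ℕ → Set
      P i k = (ent ns i ≤ k × k ≤ ent ns i ⊔ ent ls i) × (∀ j → ent ns i < j → j ≤ ent ls i → f (suc i , j) ≡ (j ≤ᵇ k))
      thr : ∀ i → i < N → ∃[ k ] P i k
      thr i _ = let (k , a , b , e) = threshold (λ j → f (suc i , j)) (ent ns i) (ent ls i ∸ ent ns i) mono in
        k , (a , subst (k ≤_) (cut (ent ns i) (ent ls i)) b) , λ j p q → e j p (≤-trans q (ℕₚ.m≤n+m∸n (ent ls i) (ent ns i)))
        where
        mono : ∀ j j' → ent ns i < j → j < j' → j' ≤ ent ns i ℕ.+ (ent ls i ∸ ent ns i) → T (f (suc i , j')) → T (f (suc i , j))
        mono j j' p q s tj' = lem (f (suc i , j)) (f (suc i , j')) tj'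
            (proj₁ (T-pairwise-withFlags⁻ f bs t (suc i , j) (suc i , j') (member p (≤-trans (ℕₚ.<⇒≤ q) j'≤)) (member (ℕₚ.<-trans p q) j'≤)) (sameRow⁺ {suc i} q))
          where
          j'≤ : j' ≤ ent ls i
          j'≤ = <⊔⇒≤ʳ (ℕₚ.<-trans p q) ≤-refl (subst (j' ≤_) (cut (ent ns i) (ent ls i)) s)
          lem : ∀ x y → T y → T (may r x y) → T x
          lem true  _    _ _ = _
          lem false true _ ()
      κ = proj₁ (vec-choice N P thr)
      κP = proj₂ (vec-choice N P thr)
      bt : ∀ i → i < N → ent ns i ≤ ent κ i × ent κ i ≤ ent ns i ⊔ ent ls i
      bt i p = proj₁ (κP i p)
      bounds : ∀ i → i < N → c₀ ≤ ent κ i × ent κ i ≤ C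
      bounds i p = ≤-trans (ent≥c₀ pn i) (proj₁ (bt i p)) , ≤-trans (proj₂ (bt i p)) (ℕₚ.⊔-lub (ent≤ pn i) (ent≤ pl i))
      χ≡ : withFlags f bs ≡ φ κ
      χ≡ = withFlags-cong bs (λ { (zero , j) b∈ → ⊥-elim (row≢0 b∈)
                                ; (suc i , j) b∈ → let (p , q) = inside b∈ in proj₂ (κP i (row< b∈)) j p q })

  canon : ∀ {N} → Vec ℕ N → Vec ℕ N → List Box
  canon {N} ls ns = concatMap (λ i → map (suc i ,_) (range (suc (ent ns i)) (ent ls i))) (upTo N)

  canon-Rep : ∀ {N} (ls ns : Vec ℕ N) → Rep (canon ls ns) ls ns
  canon-Rep {N} ls ns = record
    { unique = concatMap-unique rows (upTo N) (Uniq.upTo⁺ N) (λ i → Uniq.map⁺ (λ { refl → refl }) (range-unique _ _))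
        (λ x y b p q → lem x y b (∈-map⁻ _ p) (∈-map⁻ _ q))
    ; row≢0  = λ m → no0 (concatMap-∈ rows (upTo N) m)
    ; inside = λ m → ins (concatMap-∈ rows (upTo N) m)
    ; member = mem
    }
    where
    rows : ℕ → List Box
    rows i = map (suc i ,_) (range (suc (ent ns i)) (ent ls i))
    lem : ∀ x y b → ∃[ j ] j ∈ range (suc (ent ns x)) (ent ls x) × b ≡ (suc x , j) →
      ∃[ j ] j ∈ range (suc (ent ns y)) (ent ls y) × b ≡ (suc y , j) → x ≡ y
    lem x y b (_ , _ , refl) (_ , _ , refl) = refl
    no0 : ∀ {j} → ∃[ i ] i ∈ upTo N × (0 , j) ∈ rows i → ⊥
    no0 (i , _ , m) with ∈-map⁻ (suc i ,_) m
    ... | _ , _ , ()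
    ins : ∀ {i j} → ∃[ x ] x ∈ upTo N × (suc i , j) ∈ rows x → ent ns i < j × j ≤ ent ls i
    ins (x , _ , m) with _ , j∈ , refl ← ∈-map⁻ (suc x ,_) m = ∈-range⁻ _ _ j∈
    mem : ∀ {i j} → ent ns i < j → j ≤ ent ls i → (suc i , j) ∈ canon ls ns
    mem {i} p q with i ℕₚ.<? N
    ... | yes r = ∈-concatMap rows (upTo N) (∈-upTo⁺ r) (∈-map⁺ (suc i ,_) (∈-range⁺ p q))
    ... | no nr rewrite ent-beyond ls i (ℕₚ.≮⇒≥ nr) | ent-beyond ns i (ℕₚ.≮⇒≥ nr) = ⊥-elim (<⇒≱ p q)

  Rep-↭ : ∀ {N bs bs'} {ls ns : Vec ℕ N} → Rep bs ls ns → Rep bs' ls ns → bs ↭ bs'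
  Rep-↭ {bs = bs} {bs'} rep rep' = unique-↭ (Rep.unique rep) (Rep.unique rep') (half rep rep') (half rep' rep)
    where
    half : ∀ {bs bs' ls ns} → Rep bs ls ns → Rep bs' ls ns → ∀ b → b ∈ bs → b ∈ bs'
    half r r' (zero , j)  m = ⊥-elim (Rep.row≢0 r m)
    half r r' (suc i , j) m = let (p , q) = Rep.inside r m in Rep.member r' p q

  ∏-concatMap : {A B : Set} (φ : B → List A) (ys : List B) (f : A → Carrier) →
    ∏ (concatMap φ ys) f ≈ ∏ ys (λ y → ∏ (φ y) f)
  ∏-concatMap φ []       f = ≈-refl
  ∏-concatMap φ (y ∷ ys) f = ≈-trans (∏-++ (φ y) _ f) (*-congˡ (∏-concatMap φ ys f))

  ∏-Rep : ∀ {N bs} {ls ns : Vec ℕ N} → Rep bs ls ns → (f : Box → Carrier) →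
    ∏ bs f ≈ ∏ (upTo N) (λ i → ∏ (range (suc (ent ns i)) (ent ls i)) (λ j → f (suc i , j)))
  ∏-Rep {N} {ls = ls} {ns} rep f = ≈-trans (∏-↭ f (Rep-↭ rep (canon-Rep ls ns)))
    (≈-trans (∏-concatMap _ (upTo N) f) (∏-cong∈ (upTo N) (λ i _ → ≈-reflexive (∏-map (suc i ,_) (range (suc (ent ns i)) (ent ls i)) f))))

  Rep-below : ∀ {N bs} {ls ns : Vec ℕ N} (κ : Vec ℕ N) → Rep bs ls ns →
    (∀ i → i < N → ent κ i ≤ ent ns i ⊔ ent ls i) → Rep (filterᵇ (below κ) bs) κ ns
  Rep-below {N} {bs} {ls} {ns} κ rep h = record
    { unique = filterᵇ-unique (below κ) bs unique
    ; row≢0  = λ m → row≢0 (proj₁ (∈-filterᵇ⁻ (below κ) bs m))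
    ; inside = λ m → let (p , q) = ∈-filterᵇ⁻ (below κ) bs m in proj₁ (inside p) , ≤ᵇ⇒≤ _ _ q
    ; member = mem
    }
    where
    open Rep rep
    mem : ∀ {i j} → ent ns i < j → j ≤ ent κ i → (suc i , j) ∈ filterᵇ (below κ) bs
    mem {i} p q with i ℕₚ.<? N
    ... | yes r = ∈-filterᵇ⁺ (below κ) bs (member p (<⊔⇒≤ʳ p q (h i r))) (≤⇒≤ᵇ q)
    ... | no nr rewrite ent-beyond κ i (ℕₚ.≮⇒≥ nr) | ent-beyond ns i (ℕₚ.≮⇒≥ nr) = ⊥-elim (<⇒≱ p q)

  ∏-range-threshold : ∀ x n l k → n ≤ k → ∏ (range (suc n) l) (λ j → if j ≤ᵇ k then 1# else x) ≈ x ^ (l ∸ k)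
  ∏-range-threshold x n zero k p rewrite range-empty {suc n} {0} (s≤s z≤n) | ℕₚ.0∸n≡0 k = ≈-refl
  ∏-range-threshold x n (suc l) k p with n ℕₚ.≤? l
  ... | no np rewrite range-empty {suc n} {suc l} (s≤s (ℕₚ.≰⇒> np)) | ℕₚ.m≤n⇒m∸n≡0 {suc l} {k} (≤-trans (ℕₚ.≰⇒> np) p) = ≈-refl
  ... | yes n≤l rewrite range-∷ʳ {suc n} {l} (s≤s n≤l) = ≈-trans (∏-++ (range (suc n) l) _ _)
      (≈-trans (*-cong (∏-range-threshold x n l k p) (*-identityʳ _)) last)
    where
    last : x ^ (l ∸ k) * (if suc l ≤ᵇ k then 1# else x) ≈ x ^ (suc l ∸ k)
    last with k ℕₚ.≤? l
    ... | yes k≤l rewrite ≤ᵇ-no (s≤s k≤l) | ℕₚ.+-∸-assoc 1 k≤l = *-comm _ _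
    ... | no k≰l rewrite ≤ᵇ-yes (ℕₚ.≰⇒> k≰l) | ℕₚ.m≤n⇒m∸n≡0 {suc l} {k} (ℕₚ.≰⇒> k≰l) | ℕₚ.m≤n⇒m∸n≡0 {l} {k} (ℕₚ.<⇒≤ (ℕₚ.≰⇒> k≰l)) = *-identityʳ _

  ∏-new : ∀ {N bs} {ls ns : Vec ℕ N} (κ : Vec ℕ N) (x : ℕ → Carrier) → Rep bs ls ns → T (betweenᵇ ls ns κ) →
    ∏ (withFlags (below κ) bs) (λ p → if proj₂ p then 1# else x (row (proj₁ p)))
    ≈ ∏ (upTo N) (λ i → x (suc i) ^ (ent ls i ∸ ent κ i))
  ∏-new {N} {bs} {ls} {ns} κ x rep bt = ≈-trans (≈-reflexive (∏-map (λ b → b , below κ b) bs _))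
    (≈-trans (∏-Rep rep _) (∏-cong∈ (upTo N) (λ i i∈ →
      ∏-range-threshold (x (suc i)) (ent ns i) (ent ls i) (ent κ i) (proj₁ (between⁻ ls ns κ bt i (∈-upTo⁻ i∈))))))

-- Tableaux as products of strip matrices.

data Peelables (ρ : ℕ → ℕ → Bool) (q : Bool) : List ℕ → Set where
  []  : Peelables ρ q []
  _∷_ : ∀ {l ls} → Peelable ρ l ls q → Peelables ρ q ls → Peelables ρ q (l ∷ ls)

module Chains {c ℓ} (R : CommutativeRing c ℓ) (c₀ C : ℕ) where
  open CommutativeRing R
    hiding (zero)
    renaming (refl to ≈-refl; sym to ≈-sym; trans to ≈-trans; reflexive to ≈-reflexive)
  open Sums R
  open Matrices R c₀ C
  open Commutation R c₀ C
  open Expansion R c₀ C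
  open Peel R
  open Reindex R c₀ C
  open import Relation.Binary.Reasoning.Setoid setoid

  ∏-upTo-suc : ∀ N (f : ℕ → Carrier) → ∏ (upTo (suc N)) f ≈ f 0 * ∏ (upTo N) (f ∘ suc)
  ∏-upTo-suc N f = *-congˡ (≈-trans (≈-reflexive (cong (λ xs → ∏ xs f) (sym (map-upTo suc N)))) (≈-reflexive (∏-map suc (upTo N) f)))
    where open import Data.List.Properties using (map-upTo)

  hd≡ent : ∀ {N} (ls : Vec ℕ N) → hd ls ≡ ent ls 0
  hd≡ent []      = refl
  hd≡ent (_ ∷ _) = refl

  Hrows-∏ : ∀ {N} x v (ls κ : Vec ℕ N) → Hrows x v ls κ ≈
    ∏ (upTo N) (λ i → hfac (x i) (ent ls i) (ent κ i) * cap (x i) (v i) (ent ls (suc i)) (ent κ i))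
  Hrows-∏ x v [] [] = ≈-refl
  Hrows-∏ {suc N} x v (l ∷ ls) (k ∷ κ) rewrite hd≡ent ls = ≈-trans (≈-sym (*-assoc _ _ _))
    (≈-trans (*-congˡ (Hrows-∏ (x ∘ suc) (v ∘ suc) ls κ)) (≈-sym (∏-upTo-suc N _)))

  Dif-∏ : ∀ {N} d (ls ns : Vec ℕ N) → Dif d ls ns ≈ ∏ (upTo N) (λ i → hfac (d i) (ent ns i) (ent ls i))
  Dif-∏ d [] [] = ≈-refl
  Dif-∏ {suc N} d (l ∷ ls) (n ∷ ns) = ≈-trans (*-congˡ (Dif-∏ (d ∘ suc) ls ns)) (≈-sym (∏-upTo-suc N _))

  Ver-∏ : ∀ {N} y (κ ls : Vec ℕ N) → Ver y κ ls ≈ ∏ (upTo N) (λ i → vfac (y i) (ent κ i) (ent ls i))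
  Ver-∏ y [] [] = ≈-refl
  Ver-∏ {suc N} y (k ∷ κ) (l ∷ ls) = ≈-trans (*-congˡ (Ver-∏ (y ∘ suc) κ ls)) (≈-sym (∏-upTo-suc N _))

  -- Since `Ψ` sees the vector only through its maximum with `ns`, the weights can be exchanged one
  -- row at a time, provided that both have the same sums against every function of that maximum.
  ∑-collapse : ∀ {N} (ns : Vec ℕ N) (f f' : ℕ → ℕ → Carrier) (Ψ : Vec ℕ N → Carrier) →
    (∀ i → i < N → ∀ (h : ℕ → Carrier) → (∀ c → h c ≈ h (c ⊔ ent ns i)) → ∑ cs (λ c → f i c * h c) ≈ ∑ cs (λ c → f' i c * h c)) →
    (∀ κ κ' → (∀ i → ent κ i ⊔ ent ns i ≡ ent κ' i ⊔ ent ns i) → Ψ κ ≈ Ψ κ') →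
    ∑ (vecs N) (λ κ → ∏ (upTo N) (λ i → f i (ent κ i)) * Ψ κ) ≈ ∑ (vecs N) (λ κ → ∏ (upTo N) (λ i → f' i (ent κ i)) * Ψ κ)
  ∑-collapse [] f f' Ψ _ _ = ≈-refl
  ∑-collapse {suc N} (n ∷ ns) f f' Ψ row-f inv = begin
    ∑ (vecs (suc N)) (λ κ → ∏ (upTo (suc N)) (λ i → f i (ent κ i)) * Ψ κ)
      ≈⟨ expand f ⟩
    ∑ cs (λ c → f 0 c * ∑ (vecs N) (λ v → ∏ (upTo N) (λ i → f (suc i) (ent v i)) * Ψ (c ∷ v)))
      ≈⟨ ∑-cong cs (λ c → *-congˡ (∑-collapse ns (f ∘ suc) (f' ∘ suc) (λ v → Ψ (c ∷ v)) (λ i p → row-f (suc i) (s≤s p))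
           (λ κ κ' e → inv (c ∷ κ) (c ∷ κ') (λ { zero → refl ; (suc i) → e i })))) ⟩
    ∑ cs (λ c → f 0 c * H c)
      ≈⟨ row-f 0 (s≤s z≤n) H (λ c → ∑-cong (vecs N) (λ v → *-congˡ (inv (c ∷ v) ((c ⊔ n) ∷ v)
           (λ { zero → sym (trans (ℕₚ.⊔-assoc c n n) (cong (c ⊔_) (ℕₚ.⊔-idem n))) ; (suc i) → refl })))) ⟩
    ∑ cs (λ c → f' 0 c * H c)
      ≈⟨ ≈-sym (expand f') ⟩
    ∑ (vecs (suc N)) (λ κ → ∏ (upTo (suc N)) (λ i → f' i (ent κ i)) * Ψ κ) ∎
    where
    H : ℕ → Carrier
    H c = ∑ (vecs N) (λ v → ∏ (upTo N) (λ i → f' (suc i) (ent v i)) * Ψ (c ∷ v))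
    expand : ∀ f → ∑ (vecs (suc N)) (λ κ → ∏ (upTo (suc N)) (λ i → f i (ent κ i)) * Ψ κ) ≈
      ∑ cs (λ c → f 0 c * ∑ (vecs N) (λ v → ∏ (upTo N) (λ i → f (suc i) (ent v i)) * Ψ (c ∷ v)))
    expand f = ≈-trans (∑-vecs N _) (∑-cong cs (λ c → ≈-trans (∑-cong (vecs N) (λ v →
      ≈-trans (*-congʳ (∏-upTo-suc N (λ i → f i (ent (c ∷ v) i)))) (*-assoc _ _ _))) (∑-*ˡ (vecs N) _ _)))

  -- `f n` is the row factor of `Hor`, which ignores the inner end `n` of the row, times the
  -- correction `(- v)^(n - c)`; `f' n` comes from peeling the tableau, where a corner counts only
  -- if it lies beyond `n`. The two agree for `c > n`, and all `c ≤ n` together amount to the one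
  -- term `c = n` of `f'`.
  module RowCollapse (x v : Carrier) (m l : ℕ) (c₀≤m : c₀ ≤ m) (m≤l : m ≤ l) where
    d : Carrier
    d = - v

    f : ℕ → ℕ → Carrier
    f n c = (hfac x l c * cap x v m c) * d ^ (n ∸ c)

    v+d : v + d ≈ 0#
    v+d = -‿inverseʳ v

    -- The corner term at `c` is `v x^(l - c + 1) (- v)^(n - c)` and cancels the leading term at
    -- `c - 1`. What remains is the leading term at the largest admissible `c`, that is at `n` or,
    -- if smaller, at `l`.
    telescope : ∀ n → c₀ ≤ n → ∑ (range c₀ n) (f n) ≈ d ^ (n ∸ l) * (⟦ m ≤ᵇ n ⟧ * x ^ (l ∸ n))
    -- At the lower end of the range there is no corner term left to cancel, because `c₀ ≤ m`.
    first-sum : ∑ (range c₀ c₀) (f c₀) ≈ d ^ (c₀ ∸ l) * (⟦ m ≤ᵇ c₀ ⟧ * x ^ (l ∸ c₀))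
    first-sum rewrite ℕₚ.m≤n⇒m∸n≡0 {c₀} {l} (≤-trans c₀≤m m≤l) | ℕₚ.+-∸-assoc 1 (≤-refl {c₀}) | ℕₚ.n∸n≡0 c₀ | ℕₚ.+-identityʳ c₀ | ℕₚ.n∸n≡0 c₀ | <ᵇ-no c₀≤m =
      ≈-trans (+-congʳ (*-congʳ (*-congʳ (hfac-yes x (≤-trans c₀≤m m≤l)))))
        (solve 3 (λ e p w → (e :* (p :* (con 1 :+ con 0 :* w))) :* con 1 :+ con 0 := con 1 :* (p :* e)) ≈-refl _ _ _)
    telescope zero    p with refl ← ℕₚ.n≤0⇒n≡0 p = first-sum
    telescope (suc n) p with ℕₚ.m≤n⇒m<n∨m≡n p
    ... | inj₂ refl = first-sum
    ... | inj₁ (s≤s q) rewrite range-∷ʳ {c₀} {n} p = ≈-trans (∑-++ (range c₀ n) _ (f (suc n)))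
        (≈-trans (+-cong prev (+-identityʳ _)) (step (suc n ℕₚ.≤? l)))
      where
      prev : ∑ (range c₀ n) (f (suc n)) ≈ d * (d ^ (n ∸ l) * (⟦ m ≤ᵇ n ⟧ * x ^ (l ∸ n)))
      prev = ≈-trans (∑-cong∈ (range c₀ n) (λ c c∈ → ≈-trans
          (*-congˡ (≈-reflexive (cong (d ^_) (ℕₚ.+-∸-assoc 1 (proj₂ (∈-range⁻ c₀ n c∈))))))
          (solve 3 (λ a d e → a :* (d :* e) := d :* (a :* e)) ≈-refl _ d _)))
        (≈-trans (∑-*ˡ (range c₀ n) d (f n)) (*-congˡ (telescope n q)))
      m<sn : ⟦ m <ᵇ suc n ⟧ ≈ ⟦ m ≤ᵇ n ⟧
      m<sn = ≈-reflexive (cong ⟦_⟧ (T-ext (λ t → ≤⇒≤ᵇ (ℕₚ.≤-pred (<ᵇ⇒< m (suc n) t))) (λ t → <⇒<ᵇ (s≤s (≤ᵇ⇒≤ m n t)))))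
      absorb : ⟦ m ≤ᵇ suc n ⟧ * ⟦ m ≤ᵇ n ⟧ ≈ ⟦ m ≤ᵇ n ⟧
      absorb with m ℕₚ.≤? n
      ... | yes r rewrite ≤ᵇ-yes r | ≤ᵇ-yes (ℕₚ.m≤n⇒m≤1+n r) = *-identityˡ _
      ... | no nr rewrite ≤ᵇ-no (ℕₚ.≰⇒> nr) = zeroʳ _
      step : Dec (suc n ≤ l) →
        d * (d ^ (n ∸ l) * (⟦ m ≤ᵇ n ⟧ * x ^ (l ∸ n))) + f (suc n) (suc n)
        ≈ d ^ (suc n ∸ l) * (⟦ m ≤ᵇ suc n ⟧ * x ^ (l ∸ suc n))
      step (yes r) rewrite ℕₚ.m≤n⇒m∸n≡0 {n} {l} (ℕₚ.<⇒≤ r) | ℕₚ.m≤n⇒m∸n≡0 {suc n} {l} r | ℕₚ.n∸n≡0 n = begin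
        d * (1# * (⟦ m ≤ᵇ n ⟧ * x ^ (l ∸ n))) + (hfac x l (suc n) * cap x v m (suc n)) * 1#
          ≈⟨ +-cong (*-congˡ (*-congˡ (*-congˡ (≈-reflexive (cong (x ^_) (ℕₚ.+-∸-assoc 1 r))))))
               (*-congʳ (*-cong (hfac-yes x r) (*-congˡ (+-congˡ (*-congʳ m<sn))))) ⟩
        d * (1# * (⟦ m ≤ᵇ n ⟧ * (x * e))) + (e * (⟦ m ≤ᵇ suc n ⟧ * (1# + ⟦ m ≤ᵇ n ⟧ * (v * x)))) * 1#
          ≈⟨ solve 6 (λ d q x e p v → d :* (con 1 :* (q :* (x :* e))) :+ (e :* (p :* (con 1 :+ q :* (v :* x)))) :* con 1
               := p :* e :+ (d :* q :+ v :* (p :* q)) :* (x :* e)) ≈-refl d ⟦ m ≤ᵇ n ⟧ x e ⟦ m ≤ᵇ suc n ⟧ v ⟩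
        ⟦ m ≤ᵇ suc n ⟧ * e + (d * ⟦ m ≤ᵇ n ⟧ + v * (⟦ m ≤ᵇ suc n ⟧ * ⟦ m ≤ᵇ n ⟧)) * (x * e)
          ≈⟨ +-congˡ (*-congʳ (≈-trans (+-congˡ (*-congˡ absorb)) (≈-trans (solve 3 (λ d v q → d :* q :+ v :* q := (v :+ d) :* q) ≈-refl d v _)
               (≈-trans (*-congʳ v+d) (zeroˡ _))))) ⟩
        ⟦ m ≤ᵇ suc n ⟧ * e + 0# * (x * e)
          ≈⟨ solve 3 (λ p e x → p :* e :+ con 0 :* (x :* e) := con 1 :* (p :* e)) ≈-refl _ e x ⟩
        1# * (⟦ m ≤ᵇ suc n ⟧ * e) ∎
        where e = x ^ (l ∸ suc n)
      step (no nr) = ≈-trans (+-congˡ (0*≈ (0*≈ (hfac-no x (ℕₚ.≰⇒> nr))))) (≈-trans (+-identityʳ _) (past (ℕₚ.≤-pred (ℕₚ.≰⇒> nr))))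
        where
        past : l ≤ n → d * (d ^ (n ∸ l) * (⟦ m ≤ᵇ n ⟧ * x ^ (l ∸ n))) ≈ d ^ (suc n ∸ l) * (⟦ m ≤ᵇ suc n ⟧ * x ^ (l ∸ suc n))
        past l≤n rewrite ℕₚ.m≤n⇒m∸n≡0 {l} {n} l≤n | ℕₚ.m≤n⇒m∸n≡0 {l} {suc n} (ℕₚ.m≤n⇒m≤1+n l≤n) | ℕₚ.+-∸-assoc 1 l≤n
          | ≤ᵇ-yes (≤-trans m≤l l≤n) | ≤ᵇ-yes (≤-trans m≤l (ℕₚ.m≤n⇒m≤1+n l≤n)) = ≈-sym (*-assoc _ _ _)

    f' : ℕ → ℕ → Carrier
    f' n c = (d ^ (n ∸ l) * ⟦ ((n ≤ᵇ c) ∧ (c ≤ᵇ (n ⊔ l))) ∧ (m ≤ᵇ c) ⟧) * (x ^ (l ∸ c) * (⟦ (n <ᵇ c) ∧ (m <ᵇ c) ⟧ * (v * x) + 1#))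

    collapse : ∀ n → c₀ ≤ n → n ≤ C → ∀ (h : ℕ → Carrier) → (∀ c → h c ≈ h (c ⊔ n)) → ∑ cs (λ c → f n c * h c) ≈ ∑ cs (λ c → f' n c * h c)
    collapse n c₀≤n n≤C h inv = begin
      ∑ cs (λ c → f n c * h c)
        ≈⟨ split (λ c → f n c * h c) ⟩
      ∑ (range c₀ n) (λ c → f n c * h c) + ∑ (range (suc n) C) (λ c → f n c * h c)
        ≈⟨ +-cong (≈-trans (∑-cong∈ (range c₀ n) (λ c c∈ → *-congˡ (≈-trans (inv c) (≈-reflexive (cong h (ℕₚ.m≤n⇒m⊔n≡n (proj₂ (∈-range⁻ c₀ n c∈))))))))
                    (≈-trans (∑-*ʳ (range c₀ n) (h n) (f n)) (≈-trans (*-congʳ (telescope n c₀≤n)) (≈-sym low))))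
                  (∑-cong∈ (range (suc n) C) (λ c c∈ → *-congʳ (high c (proj₁ (∈-range⁻ (suc n) C c∈))))) ⟩
      ∑ (range c₀ n) (λ c → f' n c * h c) + ∑ (range (suc n) C) (λ c → f' n c * h c)
        ≈⟨ ≈-sym (split (λ c → f' n c * h c)) ⟩
      ∑ cs (λ c → f' n c * h c) ∎
      where
      split : ∀ F → ∑ cs F ≈ ∑ (range c₀ n) F + ∑ (range (suc n) C) F
      split F = ≈-trans (∑-↭ F (range-split (ℕₚ.m≤n⇒m≤1+n c₀≤n) n≤C)) (∑-++ (range c₀ n) (range (suc n) C) F)

      low : ∑ (range c₀ n) (λ c → f' n c * h c) ≈ (d ^ (n ∸ l) * (⟦ m ≤ᵇ n ⟧ * x ^ (l ∸ n))) * h n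
      low = ≈-trans (∑-cong∈ (range c₀ n) (λ c c∈ → lem c (proj₂ (∈-range⁻ c₀ n c∈))))
        (∑-delta (range c₀ n) n (λ c → (d ^ (n ∸ l) * (⟦ m ≤ᵇ c ⟧ * x ^ (l ∸ c))) * h c) (range-unique c₀ n) (∈-range⁺ c₀≤n ≤-refl))
        where
        lem : ∀ c → c ≤ n → f' n c * h c ≈ ⟦ n ≡ᵇ c ⟧ * ((d ^ (n ∸ l) * (⟦ m ≤ᵇ c ⟧ * x ^ (l ∸ c))) * h c)
        lem c c≤n with ℕₚ.m≤n⇒m<n∨m≡n c≤n
        ... | inj₁ c<n rewrite ≤ᵇ-no c<n | ≡ᵇ-no {n} {c} (λ { refl → ℕₚ.n≮n c c<n }) = ≈-trans (0*≈ (0*≈ (zeroʳ _))) (≈-sym (zeroˡ _))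
        ... | inj₂ refl rewrite ≤ᵇ-yes (≤-refl {c}) | ≤ᵇ-yes (ℕₚ.m≤m⊔n c l) | <ᵇ-no (≤-refl {c}) | ≡ᵇ-refl c =
          solve 5 (λ d p e w h → ((d :* p) :* (e :* (con 0 :* w :+ con 1))) :* h := con 1 :* ((d :* (p :* e)) :* h)) ≈-refl _ _ _ (v * x) _

      high : ∀ c → n < c → f n c ≈ f' n c
      high c n<c with c ℕₚ.≤? l
      ... | no np rewrite ≤ᵇ-yes (ℕₚ.<⇒≤ n<c) | ≤ᵇ-no {c} {n ⊔ l} (ℕₚ.⊔-pres-<m n<c (ℕₚ.≰⇒> np)) =
        ≈-trans (0*≈ (0*≈ (hfac-no x (ℕₚ.≰⇒> np)))) (≈-sym (0*≈ (zeroʳ _)))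
      ... | yes c≤l rewrite ≤ᵇ-yes (ℕₚ.<⇒≤ n<c) | ≤ᵇ-yes (≤-trans c≤l (ℕₚ.m≤n⊔m n l)) | <ᵇ-yes n<c
                          | ℕₚ.m≤n⇒m∸n≡0 {n} {c} (ℕₚ.<⇒≤ n<c) | ℕₚ.m≤n⇒m∸n≡0 {n} {l} (≤-trans (ℕₚ.<⇒≤ n<c) c≤l) =
        ≈-trans (*-congʳ (*-congʳ (hfac-yes x c≤l)))
          (solve 4 (λ e p q w → (e :* (p :* (con 1 :+ q :* w))) :* con 1 := (con 1 :* p) :* (e :* (q :* w :+ con 1))) ≈-refl _ _ _ _)

  -- Without labels only the empty shape has a tableau. In that case `ls` lies below `ns` in every
  -- row and the given powers are the entry of `Dif`; otherwise both sides vanish.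
  tableaux-[] : ∀ {N ρ κ v g} (bs : List Box) (ls ns : Vec ℕ N) → Rep bs ls ns →
    ∏ (upTo N) (λ i → (- v (suc i)) ^ (ent ns i ∸ ent ls i)) * tableaux ρ κ v g bs [] ≈ Dif (neg (v ∘ suc)) ls ns
  tableaux-[] {N} {v = v} [] ls ns rep = ≈-trans (≈-trans (*-congˡ (≈-trans (+-identityʳ _) (*-identityˡ _))) (*-identityʳ _))
    (≈-trans (∏-cong∈ (upTo N) (λ i _ → ≈-sym (hfac-yes _ (le i)))) (≈-sym (Dif-∏ (neg (v ∘ suc)) ls ns)))
    where
    le : ∀ i → ent ls i ≤ ent ns i
    le i with ent ls i ℕₚ.≤? ent ns i
    ... | yes p = p
    ... | no np with () ← Rep.member rep (ℕₚ.≰⇒> np) ≤-refl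
  tableaux-[] {v = v} ((zero , j) ∷ bs)  ls ns rep = ⊥-elim (Rep.row≢0 rep (here refl))
  tableaux-[] {v = v} ((suc i , j) ∷ bs) ls ns rep with Dif-supp (neg (v ∘ suc)) ls ns
  ... | inj₂ z  = ≈-trans (zeroʳ _) (≈-sym z)
  ... | inj₁ le = let (p , q) = Rep.inside rep (here refl) in ⊥-elim (<⇒≱ p (≤-trans q (le i)))

  module _ {N} (ls ns : Vec ℕ N) (pl : Par C ls) (pn : Par C ns) (bs : List Box) (rep : Rep bs ls ns) where
    open Rep rep

    horizontalᵇ : Vec ℕ N → ℕ → Bool
    horizontalᵇ κ i = ((ent ns i ≤ᵇ ent κ i) ∧ (ent κ i ≤ᵇ (ent ns i ⊔ ent ls i))) ∧ (ent ls (suc i) ≤ᵇ ent κ i)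

    horizontal⁻ : ∀ κ → T (allI N (horizontalᵇ κ)) → T (betweenᵇ ls ns κ) × (∀ i → i < N → ent ls (suc i) ≤ ent κ i)
    horizontal⁻ κ t = T-allI⁺ N _ (λ i p → proj₁ (T-∧⁻ (T-allI⁻ N _ t i p)))
      , λ i p → ≤ᵇ⇒≤ _ _ (proj₂ (T-∧⁻ {(ent ns i ≤ᵇ ent κ i) ∧ (ent κ i ≤ᵇ (ent ns i ⊔ ent ls i))} (T-allI⁻ N _ t i p)))

    -- New boxes must not repeat in a column. For the strip condition it is enough to look at the
    -- last box of a row of `ls` and the box above it.
    between-horizontal : ∀ κ →
      betweenᵇ ls ns κ ∧ pairwiseᵇ (compat (may true) (may false)) (withFlags (below κ) bs) ≡ allI N (horizontalᵇ κ)
    between-horizontal κ = T-ext to from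
      where
      to : T (betweenᵇ ls ns κ ∧ pairwiseᵇ (compat (may true) (may false)) (withFlags (below κ) bs)) → T (allI N (horizontalᵇ κ))
      to t with bt , pw ← T-∧⁻ {betweenᵇ ls ns κ} t =
        T-allI⁺ N _ (λ i p → T-∧⁺ (T-allI⁻ N _ bt i p) (≤⇒≤ᵇ (strip i p)))
        where
        strip : ∀ i → i < N → ent ls (suc i) ≤ ent κ i
        strip i i<N with ent ls (suc i) ℕₚ.≤? ent κ i
        ... | yes p = p
        ... | no np = ⊥-elim (no-way (below κ (suc (suc i) , j)) (subst (λ z → T (may false z (below κ (suc (suc i) , j)))) (≤ᵇ-no (ℕₚ.≰⇒> np))
            (proj₂ (T-pairwise-withFlags⁻ (below κ) bs pw (suc i , j) (suc (suc i) , j)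
              (member n<j (ent-anti pl (ℕₚ.n≤1+n i))) (member (ℕₚ.≤-<-trans (ent-anti pn (ℕₚ.n≤1+n i)) n<j) ≤-refl)) (sameCol⁺ {suc i} {suc (suc i)} {j} (ℕₚ.n<1+n _)))))
          where
          j = ent ls (suc i)
          n<j : ent ns i < j
          n<j = ℕₚ.≤-<-trans (proj₁ (between⁻ ls ns κ bt i i<N)) (ℕₚ.≰⇒> np)
          no-way : ∀ y → T (may false false y) → ⊥
          no-way true  ()
          no-way false ()
      from : T (allI N (horizontalᵇ κ)) → T (betweenᵇ ls ns κ ∧ pairwiseᵇ (compat (may true) (may false)) (withFlags (below κ) bs))
      from t with bt , strip ← horizontal⁻ κ t = T-∧⁺ bt (T-pairwise-withFlags⁺ (below κ) bs pairs)
        where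
        pairs : ∀ a b → a ∈ bs → b ∈ bs → (T (sameRowLeftOf a b) → T (may true (below κ a) (below κ b))) ×
          (T (sameColAbove a b) → T (may false (below κ a) (below κ b)))
        pairs (zero , _) _ a∈ _ = ⊥-elim (row≢0 a∈)
        pairs (suc i , j) (zero , _) _ b∈ = ⊥-elim (row≢0 b∈)
        pairs (suc i , j) (suc i' , j') a∈ b∈ = rows , cols
          where
          rows : T (sameRowLeftOf (suc i , j) (suc i' , j')) → T (may true (j ≤ᵇ ent κ i) (j' ≤ᵇ ent κ i'))
          rows s with refl , j<j' ← sameRow⁻ {suc i} {j} {suc i'} {j'} s with j ℕₚ.≤? ent κ i
          ... | yes p rewrite ≤ᵇ-yes p = _
          ... | no np rewrite ≤ᵇ-no (ℕₚ.≰⇒> np) | ≤ᵇ-no {j'} (ℕₚ.<-trans (ℕₚ.≰⇒> np) j<j') = _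
          cols : T (sameColAbove (suc i , j) (suc i' , j')) → T (may false (j ≤ᵇ ent κ i) (j' ≤ᵇ ent κ i'))
          cols s with refl , s≤s i<i' ← sameCol⁻ {suc i} {j} {suc i'} {j'} s
            rewrite ≤ᵇ-yes (≤-trans (proj₂ (inside b∈)) (≤-trans (ent-anti pl i<i') (strip i (row< a∈)))) = _

    -- An old box to the right would have to hold labels of at least `l`, and any box below would
    -- have to exceed `l`. Neither is possible, so the label fits exactly into the corners that
    -- `cap` counts.
    eligible : ∀ κ → T (allI N (horizontalᵇ κ)) → ∀ i j → i < N → ent ns i < j → j ≤ ent κ i →
      all (compat (may true) (may false) ((suc i , j) , false)) (withFlags (below κ) bs) ≡ (j ≡ᵇ ent κ i) ∧ (ent ls (suc i) <ᵇ ent κ i)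
    eligible κ t i j i<N n<j j≤k with bt , strip ← horizontal⁻ κ t = T-ext to from
      where
      a : Box
      a = suc i , j
      use : T (all (compat (may true) (may false) (a , false)) (withFlags (below κ) bs)) → ∀ b → b ∈ bs →
        (T (sameRowLeftOf a b) → T (may true false (below κ b))) × (T (sameColAbove a b) → T (may false false (below κ b)))
      use s b b∈ with p , q ← T-∧⁻ {sameRowLeftOf a b ⇒ᵇ may true false (below κ b)} (T-all⁻ _ (withFlags (below κ) bs) s (b , below κ b) (∈-map⁺ _ b∈)) = T-⇒⁻ p , T-⇒⁻ q
      to : T (all (compat (may true) (may false) (a , false)) (withFlags (below κ) bs)) → T ((j ≡ᵇ ent κ i) ∧ (ent ls (suc i) <ᵇ ent κ i))
      to s = T-∧⁺ (≡⇒≡ᵇ _ _ last) (<⇒<ᵇ corner)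
        where
        last : j ≡ ent κ i
        last with ℕₚ.m≤n⇒m<n∨m≡n j≤k
        ... | inj₂ e = e
        ... | inj₁ j<k with () ← subst (T ∘ may true false) (≤ᵇ-yes (≤-refl {ent κ i}))
              (proj₁ (use s (suc i , ent κ i) (member (ℕₚ.<-trans n<j j<k) (<⊔⇒≤ʳ (ℕₚ.<-trans n<j j<k) ≤-refl (proj₂ (between⁻ ls ns κ bt i i<N))))) (sameRow⁺ {suc i} j<k))
        corner : ent ls (suc i) < ent κ i
        corner with ent ls (suc i) ℕₚ.<? ent κ i
        ... | yes p = p
        ... | no np = ⊥-elim (no-way (below κ (suc (suc i) , j)) (proj₂ (use s (suc (suc i) , j)
              (member (ℕₚ.≤-<-trans (ent-anti pn (ℕₚ.n≤1+n i)) n<j) (≤-trans j≤k (ℕₚ.≮⇒≥ np)))) (sameCol⁺ {suc i} {suc (suc i)} {j} (ℕₚ.n<1+n _))))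
          where
          no-way : ∀ y → T (may false false y) → ⊥
          no-way true  ()
          no-way false ()
      from : T ((j ≡ᵇ ent κ i) ∧ (ent ls (suc i) <ᵇ ent κ i)) → T (all (compat (may true) (may false) (a , false)) (withFlags (below κ) bs))
      from s with e , r ← T-∧⁻ {j ≡ᵇ ent κ i} s = T-all⁺ _ (withFlags (below κ) bs) (λ p p∈ → lem p (∈-map⁻ _ p∈))
        where
        lem : ∀ p → ∃[ b ] b ∈ bs × p ≡ (b , below κ b) → T (compat (may true) (may false) (a , false) p)
        lem _ ((zero , _) , b∈ , refl) = ⊥-elim (row≢0 b∈)
        lem _ ((suc i' , j') , b∈ , refl) = T-∧⁺ (T-⇒⁺ (sameRowLeftOf a (suc i' , j')) rows) (T-⇒⁺ (sameColAbove a (suc i' , j')) cols)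
          where
          rows : T (sameRowLeftOf a (suc i' , j')) → T (may true false (j' ≤ᵇ ent κ i'))
          rows s with refl , j<j' ← sameRow⁻ {suc i} {j} {suc i'} {j'} s
            rewrite ≤ᵇ-no {j'} (subst (_< j') (≡ᵇ⇒≡ j _ e) j<j') = _
          cols : T (sameColAbove a (suc i' , j')) → T (may false false (j' ≤ᵇ ent κ i'))
          cols s with refl , s≤s i<i' ← sameCol⁻ {suc i} {j} {suc i'} {j'} s =
            ⊥-elim (<⇒≱ (<ᵇ⇒< _ _ r) (subst (_≤ ent ls (suc i)) (≡ᵇ⇒≡ j _ e) (≤-trans (proj₂ (inside b∈)) (ent-anti pl i<i'))))

  ∏-range-last : ∀ z n k b → ∏ (range (suc n) k) (λ j → ⟦ (j ≡ᵇ k) ∧ b ⟧ * z + 1#) ≈ ⟦ (n <ᵇ k) ∧ b ⟧ * z + 1#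
  ∏-range-last z n k b with n ℕₚ.<? k
  ... | no np rewrite range-empty {suc n} {k} (s≤s (ℕₚ.≮⇒≥ np)) | <ᵇ-no (ℕₚ.≮⇒≥ np) = ≈-sym (≈-trans (+-congʳ (zeroˡ _)) (+-identityˡ _))
  ∏-range-last z n (suc k) b | yes n<k rewrite range-∷ʳ {suc n} {k} n<k | <ᵇ-yes n<k = ≈-trans (∏-++ (range (suc n) k) _ _)
    (≈-trans (*-cong (∏-one (range (suc n) k) one) (≈-trans (*-identityʳ _) (≈-reflexive (cong (λ e → ⟦ e ∧ b ⟧ * z + 1#) (≡ᵇ-refl k))))) (*-identityˡ _))
    where
    one : ∀ j → j ∈ range (suc n) k → ⟦ (j ≡ᵇ suc k) ∧ b ⟧ * z + 1# ≈ 1#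
    one j j∈ rewrite ≡ᵇ-no {j} {suc k} (λ { refl → ℕₚ.n≮n k (proj₂ (∈-range⁻ (suc n) k j∈)) }) = ≈-trans (+-congʳ (zeroˡ _)) (+-identityˡ _)

  tableaux-step : ∀ {N ρ κ l labs r c} v g (ls ns : Vec ℕ N) → Par C ls → Par C ns → (bs : List Box) → Rep bs ls ns →
    Peelable ρ l labs r → Peelable κ l labs c →
    tableaux ρ κ v g bs (l ∷ labs) ≈ ∑ (vecs N) (λ q →
      ⟦ betweenᵇ ls ns q ∧ pairwiseᵇ (compat (may r) (may c)) (withFlags (below q) bs) ⟧ *
      ((∏ (upTo N) (λ i → g l (suc i) ^ (ent ls i ∸ ent q i)) *
        ∏ (filterᵇ (below q) bs) (λ b → ⟦ all (compat (may r) (may c) (b , false)) (withFlags (below q) bs) ⟧ * (v (row b) * g l (row b)) + 1#))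
       * tableaux ρ κ v g (filterᵇ (below q) bs) labs))
  tableaux-step {N} {ρ} {κ} {l} {labs} {r} {c} v g ls ns pl pn bs rep pρ pκ = begin
    tableaux ρ κ v g bs (l ∷ labs)
      ≈⟨ tableaux-peel v g bs pρ pκ ⟩
    ∑ (fillings bs (λ _ → bools)) (λ χ → ⟦ pairwiseᵇ (compat (may r) (may c)) χ ⟧ * G χ)
      ≈⟨ ∑-flags bs ls ns r c G rep pl pn ⟩
    ∑ (vecs N) (λ q → ⟦ betweenᵇ ls ns q ∧ pairwiseᵇ (compat (may r) (may c)) (withFlags (below q) bs) ⟧ * G (withFlags (below q) bs))
      ≈⟨ ∑-cong (vecs N) term ⟩
    _ ∎
    where
    M : Filling Bool → List Box → Carrier
    M χ os = ∏ os (λ b → ⟦ all (compat (may r) (may c) (b , false)) χ ⟧ * (v (row b) * g l (row b)) + 1#)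
    G : Filling Bool → Carrier
    G χ = (∏ χ (λ p → if proj₂ p then 1# else g l (row (proj₁ p))) * M χ (oldBoxes χ)) * tableaux ρ κ v g (oldBoxes χ) labs
    term : ∀ q → ⟦ betweenᵇ ls ns q ∧ pairwiseᵇ (compat (may r) (may c)) (withFlags (below q) bs) ⟧ * G (withFlags (below q) bs) ≈
      ⟦ betweenᵇ ls ns q ∧ pairwiseᵇ (compat (may r) (may c)) (withFlags (below q) bs) ⟧ *
      ((∏ (upTo N) (λ i → g l (suc i) ^ (ent ls i ∸ ent q i)) * M (withFlags (below q) bs) (filterᵇ (below q) bs))
       * tableaux ρ κ v g (filterᵇ (below q) bs) labs)
    term q rewrite oldBoxes-withFlags (below q) bs with T? (betweenᵇ ls ns q)
    ... | yes t = *-congˡ (*-congʳ (*-congʳ (∏-new q (g l) rep t)))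
    ... | no nt rewrite ¬T⇒false nt = ≈-trans (zeroˡ _) (≈-sym (zeroˡ _))

  tableaux-horizontal : ∀ {N ρ κ l labs} v g (ls ns : Vec ℕ N) (pl : Par C ls) (pn : Par C ns) (bs : List Box) (rep : Rep bs ls ns) →
    Peelable ρ l labs true → Peelable κ l labs false →
    tableaux ρ κ v g bs (l ∷ labs) ≈ ∑ (vecs N) (λ q → ⟦ allI N (horizontalᵇ ls ns pl pn bs rep q) ⟧ *
      (∏ (upTo N) (λ i → g l (suc i) ^ (ent ls i ∸ ent q i) *
         (⟦ (ent ns i <ᵇ ent q i) ∧ (ent ls (suc i) <ᵇ ent q i) ⟧ * (v (suc i) * g l (suc i)) + 1#))
       * tableaux ρ κ v g (filterᵇ (below q) bs) labs))
  tableaux-horizontal {N} {ρ} {κ} {l} {labs} v g ls ns pl pn bs rep pρ pκ =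
    ≈-trans (tableaux-step v g ls ns pl pn bs rep pρ pκ) (∑-cong (vecs N) term)
    where
    hor : Vec ℕ N → Bool
    hor q = allI N (horizontalᵇ ls ns pl pn bs rep q)
    M : Vec ℕ N → Carrier
    M q = ∏ (filterᵇ (below q) bs) (λ b → ⟦ all (compat (may true) (may false) (b , false)) (withFlags (below q) bs) ⟧ * (v (row b) * g l (row b)) + 1#)
    F : Vec ℕ N → ℕ → Carrier
    F q i = ⟦ (ent ns i <ᵇ ent q i) ∧ (ent ls (suc i) <ᵇ ent q i) ⟧ * (v (suc i) * g l (suc i)) + 1#
    corners : ∀ q → T (hor q) → M q ≈ ∏ (upTo N) (F q)
    corners q t = ≈-trans (∏-Rep (Rep-below q rep (λ i p → proj₂ (between⁻ ls ns q (proj₁ (horizontal⁻ ls ns pl pn bs rep q t)) i p))) _)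
      (∏-cong∈ (upTo N) (λ i i∈ → ≈-trans
        (∏-cong∈ (range (suc (ent ns i)) (ent q i)) (λ j j∈ → let (a , b) = ∈-range⁻ _ _ j∈ in
          +-congʳ (*-congʳ (≈-reflexive (cong ⟦_⟧ (eligible ls ns pl pn bs rep q t i j (∈-upTo⁻ i∈) a b))))))
        (∏-range-last _ (ent ns i) (ent q i) _)))
    term : ∀ q → ⟦ betweenᵇ ls ns q ∧ pairwiseᵇ (compat (may true) (may false)) (withFlags (below q) bs) ⟧ *
        ((∏ (upTo N) (λ i → g l (suc i) ^ (ent ls i ∸ ent q i)) * M q) * tableaux ρ κ v g (filterᵇ (below q) bs) labs)
      ≈ ⟦ hor q ⟧ * (∏ (upTo N) (λ i → g l (suc i) ^ (ent ls i ∸ ent q i) * F q i) * tableaux ρ κ v g (filterᵇ (below q) bs) labs)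
    term q = ≈-trans (*-congʳ (≈-reflexive (cong ⟦_⟧ (between-horizontal ls ns pl pn bs rep q)))) (go (T? (hor q)))
      where
      go : Dec (T (hor q)) → ⟦ hor q ⟧ * ((∏ (upTo N) (λ i → g l (suc i) ^ (ent ls i ∸ ent q i)) * M q) * tableaux ρ κ v g (filterᵇ (below q) bs) labs)
        ≈ ⟦ hor q ⟧ * (∏ (upTo N) (λ i → g l (suc i) ^ (ent ls i ∸ ent q i) * F q i) * tableaux ρ κ v g (filterᵇ (below q) bs) labs)
      go (yes t) = *-congˡ (*-congʳ (≈-trans (*-congˡ (corners q t)) (≈-sym (∏-* (upTo N) _ _))))
      go (no nt) = ≈-trans (0*≈ z) (≈-sym (0*≈ z))
        where
        z : ⟦ hor q ⟧ ≈ 0#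
        z = ≈-reflexive (cong ⟦_⟧ (¬T⇒false nt))

  filter-below-cong : ∀ {N bs} {ls ns : Vec ℕ N} → Rep bs ls ns → ∀ (κ κ' : Vec ℕ N) →
    (∀ i → ent κ i ⊔ ent ns i ≡ ent κ' i ⊔ ent ns i) → filterᵇ (below κ) bs ≡ filterᵇ (below κ') bs
  filter-below-cong {bs = bs} {ls} {ns} rep κ κ' e = filterᵇ-cong bs lem
    where
    half : ∀ {a b n j} → n < j → a ⊔ n ≡ b ⊔ n → T (j ≤ᵇ a) → T (j ≤ᵇ b)
    half {a} {b} {n} {j} p q t = ≤⇒≤ᵇ (<⊔⇒≤ʳ p (≤-trans (≤ᵇ⇒≤ j a t) (ℕₚ.m≤m⊔n a n)) (ℕₚ.≤-reflexive (trans q (ℕₚ.⊔-comm b n))))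
    lem : ∀ b → b ∈ bs → below κ b ≡ below κ' b
    lem (zero , j)  b∈ = ⊥-elim (Rep.row≢0 rep b∈)
    lem (suc i , j) b∈ with p , _ ← Rep.inside rep b∈ = T-ext (half p (e i)) (half p (sym (e i)))

  -- The row lengths met in the recursion need not dominate ns; the powers of - v account for the defect.
  tableaux-Pow : ∀ {N ρ κ} v g labs → v 0 ≈ 0# → Peelables ρ true labs → Peelables κ false labs →
    (bs : List Box) (ls ns : Vec ℕ N) → Par C ls → Par C ns → Rep bs ls ns →
    ∏ (upTo N) (λ i → (- v (suc i)) ^ (ent ns i ∸ ent ls i)) * tableaux ρ κ v g bs labs ≈ Pow v (map g labs) ls ns
  tableaux-Pow v g [] v0 [] [] bs ls ns pl pn rep = tableaux-[] bs ls ns rep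
  tableaux-Pow {N} {ρ} {κ} v g (l ∷ labs) v0 (pρ ∷ psρ) (pκ ∷ psκ) bs ls ns pl pn rep = begin
    E ls * tableaux ρ κ v g bs (l ∷ labs)
      ≈⟨ *-congˡ (tableaux-horizontal v g ls ns pl pn bs rep pρ pκ) ⟩
    E ls * ∑ (vecs N) (λ q → ⟦ allI N (horizontalᵇ ls ns pl pn bs rep q) ⟧ * (∏ (upTo N) (λ i → w q i) * Ψ q))
      ≈⟨ ≈-sym (∑-*ˡ (vecs N) _ _) ⟩
    ∑ (vecs N) (λ q → E ls * (⟦ allI N (horizontalᵇ ls ns pl pn bs rep q) ⟧ * (∏ (upTo N) (λ i → w q i) * Ψ q)))
      ≈⟨ ∑-cong (vecs N) (λ q → ≈-trans (*-congˡ (*-congʳ (⟦all⟧ (horizontalᵇ ls ns pl pn bs rep q) (upTo N))))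
           (≈-trans (solve 4 (λ a b c d → a :* (b :* (c :* d)) := ((a :* b) :* c) :* d) ≈-refl _ _ _ _)
             (*-congʳ (≈-sym (≈-trans (∏-* (upTo N) _ _) (*-congʳ (∏-* (upTo N) _ _))))))) ⟩
    ∑ (vecs N) (λ q → ∏ (upTo N) (λ i → RC.f' i (ent ns i) (ent q i)) * Ψ q)
      -- The smaller tableau in `Ψ` consists of boxes beyond `ns` only. So the factors of the peeled
      -- tableau may be replaced by those of `Hor`, which admit rows shorter than `ns`.
      ≈⟨ ≈-sym (∑-collapse ns (λ i → RC.f i (ent ns i)) (λ i → RC.f' i (ent ns i)) Ψ
           (λ i _ → RC.collapse i (ent ns i) (ent≥c₀ pn i) (ent≤ pn i))
           (λ q q' e → ≈-reflexive (cong (λ z → tableaux ρ κ v g z labs) (filter-below-cong rep q q' e)))) ⟩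
    ∑ (vecs N) (λ q → ∏ (upTo N) (λ i → RC.f i (ent ns i) (ent q i)) * Ψ q)
      ≈⟨ ∑-cong (vecs N) (λ q → ≈-trans (*-congʳ (≈-trans (∏-* (upTo N) _ _) (*-congʳ (≈-sym (Hor≈ q))))) (*-assoc _ _ _)) ⟩
    ∑ (vecs N) (λ q → Hor (g l) v C ls q * (E q * Ψ q))
      ≈⟨ ≈-sym (∑-pars N supp) ⟩
    ∑ (pars N) (λ q → Hor (g l) v C ls q * (E q * Ψ q))
      ≈⟨ ∑-cong∈ (pars N) rec ⟩
    ∑ (pars N) (λ q → Hor (g l) v C ls q * Pow v (map g labs) q ns) ∎
    where
    E : Vec ℕ N → Carrier
    E q = ∏ (upTo N) (λ i → (- v (suc i)) ^ (ent ns i ∸ ent q i))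
    Ψ : Vec ℕ N → Carrier
    Ψ q = tableaux ρ κ v g (filterᵇ (below q) bs) labs
    w : Vec ℕ N → ℕ → Carrier
    w q i = g l (suc i) ^ (ent ls i ∸ ent q i) *
      (⟦ (ent ns i <ᵇ ent q i) ∧ (ent ls (suc i) <ᵇ ent q i) ⟧ * (v (suc i) * g l (suc i)) + 1#)
    module RC (i : ℕ) = RowCollapse (g l (suc i)) (v (suc i)) (ent ls (suc i)) (ent ls i) (ent≥c₀ pl (suc i)) (ent-anti pl (ℕₚ.n≤1+n i))
    Hor≈ : ∀ q → Hor (g l) v C ls q ≈
      ∏ (upTo N) (λ i → hfac (g l (suc i)) (ent ls i) (ent q i) * cap (g l (suc i)) (v (suc i)) (ent ls (suc i)) (ent q i))
    Hor≈ q = ≈-trans (*-cong top (Hrows-∏ (g l ∘ suc) (v ∘ suc) ls q)) (*-identityˡ _)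
      where
      -- The row above is fictitious: it has full length `C`, and `v 0 ≈ 0#` removes its corner.
      top : cap (g l 0) (v 0) (hd ls) C ≈ 1#
      top rewrite ≤ᵇ-yes (Par-hd pl) = ≈-trans (*-identityˡ _) (≈-trans (+-congˡ (*0≈ (0*≈ v0))) (+-identityʳ _))
    supp : ∀ q → Par C q ⊎ Hor (g l) v C ls q * (E q * Ψ q) ≈ 0#
    supp q with Hor-supp (g l) v C ls q
    ... | inj₁ hs = inj₁ (HStrip⇒Parʳ hs)
    ... | inj₂ z  = inj₂ (0*≈ z)
    rec : ∀ q → q ∈ pars N → Hor (g l) v C ls q * (E q * Ψ q) ≈ Hor (g l) v C ls q * Pow v (map g labs) q ns
    rec q q∈ with Hor-supp (g l) v C ls q
    ... | inj₂ z  = ≈-trans (0*≈ z) (≈-sym (0*≈ z))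
    ... | inj₁ hs = *-congˡ (tableaux-Pow v g labs v0 psρ psκ (filterᵇ (below q) bs) q ns (proj₂ (∈-pars⁻ q∈)) pn
            (Rep-below q rep (λ i _ → ≤-trans (HStrip-ent≤ hs i) (ℕₚ.m≤n⊔m _ _))))

module VerticalChain {c ℓ} (R : CommutativeRing c ℓ) (c₀ C : ℕ) where
  open CommutativeRing R
    hiding (zero)
    renaming (refl to ≈-refl; sym to ≈-sym; trans to ≈-trans; reflexive to ≈-reflexive)
  open Sums R
  open Matrices R c₀ C
  open Commutation R c₀ C
  open Expansion R c₀ C
  open Peel R
  open Reindex R c₀ C
  open Chains R c₀ C
  open import Relation.Binary.Reasoning.Setoid setoid

  Par-ent : ∀ {N} a (κ : Vec ℕ N) → ent κ 0 ≤ a → (∀ i → ent κ (suc i) ≤ ent κ i) → Par a κ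
  Par-ent a []      p h = [] p
  Par-ent a (k ∷ κ) p h = p ∷ Par-ent k κ (h 0) (h ∘ suc)

  vfac-supp : ∀ y l l' → (l ≤ l' × l' ≤ suc l) ⊎ vfac y l l' ≈ 0#
  vfac-supp y l l' with l ℕₚ.≟ l' | suc l ℕₚ.≟ l'
  ... | yes refl | _        = inj₁ (≤-refl , ℕₚ.n≤1+n l)
  ... | no _     | yes refl = inj₁ (ℕₚ.n≤1+n l , ≤-refl)
  ... | no a     | no b rewrite ≡ᵇ-no a | ≡ᵇ-no b = inj₂ (≈-trans (+-identityˡ _) (zeroˡ _))

  vfac-yes : ∀ y l l' → l ≤ l' → l' ≤ suc l → vfac y l l' ≈ y ^ (l' ∸ l)
  vfac-yes y l l' p q with ℕₚ.m≤n⇒m<n∨m≡n p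
  ... | inj₂ refl rewrite ≡ᵇ-refl l | ≡ᵇ-no {suc l} {l} (λ ()) | ℕₚ.n∸n≡0 l = ≈-trans (+-congˡ (zeroˡ y)) (+-identityʳ 1#)
  ... | inj₁ r with refl ← ℕₚ.≤-antisym q r rewrite ≡ᵇ-no {l} {suc l} (λ ()) | ≡ᵇ-refl l | ℕₚ.+-∸-assoc 1 (≤-refl {l}) | ℕₚ.n∸n≡0 l =
    ≈-trans (+-identityˡ _) (*-comm _ _)

  Ver-supp : ∀ {N} y (κ ls : Vec ℕ N) → (∀ i → ent κ i ≤ ent ls i × ent ls i ≤ suc (ent κ i)) ⊎ Ver y κ ls ≈ 0#
  Ver-supp y [] [] = inj₁ (λ _ → ≤-refl , ℕₚ.n≤1+n c₀)
  Ver-supp y (k ∷ κ) (l ∷ ls) with vfac-supp (y 0) k l | Ver-supp (y ∘ suc) κ ls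
  ... | inj₂ z | _      = inj₂ (0*≈ z)
  ... | inj₁ _ | inj₂ z = inj₂ (*0≈ z)
  ... | inj₁ p | inj₁ q = inj₁ (λ { zero → p ; (suc i) → q i })

  Vpow-supp : ∀ {N} ys (ls ns : Vec ℕ N) → (∀ i → ent ns i ≤ ent ls i) ⊎ Vpow ys ls ns ≈ 0#
  Vpow-supp [] ls ns with Dif-δ-supp ls ns
  ... | inj₁ refl = inj₁ (λ _ → ≤-refl)
  ... | inj₂ z    = inj₂ z
  Vpow-supp {N} (y ∷ ys) ls ns with T? (allI N (λ i → ent ns i ≤ᵇ ent ls i))
  ... | yes t = inj₁ le
    where
    le : ∀ i → ent ns i ≤ ent ls i
    le i with i ℕₚ.<? N
    ... | yes p = ≤ᵇ⇒≤ _ _ (T-allI⁻ N _ t i p)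
    ... | no np rewrite ent-beyond ls i (ℕₚ.≮⇒≥ np) | ent-beyond ns i (ℕₚ.≮⇒≥ np) = ≤-refl
  ... | no nt = inj₂ (∑-zero (pars N) (λ κ _ → term κ))
    where
    term : ∀ κ → Ver y κ ls * Vpow ys κ ns ≈ 0#
    term κ with Ver-supp y κ ls | Vpow-supp ys κ ns
    ... | inj₂ z | _      = 0*≈ z
    ... | inj₁ _ | inj₂ z = *0≈ z
    ... | inj₁ p | inj₁ q = ⊥-elim (nt (T-allI⁺ N _ (λ i _ → ≤⇒≤ᵇ (≤-trans (q i) (proj₁ (p i))))))

  module _ {N} (ls ns : Vec ℕ N) (pl : Par C ls) (pn : Par C ns) (le : ∀ i → ent ns i ≤ ent ls i) (bs : List Box) (rep : Rep bs ls ns) where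
    open Rep rep

    verticalᵇ : Vec ℕ N → Bool
    verticalᵇ κ = betweenᵇ ls ns κ ∧ pairwiseᵇ (compat (may false) (may true)) (withFlags (below κ) bs)

    vertical⁻ : ∀ κ → T (verticalᵇ κ) →
      Par C κ × (∀ i → ent ns i ≤ ent κ i) × (∀ i → ent κ i ≤ ent ls i × ent ls i ≤ suc (ent κ i))
    vertical⁻ κ t with bt , pw ← T-∧⁻ {betweenᵇ ls ns κ} t =
      Par-ent C κ (≤-trans (k≤l 0) (ent≤ pl 0)) decreasing , n≤k , λ i → k≤l i , l≤sk i
      where
      n≤k : ∀ i → ent ns i ≤ ent κ i
      n≤k i with i ℕₚ.<? N
      ... | yes p = proj₁ (between⁻ ls ns κ bt i p)
      ... | no np rewrite ent-beyond κ i (ℕₚ.≮⇒≥ np) | ent-beyond ns i (ℕₚ.≮⇒≥ np) = ≤-refl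
      k≤l : ∀ i → ent κ i ≤ ent ls i
      k≤l i with i ℕₚ.<? N
      ... | yes p = ≤-trans (proj₂ (between⁻ ls ns κ bt i p)) (ℕₚ.≤-reflexive (ℕₚ.m≤n⇒m⊔n≡n (le i)))
      ... | no np rewrite ent-beyond κ i (ℕₚ.≮⇒≥ np) | ent-beyond ls i (ℕₚ.≮⇒≥ np) = ≤-refl
      l≤sk : ∀ i → ent ls i ≤ suc (ent κ i)
      -- Two boxes beyond `ent κ i` would put the peeled label twice into one row.
      l≤sk i with ent ls i ℕₚ.≤? suc (ent κ i)
      ... | yes p = p
      ... | no np with sk<l ← ℕₚ.≰⇒> np
        = ⊥-elim (subst₂ (λ x y → T (may false x y)) (≤ᵇ-no (ℕₚ.n<1+n (ent κ i))) (≤ᵇ-no (ℕₚ.<-trans (ℕₚ.n<1+n _) sk<l))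
            (proj₁ (T-pairwise-withFlags⁻ (below κ) bs pw (suc i , suc (ent κ i)) (suc i , ent ls i)
              (member (s≤s (n≤k i)) (ℕₚ.<⇒≤ sk<l)) (member (≤-trans (s≤s (n≤k i)) (ℕₚ.<⇒≤ sk<l)) ≤-refl)) (sameRow⁺ {suc i} sk<l)))
      decreasing : ∀ i → ent κ (suc i) ≤ ent κ i
      -- Otherwise a new box would stand above an old one.
      decreasing i with ent κ (suc i) ℕₚ.≤? ent κ i
      ... | yes p = p
      ... | no np with k<k' ← ℕₚ.≰⇒> np
        = ⊥-elim (subst₂ (λ x y → T (may true x y)) (≤ᵇ-no k<k') (≤ᵇ-yes (≤-refl {ent κ (suc i)}))
            (proj₂ (T-pairwise-withFlags⁻ (below κ) bs pw (suc i , ent κ (suc i)) (suc (suc i) , ent κ (suc i))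
              (member (ℕₚ.≤-<-trans (n≤k i) k<k') (≤-trans (k≤l (suc i)) (ent-anti pl (ℕₚ.n≤1+n i))))
              (member (ℕₚ.≤-<-trans (≤-trans (ent-anti pn (ℕₚ.n≤1+n i)) (n≤k i)) k<k') (k≤l (suc i)))) (sameCol⁺ {suc i} {suc (suc i)} {ent κ (suc i)} (ℕₚ.n<1+n _))))

    vertical⁺ : ∀ κ → Par C κ → (∀ i → ent ns i ≤ ent κ i) → (∀ i → ent κ i ≤ ent ls i × ent ls i ≤ suc (ent κ i)) → T (verticalᵇ κ)
    vertical⁺ κ pk n≤k kl = T-∧⁺ (between⁺ ls ns κ (λ i _ → n≤k i , ≤-trans (proj₁ (kl i)) (ℕₚ.m≤n⊔m _ _)))
      (T-pairwise-withFlags⁺ (below κ) bs pairs)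
      where
      pairs : ∀ a b → a ∈ bs → b ∈ bs → (T (sameRowLeftOf a b) → T (may false (below κ a) (below κ b))) ×
        (T (sameColAbove a b) → T (may true (below κ a) (below κ b)))
      pairs (zero , _) _ a∈ _ = ⊥-elim (row≢0 a∈)
      pairs (suc i , j) (zero , _) _ b∈ = ⊥-elim (row≢0 b∈)
      pairs (suc i , j) (suc i' , j') a∈ b∈ = rows , cols
        where
        rows : T (sameRowLeftOf (suc i , j) (suc i' , j')) → T (may false (j ≤ᵇ ent κ i) (j' ≤ᵇ ent κ i'))
        rows s with refl , j<j' ← sameRow⁻ {suc i} {j} {suc i'} {j'} s
          rewrite ≤ᵇ-yes (ℕₚ.≤-pred (≤-trans j<j' (≤-trans (proj₂ (inside b∈)) (proj₂ (kl i))))) = _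
        cols : T (sameColAbove (suc i , j) (suc i' , j')) → T (may true (j ≤ᵇ ent κ i) (j' ≤ᵇ ent κ i'))
        cols s with refl , s≤s i<i' ← sameCol⁻ {suc i} {j} {suc i'} {j'} s with j ℕₚ.≤? ent κ i
        ... | yes p rewrite ≤ᵇ-yes p = _
        ... | no np rewrite ≤ᵇ-no (ℕₚ.≰⇒> np) | ≤ᵇ-no {j} (ℕₚ.≤-<-trans (ent-anti pk (ℕₚ.<⇒≤ i<i')) (ℕₚ.≰⇒> np)) = _

  -- The counterpart of `tableaux-Pow` for labels that may repeat in columns but not in rows: each
  -- label occupies a vertical strip. With excess weight 0 there are no corner factors, and `ns`
  -- lies below `ls` throughout, so no correction is called for.
  tableaux-Vpow : ∀ {N ρ κ} g labs → Peelables ρ false labs → Peelables κ true labs →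
    (bs : List Box) (ls ns : Vec ℕ N) → Par C ls → Par C ns → (∀ i → ent ns i ≤ ent ls i) → Rep bs ls ns →
    tableaux ρ κ zeros g bs labs ≈ Vpow (map (λ l → g l ∘ suc) labs) ls ns
  tableaux-Vpow {N} {ρ} {κ} g [] [] [] bs ls ns pl pn le rep = begin
    tableaux ρ κ zeros g bs []
      ≈⟨ ≈-sym (*-identityˡ _) ⟩
    1# * tableaux ρ κ zeros g bs []
      ≈⟨ *-congʳ (≈-sym (∏-one (upTo N) (λ i _ → ≈-reflexive (cong ((- 0#) ^_) (ℕₚ.m≤n⇒m∸n≡0 (le i)))))) ⟩
    ∏ (upTo N) (λ i → (- 0#) ^ (ent ns i ∸ ent ls i)) * tableaux ρ κ zeros g bs []
      ≈⟨ tableaux-[] bs ls ns rep ⟩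
    Dif (neg zeros) ls ns ∎
  tableaux-Vpow {N} {ρ} {κ} g (l ∷ labs) (pρ ∷ psρ) (pκ ∷ psκ) bs ls ns pl pn le rep = begin
    tableaux ρ κ zeros g bs (l ∷ labs)
      ≈⟨ tableaux-step zeros g ls ns pl pn bs rep pρ pκ ⟩
    ∑ (vecs N) (λ q → ⟦ vert q ⟧ * ((W q * M q) * tableaux ρ κ zeros g (filterᵇ (below q) bs) labs))
      ≈⟨ ∑-cong (vecs N) (λ q → term q (T? (vert q))) ⟩
    ∑ (vecs N) (λ q → ⟦ parᵇ C q ⟧ * (Ver y q ls * Vpow ys q ns))
      ≈⟨ ≈-sym (∑-filterᵇ (parᵇ C) (vecs N) _) ⟩
    ∑ (pars N) (λ q → Ver y q ls * Vpow ys q ns) ∎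
    where
    y : ℕ → Carrier
    y = g l ∘ suc
    ys : List (ℕ → Carrier)
    ys = map (λ l → g l ∘ suc) labs
    vert : Vec ℕ N → Bool
    vert = verticalᵇ ls ns pl pn le bs rep
    W M : Vec ℕ N → Carrier
    W q = ∏ (upTo N) (λ i → g l (suc i) ^ (ent ls i ∸ ent q i))
    M q = ∏ (filterᵇ (below q) bs) (λ b → ⟦ all (compat (may false) (may true) (b , false)) (withFlags (below q) bs) ⟧ * (0# * g l (row b)) + 1#)
    term : ∀ q → Dec (T (vert q)) →
      ⟦ vert q ⟧ * ((W q * M q) * tableaux ρ κ zeros g (filterᵇ (below q) bs) labs) ≈ ⟦ parᵇ C q ⟧ * (Ver y q ls * Vpow ys q ns)
    term q (yes t) = *-cong (≈-reflexive (cong ⟦_⟧ (trans (T⇒true t) (sym (T⇒true (Par⇒parᵇ pq))))))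
      (*-cong (≈-trans (*-cong (≈-trans (∏-cong∈ (upTo N) (λ i _ → ≈-sym (vfac-yes _ (ent q i) (ent ls i) (proj₁ (kl i)) (proj₂ (kl i))))) (≈-sym (Ver-∏ y q ls)))
                        (∏-one (filterᵇ (below q) bs) (λ b _ → ≈-trans (+-congʳ (≈-trans (*-congˡ (zeroˡ _)) (zeroʳ _))) (+-identityˡ _))))
                (*-identityʳ _))
        (tableaux-Vpow g labs psρ psκ (filterᵇ (below q) bs) q ns pq pn n≤k
          (Rep-below q rep (λ i _ → ≤-trans (proj₁ (kl i)) (ℕₚ.m≤n⊔m _ _)))))
      where
      v⁻ = vertical⁻ ls ns pl pn le bs rep q t
      pq = proj₁ v⁻
      n≤k = proj₁ (proj₂ v⁻)
      kl = proj₂ (proj₂ v⁻)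
    term q (no nt) = ≈-trans (0*≈ (≈-reflexive (cong ⟦_⟧ (¬T⇒false nt)))) (≈-sym (vanish (T? (parᵇ C q))))
      where
      vanish : Dec (T (parᵇ C q)) → ⟦ parᵇ C q ⟧ * (Ver y q ls * Vpow ys q ns) ≈ 0#
      vanish (no np) = 0*≈ (≈-reflexive (cong ⟦_⟧ (¬T⇒false np)))
      vanish (yes p) with Ver-supp y q ls | Vpow-supp ys q ns
      ... | inj₂ z  | _       = *0≈ (0*≈ z)
      ... | inj₁ _  | inj₂ z  = *0≈ (*0≈ z)
      ... | inj₁ kl | inj₁ nk = ⊥-elim (nt (vertical⁺ ls ns pl pn le bs rep q (parᵇ⇒Par C q p) nk kl))

-- The order of the labels, and ordinary tableaux among the set-valued ones.

Peelables-sorted : ∀ {ρ q} {P : ℕ → ℕ → Set} (labs : List ℕ) → AllPairs P labs →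
  (∀ l x → P l x → ρ x l ≡ true) → (∀ l x → P l x → ρ l x ≡ false) → (∀ l → ρ l l ≡ q) → Peelables ρ q labs
Peelables-sorted []         []       f g h = []
Peelables-sorted (l ∷ labs) (a ∷ as) f g h = record
  { below = λ x x∈ → f l x (All.lookup a x∈)
  ; above = λ x x∈ → g l x (All.lookup a x∈)
  ; self  = h l
  } ∷ Peelables-sorted labs as f g h

downs : ℕ → List ℕ
downs zero    = []
downs (suc n) = suc n ∷ downs n

downs-≤ : ∀ n x → x ∈ downs n → x ≤ n
downs-≤ (suc n) x (here refl) = ≤-refl
downs-≤ (suc n) x (there x∈)  = ℕₚ.m≤n⇒m≤1+n (downs-≤ n x x∈)

downs-sorted : ∀ n → AllPairs (λ l x → x < l) (downs n)
downs-sorted zero    = []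
downs-sorted (suc n) = All.tabulate (λ {x} x∈ → s≤s (downs-≤ n x x∈)) ∷ downs-sorted n

downs-↭ : ∀ n → range 1 n ↭ downs n
downs-↭ zero    = Perm.refl
downs-↭ (suc n) rewrite range-suc n = Perm.trans (Perm.↭-sym (∷↭∷ʳ (suc n) (range 1 n))) (Perm.prep (suc n) (downs-↭ n))
  where open import Data.List.Relation.Binary.Permutation.Propositional.Properties using (∷↭∷ʳ)

range-sorted : ∀ a b → AllPairs _<_ (range a b)
range-sorted a b = AP.map⁺ (AP.applyUpTo⁺₁ id (suc b ∸ a) (λ i<j _ → ℕₚ.+-monoʳ-< a i<j))
  where import Data.List.Relation.Unary.AllPairs.Properties as AP

-- Peeling from the largest label lists every set in decreasing order, the enumeration of tableaux
-- in increasing order; entries then agree only up to permutation.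
data SameSets : Filling (List ℕ) → Filling (List ℕ) → Set where
  []  : SameSets [] []
  _∷_ : ∀ {b S S' t t'} → S ↭ S' → SameSets t t' → SameSets ((b , S) ∷ t) ((b , S') ∷ t')

SameSets-refl : ∀ t → SameSets t t
SameSets-refl []            = []
SameSets-refl ((b , S) ∷ t) = Perm.refl ∷ SameSets-refl t

all-↭ : {A : Set} (p : A → Bool) {xs ys : List A} → xs ↭ ys → all p xs ≡ all p ys
all-↭ p {xs} {ys} e = T-ext (half e) (half (Perm.↭-sym e))
  where
  open import Data.List.Relation.Binary.Permutation.Propositional.Properties using (∈-resp-↭)
  half : ∀ {xs ys} → xs ↭ ys → T (all p xs) → T (all p ys)
  half {xs} {ys} e t = T-all⁺ p ys (λ x x∈ → T-all⁻ p xs t x (∈-resp-↭ (Perm.↭-sym e) x∈))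

allPairs-↭ : ∀ ρ {S₁ S₂ S₁' S₂'} → S₁ ↭ S₁' → S₂ ↭ S₂' → allPairs ρ S₁ S₂ ≡ allPairs ρ S₁' S₂'
allPairs-↭ ρ {S₁} p q = trans (all-cong S₁ (λ x _ → all-↭ (ρ x) q)) (all-↭ _ p)

module Labels {c ℓ} (R : CommutativeRing c ℓ) where
  open CommutativeRing R
    hiding (zero)
    renaming (refl to ≈-refl; sym to ≈-sym; trans to ≈-trans; reflexive to ≈-reflexive)
  open Sums R
  open Peel R
  open import Relation.Binary.Reasoning.Setoid setoid

  ∑-subsets-∷ : {A : Set} (x : A) (xs : List A) (f : List A → Carrier) →
    ∑ (subsets (x ∷ xs)) f ≈ ∑ (subsets xs) f + ∑ (subsets xs) (f ∘ (x ∷_))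
  ∑-subsets-∷ x xs f = ≈-trans (∑-++ (subsets xs) _ f) (+-congˡ (≈-reflexive (∑-map (x ∷_) (subsets xs) f)))

  ∑-subsets-↭ : {A : Set} {xs ys : List A} (f : List A → Carrier) → (∀ {S S'} → S ↭ S' → f S ≈ f S') → xs ↭ ys →
    ∑ (subsets xs) f ≈ ∑ (subsets ys) f
  ∑-subsets-↭ f r Perm.refl = ≈-refl
  ∑-subsets-↭ f r (Perm.trans p q) = ≈-trans (∑-subsets-↭ f r p) (∑-subsets-↭ f r q)
  ∑-subsets-↭ f r (Perm.prep {xs} {ys} x p) = begin
    ∑ (subsets (x ∷ xs)) f                        ≈⟨ ∑-subsets-∷ x xs f ⟩
    ∑ (subsets xs) f + ∑ (subsets xs) (f ∘ (x ∷_)) ≈⟨ +-cong (∑-subsets-↭ f r p) (∑-subsets-↭ (f ∘ (x ∷_)) (λ e → r (Perm.prep x e)) p) ⟩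
    ∑ (subsets ys) f + ∑ (subsets ys) (f ∘ (x ∷_)) ≈⟨ ≈-sym (∑-subsets-∷ x ys f) ⟩
    ∑ (subsets (x ∷ ys)) f ∎
  ∑-subsets-↭ f r (Perm.swap {xs} {ys} x y p) = begin
    ∑ (subsets (x ∷ y ∷ xs)) f
      ≈⟨ four x y xs ⟩
    (∑ (subsets xs) f + ∑ (subsets xs) (f ∘ (y ∷_))) + (∑ (subsets xs) (f ∘ (x ∷_)) + ∑ (subsets xs) (λ S → f (x ∷ y ∷ S)))
      ≈⟨ +-cong (+-cong (∑-subsets-↭ f r p) (∑-subsets-↭ (f ∘ (y ∷_)) (λ e → r (Perm.prep y e)) p))
           (+-cong (∑-subsets-↭ (f ∘ (x ∷_)) (λ e → r (Perm.prep x e)) p)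
             (≈-trans (∑-subsets-↭ (λ S → f (x ∷ y ∷ S)) (λ e → r (Perm.prep x (Perm.prep y e))) p)
               (∑-cong (subsets ys) (λ S → r (Perm.swap x y Perm.refl))))) ⟩
    (∑ (subsets ys) f + ∑ (subsets ys) (f ∘ (y ∷_))) + (∑ (subsets ys) (f ∘ (x ∷_)) + ∑ (subsets ys) (λ S → f (y ∷ x ∷ S)))
      ≈⟨ solve 4 (λ a b c d → (a :+ b) :+ (c :+ d) := (a :+ c) :+ (b :+ d)) ≈-refl _ _ _ _ ⟩
    (∑ (subsets ys) f + ∑ (subsets ys) (f ∘ (x ∷_))) + (∑ (subsets ys) (f ∘ (y ∷_)) + ∑ (subsets ys) (λ S → f (y ∷ x ∷ S)))
      ≈⟨ ≈-sym (four y x ys) ⟩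
    ∑ (subsets (y ∷ x ∷ ys)) f ∎
    where
    four : ∀ x y xs → ∑ (subsets (x ∷ y ∷ xs)) f ≈
      (∑ (subsets xs) f + ∑ (subsets xs) (f ∘ (y ∷_))) + (∑ (subsets xs) (f ∘ (x ∷_)) + ∑ (subsets xs) (λ S → f (x ∷ y ∷ S)))
    four x y xs = ≈-trans (∑-subsets-∷ x (y ∷ xs) f) (+-cong (∑-subsets-∷ y xs f) (∑-subsets-∷ y xs (f ∘ (x ∷_))))

  -- The recursion for `nonemptySubsets` treats its elements unevenly, that for `subsets` does not.
  -- So the term of the empty set is added, the elements are permuted, and the term is subtracted
  -- again.
  ∑-nonemptySubsets-↭ : {A : Set} {xs ys : List A} (f : List A → Carrier) → (∀ {S S'} → S ↭ S' → f S ≈ f S') → xs ↭ ys →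
    ∑ (nonemptySubsets xs) f ≈ ∑ (nonemptySubsets ys) f
  ∑-nonemptySubsets-↭ {xs = xs} {ys} f r p = ≈-trans (cancel xs) (≈-trans (+-congˡ (∑-subsets-↭ f r p)) (≈-sym (cancel ys)))
    where
    cancel : ∀ xs → ∑ (nonemptySubsets xs) f ≈ - f [] + ∑ (subsets xs) f
    cancel xs = ≈-sym (≈-trans (+-congˡ (∑-subsets xs f)) (≈-trans (≈-sym (+-assoc _ _ _))
      (≈-trans (+-congʳ (-‿inverseˡ _)) (+-identityˡ _))))

  ∑-fillings-↭ : ∀ (bs : List Box) {xs ys : List ℕ} (Φ : Filling (List ℕ) → Carrier) →
    (∀ {t t'} → SameSets t t' → Φ t ≈ Φ t') → xs ↭ ys →
    ∑ (fillings bs (λ _ → nonemptySubsets xs)) Φ ≈ ∑ (fillings bs (λ _ → nonemptySubsets ys)) Φ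
  ∑-fillings-↭ []       Φ r p = ≈-refl
  ∑-fillings-↭ (b ∷ bs) {xs} {ys} Φ r p = begin
    ∑ (fillings (b ∷ bs) (λ _ → nonemptySubsets xs)) Φ
      ≈⟨ ∑-fillings b bs (λ _ → nonemptySubsets xs) Φ ⟩
    ∑ (nonemptySubsets xs) (λ S → ∑ (fillings bs (λ _ → nonemptySubsets xs)) (λ t → Φ ((b , S) ∷ t)))
      ≈⟨ ∑-cong (nonemptySubsets xs) (λ S → ∑-fillings-↭ bs (λ t → Φ ((b , S) ∷ t)) (λ e → r (Perm.refl ∷ e)) p) ⟩
    ∑ (nonemptySubsets xs) (λ S → ∑ (fillings bs (λ _ → nonemptySubsets ys)) (λ t → Φ ((b , S) ∷ t)))
      ≈⟨ ∑-nonemptySubsets-↭ _ (λ e → ∑-cong (fillings bs (λ _ → nonemptySubsets ys)) (λ t → r (e ∷ SameSets-refl t))) p ⟩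
    ∑ (nonemptySubsets ys) (λ S → ∑ (fillings bs (λ _ → nonemptySubsets ys)) (λ t → Φ ((b , S) ∷ t)))
      ≈⟨ ≈-sym (∑-fillings b bs (λ _ → nonemptySubsets ys) Φ) ⟩
    ∑ (fillings (b ∷ bs) (λ _ → nonemptySubsets ys)) Φ ∎

  ∏-SameSets : ∀ {t t'} (f : Box × List ℕ → Carrier) → (∀ b {S S'} → S ↭ S' → f (b , S) ≈ f (b , S')) → SameSets t t' → ∏ t f ≈ ∏ t' f
  ∏-SameSets f r []       = ≈-refl
  ∏-SameSets f r (p ∷ ps) = *-cong (r _ p) (∏-SameSets f r ps)

  tableaux-↭ : ∀ {ρ κ} v g (bs : List Box) {xs ys} → xs ↭ ys → tableaux ρ κ v g bs xs ≈ tableaux ρ κ v g bs ys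
  tableaux-↭ {ρ} {κ} v g bs p = ∑-fillings-↭ bs _ resp p
    where
    rel = compat (allPairs ρ) (allPairs κ)
    rel-↭ : ∀ a b {S₁ S₂ S₁' S₂'} → S₁ ↭ S₁' → S₂ ↭ S₂' → rel (a , S₁) (b , S₂) ≡ rel (a , S₁') (b , S₂')
    rel-↭ a b p q = cong₂ (λ x y → (sameRowLeftOf a b ⇒ᵇ x) ∧ (sameColAbove a b ⇒ᵇ y)) (allPairs-↭ ρ p q) (allPairs-↭ κ p q)
    resp : ∀ {t t'} → SameSets t t' → ⟦ pairwiseᵇ rel t ⟧ * ∏ t (weight v g) ≈ ⟦ pairwiseᵇ rel t' ⟧ * ∏ t' (weight v g)
    resp {t} {t'} e = *-cong
      (≈-trans (⟦pairwise⟧ rel t) (≈-trans (≈-trans (∏-cong∈ t (λ p _ → ∏-SameSets _ (λ b q → ≈-reflexive (cong ⟦_⟧ (rel-↭ (proj₁ p) b {proj₂ p} {_} {proj₂ p} Perm.refl q))) e))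
        (∏-SameSets _ (λ b q → ∏-cong∈ t' (λ p _ → ≈-reflexive (cong ⟦_⟧ (rel-↭ b (proj₁ p) {S₂ = proj₂ p} {S₂' = proj₂ p} q Perm.refl)))) e)) (≈-sym (⟦pairwise⟧ rel t'))))
      (∏-SameSets (weight v g) (λ b q → *-cong (≈-reflexive (cong (λ k → v (row b) ^ (k ∸ 1)) (↭-length q))) (∏-↭ _ q)) e)
      where open import Data.List.Relation.Binary.Permutation.Propositional.Properties using (↭-length)

  singles : Filling ℕ → Filling (List ℕ)
  singles = map (λ p → proj₁ p , proj₂ p ∷ [])

  ∑-fillings-singles : ∀ (bs : List Box) labs (Φ : Filling (List ℕ) → Carrier) →
    (∀ t b x y ys → (b , x ∷ y ∷ ys) ∈ t → Φ t ≈ 0#) →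
    ∑ (fillings bs (λ _ → nonemptySubsets labs)) Φ ≈ ∑ (fillings bs (λ _ → labs)) (Φ ∘ singles)
  ∑-fillings-singles []       labs Φ h = ≈-refl
  ∑-fillings-singles (b ∷ bs) labs Φ h = begin
    ∑ (fillings (b ∷ bs) (λ _ → nonemptySubsets labs)) Φ
      ≈⟨ ∑-fillings b bs (λ _ → nonemptySubsets labs) Φ ⟩
    ∑ (nonemptySubsets labs) (λ S → ∑ (fillings bs (λ _ → nonemptySubsets labs)) (λ t → Φ ((b , S) ∷ t)))
      ≈⟨ ∑-cong (nonemptySubsets labs) (λ S → ∑-fillings-singles bs labs (λ t → Φ ((b , S) ∷ t)) (λ t c x y ys m → h _ c x y ys (there m))) ⟩
    ∑ (nonemptySubsets labs) (λ S → ∑ (fillings bs (λ _ → labs)) (λ t → Φ ((b , S) ∷ singles t)))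
      ≈⟨ choose labs _ (λ x y ys → ∑-zero (fillings bs (λ _ → labs)) (λ t _ → h _ b x y ys (here refl))) ⟩
    ∑ labs (λ x → ∑ (fillings bs (λ _ → labs)) (λ t → Φ ((b , x ∷ []) ∷ singles t)))
      ≈⟨ ≈-sym (∑-fillings b bs (λ _ → labs) (Φ ∘ singles)) ⟩
    ∑ (fillings (b ∷ bs) (λ _ → labs)) (Φ ∘ singles) ∎
    where
    choose : ∀ labs (f : List ℕ → Carrier) → (∀ x y ys → f (x ∷ y ∷ ys) ≈ 0#) → ∑ (nonemptySubsets labs) f ≈ ∑ labs (λ x → f (x ∷ []))
    choose []         f z = ≈-refl
    choose (x ∷ labs) f z = ≈-trans (∑-nonemptySubsets x labs f) (+-congˡ (≈-trans
      (∑-cong∈ (nonemptySubsets labs) (λ S S∈ → lem S (∈-nonemptySubsets labs S S∈))) (choose labs f z)))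
      where
      lem : ∀ S → ∃[ y ] ∃[ ys ] S ≡ y ∷ ys × (∀ x → x ∈ S → x ∈ labs) → f (x ∷ S) + f S ≈ f S
      lem _ (y , ys , refl , _) = ≈-trans (+-congʳ (z x y ys)) (+-identityˡ _)

  ordinary : (ρ κ : ℕ → ℕ → Bool) → (ℕ → ℕ → Carrier) → List Box → (Box → List ℕ) → Carrier
  ordinary ρ κ g bs opts = ∑ (fillings bs opts)
    (λ t → ⟦ pairwiseᵇ (compat ρ κ) t ⟧ * ∏ t (λ p → g (proj₂ p) (row (proj₁ p))))

  ∏-zero∈ : {A : Set} (xs : List A) (f : A → Carrier) → ∀ x → x ∈ xs → f x ≈ 0# → ∏ xs f ≈ 0#
  ∏-zero∈ (x ∷ xs) f _ (here refl) z = ≈-trans (*-congʳ z) (zeroˡ _)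
  ∏-zero∈ (x ∷ xs) f y (there y∈)  z = ≈-trans (*-congˡ (∏-zero∈ xs f y y∈ z)) (zeroʳ _)

  -- The factor `v ^ (length S ∸ 1)` vanishes for `v ≈ 0#` unless `S` is a singleton, for which it
  -- is 1.
  tableaux-ordinary : ∀ {ρ κ v} g (bs : List Box) labs → (∀ b → b ∈ bs → v (row b) ≈ 0#) →
    tableaux ρ κ v g bs labs ≈ ordinary ρ κ g bs (λ _ → labs)
  tableaux-ordinary {ρ} {κ} {v} g bs labs v≈0 = begin
    tableaux ρ κ v g bs labs
      ≈⟨ ∑-cong∈ (fillings bs (λ _ → nonemptySubsets labs)) (λ t t∈ → *-congˡ (∏-cong∈ t (λ p p∈ →
           *-congʳ (^-congˡ (length (proj₂ p) ∸ 1) (v≈0 (proj₁ p) (proj₁ (∈-fillings bs _ t t∈ (proj₁ p) (proj₂ p) p∈))))))) ⟩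
    tableaux ρ κ (λ _ → 0#) g bs labs
      ≈⟨ ∑-fillings-singles bs labs _ (λ t b x y ys m → ≈-trans (*-congˡ (∏-zero∈ t _ (b , x ∷ y ∷ ys) m
           (≈-trans (*-congʳ (zeroˡ _)) (zeroˡ _)))) (zeroʳ _)) ⟩
    ∑ (fillings bs (λ _ → labs)) (λ t → ⟦ pairwiseᵇ (compat (allPairs ρ) (allPairs κ)) (singles t) ⟧ * ∏ (singles t) (weight (λ _ → 0#) g))
      ≈⟨ ∑-cong (fillings bs (λ _ → labs)) (λ t → *-cong (pairs t)
           (≈-trans (≈-reflexive (∏-map _ t _)) (∏-cong∈ t (λ p _ → ≈-trans (*-identityˡ _) (*-identityʳ _))))) ⟩
    ordinary ρ κ g bs (λ _ → labs) ∎
    where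
    open import Data.Bool.Properties using (∧-identityʳ)
    single : ∀ ρ x y → allPairs ρ (x ∷ []) (y ∷ []) ≡ ρ x y
    single ρ x y = trans (∧-identityʳ _) (∧-identityʳ _)
    pairs : ∀ t → ⟦ pairwiseᵇ (compat (allPairs ρ) (allPairs κ)) (singles t) ⟧ ≈ ⟦ pairwiseᵇ (compat ρ κ) t ⟧
    pairs t = ≈-trans (⟦pairwise⟧ _ (singles t)) (≈-trans (≈-reflexive (∏-map _ t _))
      (≈-trans (∏-cong∈ t (λ p _ → ≈-trans (≈-reflexive (∏-map _ t _)) (∏-cong∈ t (λ q _ → ≈-reflexive
        (cong₂ (λ x y → ⟦ (sameRowLeftOf (proj₁ p) (proj₁ q) ⇒ᵇ x) ∧ (sameColAbove (proj₁ p) (proj₁ q) ⇒ᵇ y) ⟧)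
          (single ρ (proj₂ p) (proj₂ q)) (single κ (proj₂ p) (proj₂ q)))))))
        (≈-sym (⟦pairwise⟧ (compat ρ κ) t))))

  -- Peeling uses one list of labels for all boxes, whereas `aCoeff` offers each box the labels up
  -- to its row. The labels in between carry weight 0.
  ∑-fillings-shrink : ∀ (bs : List Box) K (Φ : Filling ℕ → Carrier) → (∀ b → b ∈ bs → row b ≤ K) →
    (∀ t b x → (b , x) ∈ t → row b < x → Φ t ≈ 0#) →
    ∑ (fillings bs (λ _ → range 1 K)) Φ ≈ ∑ (fillings bs (λ b → range 1 (row b))) Φ
  ∑-fillings-shrink []       K Φ _ _ = ≈-refl
  ∑-fillings-shrink (b ∷ bs) K Φ r h = begin
    ∑ (fillings (b ∷ bs) (λ _ → range 1 K)) Φ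
      ≈⟨ ∑-fillings b bs (λ _ → range 1 K) Φ ⟩
    ∑ (range 1 K) (λ x → ∑ (fillings bs (λ _ → range 1 K)) (λ t → Φ ((b , x) ∷ t)))
      ≈⟨ ∑-cong (range 1 K) (λ x → ∑-fillings-shrink bs K _ (λ c c∈ → r c (there c∈)) (λ t c y m → h _ c y (there m))) ⟩
    ∑ (range 1 K) F
      ≈⟨ ≈-trans (∑-↭ F (range-split {1} {row b} (s≤s z≤n) (r b (here refl)))) (∑-++ (range 1 (row b)) _ F) ⟩
    ∑ (range 1 (row b)) F + ∑ (range (suc (row b)) K) F
      ≈⟨ ≈-trans (+-congˡ (∑-zero (range (suc (row b)) K) (λ x x∈ → ∑-zero (fillings bs (λ b → range 1 (row b)))
           (λ t _ → h _ b x (here refl) (proj₁ (∈-range⁻ _ K x∈)))))) (+-identityʳ _) ⟩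
    ∑ (range 1 (row b)) F
      ≈⟨ ≈-sym (∑-fillings b bs (λ b → range 1 (row b)) Φ) ⟩
    ∑ (fillings (b ∷ bs) (λ b → range 1 (row b))) Φ ∎
    where
    F : ℕ → Carrier
    F x = ∑ (fillings bs (λ b → range 1 (row b))) (λ t → Φ ((b , x) ∷ t))

-- Shapes

T-not⁻ : ∀ {b} → T (not b) → ¬ T b
T-not⁻ {false} _ ()

T-not⁺ : ∀ {b} → ¬ T b → T (not b)
T-not⁺ {false} _ = _
T-not⁺ {true}  h = h _

memᵇ⁺ : ∀ {b} (σ : List Box) → b ∈ σ → T (memᵇ b σ)
memᵇ⁺ {i , j} σ b∈ = T-any⁺ _ σ (i , j) b∈ (T-∧⁺ (≡⇒≡ᵇ i i refl) (≡⇒≡ᵇ j j refl))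

memᵇ⁻ : ∀ {b} (σ : List Box) → T (memᵇ b σ) → b ∈ σ
memᵇ⁻ {i , j} σ t with (i' , j') , m , e ← T-any⁻ _ σ t with p , q ← T-∧⁻ {i ≡ᵇ i'} e
  with refl ← ≡ᵇ⇒≡ i i' p | refl ← ≡ᵇ⇒≡ j j' q = m

noDupᵇ⁻ : (σ : List Box) → T (noDupᵇ σ) → Unique σ
noDupᵇ⁻ []      _ = []
noDupᵇ⁻ (b ∷ σ) t with p , q ← T-∧⁻ {not (memᵇ b σ)} t = ∉⇒All≢ σ (λ m → T-not⁻ p (memᵇ⁺ σ m)) ∷ noDupᵇ⁻ σ q

noDupᵇ⁺ : (σ : List Box) → Unique σ → T (noDupᵇ σ)
noDupᵇ⁺ []      _        = _
noDupᵇ⁺ (b ∷ σ) (a ∷ us) = T-∧⁺ (T-not⁺ (λ m → All≢⇒∉ σ a (memᵇ⁻ σ m))) (noDupᵇ⁺ σ us)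

Convex : List Box → Set
Convex σ = ∀ {i j r s i' j'} → (i , j) ∈ σ → (i' , j') ∈ σ → i ≤ r → r ≤ i' → j ≤ s → s ≤ j' → (r , s) ∈ σ

record Skew (σ : List Box) : Set where
  field
    unique   : Unique σ
    positive : ∀ {i j} → (i , j) ∈ σ → 1 ≤ i × 1 ≤ j
    convex   : Convex σ

skew⁻ : (σ : List Box) → T (isSkewShape σ) → Skew σ
skew⁻ σ t with u , t' ← T-∧⁻ {noDupᵇ σ} t with p , c ← T-∧⁻ {all positiveᵇ σ} t' = record
  { unique   = noDupᵇ⁻ σ u
  ; positive = λ {i} {j} m → let (x , y) = T-∧⁻ {1 ≤ᵇ i} (T-all⁻ positiveᵇ σ p (i , j) m) in ≤ᵇ⇒≤ 1 i x , ≤ᵇ⇒≤ 1 j y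
  ; convex   = λ {i} {j} {r} {s} {i'} {j'} a∈ c∈ ir ri js sj → memᵇ⁻ σ
      (T-all⁻ _ (boxesBetween (i , j) (i' , j')) (T-all⁻ _ σ (T-all⁻ _ σ c (i , j) a∈) (i' , j') c∈) (r , s)
        (∈-concatMap (λ r → map (r ,_) (range j j')) (range i i') (∈-range⁺ ir ri) (∈-map⁺ (r ,_) (∈-range⁺ js sj))))
  }

skew⁺ : (σ : List Box) → Skew σ → T (isSkewShape σ)
skew⁺ σ sk = T-∧⁺ (noDupᵇ⁺ σ unique) (T-∧⁺
  (T-all⁺ positiveᵇ σ (λ (i , j) m → T-∧⁺ (≤⇒≤ᵇ (proj₁ (positive m))) (≤⇒≤ᵇ (proj₂ (positive m)))))
  (T-all⁺ _ σ (λ a a∈ → T-all⁺ _ σ (λ c c∈ → T-all⁺ _ (boxesBetween a c) (λ b b∈ → memᵇ⁺ σ (lem a c b a∈ c∈ b∈))))))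
  where
  open Skew sk
  lem : ∀ a c b → a ∈ σ → c ∈ σ → b ∈ boxesBetween a c → b ∈ σ
  lem (i , j) (i' , j') b a∈ c∈ b∈
    with r , r∈ , b∈' ← concatMap-∈ (λ r → map (r ,_) (range j j')) (range i i') b∈
    with s , s∈ , refl ← ∈-map⁻ (r ,_) b∈'
    with ir , ri ← ∈-range⁻ i i' r∈ | js , sj ← ∈-range⁻ j j' s∈ = convex a∈ c∈ ir ri js sj

row≤maxRow : (σ : List Box) → ∀ {i j} → (i , j) ∈ σ → i ≤ maxRow σ
row≤maxRow ((i , _) ∷ σ) (here refl) = ℕₚ.m≤m⊔n i (maxRow σ)
row≤maxRow ((i , _) ∷ σ) (there m)   = ≤-trans (row≤maxRow σ m) (ℕₚ.m≤n⊔m i (maxRow σ))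

col≤maxCol : (σ : List Box) → ∀ {i j} → (i , j) ∈ σ → j ≤ maxCol σ
col≤maxCol ((_ , j) ∷ σ) (here refl) = ℕₚ.m≤m⊔n j (maxCol σ)
col≤maxCol ((_ , j) ∷ σ) (there m)   = ≤-trans (col≤maxCol σ m) (ℕₚ.m≤n⊔m j (maxCol σ))

maxRow-attained : (σ : List Box) → ∀ {b} → b ∈ σ → ∃[ j ] (maxRow σ , j) ∈ σ
maxRow-attained ((i , j) ∷ []) _ = j , here (cong (_, j) (ℕₚ.⊔-identityʳ i))
maxRow-attained ((i , j) ∷ b ∷ σ) _ with ℕₚ.⊔-sel i (maxRow (b ∷ σ)) | maxRow-attained (b ∷ σ) (here refl)
... | inj₁ e | _      rewrite e = j , here refl
... | inj₂ e | k , m  rewrite e = k , there m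

maxCol-attained : (σ : List Box) → ∀ {b} → b ∈ σ → ∃[ i ] (i , maxCol σ) ∈ σ
maxCol-attained ((i , j) ∷ []) _ = i , here (cong (i ,_) (ℕₚ.⊔-identityʳ j))
maxCol-attained ((i , j) ∷ b ∷ σ) _ with ℕₚ.⊔-sel j (maxCol (b ∷ σ)) | maxCol-attained (b ∷ σ) (here refl)
... | inj₁ e | _      rewrite e = i , here refl
... | inj₂ e | k , m  rewrite e = k , there m

-- Some step of the walk leads from a row at most `i` to a row beyond `i`. Its two boxes are
-- comparable, so by convexity the column of the upper box meets both rows `i` and `suc i`.
crossing : ∀ {σ a b} → Convex σ → Linked σ a b → ∀ i → row a ≤ i → i < row b → ∃[ c ] (i , c) ∈ σ × (suc i , c) ∈ σ
crossing cv here i p q = ⊥-elim (<⇒≱ q p)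
crossing {a = r , s} cv (up {b = r' , s'} (a∈ , b∈ , ((rr' , ss') , _) , _) l) i p q with r' ℕₚ.≤? i
... | yes r'≤i = crossing cv l i r'≤i q
... | no np = s , cv a∈ b∈ p (ℕₚ.<⇒≤ (ℕₚ.≰⇒> np)) ≤-refl ss' , cv a∈ b∈ (ℕₚ.m≤n⇒m≤1+n p) (ℕₚ.≰⇒> np) ≤-refl ss'
crossing cv (down (_ , _ , ((rr' , _) , _) , _) l) i p q = crossing cv l i (≤-trans rr' p) q

interval : (p : ℕ → Bool) (B : ℕ) → (∀ j → T (p j) → 1 ≤ j × j ≤ B) → (∀ i j k → T (p i) → T (p k) → i ≤ j → j ≤ k → T (p j)) →
  ∀ j₀ → T (p j₀) → ∃[ n ] ∃[ l ] n < l × T (p l) × T (p (suc n)) × (∀ j → T (p j) → n < j × j ≤ l)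
interval p B bound cv j₀ pj₀ = finish (least j₀ pj₀) (greatest B (λ j t → proj₂ (bound j t)))
  where
  least : ∀ k → T (p k) → ∃[ m ] T (p m) × (∀ j → T (p j) → m ≤ j)
  least zero    t = 0 , t , λ _ _ → z≤n
  least (suc k) t with T? (p k)
  ... | yes t' = least k t'
  ... | no nt = suc k , t , low
    where
    low : ∀ j → T (p j) → suc k ≤ j
    low j tj with suc k ℕₚ.≤? j
    ... | yes q = q
    ... | no nq = ⊥-elim (nt (cv j k (suc k) tj t (ℕₚ.≤-pred (ℕₚ.≰⇒> nq)) (ℕₚ.n≤1+n k)))
  greatest : ∀ b → (∀ j → T (p j) → j ≤ b) → ∃[ l ] T (p l) × (∀ j → T (p j) → j ≤ l)
  greatest zero    h = j₀ , pj₀ , λ j t → ≤-trans (h j t) z≤n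
  greatest (suc b) h with T? (p (suc b))
  ... | yes t = suc b , t , h
  ... | no nt = greatest b (λ j t → ℕₚ.≤-pred (ℕₚ.≤∧≢⇒< (h j t) (λ { refl → nt t })))
  finish : ∃[ m ] T (p m) × (∀ j → T (p j) → m ≤ j) → ∃[ l ] T (p l) × (∀ j → T (p j) → j ≤ l) →
    ∃[ n ] ∃[ l ] n < l × T (p l) × T (p (suc n)) × (∀ j → T (p j) → n < j × j ≤ l)
  finish (zero  , pm , m≤) _ with () ← proj₁ (bound 0 pm)
  finish (suc n , pm , m≤) (l , pl , ≤l) = n , l , m≤ l pl , pl , pm , λ j t → m≤ j t , ≤l j t

abstract
  rowInterval : (σ : List Box) → Skew σ → ∀ i → ∃[ j ] (i , j) ∈ σ →
    ∃[ n ] ∃[ l ] n < l × (i , l) ∈ σ × (i , suc n) ∈ σ × (∀ j → (i , j) ∈ σ → n < j × j ≤ l)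
  rowInterval σ sk i (j₀ , m₀) =
    let (n , l , n<l , tl , tn , h) = interval (λ j → memᵇ (i , j) σ) (maxCol σ)
          (λ j t → proj₂ (positive (mem⁻ t)) , col≤maxCol σ (mem⁻ t))
          (λ a b c ta tc ab bc → memᵇ⁺ {i , b} σ (convex (mem⁻ ta) (mem⁻ tc) ≤-refl ≤-refl ab bc)) j₀ (memᵇ⁺ {i , j₀} σ m₀)
    in n , l , n<l , mem⁻ tl , mem⁻ tn , λ j m → h j (memᵇ⁺ {i , j} σ m)
    where
    open Skew sk
    mem⁻ : ∀ {j} → T (memᵇ (i , j) σ) → (i , j) ∈ σ
    mem⁻ {j} = memᵇ⁻ {i , j} σ

-- All that is used of connectedness is that neighbouring rows share a column. It follows that the
-- bottom row reaches furthest to the left, so the column `c₀` before its first box can serve as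
-- zero for all row lengths.
record Frame (σ : List Box) (c₀ : ℕ) : Set where
  field
    skew    : Skew σ
    linked  : ∀ i → 1 ≤ i → i < maxRow σ → ∃[ c ] (i , c) ∈ σ × (suc i , c) ∈ σ
    corner  : (maxRow σ , suc c₀) ∈ σ
    columns : ∀ {i j} → (i , j) ∈ σ → c₀ < j

frame : (σ : List Box) → T (isSkewShape σ) → Connected σ → TopRowIsOne σ → ∃[ c₀ ] Frame σ c₀
frame σ sk conn ((_ , j₁) , b∈ , refl) with maxRow-attained σ b∈
... | jR , mR with rowInterval σ (skew⁻ σ sk) (maxRow σ) (jR , mR)
... | n , _ , _ , _ , mn , h = n , record
  { skew    = skew⁻ σ sk
  ; linked  = link
  ; corner  = mn
  ; columns = λ m → cols _ _ m (row≤maxRow σ m)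
  }
  where
  open Skew (skew⁻ σ sk)
  link : ∀ i → 1 ≤ i → i < maxRow σ → ∃[ c ] (i , c) ∈ σ × (suc i , c) ∈ σ
  link i 1≤i i<R = crossing convex (conn (1 , j₁) (maxRow σ , jR) b∈ mR) i 1≤i i<R
  cols : ∀ i j → (i , j) ∈ σ → i ≤ maxRow σ → n < j
  cols i j m i≤R = go (maxRow σ ∸ i) i j m (ℕₚ.m+[n∸m]≡n i≤R)
    where
    go : ∀ d i j → (i , j) ∈ σ → i ℕ.+ d ≡ maxRow σ → n < j
    go zero    i j m e with refl ← trans (sym (ℕₚ.+-identityʳ i)) e = proj₁ (h j m)
    go (suc d) i j m e with c , ic , sic ← link i (proj₁ (positive m)) (subst (suc i ≤_) (trans (sym (ℕₚ.+-suc i d)) e) (s≤s (ℕₚ.m≤m+n i d)))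
      with j ℕₚ.≤? c
    -- A box to the left of a shared column `c` has a box of `σ` below it by convexity; a box to the
    -- right of `c` is compared with `c` itself.
    ... | yes j≤c = go d (suc i) j (convex m sic (ℕₚ.n≤1+n i) ≤-refl ≤-refl j≤c) (trans (sym (ℕₚ.+-suc i d)) e)
    ... | no j≰c = ℕₚ.<-trans (go d (suc i) c sic (trans (sym (ℕₚ.+-suc i d)) e)) (ℕₚ.≰⇒> j≰c)

module ShapeVectors {c ℓ} (R : CommutativeRing c ℓ) (σ : List Box) (c₀ : ℕ) (fr : Frame σ c₀) where
  open Frame fr
  C : ℕ
  C = maxCol σ
  open Matrices R c₀ C using (Par; []; _∷_; vecs)
  open Expansion R c₀ C using (ent; ent≥c₀; ent≤; ent-anti; ent-beyond; pars)
  open Reindex R c₀ C using (Rep; vec-choice; ent-ext)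
  open VerticalChain R c₀ C using (Par-ent)

  c₀≤C : c₀ ≤ C
  c₀≤C = ℕₚ.<⇒≤ (col≤maxCol σ corner)

  σ-row : ∀ i → 1 ≤ i → i ≤ maxRow σ → ∃[ j ] (i , j) ∈ σ
  σ-row i 1≤i i≤R with ℕₚ.m≤n⇒m<n∨m≡n i≤R
  ... | inj₂ refl = suc c₀ , corner
  ... | inj₁ i<R with c , m , _ ← linked i 1≤i i<R = c , m

  record Above (N : ℕ) (μ : List Box) : Set where
    field
      skewμ    : Skew μ
      contains : ∀ {b} → b ∈ σ → b ∈ μ
      colsμ    : ∀ {i j} → (i , j) ∈ μ → c₀ < j × j ≤ C
      rowsμ    : ∀ {i j} → (i , j) ∈ μ → i ≤ N

  -- An empty row would leave its two ends undetermined. Such rows occur only below `σ`, and there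
  -- `flat` fixes the left end.
  record Vectors {N} (μ : List Box) (p q : Vec ℕ N) : Set where
    field
      Par-outer : Par C p
      Par-inner : Par C q
      rep       : Rep μ p q
      proper    : ∀ i → i < maxRow σ → ent q i < ent p i
      flat      : ∀ i → maxRow σ ≤ i → ent q i ≡ c₀

  -- Each row of `μ` is an interval. That its ends decrease from row to row follows beside `σ` from
  -- the columns shared by neighbouring rows of `σ`, and below `σ` from the box `corner`.
  vectors : ∀ {N} → maxRow σ ≤ N → (μ : List Box) → Above N μ → Σ[ p ∈ Vec ℕ N ] Σ[ q ∈ Vec ℕ N ] Vectors μ p q
  vectors {N} R≤N μ ab = p , q , record
    { Par-outer = Par-ent C p (p≤C 0) p-anti
    ; Par-inner = Par-ent C q (≤-trans (q≤p 0) (p≤C 0)) q-anti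
    ; rep = record
      { unique = Skew.unique skewμ
      ; row≢0  = λ m → ℕₚ.n≮0 (proj₁ (Skew.positive skewμ m))
      ; inside = λ {i} {j} m → proj₁ (proj₂ (proj₂ (proj₂ (rows i (rowsμ m))))) j m
      ; member = λ {i} {j} a b → proj₂ (ok i (in-range a b)) j a b
      }
    ; proper = λ i i<R → proj₂ (proj₂ (proj₂ (proj₂ (proj₂ (rows i (≤-trans i<R R≤N)))))) i<R
    ; flat = flat
    }
    where
    open Above ab
    Row : ℕ → ℕ → ℕ → Set
    Row i n l = c₀ ≤ n × n ≤ l × l ≤ C × (∀ j → (suc i , j) ∈ μ → n < j × j ≤ l) × (maxRow σ ≤ i → n ≡ c₀) × (i < maxRow σ → n < l)
    Full : ℕ → ℕ → ℕ → Set
    Full i n l = Row i n l × (∀ j → n < j → j ≤ l → (suc i , j) ∈ μ)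
    choose : ∀ i → ∃[ n ] ∃[ l ] Full i n l
    choose i with T? (any (λ b → row b ≡ᵇ suc i) μ)
    ... | no nt = c₀ , c₀ , (≤-refl , ≤-refl , c₀≤C , (λ j m → ⊥-elim (nt (T-any⁺ _ μ _ m (≡⇒≡ᵇ (suc i) (suc i) refl))))
                  , (λ _ → refl) , (λ i<R → ⊥-elim (nt (let (j , m) = σ-row (suc i) (s≤s z≤n) i<R in T-any⁺ _ μ _ (contains m) (≡⇒≡ᵇ (suc i) (suc i) refl)))))
                  , λ j a b → ⊥-elim (<⇒≱ a b)
    ... | yes t with (i' , j₀) , m₀ , e ← T-any⁻ _ μ t with refl ← ≡ᵇ⇒≡ i' (suc i) e
      with n , l , n<l , ml , mn , h ← rowInterval μ skewμ (suc i) (j₀ , m₀) =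
      n , l , (ℕₚ.≤-pred (proj₁ (colsμ mn)) , ℕₚ.<⇒≤ n<l , proj₂ (colsμ ml) , h
        -- Below `σ` the box in column `suc c₀` lies between `corner` and any given box of the row,
        -- so every nonempty row begins there.
        , (λ R≤i → ℕₚ.≤-antisym (ℕₚ.≤-pred (proj₁ (h (suc c₀) (Skew.convex skewμ (contains corner) m₀ (ℕₚ.m≤n⇒m≤1+n R≤i) ≤-refl ≤-refl (proj₁ (colsμ m₀))))))
                     (ℕₚ.≤-pred (proj₁ (colsμ mn))))
        , λ _ → n<l)
        , λ j a b → Skew.convex skewμ mn ml ≤-refl ≤-refl a b
    qc = vec-choice N (λ i n → ∃[ l ] Full i n l) (λ i _ → choose i)
    q = proj₁ qc
    pc = vec-choice N (λ i l → Full i (ent q i) l) (λ i i<N → proj₂ qc i i<N)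
    p = proj₁ pc
    ok : ∀ i → i < N → Full i (ent q i) (ent p i)
    ok = proj₂ pc
    rows : ∀ i → i < N → Row i (ent q i) (ent p i)
    rows i i<N = proj₁ (ok i i<N)
    in-range : ∀ {i j} → ent q i < j → j ≤ ent p i → i < N
    in-range {i} a b with i ℕₚ.<? N
    ... | yes r = r
    ... | no nr rewrite ent-beyond p i (ℕₚ.≮⇒≥ nr) | ent-beyond q i (ℕₚ.≮⇒≥ nr) = ⊥-elim (<⇒≱ a b)
    c₀≤q : ∀ i → c₀ ≤ ent q i
    c₀≤q i with i ℕₚ.<? N
    ... | yes r = proj₁ (rows i r)
    ... | no nr rewrite ent-beyond q i (ℕₚ.≮⇒≥ nr) = ≤-refl
    q≤p : ∀ i → ent q i ≤ ent p i
    q≤p i with i ℕₚ.<? N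
    ... | yes r = proj₁ (proj₂ (rows i r))
    ... | no nr rewrite ent-beyond p i (ℕₚ.≮⇒≥ nr) | ent-beyond q i (ℕₚ.≮⇒≥ nr) = ≤-refl
    p≤C : ∀ i → ent p i ≤ C
    p≤C i with i ℕₚ.<? N
    ... | yes r = proj₁ (proj₂ (proj₂ (rows i r)))
    ... | no nr rewrite ent-beyond p i (ℕₚ.≮⇒≥ nr) = c₀≤C
    flat : ∀ i → maxRow σ ≤ i → ent q i ≡ c₀
    flat i R≤i with i ℕₚ.<? N
    ... | yes r = proj₁ (proj₂ (proj₂ (proj₂ (proj₂ (rows i r))))) R≤i
    ... | no nr = ent-beyond q i (ℕₚ.≮⇒≥ nr)
    out : ∀ {i j} → (suc i , j) ∈ μ → ent q i < j × j ≤ ent p i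
    out {i} {j} m = proj₁ (proj₂ (proj₂ (proj₂ (rows i (rowsμ m))))) j m
    mem : ∀ {i j} → ent q i < j → j ≤ ent p i → (suc i , j) ∈ μ
    mem {i} {j} a b = proj₂ (ok i (in-range a b)) j a b
    p-anti : ∀ i → ent p (suc i) ≤ ent p i
    p-anti i with ent p (suc i) ℕₚ.≤? ent q (suc i)
    ... | yes p≤q = ≤-trans p≤q (low (suc i ℕₚ.<? maxRow σ))
      where
      low : Dec (suc i < maxRow σ) → ent q (suc i) ≤ ent p i
      low (yes r) = ⊥-elim (<⇒≱ (proj₂ (proj₂ (proj₂ (proj₂ (proj₂ (rows (suc i) (≤-trans r R≤N)))))) r) p≤q)
      low (no nr) = ≤-trans (ℕₚ.≤-reflexive (flat (suc i) (ℕₚ.≮⇒≥ nr))) (≤-trans (c₀≤q i) (q≤p i))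
    ... | no np = high (suc i ℕₚ.<? maxRow σ)
      where
      m : (suc (suc i) , ent p (suc i)) ∈ μ
      m = mem (ℕₚ.≰⇒> np) ≤-refl
      high : Dec (suc i < maxRow σ) → ent p (suc i) ≤ ent p i
      high (no nr) = proj₂ (out (Skew.convex skewμ (contains corner) m (ℕₚ.≮⇒≥ nr) (ℕₚ.n≤1+n _) (proj₁ (colsμ m)) ≤-refl))
      high (yes r) with k , ic , sic ← linked (suc i) (s≤s z≤n) r with k ℕₚ.≤? ent p (suc i)
      ... | yes k≤ = proj₂ (out (Skew.convex skewμ (contains ic) m ≤-refl (ℕₚ.n≤1+n _) k≤ ≤-refl))
      ... | no k≰ = ≤-trans (ℕₚ.<⇒≤ (ℕₚ.≰⇒> k≰)) (proj₂ (out (contains ic)))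
    q-anti : ∀ i → ent q (suc i) ≤ ent q i
    q-anti i with suc i ℕₚ.<? maxRow σ
    ... | no nr = ≤-trans (ℕₚ.≤-reflexive (flat (suc i) (ℕₚ.≮⇒≥ nr))) (c₀≤q i)
    ... | yes r with k , ic , sic ← linked (suc i) (s≤s z≤n) r = ℕₚ.≤-pred (proj₁ (out (Skew.convex skewμ
          (mem {i} {suc (ent q i)} ≤-refl (≤-trans (proj₁ (out (contains ic))) (proj₂ (out (contains ic)))))
          (contains sic) (ℕₚ.n≤1+n _) ≤-refl ≤-refl (proj₁ (out (contains ic))))))

-- The shapes above `σ` as pairs of partitions.

∈-subsets⁺ : {A : Set} (f : A → Bool) (L : List A) → filterᵇ f L ∈ subsets L
∈-subsets⁺ f []      = here refl
∈-subsets⁺ f (x ∷ L) with f x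
... | true  = ∈-++⁺ʳ (subsets L) (∈-map⁺ (x ∷_) (∈-subsets⁺ f L))
... | false = ∈-++⁺ˡ (∈-subsets⁺ f L)

subsets-filterᵇ : {A : Set} (f : A → Bool) (L S : List A) → Unique L → S ∈ subsets L →
  (∀ x → x ∈ L → x ∈ S → T (f x)) → (∀ x → x ∈ L → T (f x) → x ∈ S) → S ≡ filterᵇ f L
subsets-filterᵇ f []      S _        (here refl) _ _ = refl
subsets-filterᵇ f (x ∷ L) S (a ∷ us) S∈ to from with ∈-++⁻ (subsets L) S∈
... | inj₁ m rewrite ¬T⇒false {f x} (λ t → All≢⇒∉ L a (∈-subsets L S m x (from x (here refl) t))) =
  subsets-filterᵇ f L S us m (λ y y∈ → to y (there y∈)) (λ y y∈ → from y (there y∈))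
... | inj₂ m with S' , S'∈ , refl ← ∈-map⁻ (x ∷_) m rewrite T⇒true (to x (here refl) (here refl)) =
  cong (x ∷_) (subsets-filterᵇ f L S' us S'∈ (λ y y∈ y∈S' → to y (there y∈) (there y∈S')) back)
  where
  back : ∀ y → y ∈ L → T (f y) → y ∈ S'
  back y y∈ t with from y (there y∈) t
  ... | here refl = ⊥-elim (All≢⇒∉ L a y∈)
  ... | there y∈S' = y∈S'

subsets-unique : {A : Set} (L : List A) → Unique L → Unique (subsets L)
subsets-unique []      _        = [] ∷ []
subsets-unique (x ∷ L) (a ∷ us) = Uniq.++⁺ (subsets-unique L us) (Uniq.map⁺ (λ { refl → refl }) (subsets-unique L us)) dis
  where
  dis : ∀ {S} → S ∈ subsets L × S ∈ map (x ∷_) (subsets L) → ⊥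
  dis (p , q) with S' , _ , refl ← ∈-map⁻ (x ∷_) q = All≢⇒∉ L a (∈-subsets L _ p x (here refl))

module ShapeSum {c ℓ} (R : CommutativeRing c ℓ) (σ : List Box) (c₀ : ℕ) (fr : Frame σ c₀) (N : ℕ) (R≤N : maxRow σ ≤ N) where
  open CommutativeRing R
    hiding (zero)
    renaming (refl to ≈-refl; sym to ≈-sym; trans to ≈-trans; reflexive to ≈-reflexive)
  open Frame fr
  open ShapeVectors R σ c₀ fr
  open Sums R
  open Matrices R c₀ C using (Par; []; _∷_; vecs)
  open Expansion R c₀ C using (ent; ent≥c₀; ent≤; ent-anti; ent-beyond; pars; ∈-pars⁺; ∈-pars⁻; parᵇ)
  open Reindex R c₀ C using (Rep; ent-ext; allI; T-allI⁺; T-allI⁻; vecs-unique)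
  open import Relation.Binary.Reasoning.Setoid setoid

  σ-above : Above N σ
  σ-above = record
    { skewμ = skew
    ; contains = λ m → m
    ; colsμ = λ m → columns m , col≤maxCol σ m
    ; rowsμ = λ m → ≤-trans (row≤maxRow σ m) R≤N
    }

  abstract
    outer inner : Vec ℕ N
    outer = proj₁ (vectors R≤N σ σ-above)
    inner = proj₁ (proj₂ (vectors R≤N σ σ-above))

    σ-vectors : Vectors σ outer inner
    σ-vectors = proj₂ (proj₂ (vectors R≤N σ σ-above))

  open Vectors σ-vectors renaming (rep to σ-rep; proper to σ-proper; flat to σ-flat; Par-outer to Par-λ; Par-inner to Par-ν)

  private
    in-σ : ∀ {i j} → (suc i , j) ∈ σ → ent inner i < j × j ≤ ent outer i
    in-σ = Rep.inside σ-rep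
    σ-mem : ∀ {i j} → ent inner i < j → j ≤ ent outer i → (suc i , j) ∈ σ
    σ-mem = Rep.member σ-rep

  row-pos : ∀ {j} → (0 , j) ∉ σ
  row-pos m = ℕₚ.n≮0 (proj₁ (Skew.positive skew m))

  σ-flat-outer : ∀ i → maxRow σ ≤ i → ent outer i ≤ c₀
  σ-flat-outer i R≤i with ent outer i ℕₚ.≤? c₀
  ... | yes p = p
  ... | no np = ⊥-elim (<⇒≱ (s≤s R≤i) (row≤maxRow σ (σ-mem {i} (subst (_< ent outer i) (sym (σ-flat i R≤i)) (ℕₚ.≰⇒> np)) ≤-refl)))

  ν≤λ : ∀ i → ent inner i ≤ ent outer i
  ν≤λ i with i ℕₚ.<? maxRow σ
  ... | yes r = ℕₚ.<⇒≤ (σ-proper i r)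
  ... | no nr = ≤-trans (ℕₚ.≤-reflexive (σ-flat i (ℕₚ.≮⇒≥ nr))) (ent≥c₀ Par-λ i)

  R-pos : 1 ≤ maxRow σ
  R-pos = ≤-trans (proj₁ (Skew.positive skew corner)) (row≤maxRow σ corner)

  top-row : ∀ j → j ≤ C → j ≤ ent outer 0
  top-row j j≤C with maxCol-attained σ corner
  ... | zero , m  = ⊥-elim (row-pos m)
  ... | suc i , m = ≤-trans j≤C (≤-trans (proj₂ (in-σ m)) (ent-anti Par-λ (z≤n {i})))

  -- The search starts in the bottom row, which begins at `suc c₀`. If a row ends before `j`, the
  -- row above it begins before `j`, because the two share a column. The top row reaches `C`, so the
  -- search ends with a box.
  cover : ∀ j → c₀ < j → j ≤ C → ∃[ i ] (suc i , j) ∈ σ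
  cover j c₀<j j≤C = enter (maxRow σ) refl R-pos
    where
    go : ∀ k → suc k ≤ maxRow σ → ent inner k < j → ∃[ i ] (suc i , j) ∈ σ
    go k k<R n<j with j ℕₚ.≤? ent outer k
    ... | yes p = k , σ-mem n<j p
    go zero k<R n<j | no np = ⊥-elim (np (top-row j j≤C))
    go (suc k) k<R n<j | no np with x , kx , skx ← linked (suc k) (s≤s z≤n) k<R =
      go k (ℕₚ.<⇒≤ k<R) (ℕₚ.<-trans (proj₁ (in-σ kx)) (ℕₚ.≤-<-trans (proj₂ (in-σ skx)) (ℕₚ.≰⇒> np)))
    enter : ∀ r → r ≡ maxRow σ → 1 ≤ r → ∃[ i ] (suc i , j) ∈ σ
    enter (suc r) e _ = go r (ℕₚ.≤-reflexive e)
      (ℕₚ.≤-<-trans (ℕₚ.≤-pred (proj₁ (in-σ (subst (λ z → (z , suc c₀) ∈ σ) (sym e) corner)))) c₀<j)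

  ∈-columnsOf⁺ : ∀ {j} → c₀ < j → j ≤ C → j ∈ columnsOf σ
  ∈-columnsOf⁺ {j} p q with i , m ← cover j p q =
    ∈-filterᵇ⁺ _ (range 1 (maxCol σ)) (∈-range⁺ (≤-trans (s≤s z≤n) p) q) (T-any⁺ _ σ (suc i , j) m (≡⇒≡ᵇ j j refl))

  ∈-columnsOf⁻ : ∀ {j} → j ∈ columnsOf σ → ∃[ i ] (i , j) ∈ σ
  ∈-columnsOf⁻ {j} m with (i , j') , b∈ , e ← T-any⁻ _ σ (proj₂ (∈-filterᵇ⁻ _ (range 1 (maxCol σ)) m)) with refl ← ≡ᵇ⇒≡ j' j e = i , b∈

  candidates : List Box
  candidates = candidateBoxes σ N

  ∈-candidates⁺ : ∀ {i j} → i < N → c₀ < j → j ≤ C → (suc i , j) ∈ candidates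
  ∈-candidates⁺ {i} p q r = ∈-concatMap (λ i → map (i ,_) (columnsOf σ)) (range 1 N) (∈-range⁺ (s≤s z≤n) p) (∈-map⁺ (suc i ,_) (∈-columnsOf⁺ q r))

  ∈-candidates⁻ : ∀ {i j} → (i , j) ∈ candidates → (1 ≤ i × i ≤ N) × (c₀ < j × j ≤ C)
  ∈-candidates⁻ m with i , i∈ , m' ← concatMap-∈ (λ i → map (i ,_) (columnsOf σ)) (range 1 N) m
    with j , j∈ , refl ← ∈-map⁻ (i ,_) m' with _ , b∈ ← ∈-columnsOf⁻ j∈ = ∈-range⁻ 1 N i∈ , columns b∈ , col≤maxCol σ b∈

  candidates-unique : Unique candidates
  candidates-unique = concatMap-unique (λ i → map (i ,_) (columnsOf σ)) (range 1 N) (range-unique 1 N)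
    (λ i → Uniq.map⁺ (λ { refl → refl }) (filterᵇ-unique _ (range 1 (maxCol σ)) (range-unique 1 (maxCol σ))))
    (λ x y b p q → lem x y b (∈-map⁻ _ p) (∈-map⁻ _ q))
    where
    lem : ∀ x y b → ∃[ j ] j ∈ columnsOf σ × b ≡ (x , j) → ∃[ j ] j ∈ columnsOf σ × b ≡ (y , j) → x ≡ y
    lem x y b (_ , _ , refl) (_ , _ , refl) = refl

  largerᵇ : Vec ℕ N × Vec ℕ N → Bool
  largerᵇ (p , q) = allI N (λ i → (ent outer i ≤ᵇ ent p i) ∧ (ent q i ≤ᵇ ent inner i))

  record Larger (p q : Vec ℕ N) : Set where
    field
      Par-p : Par C p
      Par-q : Par C q
      λ≤p   : ∀ i → ent outer i ≤ ent p i
      q≤ν   : ∀ i → ent q i ≤ ent inner i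

    q≤p : ∀ i → ent q i ≤ ent p i
    q≤p i = ≤-trans (q≤ν i) (≤-trans (ν≤λ i) (λ≤p i))

    flat-q : ∀ i → maxRow σ ≤ i → ent q i ≤ c₀
    flat-q i R≤i = ≤-trans (q≤ν i) (ℕₚ.≤-reflexive (σ-flat i R≤i))

  larger⁻ : ∀ p q → Par C p → Par C q → T (largerᵇ (p , q)) → Larger p q
  larger⁻ p q pp pq t = record { Par-p = pp ; Par-q = pq ; λ≤p = λ i → proj₁ (go i) ; q≤ν = λ i → proj₂ (go i) }
    where
    go : ∀ i → ent outer i ≤ ent p i × ent q i ≤ ent inner i
    go i with i ℕₚ.<? N
    ... | yes r with a , b ← T-∧⁻ {ent outer i ≤ᵇ ent p i} (T-allI⁻ N _ t i r) = ≤ᵇ⇒≤ _ _ a , ≤ᵇ⇒≤ _ _ b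
    ... | no nr rewrite ent-beyond p i (ℕₚ.≮⇒≥ nr) | ent-beyond q i (ℕₚ.≮⇒≥ nr) | ent-beyond outer i (ℕₚ.≮⇒≥ nr) | ent-beyond inner i (ℕₚ.≮⇒≥ nr) = ≤-refl , ≤-refl

  larger⁺ : ∀ p q → (∀ i → ent outer i ≤ ent p i) → (∀ i → ent q i ≤ ent inner i) → T (largerᵇ (p , q))
  larger⁺ p q f g = T-allI⁺ N _ (λ i _ → T-∧⁺ (≤⇒≤ᵇ (f i)) (≤⇒≤ᵇ (g i)))

  insideᵇ : Vec ℕ N × Vec ℕ N → Box → Bool
  insideᵇ (p , q) (i , j) = (ent q (ℕ.pred i) <ᵇ j) ∧ (j ≤ᵇ ent p (ℕ.pred i))

  boxes : Vec ℕ N × Vec ℕ N → List Box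
  boxes pq = filterᵇ (insideᵇ pq) candidates

  boxes-Rep : ∀ p q → Par C p → Par C q → Rep (boxes (p , q)) p q
  boxes-Rep p q pp pq = record
    { unique = filterᵇ-unique _ candidates candidates-unique
    ; row≢0  = λ m → ℕₚ.n≮0 (proj₁ (proj₁ (∈-candidates⁻ (proj₁ (∈-filterᵇ⁻ (insideᵇ (p , q)) candidates m)))))
    ; inside = λ {i} {j} m → let (a , b) = T-∧⁻ {ent q i <ᵇ j} (proj₂ (∈-filterᵇ⁻ (insideᵇ (p , q)) candidates m)) in <ᵇ⇒< _ _ a , ≤ᵇ⇒≤ _ _ b
    ; member = mem
    }
    where
    mem : ∀ {i j} → ent q i < j → j ≤ ent p i → (suc i , j) ∈ boxes (p , q)
    mem {i} {j} a b with i ℕₚ.<? N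
    ... | yes r = ∈-filterᵇ⁺ (insideᵇ (p , q)) candidates (∈-candidates⁺ r (ℕₚ.≤-<-trans (ent≥c₀ pq i) a) (≤-trans b (ent≤ pp i))) (T-∧⁺ (<⇒<ᵇ a) (≤⇒≤ᵇ b))
    ... | no nr rewrite ent-beyond p i (ℕₚ.≮⇒≥ nr) | ent-beyond q i (ℕₚ.≮⇒≥ nr) = ⊥-elim (<⇒≱ a b)

  shapeᵇ : List Box → Bool
  shapeᵇ μ = isSkewShape μ ∧ containsᵇ μ σ

  boxes-shape : ∀ p q → Larger p q → T (shapeᵇ (boxes (p , q)))
  boxes-shape p q lg = T-∧⁺ (skew⁺ μ sk) (T-∧⁺ (T-all⁺ _ σ (λ b b∈ → memᵇ⁺ μ (sub b b∈)))
      (T-all⁺ _ μ (λ b b∈ → col b b∈)))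
    where
    open Larger lg
    μ = boxes (p , q)
    rep = boxes-Rep p q Par-p Par-q
    cand : ∀ {b} → b ∈ μ → b ∈ candidates
    cand m = proj₁ (∈-filterᵇ⁻ (insideᵇ (p , q)) candidates m)
    cv : Convex μ
    cv {zero} a∈ _ _ _ _ _ = ⊥-elim (Rep.row≢0 rep a∈)
    cv {suc i} {r = zero} _ _ () _ _ _
    cv {suc i} {r = suc r} {i' = zero} _ _ _ () _ _
    cv {suc i} {r = suc r} {i' = suc i'} a∈ c∈ (s≤s ir) (s≤s ri) js sj = Rep.member rep
      (ℕₚ.≤-<-trans (ent-anti Par-q ir) (ℕₚ.<-≤-trans (proj₁ (Rep.inside rep a∈)) js))
      (≤-trans sj (≤-trans (proj₂ (Rep.inside rep c∈)) (ent-anti Par-p ri)))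
    sk : Skew μ
    sk = record { unique = Rep.unique rep ; convex = cv
      ; positive = λ m → let (x , y) = ∈-candidates⁻ (cand m) in proj₁ x , ≤-trans (s≤s z≤n) (proj₁ y) }
    sub : ∀ b → b ∈ σ → b ∈ μ
    sub (zero , _)  b∈ = ⊥-elim (row-pos b∈)
    sub (suc i , j) b∈ with x , y ← in-σ b∈ = Rep.member rep (ℕₚ.≤-<-trans (q≤ν i) x) (≤-trans y (λ≤p i))
    col : ∀ b → b ∈ μ → T (any (sameColumnᵇ b) σ)
    col (i , j) b∈ with y , z ← proj₂ (∈-candidates⁻ (cand b∈)) with k , m ← cover j y z = T-any⁺ _ σ (suc k , j) m (≡⇒≡ᵇ j j refl)

  shape-above : ∀ μ → μ ∈ subsets candidates → T (shapeᵇ μ) → Above N μ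
  shape-above μ μ∈ t with s , c ← T-∧⁻ {isSkewShape μ} t with cσ , _ ← T-∧⁻ {all (λ b → memᵇ b μ) σ} c = record
    { skewμ = skew⁻ μ s
    ; contains = λ m → memᵇ⁻ μ (T-all⁻ _ σ cσ _ m)
    ; colsμ = λ m → proj₂ (∈-candidates⁻ (∈-subsets candidates μ μ∈ _ m))
    ; rowsμ = λ m → proj₂ (proj₁ (∈-candidates⁻ (∈-subsets candidates μ μ∈ _ m)))
    }

  vectors-larger : ∀ μ p q → Above N μ → Vectors μ p q → Larger p q
  vectors-larger μ p q ab vs = record { Par-p = V.Par-outer ; Par-q = V.Par-inner ; λ≤p = le ; q≤ν = ge }
    where
    module V = Vectors vs
    le : ∀ i → ent outer i ≤ ent p i
    le i with i ℕₚ.<? maxRow σ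
    ... | yes r = proj₂ (Rep.inside V.rep (Above.contains ab (σ-mem {i} (σ-proper i r) ≤-refl)))
    ... | no nr = ≤-trans (σ-flat-outer i (ℕₚ.≮⇒≥ nr)) (ent≥c₀ V.Par-outer i)
    ge : ∀ i → ent q i ≤ ent inner i
    ge i with i ℕₚ.<? maxRow σ
    ... | yes r = ℕₚ.≤-pred (proj₁ (Rep.inside V.rep (Above.contains ab (σ-mem {i} ≤-refl (σ-proper i r)))))
    ... | no nr = ≤-trans (ℕₚ.≤-reflexive (V.flat i (ℕₚ.≮⇒≥ nr))) (ent≥c₀ Par-ν i)

  vectors-boxes : ∀ μ p q → μ ∈ subsets candidates → Vectors μ p q → μ ≡ boxes (p , q)
  vectors-boxes μ p q μ∈ vs = subsets-filterᵇ (insideᵇ (p , q)) candidates μ candidates-unique μ∈ to from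
    where
    module V = Vectors vs
    to : ∀ b → b ∈ candidates → b ∈ μ → T (insideᵇ (p , q) b)
    to (zero , j)  _ m = ⊥-elim (Rep.row≢0 V.rep m)
    to (suc i , j) _ m with x , y ← Rep.inside V.rep m = T-∧⁺ (<⇒<ᵇ x) (≤⇒≤ᵇ y)
    from : ∀ b → b ∈ candidates → T (insideᵇ (p , q) b) → b ∈ μ
    from (zero , j)  c∈ _ = ⊥-elim (ℕₚ.n≮0 (proj₁ (proj₁ (∈-candidates⁻ c∈))))
    from (suc i , j) _  t with x , y ← T-∧⁻ {ent q i <ᵇ j} t = Rep.member V.rep (<ᵇ⇒< _ _ x) (≤ᵇ⇒≤ _ _ y)

  -- A nonempty row determines its ends. The rows of `σ` stay nonempty, and in an empty row further
  -- down both ends must be `c₀`.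
  boxes-injective : ∀ p q p' q' → Larger p q → Larger p' q' → boxes (p , q) ≡ boxes (p' , q') → (p , q) ≡ (p' , q')
  boxes-injective p q p' q' lg lg' e = cong₂ _,_
    (ent-ext p p' (λ i _ → ℕₚ.≤-antisym (out lg lg' e i) (out lg' lg (sym e) i)))
    (ent-ext q q' (λ i _ → ℕₚ.≤-antisym (inn lg' lg (sym e) i) (inn lg lg' e i)))
    where
    nonempty : ∀ {p q} → Larger p q → ∀ i → i < maxRow σ → ent q i < ent p i
    nonempty lg i r = ℕₚ.≤-<-trans (Larger.q≤ν lg i) (ℕₚ.<-≤-trans (σ-proper i r) (Larger.λ≤p lg i))
    transport : ∀ {p q p' q'} → Larger p q → Larger p' q' → boxes (p , q) ≡ boxes (p' , q') → ∀ {i j} →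
      ent q i < j → j ≤ ent p i → ent q' i < j × j ≤ ent p' i
    transport {p} {q} {p'} {q'} lg lg' e a b = Rep.inside (boxes-Rep p' q' (Larger.Par-p lg') (Larger.Par-q lg'))
      (subst (_ ∈_) e (Rep.member (boxes-Rep p q (Larger.Par-p lg) (Larger.Par-q lg)) a b))
    out : ∀ {p q p' q'} → Larger p q → Larger p' q' → boxes (p , q) ≡ boxes (p' , q') → ∀ i → ent p i ≤ ent p' i
    out {p} {q} {p'} {q'} lg lg' e i with ent p i ℕₚ.≤? ent q i
    ... | no np = proj₂ (transport lg lg' e (ℕₚ.≰⇒> np) ≤-refl)
    ... | yes p≤q with i ℕₚ.<? maxRow σ
    ...   | yes r = ⊥-elim (<⇒≱ (nonempty lg i r) p≤q)
    ...   | no nr = ≤-trans p≤q (≤-trans (Larger.flat-q lg i (ℕₚ.≮⇒≥ nr)) (ent≥c₀ (Larger.Par-p lg') i))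
    inn : ∀ {p q p' q'} → Larger p q → Larger p' q' → boxes (p , q) ≡ boxes (p' , q') → ∀ i → ent q' i ≤ ent q i
    inn {p} {q} {p'} {q'} lg lg' e i with i ℕₚ.<? maxRow σ
    ... | yes r = ℕₚ.≤-pred (proj₁ (transport lg lg' e ≤-refl (nonempty lg i r)))
    ... | no nr = ≤-trans (Larger.flat-q lg' i (ℕₚ.≮⇒≥ nr)) (ent≥c₀ (Larger.Par-q lg) i)

  parPairs : List (Vec ℕ N × Vec ℕ N)
  parPairs = concatMap (λ p → map (p ,_) (pars N)) (pars N)

  pars-unique : Unique (pars N)
  pars-unique = filterᵇ-unique _ (vecs N) (vecs-unique N)

  parPairs-unique : Unique parPairs
  parPairs-unique = concatMap-unique (λ p → map (p ,_) (pars N)) (pars N) pars-unique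
    (λ p → Uniq.map⁺ (λ { refl → refl }) pars-unique) (λ x y b u v → lem x y b (∈-map⁻ _ u) (∈-map⁻ _ v))
    where
    lem : ∀ x y b → ∃[ q ] q ∈ pars N × b ≡ (x , q) → ∃[ q ] q ∈ pars N × b ≡ (y , q) → x ≡ y
    lem x y b (_ , _ , refl) (_ , _ , refl) = refl

  ∈-parPairs⁻ : ∀ {p q} → (p , q) ∈ parPairs → Par C p × Par C q
  ∈-parPairs⁻ m with p , p∈ , m' ← concatMap-∈ (λ p → map (p ,_) (pars N)) (pars N) m
    with q , q∈ , refl ← ∈-map⁻ (p ,_) m' = proj₂ (∈-pars⁻ p∈) , proj₂ (∈-pars⁻ q∈)

  -- Since no row of `σ` is empty, containing `σ` means exactly that the right ends are at least
  -- `outer` and the left ends at most `inner`. The column condition holds of itself, as `σ` meets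
  -- every column from `suc c₀` to `C`.
  ∑-shapes : (f : List Box → Carrier) →
    ∑ (shapesAbove σ N) f ≈ ∑ (pars N) (λ p → ∑ (pars N) (λ q → ⟦ largerᵇ (p , q) ⟧ * f (boxes (p , q))))
  ∑-shapes f = begin
    ∑ (shapesAbove σ N) f
      ≈⟨ ∑-reindex (shapesAbove σ N) (filterᵇ largerᵇ parPairs) boxes f
           (filterᵇ-unique _ (subsets candidates) (subsets-unique candidates candidates-unique))
           (filterᵇ-unique largerᵇ parPairs parPairs-unique)
           (λ pq pq' m m' → boxes-injective _ _ _ _ (lg m) (lg m'))
           (λ { (p , q) m → ∈-filterᵇ⁺ shapeᵇ (subsets candidates) (∈-subsets⁺ (insideᵇ (p , q)) candidates) (boxes-shape p q (lg m)) })
           from ⟩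
    ∑ (filterᵇ largerᵇ parPairs) (f ∘ boxes)
      ≈⟨ ∑-filterᵇ largerᵇ parPairs (f ∘ boxes) ⟩
    ∑ parPairs (λ pq → ⟦ largerᵇ pq ⟧ * f (boxes pq))
      ≈⟨ ∑-concatMap (λ p → map (p ,_) (pars N)) (pars N) _ ⟩
    ∑ (pars N) (λ p → ∑ (map (p ,_) (pars N)) (λ pq → ⟦ largerᵇ pq ⟧ * f (boxes pq)))
      ≈⟨ ∑-cong (pars N) (λ p → ≈-reflexive (∑-map (p ,_) (pars N) _)) ⟩
    ∑ (pars N) (λ p → ∑ (pars N) (λ q → ⟦ largerᵇ (p , q) ⟧ * f (boxes (p , q)))) ∎
    where
    lg : ∀ {pq} → pq ∈ filterᵇ largerᵇ parPairs → Larger (proj₁ pq) (proj₂ pq)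
    lg {p , q} m with a , t ← ∈-filterᵇ⁻ largerᵇ parPairs m with pp , pq ← ∈-parPairs⁻ a = larger⁻ p q pp pq t
    from : ∀ μ → μ ∈ shapesAbove σ N → ∃[ pq ] pq ∈ filterᵇ largerᵇ parPairs × μ ≡ boxes pq
    from μ m = (p , q) , ∈-filterᵇ⁺ largerᵇ parPairs
        (∈-concatMap (λ p → map (p ,_) (pars N)) (pars N) (∈-pars⁺ (Larger.Par-p lg')) (∈-map⁺ (p ,_) (∈-pars⁺ (Larger.Par-q lg'))))
        (larger⁺ p q (Larger.λ≤p lg') (Larger.q≤ν lg'))
      , vectors-boxes μ p q μ∈ (proj₂ (proj₂ vs))
      where
      m⁻ = ∈-filterᵇ⁻ shapeᵇ (subsets candidates) m
      μ∈ = proj₁ m⁻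
      ab = shape-above μ μ∈ (proj₂ m⁻)
      vs = vectors R≤N μ ab
      p = proj₁ vs
      q = proj₁ (proj₂ vs)
      lg' = vectors-larger μ p q ab (proj₂ (proj₂ vs))

  module _ (p q : Vec ℕ N) (lg : Larger p q) (μ : List Box) (rep : Rep μ p q) where
    open Larger lg

    private
      aboveᵇ belowᵇ : Box → Bool
      aboveᵇ b = not (memᵇ b σ) ∧ any (λ s → sameColumnᵇ b s ∧ (row b <ᵇ row s)) σ
      belowᵇ b = not (memᵇ b σ) ∧ any (λ s → sameColumnᵇ b s ∧ (row s <ᵇ row b)) σ

    -- A box of `μ` above some box of `σ` is not beyond `outer`, as the row ends decrease. If it is
    -- outside `σ`, it must therefore lie at or before `inner`.
    Aboxes-Rep : Rep (Aboxes σ μ) inner q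
    Aboxes-Rep = record
      { unique = filterᵇ-unique aboveᵇ μ (Rep.unique rep)
      ; row≢0  = λ m → Rep.row≢0 rep (proj₁ (∈-filterᵇ⁻ aboveᵇ μ m))
      ; inside = ins
      ; member = mem
      }
      where
      ins : ∀ {i j} → (suc i , j) ∈ Aboxes σ μ → ent q i < j × j ≤ ent inner i
      ins {i} {j} m with m∈ , t ← ∈-filterᵇ⁻ aboveᵇ μ m with ∉σ , s ← T-∧⁻ {not (memᵇ (suc i , j) σ)} t
        with (i' , j') , s∈ , u ← T-any⁻ _ σ s with e , lt ← T-∧⁻ {j ≡ᵇ j'} u with refl ← ≡ᵇ⇒≡ j j' e | i' | <ᵇ⇒< (suc i) i' lt
      ... | suc k | s≤s i<k with j ℕₚ.≤? ent inner i
      ...   | yes p = proj₁ (Rep.inside rep m∈) , p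
      ...   | no np = ⊥-elim (T-not⁻ ∉σ (memᵇ⁺ σ (σ-mem (ℕₚ.≰⇒> np) (≤-trans (proj₂ (in-σ s∈)) (ent-anti Par-λ (ℕₚ.<⇒≤ i<k))))))
      mem : ∀ {i j} → ent q i < j → j ≤ ent inner i → (suc i , j) ∈ Aboxes σ μ
      mem {i} {j} a b with k , s∈ ← cover j (ℕₚ.≤-<-trans (ent≥c₀ Par-q i) a) (≤-trans b (ent≤ Par-ν i)) =
        ∈-filterᵇ⁺ aboveᵇ μ (Rep.member rep a (≤-trans b (≤-trans (ν≤λ i) (λ≤p i))))
          (T-∧⁺ (T-not⁺ (λ t → <⇒≱ (proj₁ (in-σ (memᵇ⁻ {suc i , j} σ t))) b)) (T-any⁺ _ σ (suc k , j) s∈ (T-∧⁺ (≡⇒≡ᵇ j j refl) (<⇒<ᵇ (s≤s lt)))))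
        where
        lt : i < k
        lt with i ℕₚ.<? k
        ... | yes r = r
        ... | no nr = ⊥-elim (<⇒≱ (proj₁ (in-σ s∈)) (≤-trans b (ent-anti Par-ν (ℕₚ.≮⇒≥ nr))))

    Bboxes-Rep : Rep (Bboxes σ μ) p outer
    Bboxes-Rep = record
      { unique = filterᵇ-unique belowᵇ μ (Rep.unique rep)
      ; row≢0  = λ m → Rep.row≢0 rep (proj₁ (∈-filterᵇ⁻ belowᵇ μ m))
      ; inside = ins
      ; member = mem
      }
      where
      ins : ∀ {i j} → (suc i , j) ∈ Bboxes σ μ → ent outer i < j × j ≤ ent p i
      ins {i} {j} m with m∈ , t ← ∈-filterᵇ⁻ belowᵇ μ m with ∉σ , s ← T-∧⁻ {not (memᵇ (suc i , j) σ)} t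
        with (i' , j') , s∈ , u ← T-any⁻ _ σ s with e , lt ← T-∧⁻ {j ≡ᵇ j'} u with refl ← ≡ᵇ⇒≡ j j' e | i' | <ᵇ⇒< i' (suc i) lt
      ... | zero  | _ = ⊥-elim (row-pos s∈)
      ... | suc k | s≤s k<i with j ℕₚ.≤? ent outer i
      ...   | no np = ℕₚ.≰⇒> np , proj₂ (Rep.inside rep m∈)
      ...   | yes p = ⊥-elim (T-not⁻ ∉σ (memᵇ⁺ σ (σ-mem (ℕₚ.≤-<-trans (ent-anti Par-ν (ℕₚ.<⇒≤ k<i)) (proj₁ (in-σ s∈))) p)))
      mem : ∀ {i j} → ent outer i < j → j ≤ ent p i → (suc i , j) ∈ Bboxes σ μ
      mem {i} {j} a b with k , s∈ ← cover j (ℕₚ.≤-<-trans (ent≥c₀ Par-λ i) a) (≤-trans b (ent≤ Par-p i)) =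
        ∈-filterᵇ⁺ belowᵇ μ (Rep.member rep (ℕₚ.≤-<-trans (≤-trans (q≤ν i) (ν≤λ i)) a) b)
          (T-∧⁺ (T-not⁺ (λ t → <⇒≱ a (proj₂ (in-σ (memᵇ⁻ {suc i , j} σ t))))) (T-any⁺ _ σ (suc k , j) s∈ (T-∧⁺ (≡⇒≡ᵇ j j refl) (<⇒<ᵇ (s≤s lt)))))
        where
        lt : k < i
        lt with k ℕₚ.<? i
        ... | yes r = r
        ... | no nr = ⊥-elim (<⇒≱ a (≤-trans (proj₂ (in-σ s∈)) (ent-anti Par-λ (ℕₚ.≮⇒≥ nr))))

-- The monoid ring and coefficients

-- Elements of ℤ[ℕ^I] are formal sums, equal when no functional on exponents separates them: this avoids
-- normal forms, and reading off a coefficient is applying such a functional.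
module MonoidRing (I : Set) where
  Exponent : Set
  Exponent = I → ℕ

  _⊕_ : Exponent → Exponent → Exponent
  (m ⊕ k) i = m i ℕ.+ k i

  Elem : Set
  Elem = List (ℤ × Exponent)

  eval : Elem → (Exponent → ℤ) → ℤ
  eval []            φ = ℤ.+ 0
  eval ((c , m) ∷ f) φ = c ℤ.* φ m ℤ.+ eval f φ

  Resp : (Exponent → ℤ) → Set
  Resp φ = ∀ {m k} → (∀ i → m i ≡ k i) → φ m ≡ φ k

  infix 4 _≋_
  record _≋_ (f g : Elem) : Set where
    constructor by
    field on : ∀ φ → Resp φ → eval f φ ≡ eval g φ

  open _≋_ public

  scale : ℤ × Exponent → Elem → Elem
  scale (c , m) = map (λ (d , k) → c ℤ.* d , m ⊕ k)

  _⊛_ : Elem → Elem → Elem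
  f ⊛ g = concatMap (λ t → scale t g) f

  ⊖_ : Elem → Elem
  ⊖_ = map (λ (c , m) → ℤ.- c , m)

  mono : ℤ → Exponent → Elem
  mono c m = (c , m) ∷ []

  open ℤSolver.+-*-Solver

  eval-++ : ∀ f g φ → eval (f ++ g) φ ≡ eval f φ ℤ.+ eval g φ
  eval-++ []            g φ = sym (ℤₚ.+-identityˡ _)
  eval-++ ((c , m) ∷ f) g φ rewrite eval-++ f g φ = sym (ℤₚ.+-assoc (c ℤ.* φ m) (eval f φ) (eval g φ))

  eval-cong : ∀ f {φ ψ} → (∀ m → φ m ≡ ψ m) → eval f φ ≡ eval f ψ
  eval-cong []            h = refl
  eval-cong ((c , m) ∷ f) h = cong₂ (λ x y → c ℤ.* x ℤ.+ y) (h m) (eval-cong f h)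

  eval-⊖ : ∀ f φ → eval (⊖ f) φ ≡ ℤ.- eval f φ
  eval-⊖ []            φ = refl
  eval-⊖ ((c , m) ∷ f) φ rewrite eval-⊖ f φ = solve 3 (λ c x y → :- c :* x :+ :- y := :- (c :* x :+ y)) refl c (φ m) (eval f φ)

  eval-+ : ∀ f φ ψ → eval f (λ m → φ m ℤ.+ ψ m) ≡ eval f φ ℤ.+ eval f ψ
  eval-+ []            φ ψ = refl
  eval-+ ((c , m) ∷ f) φ ψ rewrite eval-+ f φ ψ = solve 5 (λ c x y a b → c :* (x :+ y) :+ (a :+ b) := (c :* x :+ a) :+ (c :* y :+ b)) refl
    c (φ m) (ψ m) (eval f φ) (eval f ψ)

  eval-* : ∀ f a φ → eval f (λ m → a ℤ.* φ m) ≡ a ℤ.* eval f φ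
  eval-* []            a φ = sym (ℤₚ.*-zeroʳ a)
  eval-* ((c , m) ∷ f) a φ rewrite eval-* f a φ = solve 4 (λ c a x y → c :* (a :* x) :+ a :* y := a :* (c :* x :+ y)) refl c a (φ m) (eval f φ)

  eval-0 : ∀ f → eval f (λ _ → ℤ.+ 0) ≡ ℤ.+ 0
  eval-0 []            = refl
  eval-0 ((c , m) ∷ f) rewrite eval-0 f | ℤₚ.*-zeroʳ c = refl

  eval-scale : ∀ c m g φ → eval (scale (c , m) g) φ ≡ c ℤ.* eval g (λ k → φ (m ⊕ k))
  eval-scale c m []            φ = sym (ℤₚ.*-zeroʳ c)
  eval-scale c m ((d , k) ∷ g) φ rewrite eval-scale c m g φ =
    solve 4 (λ c d x y → c :* d :* x :+ c :* y := c :* (d :* x :+ y)) refl c d (φ (m ⊕ k)) (eval g (λ k → φ (m ⊕ k)))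

  -- Evaluation of a product is iterated evaluation, so the laws of multiplication reduce to those
  -- for adding exponents and to the exchange of two finite sums.
  eval-⊛ : ∀ f g φ → eval (f ⊛ g) φ ≡ eval f (λ m → eval g (λ k → φ (m ⊕ k)))
  eval-⊛ []            g φ = refl
  eval-⊛ ((c , m) ∷ f) g φ = trans (eval-++ (scale (c , m) g) (f ⊛ g) φ) (cong₂ ℤ._+_ (eval-scale c m g φ) (eval-⊛ f g φ))

  eval-swap : ∀ f g (ψ : Exponent → Exponent → ℤ) → eval f (λ m → eval g (ψ m)) ≡ eval g (λ k → eval f (λ m → ψ m k))
  eval-swap []            g ψ = sym (eval-0 g)
  eval-swap ((c , m) ∷ f) g ψ rewrite eval-swap f g ψ = sym (trans (eval-+ g _ _) (cong (ℤ._+ _) (eval-* g c (ψ m))))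

  resp-⊕ : ∀ {φ} → Resp φ → ∀ m → Resp (λ k → φ (m ⊕ k))
  resp-⊕ r m e = r (λ i → cong (m i ℕ.+_) (e i))

  resp-eval : ∀ {φ} → Resp φ → ∀ g → Resp (λ m → eval g (λ k → φ (m ⊕ k)))
  resp-eval r g e = eval-cong g (λ k → r (λ i → cong (ℕ._+ k i) (e i)))

  ⊛-cong : ∀ {f f' g g'} → f ≋ f' → g ≋ g' → f ⊛ g ≋ f' ⊛ g'
  ⊛-cong {f} {f'} {g} {g'} p q = by λ φ r → trans (eval-⊛ f g φ) (trans (eval-cong f (λ m → on q _ (resp-⊕ r m)))
    (trans (on p _ (resp-eval r g')) (sym (eval-⊛ f' g' φ))))

  ⊛-assoc : ∀ f g h → (f ⊛ g) ⊛ h ≋ f ⊛ (g ⊛ h)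
  ⊛-assoc f g h = by λ φ r → trans (eval-⊛ (f ⊛ g) h φ) (trans (eval-⊛ f g _) (trans
    (eval-cong f (λ m → trans (eval-cong g (λ k → eval-cong h (λ l → r (λ i → ℕₚ.+-assoc (m i) (k i) (l i)))))
      (sym (eval-⊛ g h (λ k → φ (m ⊕ k))))))
    (sym (eval-⊛ f (g ⊛ h) φ))))

  ⊛-comm : ∀ f g → f ⊛ g ≋ g ⊛ f
  ⊛-comm f g = by λ φ r → trans (eval-⊛ f g φ) (trans (eval-swap f g _) (trans
    (eval-cong g (λ k → eval-cong f (λ m → r (λ i → ℕₚ.+-comm (m i) (k i))))) (sym (eval-⊛ g f φ))))

  𝟙 : Elem
  𝟙 = mono (ℤ.+ 1) (λ _ → 0)

  ⊛-identityˡ : ∀ f → 𝟙 ⊛ f ≋ f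
  ⊛-identityˡ f = by λ φ r → trans (eval-⊛ 𝟙 f φ) (trans (ℤₚ.+-identityʳ _) (ℤₚ.*-identityˡ _))

  distribʳ : ∀ f g h → (g ++ h) ⊛ f ≋ (g ⊛ f) ++ (h ⊛ f)
  distribʳ f g h = by λ φ r → trans (eval-⊛ (g ++ h) f φ) (trans (eval-++ g h _)
    (sym (trans (eval-++ (g ⊛ f) (h ⊛ f) φ) (cong₂ ℤ._+_ (eval-⊛ g f φ) (eval-⊛ h f φ)))))

  ring : CommutativeRing 0ℓ 0ℓ
  ring = record
    { Carrier = Elem ; _≈_ = _≋_ ; _+_ = _++_ ; _*_ = _⊛_ ; -_ = ⊖_ ; 0# = [] ; 1# = 𝟙
    ; isCommutativeRing = record
      { isRing = record
        { +-isAbelianGroup = record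
          { isGroup = record
            { isMonoid = record
              { isSemigroup = record
                { isMagma = record
                  { isEquivalence = record
                    { refl  = by λ _ _ → refl
                    ; sym   = λ p → by λ φ r → sym (on p φ r)
                    ; trans = λ p q → by λ φ r → trans (on p φ r) (on q φ r)
                    }
                  ; ∙-cong = λ {f} {f'} {g} {g'} p q → by λ φ r → trans (eval-++ f g φ) (trans (cong₂ ℤ._+_ (on p φ r) (on q φ r)) (sym (eval-++ f' g' φ)))
                  }
                ; assoc = λ f g h → by λ φ r → cong (λ z → eval z φ) (++-assoc f g h)
                }
              ; identity = (λ f → by λ φ r → refl) , (λ f → by λ φ r → cong (λ z → eval z φ) (++-identityʳ f))
              }
            ; inverse = (λ f → by λ φ r → trans (eval-++ (⊖ f) f φ) (trans (cong (ℤ._+ eval f φ) (eval-⊖ f φ)) (ℤₚ.+-inverseˡ (eval f φ))))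
                      , (λ f → by λ φ r → trans (eval-++ f (⊖ f) φ) (trans (cong (λ z → eval f φ ℤ.+ z) (eval-⊖ f φ)) (ℤₚ.+-inverseʳ (eval f φ))))
            ; ⁻¹-cong = λ {f} {g} p → by λ φ r → trans (eval-⊖ f φ) (trans (cong ℤ.-_ (on p φ r)) (sym (eval-⊖ g φ)))
            }
          ; comm = λ f g → by λ φ r → trans (eval-++ f g φ) (trans (ℤₚ.+-comm (eval f φ) (eval g φ)) (sym (eval-++ g f φ)))
          }
        ; *-cong = ⊛-cong
        ; *-assoc = ⊛-assoc
        ; *-identity = ⊛-identityˡ , (λ f → by λ φ r → trans (on (⊛-comm f 𝟙) φ r) (on (⊛-identityˡ f) φ r))
        ; distrib = (λ f g h → by λ φ r → trans (on (⊛-comm f (g ++ h)) φ r) (trans (on (distribʳ f g h) φ r)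
                      (trans (eval-++ (g ⊛ f) (h ⊛ f) φ) (trans (cong₂ ℤ._+_ (on (⊛-comm g f) φ r) (on (⊛-comm h f) φ r)) (sym (eval-++ (f ⊛ g) (f ⊛ h) φ))))))
                  , distribʳ
        }
      ; *-comm = ⊛-comm
      }
    }
    where open import Data.List.Properties using (++-assoc; ++-identityʳ)

  open Sums ring using (∑; ∏)
  private
    module S = Sums ring
    module Z = Sums ℤₚ.+-*-commutativeRing

  eval-∑ : {A : Set} (xs : List A) (f : A → Elem) (φ : Exponent → ℤ) → eval (∑ xs f) φ ≡ Z.∑ xs (λ x → eval (f x) φ)
  eval-∑ []       f φ = refl
  eval-∑ (x ∷ xs) f φ = trans (eval-++ (f x) (∑ xs f) φ) (cong (λ z → eval (f x) φ ℤ.+ z) (eval-∑ xs f φ))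

  mono-cong : ∀ {c d m k} → c ≡ d → (∀ i → m i ≡ k i) → mono c m ≋ mono d k
  mono-cong {c} refl h = by λ φ r → cong (λ x → c ℤ.* x ℤ.+ ℤ.+ 0) (r h)

  ⟦⟧-mono : ∀ b c m φ → eval (S.⟦ b ⟧ ⊛ mono c m) φ ≡ Z.⟦ b ⟧ ℤ.* (c ℤ.* φ m)
  ⟦⟧-mono true  c m φ = trans (ℤₚ.+-identityʳ _) (ℤₚ.*-assoc (ℤ.+ 1) c (φ m))
  ⟦⟧-mono false c m φ = refl

-- The identity in an arbitrary commutative ring.

module Master {c ℓ} (R : CommutativeRing c ℓ) (σ : List Box) (c₀ : ℕ) (fr : Frame σ c₀)
  (X u : ℕ → CommutativeRing.Carrier R) (u₀ : CommutativeRing._≈_ R (u 0) (CommutativeRing.0# R))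
  (n N : ℕ) (n+R<N : n ℕ.+ maxRow σ < N) where
  open CommutativeRing R
    hiding (zero)
    renaming (refl to ≈-refl; sym to ≈-sym; trans to ≈-trans; reflexive to ≈-reflexive)
  open Sums R
  open Peel R
  open Labels R
  open ShapeVectors R σ c₀ fr using (C; module Vectors)
  R≤N : maxRow σ ≤ N
  R≤N = ≤-trans (ℕₚ.m≤n+m (maxRow σ) n) (ℕₚ.<⇒≤ n+R<N)
  open Matrices R c₀ C
  open Commutation R c₀ C
  open Expansion R c₀ C
  open Reindex R c₀ C
  open Chains R c₀ C
  open VerticalChain R c₀ C
  open ShapeSum R σ c₀ fr N R≤N
  open import Relation.Binary.Reasoning.Setoid setoid

  -- Labels that violate a row bound are not excluded but get weight 0. For `u l = - w_l` the other
  -- weights are `w_l` above `σ` and `- w_l` below, and the latter produce the sign of `B(μ/σ)`.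
  Alabel Blabel : ℕ → ℕ → Carrier
  Alabel l r = if l ≤ᵇ r then - u l else 0#
  Blabel l r = if l <ᵇ r then u l else 0#

  Asum Bsum Ssum : List Box → Carrier
  Asum μ = ordinary _≤ᵇ_ _<ᵇ_ Alabel (Aboxes σ μ) (λ b → range 1 (row b))
  Bsum μ = ordinary (λ x y → y <ᵇ x) (λ x y → y ≤ᵇ x) Blabel (Bboxes σ μ) (λ b → range 1 (row b))
  Ssum μ = ordinary _≤ᵇ_ _<ᵇ_ (λ l _ → X l) μ (λ _ → range 1 n)

  before-≤ : ∀ k (v : ℕ → Carrier) i → i ≤ k → before (suc k) v i ≡ v i
  before-≤ k       v zero    _       = refl
  before-≤ (suc k) v (suc i) (s≤s p) = before-≤ k (v ∘ suc) i p

  after-≤ : ∀ k y i → after k y i ≡ (if k ≤ᵇ i then y else 0#)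
  after-≤ zero    y i       = refl
  after-≤ (suc k) y zero    = refl
  after-≤ (suc k) y (suc i) = trans (after-≤ k y i) (cong (λ b → if b then y else 0#)
    (T-ext (λ t → <⇒<ᵇ (s≤s (≤ᵇ⇒≤ k i t))) (λ t → ≤⇒≤ᵇ (ℕₚ.≤-pred (<ᵇ⇒< k (suc i) t)))))

  sorted-≤ : ∀ labs → AllPairs (λ l x → x < l) labs → Peelables _≤ᵇ_ true labs
  sorted-≤ labs s = Peelables-sorted labs s (λ l x p → ≤ᵇ-yes (ℕₚ.<⇒≤ p)) (λ l x p → ≤ᵇ-no p) (λ l → ≤ᵇ-yes (≤-refl {l}))

  tableaux-cong : ∀ {ρ κ v v' g g'} (bs : List Box) labs → (∀ b → b ∈ bs → v (row b) ≈ v' (row b)) →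
    (∀ l b → b ∈ bs → g l (row b) ≈ g' l (row b)) → tableaux ρ κ v g bs labs ≈ tableaux ρ κ v' g' bs labs
  tableaux-cong bs labs hv hg = ∑-cong∈ (fillings bs (λ _ → nonemptySubsets labs)) (λ t t∈ → *-congˡ (∏-cong∈ t (λ (b , S) p∈ →
    let b∈ = proj₁ (∈-fillings bs _ t t∈ b S p∈) in
    *-cong (^-congˡ (length S ∸ 1) (hv b b∈)) (∏-cong∈ S (λ l _ → hg l b b∈)))))

  sorted-< : ∀ labs → AllPairs (λ l x → x < l) labs → Peelables _<ᵇ_ false labs
  sorted-< labs s = Peelables-sorted labs s (λ l x p → <ᵇ-yes p) (λ l x p → <ᵇ-no (ℕₚ.<⇒≤ p)) (λ l → <ᵇ-no (≤-refl {l}))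

  hlabels-map : ∀ k → hlabels u k ≡ map (λ l → after l (- u l)) (downs k)
  hlabels-map zero    = refl
  hlabels-map (suc k) = cong (after (suc k) (- u (suc k)) ∷_) (hlabels-map k)

  vlabels-map : ∀ k → vlabels u k ≡ map (λ l → after l (u l)) (range 1 k)
  vlabels-map zero    = refl
  vlabels-map (suc k) = trans (cong (_++ (after (suc k) (u (suc k)) ∷ [])) (vlabels-map k))
    (trans (sym (map-++ (λ l → after l (u l)) (range 1 k) (suc k ∷ []))) (cong (map (λ l → after l (u l))) (sym (range-suc k))))
    where open import Data.List.Properties using (map-++)

  consts-map : ∀ k → consts (map X (downs k)) ≡ map (λ l _ → X l) (downs k)
  consts-map zero    = refl
  consts-map (suc k) = cong (const (X (suc k)) ∷_) (consts-map k)

  length-consts : ∀ k → length (consts (map X (downs k))) ≡ k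
  length-consts zero    = refl
  length-consts (suc k) = cong suc (length-consts k)

  ∏-^-one : ∀ (v : ℕ → Carrier) (ls ns : Vec ℕ N) → (∀ i → ent ns i ≤ ent ls i) →
    ∏ (upTo N) (λ i → v i ^ (ent ns i ∸ ent ls i)) ≈ 1#
  ∏-^-one v ls ns le = ∏-one (upTo N) (λ i _ → ≈-reflexive (cong (v i ^_) (ℕₚ.m≤n⇒m∸n≡0 (le i))))

  Pow-supp : ∀ xs (ls ns : Vec ℕ N) → (∀ i → ent ns i ≤ ent ls i) ⊎ Pow zeros xs ls ns ≈ 0#
  Pow-supp [] ls ns with Dif-δ-supp ls ns
  ... | inj₁ refl = inj₁ (λ _ → ≤-refl)
  ... | inj₂ z    = inj₂ z
  Pow-supp (x ∷ xs) ls ns with T? (allI N (λ i → ent ns i ≤ᵇ ent ls i))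
  ... | yes t = inj₁ le
    where
    le : ∀ i → ent ns i ≤ ent ls i
    le i with i ℕₚ.<? N
    ... | yes p = ≤ᵇ⇒≤ _ _ (T-allI⁻ N _ t i p)
    ... | no np rewrite ent-beyond ls i (ℕₚ.≮⇒≥ np) | ent-beyond ns i (ℕₚ.≮⇒≥ np) = ≤-refl
  ... | no nt = inj₂ (∑-zero (pars N) (λ κ _ → term κ))
    where
    term : ∀ κ → Hor x zeros C ls κ * Pow zeros xs κ ns ≈ 0#
    term κ with Hor-supp x zeros C ls κ | Pow-supp xs κ ns
    ... | inj₂ z | _      = 0*≈ z
    ... | inj₁ _ | inj₂ z = *0≈ z
    ... | inj₁ h | inj₁ q = ⊥-elim (nt (T-allI⁺ N _ (λ i _ → ≤⇒≤ᵇ (≤-trans (q i) (HStrip-ent≤ h i)))))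

  Rep-row : ∀ {bs} {ls ns : Vec ℕ N} → Rep bs ls ns → ∀ b → b ∈ bs → ∃[ i ] row b ≡ suc i × i < N
  Rep-row rep (zero , j)  b∈ = ⊥-elim (Rep.row≢0 rep b∈)
  Rep-row rep (suc i , j) b∈ = i , refl , Rep.row< rep b∈

  module _ (p q : Vec ℕ N) (lg : Larger p q) where
    open Larger lg
    private
      μ : List Box
      μ = boxes (p , q)
      rep : Rep μ p q
      rep = boxes-Rep p q Par-p Par-q

    Pow≈Ssum : Pow (before 1 u) (consts (map X (downs n))) p q ≈ Ssum μ
    Pow≈Ssum = begin
      Pow (before 1 u) (consts (map X (downs n))) p q
        ≈⟨ ≈-reflexive (cong (λ xs → Pow (before 1 u) xs p q) (consts-map n)) ⟩
      Pow (before 1 u) (map (λ l _ → X l) (downs n)) p q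
        ≈⟨ ≈-sym (tableaux-Pow (before 1 u) (λ l _ → X l) (downs n) u₀ (sorted-≤ _ (downs-sorted n)) (sorted-< _ (downs-sorted n)) μ p q Par-p Par-q rep) ⟩
      _ * tableaux _≤ᵇ_ _<ᵇ_ (before 1 u) (λ l _ → X l) μ (downs n)
        ≈⟨ ≈-trans (*-congʳ (∏-^-one _ p q q≤p)) (*-identityˡ _) ⟩
      tableaux _≤ᵇ_ _<ᵇ_ (before 1 u) (λ l _ → X l) μ (downs n)
        ≈⟨ ≈-sym (tableaux-↭ (before 1 u) _ μ (downs-↭ n)) ⟩
      tableaux _≤ᵇ_ _<ᵇ_ (before 1 u) (λ l _ → X l) μ (range 1 n)
        ≈⟨ tableaux-ordinary _ μ (range 1 n) (λ b b∈ → ≈-reflexive (lem b (Rep-row rep b b∈))) ⟩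
      Ssum μ ∎
      where
      lem : ∀ b → ∃[ i ] row b ≡ suc i × i < N → before 1 u (row b) ≡ 0#
      lem b (i , e , _) rewrite e = refl

    Pow≈Asum : Pow zeros (hlabels u N) inner q ≈ Asum μ
    Pow≈Asum = begin
      Pow zeros (hlabels u N) inner q
        ≈⟨ ≈-reflexive (cong (λ xs → Pow zeros xs inner q) (hlabels-map N)) ⟩
      Pow zeros (map (λ l → after l (- u l)) (downs N)) inner q
        ≈⟨ ≈-sym (tableaux-Pow zeros (λ l → after l (- u l)) (downs N) ≈-refl (sorted-≤ _ (downs-sorted N)) (sorted-< _ (downs-sorted N)) A inner q
             (Vectors.Par-inner σ-vectors) Par-q Arep) ⟩
      _ * tableaux _≤ᵇ_ _<ᵇ_ zeros (λ l → after l (- u l)) A (downs N)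
        ≈⟨ ≈-trans (*-congʳ (∏-^-one _ inner q q≤ν)) (*-identityˡ _) ⟩
      tableaux _≤ᵇ_ _<ᵇ_ zeros (λ l → after l (- u l)) A (downs N)
        ≈⟨ ≈-sym (tableaux-↭ zeros _ A (downs-↭ N)) ⟩
      tableaux _≤ᵇ_ _<ᵇ_ zeros (λ l → after l (- u l)) A (range 1 N)
        ≈⟨ ≈-trans (tableaux-cong A (range 1 N) (λ _ _ → ≈-refl) (λ l b _ → ≈-reflexive (after-≤ l (- u l) (row b))))
             (tableaux-ordinary Alabel A (range 1 N) (λ _ _ → ≈-refl)) ⟩
      ordinary _≤ᵇ_ _<ᵇ_ Alabel A (λ _ → range 1 N)
        ≈⟨ ∑-fillings-shrink A N _ (λ b b∈ → let (i , e , i<N) = Rep-row Arep b b∈ in subst (_≤ N) (sym e) i<N)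
             (λ t b x m r<x → ≈-trans (*-congˡ (∏-zero∈ t _ (b , x) m (≈-reflexive (cong (λ z → if z then - u x else 0#) (≤ᵇ-no r<x))))) (zeroʳ _)) ⟩
      Asum μ ∎
      where
      A = Aboxes σ μ
      Arep = Aboxes-Rep p q lg μ rep

    Vpow≈Bsum : Vpow (vlabels u N) p outer ≈ Bsum μ
    Vpow≈Bsum = begin
      Vpow (vlabels u N) p outer
        ≈⟨ ≈-reflexive (cong (λ ys → Vpow ys p outer) (vlabels-map N)) ⟩
      Vpow (map (λ l → g l ∘ suc) (range 1 N)) p outer
        ≈⟨ ≈-sym (tableaux-Vpow g (range 1 N)
             (Peelables-sorted _ (range-sorted 1 N) (λ l x r → <ᵇ-yes r) (λ l x r → <ᵇ-no (ℕₚ.<⇒≤ r)) (λ l → <ᵇ-no (≤-refl {l})))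
             (Peelables-sorted _ (range-sorted 1 N) (λ l x r → ≤ᵇ-yes (ℕₚ.<⇒≤ r)) (λ l x r → ≤ᵇ-no r) (λ l → ≤ᵇ-yes (≤-refl {l})))
             B p outer Par-p (Vectors.Par-outer σ-vectors) λ≤p Brep) ⟩
      tableaux (λ x y → y <ᵇ x) (λ x y → y ≤ᵇ x) zeros g B (range 1 N)
        ≈⟨ ≈-trans (tableaux-cong B (range 1 N) (λ _ _ → ≈-refl) (λ l b b∈ → ≈-reflexive (label l b (Rep-row Brep b b∈))))
             (tableaux-ordinary Blabel B (range 1 N) (λ _ _ → ≈-refl)) ⟩
      ordinary (λ x y → y <ᵇ x) (λ x y → y ≤ᵇ x) Blabel B (λ _ → range 1 N)
        ≈⟨ ∑-fillings-shrink B N _ (λ b b∈ → let (i , e , i<N) = Rep-row Brep b b∈ in subst (_≤ N) (sym e) i<N)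
             (λ t b x m r<x → ≈-trans (*-congˡ (∏-zero∈ t _ (b , x) m (≈-reflexive (cong (λ z → if z then u x else 0#) (<ᵇ-no (ℕₚ.<⇒≤ r<x)))))) (zeroʳ _)) ⟩
      Bsum μ ∎
      where
      B = Bboxes σ μ
      Brep = Bboxes-Rep p q lg μ rep
      g : ℕ → ℕ → Carrier
      -- The vectors in `Vpow` count rows from 0; through `pred` the condition `l ≤ pred r` becomes
      -- the strict bound `l < r`.
      g l r = after l (u l) (ℕ.pred r)
      label : ∀ l b → ∃[ i ] row b ≡ suc i × i < N → g l (row b) ≡ Blabel l (row b)
      label l b (i , e , _) rewrite e = trans (after-≤ l (u l) i) (cong (λ z → if z then u l else 0#)
        (T-ext (λ t → <⇒<ᵇ (s≤s (≤ᵇ⇒≤ l i t))) (λ t → ≤⇒≤ᵇ (ℕₚ.≤-pred (<ᵇ⇒< l (suc i) t)))))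

  -- `Pow-expand` between the two borders of `σ`, with its three factors read as tableaux on
  -- `B(μ/σ)`, `μ` and `A(μ/σ)`. Pairs of partitions that do not give a shape above `σ` contribute
  -- 0.
  master : tableaux _≤ᵇ_ _<ᵇ_ u (λ l _ → X l) σ (range 1 n) ≈ ∑ (shapesAbove σ N) (λ μ → Bsum μ * (Ssum μ * Asum μ))
  master = begin
    tableaux _≤ᵇ_ _<ᵇ_ u (λ l _ → X l) σ (range 1 n)
      ≈⟨ tableaux-cong σ (range 1 n) (λ b b∈ → let (i , e , i<N) = Rep-row σ-rep b b∈ in
           ≈-reflexive (sym (before-≤ N u (row b) (subst (_≤ N) (sym e) i<N)))) (λ _ _ _ → ≈-refl) ⟩
    tableaux _≤ᵇ_ _<ᵇ_ (before (suc N) u) (λ l _ → X l) σ (range 1 n)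
      ≈⟨ tableaux-↭ (before (suc N) u) _ σ (downs-↭ n) ⟩
    tableaux _≤ᵇ_ _<ᵇ_ (before (suc N) u) (λ l _ → X l) σ (downs n)
      ≈⟨ ≈-sym (≈-trans (*-congʳ (∏-^-one _ outer inner ν≤λ)) (*-identityˡ _)) ⟩
    ∏ (upTo N) (λ i → (- before (suc N) u (suc i)) ^ (ent inner i ∸ ent outer i)) * tableaux _≤ᵇ_ _<ᵇ_ (before (suc N) u) (λ l _ → X l) σ (downs n)
      ≈⟨ tableaux-Pow (before (suc N) u) (λ l _ → X l) (downs n) u₀ (sorted-≤ _ (downs-sorted n)) (sorted-< _ (downs-sorted n)) σ outer inner
           Par-λ Par-ν σ-rep ⟩
    Pow (before (suc N) u) (map (λ l _ → X l) (downs n)) outer inner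
      ≈⟨ ≈-reflexive (cong (λ xs → Pow (before (suc N) u) xs outer inner) (sym (consts-map n))) ⟩
    Pow (before (suc N) u) (consts (map X (downs n))) outer inner
      -- The row of index `maxRow σ` is the first one below `σ`, and `inner` is empty there.
      ≈⟨ Pow-expand N u (map X (downs n)) outer inner (maxRow σ) Par-λ Par-ν
           (ℕₚ.≤-reflexive (Vectors.flat σ-vectors (maxRow σ) ≤-refl)) (subst (λ k → k ℕ.+ maxRow σ < N) (sym (length-consts n)) n+R<N) ⟩
    ∑ (pars N) (λ p → Vpow (vlabels u N) p outer *
      ∑ (pars N) (λ q → Pow (before 1 u) (consts (map X (downs n))) p q * Pow zeros (hlabels u N) inner q))
      ≈⟨ ∑-cong∈ (pars N) (λ p p∈ → ≈-trans (≈-sym (∑-*ˡ (pars N) _ _))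
           (∑-cong∈ (pars N) (λ q q∈ → term p q (proj₂ (∈-pars⁻ p∈)) (proj₂ (∈-pars⁻ q∈)) (T? (largerᵇ (p , q)))))) ⟩
    ∑ (pars N) (λ p → ∑ (pars N) (λ q → ⟦ largerᵇ (p , q) ⟧ * F (boxes (p , q))))
      ≈⟨ ≈-sym (∑-shapes F) ⟩
    ∑ (shapesAbove σ N) F ∎
    where
    σ-rep = Vectors.rep σ-vectors
    Par-λ = Vectors.Par-outer σ-vectors
    Par-ν = Vectors.Par-inner σ-vectors
    F : List Box → Carrier
    F μ = Bsum μ * (Ssum μ * Asum μ)
    term : ∀ p q → Par C p → Par C q → Dec (T (largerᵇ (p , q))) →
      Vpow (vlabels u N) p outer * (Pow (before 1 u) (consts (map X (downs n))) p q * Pow zeros (hlabels u N) inner q)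
      ≈ ⟦ largerᵇ (p , q) ⟧ * F (boxes (p , q))
    term p q pp pq (yes t) = ≈-trans
      (*-cong (Vpow≈Bsum p q lg) (*-cong (Pow≈Ssum p q lg) (Pow≈Asum p q lg)))
      (≈-sym (≈-trans (*-congʳ (≈-reflexive (cong ⟦_⟧ (T⇒true t)))) (*-identityˡ _)))
      where lg = larger⁻ p q pp pq t
    term p q pp pq (no nt) = ≈-trans vanish (≈-sym (0*≈ (≈-reflexive (cong ⟦_⟧ (¬T⇒false nt)))))
      where
      vanish : Vpow (vlabels u N) p outer * (Pow (before 1 u) (consts (map X (downs n))) p q * Pow zeros (hlabels u N) inner q) ≈ 0#
      vanish with Vpow-supp (vlabels u N) p outer | Pow-supp (hlabels u N) inner q
      ... | inj₂ z | _      = 0*≈ z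
      ... | inj₁ _ | inj₂ z = *0≈ (*0≈ z)
      ... | inj₁ f | inj₁ g = ⊥-elim (nt (larger⁺ p q f g))

-- Comparison of coefficients.

δ : ℕ → ℕ → ℕ
δ a b = if a ≡ᵇ b then 1 else 0

negOnePow-+ : ∀ a b → negOnePow (a ℕ.+ b) ≡ negOnePow a ℤ.* negOnePow b
negOnePow-+ zero    b = sym (ℤₚ.*-identityˡ _)
negOnePow-+ (suc a) b = trans (cong ℤ.-_ (negOnePow-+ a b)) (ℤₚ.neg-distribˡ-* (negOnePow a) (negOnePow b))

countᵇ-sum : {A : Set} (p : A → Bool) (xs : List A) → countᵇ p xs ≡ sum (map (λ x → if p x then 1 else 0) xs)
countᵇ-sum p []       = refl
countᵇ-sum p (x ∷ xs) with p x
... | true  = cong suc (countᵇ-sum p xs)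
... | false = countᵇ-sum p xs

countᵇ-cong : {A : Set} {p q : A → Bool} (xs : List A) → (∀ x → x ∈ xs → p x ≡ q x) → countᵇ p xs ≡ countᵇ q xs
countᵇ-cong xs h = cong length (filterᵇ-cong xs h)

sum-map-cong : {A : Set} (xs : List A) {f g : A → ℕ} → (∀ x → x ∈ xs → f x ≡ g x) → sum (map f xs) ≡ sum (map g xs)
sum-map-cong []       h = refl
sum-map-cong (x ∷ xs) h = cong₂ ℕ._+_ (h x (here refl)) (sum-map-cong xs (λ y y∈ → h y (there y∈)))

sum-map-+ : {A : Set} (xs : List A) (f g : A → ℕ) → sum (map (λ x → f x ℕ.+ g x) xs) ≡ sum (map f xs) ℕ.+ sum (map g xs)
sum-map-+ []       f g = refl
sum-map-+ (x ∷ xs) f g rewrite sum-map-+ xs f g = solve 4 (λ a b c d → (a :+ b) :+ (c :+ d) := (a :+ c) :+ (b :+ d)) refl (f x) (g x) _ _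
  where
  open import Data.Nat.Solver
  open +-*-Solver

sum-map-0 : {A : Set} (xs : List A) {f : A → ℕ} → (∀ x → x ∈ xs → f x ≡ 0) → sum (map f xs) ≡ 0
sum-map-0 []       h = refl
sum-map-0 (x ∷ xs) h = cong₂ ℕ._+_ (h x (here refl)) (sum-map-0 xs (λ y y∈ → h y (there y∈)))

sum-δ : ∀ k r (xs : List ℕ) → Unique xs → r ∈ xs → sum (map (λ i → k ℕ.* δ r i) xs) ≡ k
sum-δ k r (_ ∷ xs) (a ∷ us) (here refl) = trans (cong₂ ℕ._+_ (cong (λ b → k ℕ.* (if b then 1 else 0)) (≡ᵇ-refl r))
    (sum-map-0 xs (λ i i∈ → trans (cong (λ b → k ℕ.* (if b then 1 else 0)) (≡ᵇ-no {r} {i} (λ { refl → All≢⇒∉ xs a i∈ }))) (ℕₚ.*-zeroʳ k))))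
  (trans (ℕₚ.+-identityʳ _) (ℕₚ.*-identityʳ k))
sum-δ k r (x ∷ xs) (a ∷ us) (there r∈) = trans (cong (ℕ._+ sum (map (λ i → k ℕ.* δ r i) xs))
    (trans (cong (λ b → k ℕ.* (if b then 1 else 0)) (≡ᵇ-no {r} {x} (λ { refl → All≢⇒∉ xs a r∈ }))) (ℕₚ.*-zeroʳ k)))
  (sum-δ k r xs us r∈)

at-beyond : ∀ (e : List ℕ) i → length e < i → at e i ≡ 0
at-beyond []      i             _       = refl
at-beyond (x ∷ e) (suc (suc i)) (s≤s p) = at-beyond e (suc i) p

sum-at : ∀ (e : List ℕ) N → length e ≤ N → sum (map (at e) (range 1 N)) ≡ sum e
sum-at e N p = trans (cong sum (sym (map-∘ (upTo N)))) (go e N p)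
  where
  open import Data.List.Properties using (map-∘; map-upTo)
  go : ∀ e N → length e ≤ N → sum (map (λ k → at e (suc k)) (upTo N)) ≡ sum e
  go []      N       _       = sum-map-0 (upTo N) (λ _ _ → refl)
  go (x ∷ e) (suc N) (s≤s p) = cong (x ℕ.+_) (trans (cong (λ xs → sum (map (λ k → at (x ∷ e) (suc k)) xs)) (sym (map-upTo suc N)))
    (trans (cong sum (sym (map-∘ (upTo N)))) (go e N p)))

-- The counts in the statement test exponents up to a bound that depends on the shape, the
-- coefficient functional tests them up to `N`. Beyond the smaller bound both the exponent and the
-- entry of `e` are 0.
all-range-extend : ∀ (p : ℕ → Bool) M N → M ≤ N → (∀ i → M < i → i ≤ N → T (p i)) → all p (range 1 M) ≡ all p (range 1 N)
all-range-extend p M N M≤N h = T-ext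
  (λ t → T-all⁺ p (range 1 N) (λ i i∈ → let (1≤i , i≤N) = ∈-range⁻ 1 N i∈ in go t i 1≤i i≤N (i ℕₚ.≤? M)))
  (λ t → T-all⁺ p (range 1 M) (λ i i∈ → let (1≤i , i≤M) = ∈-range⁻ 1 M i∈ in T-all⁻ p (range 1 N) t i (∈-range⁺ 1≤i (≤-trans i≤M M≤N))))
  where
  go : T (all p (range 1 M)) → ∀ i → 1 ≤ i → i ≤ N → Dec (i ≤ M) → T (p i)
  go t i 1≤i i≤N (yes q) = T-all⁻ p (range 1 M) t i (∈-range⁺ 1≤i q)
  go t i 1≤i i≤N (no q)  = h i (ℕₚ.≰⇒> q) i≤N

fillings-length : {L : Set} (bs : List Box) (opts : Box → List L) (t : Filling L) → t ∈ fillings bs opts → length t ≡ length bs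
fillings-length []       opts .[] (here refl) = refl
fillings-length (b ∷ bs) opts t t∈ with x , _ , m ← concatMap-∈ (λ x → map ((b , x) ∷_) (fillings bs opts)) (opts b) t∈
  with t' , t'∈ , refl ← ∈-map⁻ ((b , x) ∷_) m = cong suc (fillings-length bs opts t' t'∈)

all-all-cong : {A : Set} {r r' : A → A → Bool} (t : List A) → (∀ p q → r p q ≡ r' p q) → all (λ p → all (r p) t) t ≡ all (λ p → all (r' p) t) t
all-all-cong t h = all-cong t (λ p _ → all-cong t (λ q _ → h p q))

module ℤ-sums = Sums ℤₚ.+-*-commutativeRing

sumℤ-∑ : {A : Set} (f : A → ℤ) (xs : List A) → sumℤ (map f xs) ≡ ℤ-sums.∑ xs f
sumℤ-∑ f []       = refl
sumℤ-∑ f (x ∷ xs) = cong (λ z → f x ℤ.+ z) (sumℤ-∑ f xs)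

countᵇ-∑ : {A : Set} (p : A → Bool) (xs : List A) → ℤ.+ countᵇ p xs ≡ ℤ-sums.∑ xs (λ x → ℤ-sums.⟦ p x ⟧)
countᵇ-∑ p []       = refl
countᵇ-∑ p (x ∷ xs) with p x
... | true  = cong (λ z → ℤ.+ 1 ℤ.+ z) (countᵇ-∑ p xs)
... | false = trans (countᵇ-∑ p xs) (sym (ℤₚ.+-identityˡ _))

∑-cartesianProduct : {A B : Set} (xs : List A) (ys : List B) (f : A × B → ℤ) →
  ℤ-sums.∑ (cartesianProduct xs ys) f ≡ ℤ-sums.∑ xs (λ x → ℤ-sums.∑ ys (λ y → f (x , y)))
∑-cartesianProduct []       ys f = refl
∑-cartesianProduct (x ∷ xs) ys f = trans (ℤ-sums.∑-++ (map (x ,_) ys) _ f)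
  (cong₂ ℤ._+_ (ℤ-sums.∑-map (x ,_) ys f) (∑-cartesianProduct xs ys f))

-- inj₁ k is the exponent of x_k and inj₂ i the exponent of w_i.
open MonoidRing (ℕ ⊎ ℕ)

module 𝓡 = CommutativeRing ring
module ring-sums = Sums ring
open ring-sums using (_^_)

xvar wvar : ℕ → Exponent
xvar l (inj₁ k) = δ l k
xvar l (inj₂ i) = 0
wvar l (inj₁ k) = 0
wvar l (inj₂ i) = δ l i

-- `u i` stands for `- w_i`. There is no row 0, and `u 0 = 0` takes away the corner of the
-- fictitious row above.
X u : ℕ → Elem
X l       = mono (ℤ.+ 1) (xvar l)
u zero    = []
u (suc i) = mono ℤ.-1ℤ (wvar (suc i))

∏-mono : {A : Set} (ts : List A) (h : A → Elem) (s : A → ℕ) (m : A → Exponent) →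
  (∀ t → t ∈ ts → h t ≋ mono (negOnePow (s t)) (m t)) →
  ring-sums.∏ ts h ≋ mono (negOnePow (sum (map s ts))) (λ i → sum (map (λ t → m t i) ts))
∏-mono []       h s m e = 𝓡.refl
∏-mono (t ∷ ts) h s m e = 𝓡.trans (⊛-cong (e t (here refl)) (∏-mono ts h s m (λ y y∈ → e y (there y∈))))
  (mono-cong (sym (negOnePow-+ (s t) (sum (map s ts)))) (λ _ → refl))

^-mono : ∀ (m : Exponent) k → mono ℤ.-1ℤ m ^ k ≋ mono (negOnePow k) (λ i → k ℕ.* m i)
^-mono m zero    = 𝓡.refl
^-mono m (suc k) = 𝓡.trans (⊛-cong (𝓡.refl {mono ℤ.-1ℤ m}) (^-mono m k)) (mono-cong (ℤₚ.-1*i≡-i (negOnePow k)) (λ _ → refl))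

module Extraction (α e : List ℕ) (N : ℕ) where
  n : ℕ
  n = length α

  xᵇ wᵇ : Exponent → Bool
  xᵇ m = all (λ k → m (inj₁ k) ≡ᵇ at α k) (range 1 n)
  wᵇ m = all (λ i → m (inj₂ i) ≡ᵇ at e i) (range 1 N)

  -- Only the exponents of `x_1, ..., x_n` and `w_1, ..., w_N` are tested: all labels of the
  -- tableaux of shape `σ` and `μ` are at most `n`, and all rows are at most `N`.
  coeff : Exponent → ℤ
  coeff m = ℤ-sums.⟦ xᵇ m ∧ wᵇ m ⟧

  resp-coeff : Resp coeff
  resp-coeff h = cong ℤ-sums.⟦_⟧ (cong₂ _∧_
    (all-cong (range 1 n) (λ k _ → cong (_≡ᵇ at α k) (h (inj₁ k))))
    (all-cong (range 1 N) (λ i _ → cong (_≡ᵇ at e i) (h (inj₂ i)))))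

  ∑-eval : {A : Set} (ts : List A) (b : A → Bool) (h : A → Elem) (s : A → ℤ) (m : A → Exponent) →
    (∀ t → t ∈ ts → h t ≋ mono (s t) (m t)) →
    eval (ring-sums.∑ ts (λ t → ring-sums.⟦ b t ⟧ ⊛ h t)) coeff
    ≡ ℤ-sums.∑ ts (λ t → ℤ-sums.⟦ b t ⟧ ℤ.* (s t ℤ.* coeff (m t)))
  ∑-eval ts b h s m e = trans (eval-∑ ts _ coeff) (ℤ-sums.∑-cong∈ ts (λ t t∈ →
    trans (on (⊛-cong (𝓡.refl {ring-sums.⟦ b t ⟧}) (e t t∈)) coeff resp-coeff) (⟦⟧-mono (b t) (s t) (m t) coeff)))

all-false : {A : Set} (p : A → Bool) (xs : List A) → ¬ T (all p xs) → ∃[ x ] x ∈ xs × ¬ T (p x)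
all-false p []       h = ⊥-elim (h _)
all-false p (x ∷ xs) h with T? (p x)
... | no np = x , here refl , np
... | yes px with y , y∈ , ny ← all-false p xs (λ t → h (T-∧⁺ px t)) = y , there y∈ , ny

svExponent : Box × List ℕ → Exponent
svExponent (b , S) (inj₁ k) = countᵇ (_≡ᵇ k) S
svExponent (b , S) (inj₂ i) = (length S ∸ 1) ℕ.* δ (row b) i

excesses : Filling (List ℕ) → ℕ
excesses t = sum (map (λ p → length (proj₂ p) ∸ 1) t)

excessAt : ℕ → Filling (List ℕ) → ℕ
excessAt i t = sum (map (λ p → svExponent p (inj₂ i)) t)

-- Each box of the row holds at least one label, so the truncated subtraction is exact and can be
-- distributed over the boxes.
excessRow≡ : ∀ i (t : Filling (List ℕ)) → (∀ p → p ∈ t → 1 ≤ length (proj₂ p)) → excessRow i t ≡ excessAt i t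
excessRow≡ i t h = trans (cong (_∸ countᵇ (λ p → row (proj₁ p) ≡ᵇ i) t) (trans (sum-map-cong t split) (sum-map-+ t _ _)))
  (trans (cong (λ z → excessAt i t ℕ.+ z ∸ countᵇ (λ p → row (proj₁ p) ≡ᵇ i) t) (sym (countᵇ-sum (λ p → row (proj₁ p) ≡ᵇ i) t)))
    (ℕₚ.m+n∸n≡m (excessAt i t) (countᵇ (λ p → row (proj₁ p) ≡ᵇ i) t)))
  where
  split : ∀ p → p ∈ t → (if row (proj₁ p) ≡ᵇ i then length (proj₂ p) else 0)
    ≡ svExponent p (inj₂ i) ℕ.+ (if row (proj₁ p) ≡ᵇ i then 1 else 0)
  split p p∈ with row (proj₁ p) ≡ᵇ i
  ... | true  = sym (trans (cong (ℕ._+ 1) (ℕₚ.*-identityʳ _)) (ℕₚ.m∸n+n≡m (h p p∈)))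
  ... | false = sym (trans (ℕₚ.+-identityʳ _) (ℕₚ.*-zeroʳ (length (proj₂ p) ∸ 1)))

excesses-by-row : ∀ N (t : Filling (List ℕ)) → (∀ p → p ∈ t → 1 ≤ row (proj₁ p) × row (proj₁ p) ≤ N) →
  sum (map (λ i → excessAt i t) (range 1 N)) ≡ excesses t
excesses-by-row N []      h = sum-map-0 (range 1 N) (λ _ _ → refl)
excesses-by-row N (p ∷ t) h = trans (sum-map-+ (range 1 N) _ _) (cong₂ ℕ._+_
  (sum-δ (length (proj₂ p) ∸ 1) (row (proj₁ p)) (range 1 N) (range-unique 1 N) (let (a , b) = h p (here refl) in ∈-range⁺ a b))
  (excesses-by-row N t (λ q q∈ → h q (there q∈))))

module RP = Peel ring
module RL = Labels ring

weight-mono : ∀ b S → 1 ≤ row b → RP.weight u (λ l _ → X l) (b , S) ≋ mono (negOnePow (length S ∸ 1)) (svExponent (b , S))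
weight-mono (suc r , j) S _ = 𝓡.trans
  (⊛-cong (^-mono (wvar (suc r)) (length S ∸ 1)) (∏-mono S X (λ _ → 0) xvar (λ _ _ → 𝓡.refl)))
  (mono-cong (trans (cong (λ z → negOnePow (length S ∸ 1) ℤ.* negOnePow z) (sum-map-0 S (λ _ _ → refl))) (ℤₚ.*-identityʳ _)) exponent)
  where
  exponent : ∀ i → (length S ∸ 1) ℕ.* wvar (suc r) i ℕ.+ sum (map (λ l → xvar l i) S) ≡ svExponent ((suc r , j) , S) i
  exponent (inj₁ k) = cong₂ ℕ._+_ (ℕₚ.*-zeroʳ (length S ∸ 1)) (sym (countᵇ-sum (_≡ᵇ k) S))
  exponent (inj₂ i) = trans (cong (λ z → (length S ∸ 1) ℕ.* δ (suc r) i ℕ.+ z) (sum-map-0 S (λ _ _ → refl))) (ℕₚ.+-identityʳ _)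

wExponent : Filling ℕ → Exponent
wExponent t i = sum (map (λ p → wvar (proj₂ p) i) t)

xExponent : Filling ℕ → Exponent
xExponent t i = sum (map (λ p → xvar (proj₂ p) i) t)

u-mono : ∀ x → 1 ≤ x → u x ≡ mono ℤ.-1ℤ (wvar x)
u-mono (suc x) _ = refl

negOnePow-0s : {A : Set} (t : List A) → negOnePow (sum (map (λ _ → 0) t)) ≡ ℤ.+ 1
negOnePow-0s t = cong negOnePow (sum-map-0 t (λ _ _ → refl))

sum-1s : {A : Set} (t : List A) → sum (map (λ _ → 1) t) ≡ length t
sum-1s []      = refl
sum-1s (x ∷ t) = cong suc (sum-1s t)

∑-∏-filter : {A : Set} (ts : List A) (b b' : A → Bool) (h : A → Elem) (c : ℤ) (m : A → Exponent) →
  (∀ t → t ∈ ts → ring-sums.⟦ b t ⟧ ⊛ h t ≋ ring-sums.⟦ b' t ⟧ ⊛ mono c (m t)) →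
  ring-sums.∑ ts (λ t → ring-sums.⟦ b t ⟧ ⊛ h t) ≋ ring-sums.∑ (filterᵇ b' ts) (λ t → mono c (m t))
∑-∏-filter ts b b' h c m e = 𝓡.trans (ring-sums.∑-cong∈ ts e) (𝓡.sym (ring-sums.∑-filterᵇ b' ts (λ t → mono c (m t))))

∑-∑-∑ : {A B D : Set} (xs : List A) (ys : List B) (zs : List D) (f : A → Elem) (g : B → Elem) (h : D → Elem) →
  ring-sums.∑ xs f ⊛ (ring-sums.∑ ys g ⊛ ring-sums.∑ zs h)
  ≋ ring-sums.∑ xs (λ x → ring-sums.∑ ys (λ y → ring-sums.∑ zs (λ z → f x ⊛ (g y ⊛ h z))))
∑-∑-∑ xs ys zs f g h = 𝓡.trans (𝓡.sym (ring-sums.∑-*ʳ xs _ f)) (ring-sums.∑-cong xs (λ x → 𝓡.trans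
  (⊛-cong (𝓡.refl {f x}) (𝓡.sym (ring-sums.∑-*ʳ ys _ g)))
  (𝓡.trans (𝓡.sym (ring-sums.∑-*ˡ ys (f x) _)) (ring-sums.∑-cong ys (λ y → 𝓡.trans
    (⊛-cong (𝓡.refl {f x}) (𝓡.sym (ring-sums.∑-*ˡ zs (g y) h))) (𝓡.sym (ring-sums.∑-*ˡ zs (f x) _)))))))

module Coefficients (σ : List Box) (c₀ : ℕ) (fr : Frame σ c₀) (α e : List ℕ) (N : ℕ)
  (n+R<N : length α ℕ.+ maxRow σ < N) (e≤N : length e ≤ N) where
  open Extraction α e N
  open Master ring σ c₀ fr X u 𝓡.refl n N n+R<N
  open Frame fr using (skew)

  F : List (Filling (List ℕ))
  F = fillings σ (λ _ → nonemptySubsets (range 1 n))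

  rows : ∀ {i j} → (i , j) ∈ σ → 1 ≤ i × i ≤ N
  rows m = proj₁ (Skew.positive skew m) , ≤-trans (row≤maxRow σ m) R≤N

  svᵇ : Filling (List ℕ) → Bool
  svᵇ t = semistandardSVᵇ t
    ∧ all (λ k → cntSV k t ≡ᵇ at α k) (range 1 n)
    ∧ all (λ i → excessRow i t ≡ᵇ at e i) (range 1 (maxRow σ ⊔ length e))

  left : eval (RP.tableaux _≤ᵇ_ _<ᵇ_ u (λ l _ → X l) σ (range 1 n)) coeff ≡ coeffRG σ α e
  left = trans (∑-eval F (pairwiseᵇ (compat (allPairs _≤ᵇ_) (allPairs _<ᵇ_))) (λ t → ring-sums.∏ t (RP.weight u (λ l _ → X l))) (negOnePow ∘ excesses) (λ t i → sum (map (λ p → svExponent p i) t))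
      (λ t t∈ → ∏-mono t _ (λ p → length (proj₂ p) ∸ 1) svExponent
        (λ (b , S) p∈ → weight-mono b S (proj₁ (rows (proj₁ (∈-fillings σ _ t t∈ b S p∈)))))))
    (trans (ℤ-sums.∑-cong∈ F term) (trans (ℤ-sums.∑-*ˡ F (negOnePow (sum e)) (λ t → ℤ-sums.⟦ svᵇ t ⟧)) (cong (negOnePow (sum e) ℤ.*_) (sym (countᵇ-∑ svᵇ F)))))
    where
    term : ∀ t → t ∈ F → ℤ-sums.⟦ pairwiseᵇ (compat (allPairs _≤ᵇ_) (allPairs _<ᵇ_)) t ⟧ ℤ.*
      (negOnePow (excesses t) ℤ.* coeff (λ i → sum (map (λ p → svExponent p i) t))) ≡ negOnePow (sum e) ℤ.* ℤ-sums.⟦ svᵇ t ⟧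
    term t t∈ = trans (cong₂ (λ x y → ℤ-sums.⟦ x ⟧ ℤ.* (negOnePow (excesses t) ℤ.* ℤ-sums.⟦ b₂ ∧ y ⟧)) pw≡ refl)
        (trans (go (semistandardSVᵇ t) b₂ b₃ sign) (cong (λ z → negOnePow (sum e) ℤ.* ℤ-sums.⟦ semistandardSVᵇ t ∧ b₂ ∧ z ⟧) (sym b₃≡)))
      where
      nonempty : ∀ p → p ∈ t → 1 ≤ length (proj₂ p)
      nonempty (b , S) p∈ with y , ys , refl , _ ← ∈-nonemptySubsets (range 1 n) S (proj₂ (∈-fillings σ _ t t∈ b S p∈)) = s≤s z≤n
      trows : ∀ p → p ∈ t → 1 ≤ row (proj₁ p) × row (proj₁ p) ≤ maxRow σ
      trows (b , S) p∈ = let b∈ = proj₁ (∈-fillings σ _ t t∈ b S p∈) in proj₁ (rows b∈) , row≤maxRow σ b∈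
      b₂ b₃ : Bool
      b₂ = all (λ k → cntSV k t ≡ᵇ at α k) (range 1 n)
      b₃ = all (λ i → excessAt i t ≡ᵇ at e i) (range 1 N)
      pw≡ : pairwiseᵇ (compat (allPairs _≤ᵇ_) (allPairs _<ᵇ_)) t ≡ semistandardSVᵇ t
      pw≡ = all-all-cong t (λ { (a , x) (b , y) → refl })
      M = maxRow σ ⊔ length e
      b₃≡ : all (λ i → excessRow i t ≡ᵇ at e i) (range 1 M) ≡ b₃
      b₃≡ = trans (all-cong (range 1 M) (λ i _ → cong (_≡ᵇ at e i) (excessRow≡ i t nonempty)))
        (all-range-extend _ M N (ℕₚ.⊔-lub R≤N e≤N) beyond)
        where
        beyond : ∀ i → M < i → i ≤ N → T (excessAt i t ≡ᵇ at e i)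
        beyond i M<i _ = subst₂ (λ x y → T (x ≡ᵇ y)) (sym zero-excess) (sym (at-beyond e i (ℕₚ.≤-<-trans (ℕₚ.m≤n⊔m (maxRow σ) (length e)) M<i))) _
          where
          zero-excess : excessAt i t ≡ 0
          zero-excess = sum-map-0 t (λ p p∈ → trans (cong (λ b → (length (proj₂ p) ∸ 1) ℕ.* (if b then 1 else 0))
            (≡ᵇ-no {row (proj₁ p)} {i} (ℕₚ.<⇒≢ (ℕₚ.≤-<-trans (proj₂ (trows p p∈)) (ℕₚ.≤-<-trans (ℕₚ.m≤m⊔n (maxRow σ) (length e)) M<i))))) (ℕₚ.*-zeroʳ (length (proj₂ p) ∸ 1)))
      -- The sign of a tableau depends on its own excess, yet wherever the functional does not
      -- vanish this excess is `e` in every row. So one sign can be taken out of the sum.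
      sign : T b₃ → excesses t ≡ sum e
      sign h = trans (sym (excesses-by-row N t (λ p p∈ → proj₁ (trows p p∈) , ≤-trans (proj₂ (trows p p∈)) R≤N)))
        (trans (sum-map-cong (range 1 N) (λ i i∈ → ≡ᵇ⇒≡ _ _ (T-all⁻ _ (range 1 N) h i i∈))) (sum-at e N e≤N))
      go : ∀ a b c → (T c → excesses t ≡ sum e) →
        ℤ-sums.⟦ a ⟧ ℤ.* (negOnePow (excesses t) ℤ.* ℤ-sums.⟦ b ∧ c ⟧) ≡ negOnePow (sum e) ℤ.* ℤ-sums.⟦ a ∧ b ∧ c ⟧
      go false b     c     s = sym (ℤₚ.*-zeroʳ (negOnePow (sum e)))
      go true  false c     s = trans (ℤₚ.*-identityˡ _) (trans (ℤₚ.*-zeroʳ (negOnePow (excesses t))) (sym (ℤₚ.*-zeroʳ (negOnePow (sum e)))))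
      go true  true  false s = trans (ℤₚ.*-identityˡ _) (trans (ℤₚ.*-zeroʳ (negOnePow (excesses t))) (sym (ℤₚ.*-zeroʳ (negOnePow (sum e)))))
      go true  true  true  s = trans (ℤₚ.*-identityˡ _) (cong (λ z → negOnePow z ℤ.* ℤ.+ 1) (s _))

  module Term (μ : List Box) (rowsμ : ∀ {i j} → (i , j) ∈ μ → i ≤ N) where
    fillA fillB : List (Filling ℕ)
    fillA = fillings (Aboxes σ μ) (λ b → range 1 (row b))
    fillB = fillings (Bboxes σ μ) (λ b → range 1 (row b))

    goodA goodB : Filling ℕ → Bool
    goodA t = allLabelsPositiveᵇ t ∧ semistandardᵇ t ∧ rowWeaklyBoundedᵇ t
    goodB t = allLabelsPositiveᵇ t ∧ reverseRowStrictᵇ t ∧ rowBoundedᵇ t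

    label : ∀ bs {t} → t ∈ fillings bs (λ b → range 1 (row b)) → ∀ p → p ∈ t → proj₁ p ∈ bs × 1 ≤ proj₂ p × proj₂ p ≤ row (proj₁ p)
    label bs {t} t∈ (b , x) p∈ with b∈ , x∈ ← ∈-fillings bs _ t t∈ b x p∈ = b∈ , ∈-range⁻ 1 (row b) x∈

    positive : ∀ bs {t} → t ∈ fillings bs (λ b → range 1 (row b)) → T (allLabelsPositiveᵇ t)
    positive bs {t} t∈ = T-all⁺ _ t (λ p p∈ → ≤⇒≤ᵇ (proj₁ (proj₂ (label bs t∈ p p∈))))

    semistandard≡ : ∀ t → pairwiseᵇ (compat _≤ᵇ_ _<ᵇ_) t ≡ semistandardᵇ t
    semistandard≡ t = all-all-cong t (λ { (a , x) (b , y) → refl })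

    Asum≋ : Asum μ ≋ ring-sums.∑ (filterᵇ goodA fillA) (λ t → mono (ℤ.+ 1) (wExponent t))
    Asum≋ = ∑-∏-filter fillA (pairwiseᵇ (compat _≤ᵇ_ _<ᵇ_)) goodA (λ t → ring-sums.∏ t (λ p → Alabel (proj₂ p) (row (proj₁ p)))) (ℤ.+ 1) wExponent (λ t t∈ → ⊛-cong (𝓡.reflexive (cong ring-sums.⟦_⟧ (good≡ t t∈)))
      (𝓡.trans (∏-mono t _ (λ _ → 0) (λ p → wvar (proj₂ p)) (λ p p∈ → factor p (label (Aboxes σ μ) t∈ p p∈))) (mono-cong (negOnePow-0s t) (λ _ → refl))))
      where
      good≡ : ∀ t → t ∈ fillA → pairwiseᵇ (compat _≤ᵇ_ _<ᵇ_) t ≡ goodA t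
      good≡ t t∈ = trans (semistandard≡ t) (sym (trans (cong₂ (λ x y → x ∧ semistandardᵇ t ∧ y) (T⇒true (positive (Aboxes σ μ) t∈)) (T⇒true bounded)) (∧-identityʳ _)))
        where
        open import Data.Bool.Properties using (∧-identityʳ)
        bounded : T (rowWeaklyBoundedᵇ t)
        bounded = T-all⁺ _ t (λ p p∈ → ≤⇒≤ᵇ (proj₂ (proj₂ (label (Aboxes σ μ) t∈ p p∈))))
      factor : ∀ p → proj₁ p ∈ Aboxes σ μ × 1 ≤ proj₂ p × proj₂ p ≤ row (proj₁ p) → Alabel (proj₂ p) (row (proj₁ p)) ≋ mono (ℤ.+ 1) (wvar (proj₂ p))
      factor (b , x) (_ , 1≤x , x≤b) rewrite ≤ᵇ-yes x≤b | u-mono x 1≤x = 𝓡.refl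

    Bsum≋ : Bsum μ ≋ ring-sums.∑ (filterᵇ goodB fillB) (λ t → mono (negOnePow (length (Bboxes σ μ))) (wExponent t))
    Bsum≋ = ∑-∏-filter fillB (pairwiseᵇ (compat (λ x y → y <ᵇ x) (λ x y → y ≤ᵇ x))) goodB (λ t → ring-sums.∏ t h) _ wExponent (λ t t∈ → lem t t∈ (T? (rowBoundedᵇ t)))
      where
      rev≡ : ∀ t → pairwiseᵇ (compat (λ x y → y <ᵇ x) (λ x y → y ≤ᵇ x)) t ≡ reverseRowStrictᵇ t
      rev≡ t = all-all-cong t (λ { (a , x) (b , y) → refl })
      h : Box × ℕ → Elem
      h p = Blabel (proj₂ p) (row (proj₁ p))
      lem : ∀ t → t ∈ fillB → Dec (T (rowBoundedᵇ t)) →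
        ring-sums.⟦ pairwiseᵇ (compat (λ x y → y <ᵇ x) (λ x y → y ≤ᵇ x)) t ⟧ ⊛ ring-sums.∏ t h
        ≋ ring-sums.⟦ goodB t ⟧ ⊛ mono (negOnePow (length (Bboxes σ μ))) (wExponent t)
      lem t t∈ (yes rb) = ⊛-cong (𝓡.reflexive (cong ring-sums.⟦_⟧ good≡))
        (𝓡.trans (∏-mono t h (λ _ → 1) (λ p → wvar (proj₂ p)) (λ p p∈ → factor p (T-all⁻ _ t rb p p∈) (label (Bboxes σ μ) t∈ p p∈)))
          (mono-cong (cong negOnePow (trans (sum-1s t) (fillings-length (Bboxes σ μ) _ t t∈))) (λ _ → refl)))
        where
        good≡ : pairwiseᵇ (compat (λ x y → y <ᵇ x) (λ x y → y ≤ᵇ x)) t ≡ goodB t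
        good≡ rewrite T⇒true (positive (Bboxes σ μ) t∈) | T⇒true rb = trans (rev≡ t) (sym (∧-identityʳ _))
          where open import Data.Bool.Properties using (∧-identityʳ)
        factor : ∀ p → T (proj₂ p <ᵇ row (proj₁ p)) → proj₁ p ∈ Bboxes σ μ × 1 ≤ proj₂ p × proj₂ p ≤ row (proj₁ p) → h p ≋ mono (negOnePow 1) (wvar (proj₂ p))
        factor (b , x) lt (_ , 1≤x , _) rewrite T⇒true lt | u-mono x 1≤x = 𝓡.refl
      -- The enumeration also offers the label equal to the row. It has weight 0 on the one side and
      -- fails `rowBoundedᵇ` on the other.
      lem t t∈ (no nrb) = 𝓡.trans (𝓡.trans (⊛-cong (𝓡.refl {ring-sums.⟦ pairwiseᵇ (compat (λ x y → y <ᵇ x) (λ x y → y ≤ᵇ x)) t ⟧}) ∏≋0) (𝓡.zeroʳ ring-sums.⟦ pairwiseᵇ (compat (λ x y → y <ᵇ x) (λ x y → y ≤ᵇ x)) t ⟧))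
        (𝓡.sym (𝓡.trans (⊛-cong (𝓡.reflexive (cong ring-sums.⟦_⟧ good-false)) 𝓡.refl) (𝓡.zeroˡ (mono (negOnePow (length (Bboxes σ μ))) (wExponent t)))))
        where
        bad = all-false _ t nrb
        ∏≋0 : ring-sums.∏ t h ≋ []
        ∏≋0 = RL.∏-zero∈ t h (proj₁ bad) (proj₁ (proj₂ bad)) (𝓡.reflexive (cong (λ z → if z then u (proj₂ (proj₁ bad)) else []) (¬T⇒false (proj₂ (proj₂ bad)))))
        good-false : goodB t ≡ false
        good-false = ¬T⇒false (λ g → nrb (proj₂ (T-∧⁻ {reverseRowStrictᵇ t} (proj₂ (T-∧⁻ {allLabelsPositiveᵇ t} g)))))

    fillS : List (Filling ℕ)
    fillS = fillings μ (λ _ → range 1 n)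

    Ssum≋ : Ssum μ ≋ ring-sums.∑ (filterᵇ semistandardᵇ fillS) (λ t → mono (ℤ.+ 1) (xExponent t))
    Ssum≋ = ∑-∏-filter fillS (pairwiseᵇ (compat _≤ᵇ_ _<ᵇ_)) semistandardᵇ (λ t → ring-sums.∏ t (λ p → X (proj₂ p))) (ℤ.+ 1) xExponent (λ t t∈ → ⊛-cong (𝓡.reflexive (cong ring-sums.⟦_⟧ (semistandard≡ t)))
      (𝓡.trans (∏-mono t _ (λ _ → 0) (λ p → xvar (proj₂ p)) (λ _ _ → 𝓡.refl)) (mono-cong (negOnePow-0s t) (λ _ → refl))))

    pairᵇ : Filling ℕ × Filling ℕ → Bool
    pairᵇ (t' , t'') = all (λ k → (cnt k t' ℕ.+ cnt k t'') ≡ᵇ at e k) (range 1 (maxRow μ ⊔ length e))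

    coeff-triple : ∀ t'' t t' → t' ∈ fillA → t'' ∈ fillB →
      coeff (wExponent t'' ⊕ (xExponent t ⊕ wExponent t')) ≡ ℤ-sums.⟦ contentIsᵇ n t α ⟧ ℤ.* ℤ-sums.⟦ pairᵇ (t' , t'') ⟧
    coeff-triple t'' t t' t'∈ t''∈ = trans (cong ℤ-sums.⟦_⟧ (cong₂ _∧_ xs≡ ws≡)) (ℤ-sums.⟦∧⟧ (contentIsᵇ n t α) (pairᵇ (t' , t'')))
      where
      cnt-sum : ∀ k t → sum (map (λ p → δ (proj₂ p) k) t) ≡ cnt k t
      cnt-sum k t = sym (countᵇ-sum (λ p → proj₂ p ≡ᵇ k) t)
      xs≡ : xᵇ (wExponent t'' ⊕ (xExponent t ⊕ wExponent t')) ≡ contentIsᵇ n t α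
      xs≡ = all-cong (range 1 n) (λ k _ → cong (_≡ᵇ at α k) (trans
        (cong₂ ℕ._+_ (sum-map-0 t'' (λ _ _ → refl)) (cong₂ ℕ._+_ (cnt-sum k t) (sum-map-0 t' (λ _ _ → refl)))) (ℕₚ.+-identityʳ _)))
      ws≡ : wᵇ (wExponent t'' ⊕ (xExponent t ⊕ wExponent t')) ≡ pairᵇ (t' , t'')
      ws≡ = trans (all-cong (range 1 N) (λ i _ → cong (_≡ᵇ at e i) (trans
          (cong₂ ℕ._+_ (cnt-sum i t'') (cong₂ ℕ._+_ (sum-map-0 t (λ _ _ → refl)) (cnt-sum i t'))) (ℕₚ.+-comm (cnt i t'') (cnt i t')))))
        (sym (all-range-extend _ (maxRow μ ⊔ length e) N (ℕₚ.⊔-lub maxRow≤N e≤N) beyond))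
        where
        maxRow≤N : maxRow μ ≤ N
        maxRow≤N = bound μ rowsμ
          where
          bound : ∀ μ → (∀ {i j} → (i , j) ∈ μ → i ≤ N) → maxRow μ ≤ N
          bound []      _ = z≤n
          bound (b ∷ μ) r = ℕₚ.⊔-lub (r (here refl)) (bound μ (r ∘ there))
        absent : ∀ {bs t} → (∀ b → b ∈ bs → b ∈ μ) → t ∈ fillings bs (λ b → range 1 (row b)) → ∀ k → maxRow μ < k → cnt k t ≡ 0
        absent {bs} {t} sub t∈ k lt = trans (sym (cnt-sum k t)) (sum-map-0 t (λ p p∈ → let (b∈ , _ , x≤) = label bs t∈ p p∈ in
          cong (λ z → if z then 1 else 0) (≡ᵇ-no {proj₂ p} {k} (ℕₚ.<⇒≢ (ℕₚ.≤-<-trans (≤-trans x≤ (row≤maxRow μ (sub (proj₁ p) b∈))) lt)))))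
        beyond : ∀ i → maxRow μ ⊔ length e < i → i ≤ N → T ((cnt i t' ℕ.+ cnt i t'') ≡ᵇ at e i)
        beyond i lt _ = subst₂ (λ x y → T (x ≡ᵇ y))
          (sym (cong₂ ℕ._+_ (absent {Aboxes σ μ} (λ b m → proj₁ (∈-filterᵇ⁻ _ μ m)) t'∈ i lt') (absent {Bboxes σ μ} (λ b m → proj₁ (∈-filterᵇ⁻ _ μ m)) t''∈ i lt')))
          (sym (at-beyond e i (ℕₚ.≤-<-trans (ℕₚ.m≤n⊔m (maxRow μ) (length e)) lt))) _
          where
          lt' = ℕₚ.≤-<-trans (ℕₚ.m≤m⊔n (maxRow μ) (length e)) lt

    value : eval (Bsum μ ⊛ (Ssum μ ⊛ Asum μ)) coeff
      ≡ negOnePow (length (Bboxes σ μ)) ℤ.* ((ℤ.+ aCoeff σ μ e) ℤ.* (ℤ.+ kostka μ α))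
    value = trans (on (𝓡.trans (⊛-cong Bsum≋ (⊛-cong Ssum≋ Asum≋)) (∑-∑-∑ gB gS gA _ _ _)) coeff resp-coeff)
      (trans (eval-∑ gB _ coeff)
      (trans (ℤ-sums.∑-cong∈ gB (λ t'' t''∈ → trans (eval-∑ gS _ coeff) (trans (ℤ-sums.∑-cong∈ gS (λ t _ → trans (eval-∑ gA _ coeff)
          (trans (ℤ-sums.∑-cong∈ gA (λ t' t'∈ → term t'' t t' (proj₁ (∈-filterᵇ⁻ goodA fillA t'∈)) (proj₁ (∈-filterᵇ⁻ goodB fillB t''∈))))
            (trans (ℤ-sums.∑-*ˡ gA c _) (cong (c ℤ.*_) (ℤ-sums.∑-*ˡ gA (K t) _))))))
          (trans (ℤ-sums.∑-*ˡ gS c _) (cong (c ℤ.*_) (ℤ-sums.∑-*ʳ gS _ K))))))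
      (trans (ℤ-sums.∑-*ˡ gB c _) (cong (c ℤ.*_) (trans (ℤ-sums.∑-*ˡ gB (ℤ-sums.∑ gS K) _) (trans (ℤₚ.*-comm (ℤ-sums.∑ gS K) _)
        (cong₂ ℤ._*_ (trans (ℤ-sums.∑-swap gB gA _) pairs) kostkas)))))))
      where
      gA = filterᵇ goodA fillA
      gB = filterᵇ goodB fillB
      gS = filterᵇ semistandardᵇ fillS
      c : ℤ
      c = negOnePow (length (Bboxes σ μ))
      K : Filling ℕ → ℤ
      K t = ℤ-sums.⟦ contentIsᵇ n t α ⟧
      term : ∀ t'' t t' → t' ∈ fillA → t'' ∈ fillB →
        eval (mono c (wExponent t'') ⊛ (mono (ℤ.+ 1) (xExponent t) ⊛ mono (ℤ.+ 1) (wExponent t'))) coeff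
        ≡ c ℤ.* (K t ℤ.* ℤ-sums.⟦ pairᵇ (t' , t'') ⟧)
      term t'' t t' t'∈ t''∈ = trans (ℤₚ.+-identityʳ _) (cong₂ ℤ._*_ (ℤₚ.*-identityʳ c) (coeff-triple t'' t t' t'∈ t''∈))
      pairs : ℤ-sums.∑ gA (λ t' → ℤ-sums.∑ gB (λ t'' → ℤ-sums.⟦ pairᵇ (t' , t'') ⟧)) ≡ ℤ.+ aCoeff σ μ e
      pairs = trans (sym (∑-cartesianProduct gA gB (λ p → ℤ-sums.⟦ pairᵇ p ⟧))) (trans (sym (countᵇ-∑ pairᵇ (cartesianProduct gA gB)))
        (cong ℤ.+_ (countᵇ-cong (cartesianProduct gA gB) (λ { (t' , t'') _ → refl }))))
      kostkas : ℤ-sums.∑ gS K ≡ ℤ.+ kostka μ α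
      kostkas = trans (ℤ-sums.∑-filterᵇ semistandardᵇ fillS K) (trans
        (ℤ-sums.∑-cong fillS (λ t → sym (ℤ-sums.⟦∧⟧ (semistandardᵇ t) (contentIsᵇ n t α)))) (sym (countᵇ-∑ _ fillS)))

  theorem : coeffRHSupTo σ α e N ≡ coeffRG σ α e
  theorem = trans (sumℤ-∑ _ (shapesAbove σ N)) (trans
    (ℤ-sums.∑-cong∈ (shapesAbove σ N) (λ μ m → sym (Term.value μ (λ b∈ → rowsAbove μ m b∈))))
    (trans (sym (eval-∑ (shapesAbove σ N) _ coeff)) (trans (sym (on master coeff resp-coeff)) left)))
    where
    open ShapeSum ring σ c₀ fr N R≤N using (∈-candidates⁻; shapeᵇ; candidates)
    rowsAbove : ∀ μ → μ ∈ shapesAbove σ N → ∀ {i j} → (i , j) ∈ μ → i ≤ N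
    rowsAbove μ m b∈ = proj₂ (proj₁ (∈-candidates⁻ (∈-subsets candidates μ (proj₁ (∈-filterᵇ⁻ shapeᵇ (subsets candidates) m)) _ b∈)))

theorem3p4 : (σ : List Box) → T (isSkewShape σ) → Connected σ → TopRowIsOne σ →
    (α e : List ℕ) →
    ∃[ N₀ ] (∀ N → N₀ ≤ N → coeffRHSupTo σ α e N ≡ coeffRG σ α e)
theorem3p4 σ sk conn top α e =
  let (c₀ , fr) = frame σ sk conn top in
  -- The first bound leaves an empty row below every shape that contributes to the exchange; the
  -- second lets the functional test every entry of `e`.
  suc (length α ℕ.+ maxRow σ) ⊔ length e , λ N N₀≤N →
    Coefficients.theorem σ c₀ fr α e N (≤-trans (ℕₚ.m≤m⊔n _ (length e)) N₀≤N) (≤-trans (ℕₚ.m≤n⊔m _ (length e)) N₀≤N)
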